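{- For every $\epsilon>0$, both of the following promise problems are NP-hard: (a) given a partial latin square $P$ that satisfies Hall's Condition and in which the proportion of empty cells is less than $\epsilon$, decide whether $P$ is completable; (b) given a partial latin square $P$ that satisfies Hall's Condition and in which the proportion of empty cells is greater than $1-\epsilon$, decide whether $P$ is completable.
   Context: A partial latin square of order $n$ is an $n\times n$ array in which some cells are filled with symbols from $\{1,\dots,n\}$, no symbol appearing twice in any row or column; it is completable if its empty cells can be filled to give a latin square. A symbol is missing from a row (column) if it does not appear in a filled cell of that row (column). A cell supports $\sigma$ if it contains $\sigma$, or it is empty and $\sigma$ is missing from both its row and its column. A set of cells is independent if no two lie in the same row or column; an independent set for $\sigma$ is an independent set all of whose cells support $\sigma$. $\alpha(\sigma,T)$ is the maximum size of a subset of $T$ that is an independent set for $\sigma$. Hall's Condition holds if $\sum_{\sigma=1}^n\alpha(\sigma,T)\ge|T|$ for every set $T$ of cells. NP-hard means every problem in NP can be solved in polynomial time by a Turing machine with an oracle for the problem. -}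

module Defs where

open import Data.Nat using (ℕ; zero; suc; _+_; _*_; _^_; _≤_; _<_; _⊔_)
open import Data.Bool using (Bool; true; false; if_then_else_; _∧_; _∨_; not)
open import Data.Fin using (Fin; zero; suc; _≟_)
open import Data.List using (List; []; _∷_; _++_; map; reverse; length; concatMap; foldr; allFin)
open import Data.Nat.ListAction using (sum)
open import Data.Vec using (Vec; tabulate; toList)
import Data.Vec as Vec
open import Data.Maybe using (Maybe; just; nothing)
open import Data.Product using (Σ; _×_; _,_; ∃)
open import Relation.Nullary using (¬_; does)
open import Relation.Binary.PropositionalEquality using (_≡_)

-- An n×n array; nothing = empty cell, just s = cell filled with symbol s.
Array : ℕ → Set
Array n = Fin n → Fin n → Maybe (Fin n)

IsPLS : ∀ {n} → Array n → Set
IsPLS {n} P =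
  (∀ r c c' s → P r c ≡ just s → P r c' ≡ just s → c ≡ c') ×
  (∀ r r' c s → P r c ≡ just s → P r' c ≡ just s → r ≡ r')

IsLatin : ∀ {n} → (Fin n → Fin n → Fin n) → Set
IsLatin {n} L =
  (∀ r c c' → L r c ≡ L r c' → c ≡ c') ×
  (∀ r r' c → L r c ≡ L r' c → r ≡ r')

Completable : ∀ {n} → Array n → Set
Completable {n} P =
  Σ (Fin n → Fin n → Fin n) λ L →
    IsLatin L × (∀ r c s → P r c ≡ just s → L r c ≡ s)

allB : ∀ {n} → (Fin n → Bool) → Bool
allB {n} f = foldr (λ i b → f i ∧ b) true (allFin n)

countB : ∀ {n} → (Fin n → Bool) → ℕ
countB {n} f = foldr (λ i k → if f i then suc k else k) 0 (allFin n)

isSym : ∀ {n} → Maybe (Fin n) → Fin n → Bool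
isSym nothing  σ = false
isSym (just s) σ = does (s ≟ σ)

isEmpty : ∀ {n} → Maybe (Fin n) → Bool
isEmpty nothing  = true
isEmpty (just _) = false

missingRow : ∀ {n} → Array n → Fin n → Fin n → Bool
missingRow P σ r = allB (λ c → not (isSym (P r c) σ))

missingCol : ∀ {n} → Array n → Fin n → Fin n → Bool
missingCol P σ c = allB (λ r → not (isSym (P r c) σ))

supports : ∀ {n} → Array n → Fin n → Fin n → Fin n → Bool
supports P σ r c =
  isSym (P r c) σ ∨ (isEmpty (P r c) ∧ (missingRow P σ r ∧ missingCol P σ c))

CellSet : ℕ → Set
CellSet n = Fin n → Fin n → Bool

size : ∀ {n} → CellSet n → ℕ
size S = sum (map (λ r → countB (λ c → S r c)) (allFin _))

independent : ∀ {n} → CellSet n → Bool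
independent S =
  allB (λ r → countB (λ c → S r c) Data.Nat.≤ᵇ 1) ∧
  allB (λ c → countB (λ r → S r c) Data.Nat.≤ᵇ 1)

subsetB : ∀ {n} → CellSet n → CellSet n → Bool
subsetB S T = allB (λ r → allB (λ c → not (S r c) ∨ T r c))

indepForIn : ∀ {n} → Array n → Fin n → CellSet n → CellSet n → Bool
indepForIn P σ T S =
  independent S ∧ (subsetB S T ∧ allB (λ r → allB (λ c → not (S r c) ∨ supports P σ r c)))

allVecs : ∀ {A : Set} → List A → (m : ℕ) → List (Vec A m)
allVecs xs zero    = Vec.[] ∷ []
allVecs xs (suc m) = concatMap (λ x → map (x Vec.∷_) (allVecs xs m)) xs

allCellSets : (n : ℕ) → List (CellSet n)
allCellSets n =
  map (λ g r c → Vec.lookup (Vec.lookup g r) c)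
      (allVecs (allVecs (true ∷ false ∷ []) n) n)

filterB : ∀ {A : Set} → (A → Bool) → List A → List A
filterB p [] = []
filterB p (x ∷ xs) = if p x then x ∷ filterB p xs else filterB p xs

maxList : List ℕ → ℕ
maxList = foldr _⊔_ 0

α : ∀ {n} → Array n → Fin n → CellSet n → ℕ
α {n} P σ T = maxList (map size (filterB (indepForIn P σ T) (allCellSets n)))

HallCondition : ∀ {n} → Array n → Set
HallCondition {n} P =
  (T : CellSet n) → size T ≤ sum (map (λ σ → α P σ T) (allFin n))

numEmpty : ∀ {n} → Array n → ℕ
numEmpty P = size (λ r c → isEmpty (P r c))

cellCode : ∀ {n} → Maybe (Fin n) → Fin (suc n) → Bool
cellCode nothing  zero    = true
cellCode nothing  (suc _) = false
cellCode (just s) zero    = false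
cellCode (just s) (suc i) = does (s ≟ i)

unary : ℕ → List Bool
unary zero    = false ∷ []
unary (suc n) = true ∷ unary n

encode : (n : ℕ) → Array n → List Bool
encode n P =
  unary n ++
  concatMap (λ r → concatMap (λ c → toList (tabulate (cellCode (P r c)))) (allFin n)) (allFin n)

Sym : Set
Sym = Fin 4

blank sep : Sym
blank = zero
sep   = suc (suc (suc zero))

bitSym : Bool → Sym
bitSym false = suc zero
bitSym true  = suc (suc zero)

symBits : List Sym → List Bool
symBits [] = []
symBits (zero ∷ xs) = symBits xs
symBits (suc zero ∷ xs) = false ∷ symBits xs
symBits (suc (suc zero) ∷ xs) = true ∷ symBits xs
symBits (suc (suc (suc _)) ∷ xs) = symBits xs

data Move : Set where
  mL mR mS : Move

-- bi-infinite tape: cells left of head (nearest first), head, cells right of head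
record Tape : Set where
  constructor tape
  field
    lft : List Sym
    hd  : Sym
    rgt : List Sym
open Tape public

blankTape : Tape
blankTape = tape [] blank []

initTape : List Sym → Tape
initTape []       = blankTape
initTape (x ∷ xs) = tape [] x xs

writeTape : Sym → Tape → Tape
writeTape s (tape l _ r) = tape l s r

moveTape : Move → Tape → Tape
moveTape mL (tape []       h r) = tape [] blank (h ∷ r)
moveTape mL (tape (x ∷ l)  h r) = tape l x (h ∷ r)
moveTape mR (tape l h [])       = tape (h ∷ l) blank []
moveTape mR (tape l h (x ∷ r))  = tape (h ∷ l) x r
moveTape mS t = t

contents : Tape → List Sym
contents (tape l h r) = reverse l ++ (h ∷ r)

record OTM : Set where
  field
    nQ    : ℕ
    start acc rej qry yes no : Fin nQ
    δ     : Fin nQ → Sym → Sym → Fin nQ × Sym × Sym × Move × Move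
open OTM public

record Config (M : OTM) : Set where
  constructor cfg
  field
    state : Fin (nQ M)
    work  : Tape
    query : Tape

Oracle : Set
Oracle = List Bool → Bool

initCfg : (M : OTM) → List Sym → Config M
initCfg M xs = cfg (start M) (initTape xs) blankTape

eqQ : ∀ {k} → Fin k → Fin k → Bool
eqQ a b = does (a ≟ b)

step : (M : OTM) → Oracle → Config M → Config M
step M O (cfg q w t) =
  if eqQ q (acc M) ∨ eqQ q (rej M) then cfg q w t
  else if eqQ q (qry M)
    then cfg (if O (symBits (contents t)) then yes M else no M) w blankTape
  else act (δ M q (hd w) (hd t))
  where
  act : Fin (nQ M) × Sym × Sym × Move × Move → Config M
  act (q' , a , b , m₁ , m₂) = cfg q' (moveTape m₁ (writeTape a w)) (moveTape m₂ (writeTape b t))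

result : (M : OTM) → Config M → Maybe Bool
result M (cfg q _ _) =
  if eqQ q (acc M) then just true else if eqQ q (rej M) then just false else nothing

run : (M : OTM) → Oracle → ℕ → Config M → Maybe Bool
run M O zero    c = result M c
run M O (suc k) c = run M O k (step M O c)

poly : ℕ → ℕ → ℕ → ℕ
poly c k n = c * n ^ k + c

Language : Set₁
Language = List Bool → Set

noOracle : Oracle
noOracle _ = false

verifierInput : List Bool → List Bool → List Sym
verifierInput x w = map bitSym x ++ (sep ∷ map bitSym w)

InNP : Language → Set
InNP L =
  Σ OTM λ V → Σ ℕ λ c → Σ ℕ λ k →
    (∀ x w → ∃ λ b →
       run V noOracle (poly c k (length (verifierInput x w))) (initCfg V (verifierInput x w)) ≡ just b) ×
    (∀ x → (L x → ∃ λ w → length w ≤ poly c k (length x) ×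
                  run V noOracle (poly c k (length (verifierInput x w))) (initCfg V (verifierInput x w)) ≡ just true) ×
           ((∃ λ w → length w ≤ poly c k (length x) ×
                  run V noOracle (poly c k (length (verifierInput x w))) (initCfg V (verifierInput x w)) ≡ just true) → L x))

OracleFor : Language → Language → Oracle → Set
OracleFor Yes No O = (∀ x → Yes x → O x ≡ true) × (∀ x → No x → O x ≡ false)

NPHard : Language → Language → Set₁
NPHard Yes No =
  (L : Language) → InNP L →
  Σ OTM λ M → Σ ℕ λ c → Σ ℕ λ k →
    (O : Oracle) → OracleFor Yes No O → (x : List Bool) →
      (L x → run M O (poly c k (length x)) (initCfg M (map bitSym x)) ≡ just true) ×
      (¬ L x → run M O (poly c k (length x)) (initCfg M (map bitSym x)) ≡ just false)

-- The two promise problems, for ε = a / b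

-- proportion of empty cells < a/b
FewEmpty : ℕ → ℕ → ∀ {n} → Array n → Set
FewEmpty a b {n} P = numEmpty P * b < a * (n * n)

-- proportion of empty cells > 1 - a/b
ManyEmpty : ℕ → ℕ → ∀ {n} → Array n → Set
ManyEmpty a b {n} P = b * (n * n) < numEmpty P * b + a * (n * n)

PromiseYes : (∀ {n} → Array n → Set) → Language
PromiseYes D x = Σ ℕ λ n → Σ (Array n) λ P →
  encode n P ≡ x × IsPLS P × HallCondition P × D P × Completable P

PromiseNo : (∀ {n} → Array n → Set) → Language
PromiseNo D x = Σ ℕ λ n → Σ (Array n) λ P →
  encode n P ≡ x × IsPLS P × HallCondition P × D P × ¬ Completable P

-- Acceptance by an NP verifier is turned (Cook–Levin) into satisfiability of a CNF formula each of whose clauses is purely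
-- positive or purely negative; an implication becomes a positive clause through extra variables for the negated facts.
-- The formula is realised in the subtraction table of Z_M × Z_2 × Z_p × Z_q by permuting a few rows within single columns:
-- in a column (0 , t' , a , b) variable b and clause a each permute three rows, in a way that depends on the truth value
-- of b and on the variable chosen to satisfy a, and the two permutations collide exactly when that variable has the wrong
-- value.  The cells affected by these choices are left empty, so completions correspond to satisfying assignments.
--
-- Hall's Condition concerns one symbol at a time, and for a fixed symbol at most one clause can collide.  A single clause
-- with two variables is satisfied by some assignment and by its complement, and the places of the symbol in the two
-- resulting arrays, taken over all symbols, cover every cell twice.
--
-- Only O((N/M)²) cells are empty, which settles (a); emptying all rows outside the first block of N/M rows settles (b).
-- Each bit of the encoded square is given by an arithmetic expression, which a Turing machine evaluates on a stack of
-- unary numbers.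

module Submission where

open import Defs hiding (yes; no)
open import Data.Nat using (ℕ; zero; suc; _+_; _*_; _∸_; _^_; _≤_; _<_; z≤n; s≤s; pred; _≡ᵇ_; _≤ᵇ_; _<ᵇ_)
import Data.Nat.Properties as ℕ
import Data.Nat.DivMod as ℕ
open import Data.Bool using (Bool; true; false; if_then_else_; _∧_; _∨_; not; _xor_)
import Data.Bool.Properties as 𝔹
open import Data.Fin using (Fin; zero; suc; toℕ; fromℕ<; combine; remQuot)
import Data.Fin as F
import Data.Fin.Properties as F
open import Data.List using (List; []; _∷_; _++_; map; reverse; length; concatMap; concat; foldr; allFin; replicate; _ʳ++_)
import Data.List as List
import Data.List.Properties as List
open import Data.List.Relation.Unary.All using (All; []; _∷_)
import Data.List.Relation.Unary.All as All
import Data.List.Relation.Unary.All.Properties as All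
open import Data.List.Relation.Unary.Any using (Any; here; there)
import Data.List.Relation.Unary.Any as Any
import Data.List.Relation.Unary.Any.Properties as Any
open import Data.List.Membership.Propositional using (_∈_; find; lose)
import Data.List.Membership.Propositional.Properties as ∈
open import Data.Nat.ListAction using (sum)
open import Data.Vec using (Vec; tabulate; toList)
import Data.Vec as Vec
import Data.Vec.Properties as Vec
open import Data.Maybe using (Maybe; just; nothing)
import Data.Maybe as Maybe
open import Data.Product using (Σ; _×_; _,_; ∃; proj₁; proj₂)
open import Data.Sum using (_⊎_; inj₁; inj₂; [_,_]′)
open import Data.Empty using (⊥; ⊥-elim)
open import Data.Unit using (⊤; tt)
open import Function using (_∘_; id)
open import Function.Bundles using (_⇔_; mk⇔)
import Relation.Binary
open import Relation.Nullary using (¬_; Dec; yes; no; does)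
open import Relation.Nullary.Decidable using (_×-dec_; _⊎-dec_; ¬?; does-⇔; dec-true; dec-false)
open import Relation.Binary.PropositionalEquality using (_≡_; _≢_; refl; sym; trans; cong; cong₂; subst; subst₂; module ≡-Reasoning)
open import Data.Nat.Tactic.RingSolver using (solve-∀)

-- Hall's Condition from half-integral completions

-- A variable gadget permutes rows whose last coordinate is `b`, so in its columns it moves only
-- symbols with last coordinate 0; a clause gadget permutes rows with third coordinate `e a` and
-- moves only symbols with third coordinate `e a - a`. This keeps rows Latin as long as gadgets do
-- not collide. The 3-cycle has one displaced entry that is independent of the wire; prescribing it
-- prevents a completion from leaving the gadget idle. Wires have third coordinate 0 (true) or 1
-- (false), homes of variables have 2. A clause has a single coordinate `e a` with which to block a
-- truth value, whence clauses of one sign. Only symbols with third coordinate `e a - a` notice a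
-- collision with clause `a`, and listing positive clauses before negative ones keeps these residues
-- distinct. The rules come from a finite list fixed by the verifier, instantiated at all times and
-- positions, so that one expression yields every bit.

∑ : (n : ℕ) → (Fin n → ℕ) → ℕ
∑ zero    f = 0
∑ (suc n) f = f zero + ∑ n (f ∘ suc)

∑-cong : ∀ n {f g : Fin n → ℕ} → (∀ i → f i ≡ g i) → ∑ n f ≡ ∑ n g
∑-cong zero    h = refl
∑-cong (suc n) h = cong₂ _+_ (h zero) (∑-cong n (h ∘ suc))

∑-mono : ∀ n {f g : Fin n → ℕ} → (∀ i → f i ≤ g i) → ∑ n f ≤ ∑ n g
∑-mono zero    h = z≤n
∑-mono (suc n) h = ℕ.+-mono-≤ (h zero) (∑-mono n (h ∘ suc))

∑-0 : ∀ n → ∑ n (λ _ → 0) ≡ 0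
∑-0 zero    = refl
∑-0 (suc n) = ∑-0 n

+-interchange : ∀ a b c d → (a + b) + (c + d) ≡ (a + c) + (b + d)
+-interchange = solve-∀

∑-+ : ∀ n (f g : Fin n → ℕ) → ∑ n (λ i → f i + g i) ≡ ∑ n f + ∑ n g
∑-+ zero    f g = refl
∑-+ (suc n) f g = trans (cong (f zero + g zero +_) (∑-+ n (f ∘ suc) (g ∘ suc)))
  (+-interchange (f zero) (g zero) _ _)

∑-swap : ∀ n m (f : Fin n → Fin m → ℕ) → ∑ n (λ i → ∑ m (f i)) ≡ ∑ m (λ j → ∑ n (λ i → f i j))
∑-swap zero    m f = sym (∑-0 m)
∑-swap (suc n) m f = trans (cong (∑ m (f zero) +_) (∑-swap n m (f ∘ suc)))
  (sym (∑-+ m (f zero) (λ j → ∑ n (λ i → f (suc i) j))))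

∑-term : ∀ n (f : Fin n → ℕ) i → f i ≤ ∑ n f
∑-term (suc n) f zero    = ℕ.m≤m+n _ _
∑-term (suc n) f (suc i) = ℕ.≤-trans (∑-term n (f ∘ suc) i) (ℕ.m≤n+m _ _)

∑-two : ∀ n (f : Fin n → ℕ) i j → i ≢ j → f i + f j ≤ ∑ n f
∑-two (suc n) f zero    zero    i≢j = ⊥-elim (i≢j refl)
∑-two (suc n) f zero    (suc j) i≢j = ℕ.+-monoʳ-≤ _ (∑-term n (f ∘ suc) j)
∑-two (suc n) f (suc i) zero    i≢j = subst (_≤ ∑ (suc n) f) (ℕ.+-comm (f zero) _) (ℕ.+-monoʳ-≤ _ (∑-term n (f ∘ suc) i))
∑-two (suc n) f (suc i) (suc j) i≢j = ℕ.≤-trans (∑-two n (f ∘ suc) i j (i≢j ∘ cong suc)) (ℕ.m≤n+m _ _)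

bit01 : Bool → ℕ
bit01 false = 0
bit01 true  = 1

count : ∀ {n} → (Fin n → Bool) → ℕ
count {n} f = ∑ n (bit01 ∘ f)

foldr-tabulate-+ : ∀ n m (g : Fin n → Fin m) (f : Fin m → ℕ) →
  foldr (λ i k → f i + k) 0 (List.tabulate g) ≡ ∑ n (f ∘ g)
foldr-tabulate-+ zero    m g f = refl
foldr-tabulate-+ (suc n) m g f = cong (f (g zero) +_) (foldr-tabulate-+ n m (g ∘ suc) f)

countB-count : ∀ {n} (f : Fin n → Bool) → countB f ≡ count f
countB-count {n} f = trans (same (allFin n)) (foldr-tabulate-+ n n id (bit01 ∘ f))
  where
  same : ∀ xs → foldr (λ i k → if f i then suc k else k) 0 xs ≡ foldr (λ i k → bit01 (f i) + k) 0 xs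
  same []       = refl
  same (x ∷ xs) with f x
  ... | true  = cong suc (same xs)
  ... | false = same xs

sum-map-allFin : ∀ n (f : Fin n → ℕ) → sum (map f (allFin n)) ≡ ∑ n f
sum-map-allFin n f = trans (same (allFin n)) (foldr-tabulate-+ n n id f)
  where
  same : ∀ xs → sum (map f xs) ≡ foldr (λ i k → f i + k) 0 xs
  same []       = refl
  same (x ∷ xs) = cong (f x +_) (same xs)

size-∑ : ∀ {n} (S : CellSet n) → size S ≡ ∑ n (λ r → count (S r))
size-∑ {n} S = trans (sum-map-allFin n _) (∑-cong n (λ r → countB-count (S r)))

∧-true : ∀ {a b} → a ≡ true → b ≡ true → (a ∧ b) ≡ true
∧-true refl refl = refl

∧-trueˡ : ∀ {a b} → (a ∧ b) ≡ true → a ≡ true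
∧-trueˡ {true} _ = refl

∧-trueʳ : ∀ {a b} → (a ∧ b) ≡ true → b ≡ true
∧-trueʳ {true} eq = eq

allB-intro : ∀ {n} {f : Fin n → Bool} → (∀ i → f i ≡ true) → allB f ≡ true
allB-intro {n} {f} h = go (allFin n)
  where
  go : ∀ xs → foldr (λ i b → f i ∧ b) true xs ≡ true
  go []       = refl
  go (x ∷ xs) = ∧-true (h x) (go xs)

allVecs-complete : ∀ {A : Set} (xs : List A) → (∀ a → a ∈ xs) → ∀ m (v : Vec A m) → v ∈ allVecs xs m
allVecs-complete xs all zero    Vec.[]       = here refl
allVecs-complete xs all (suc m) (a Vec.∷ v) =
  ∈.∈-concatMap⁺ _ (Any.map (λ { refl → ∈.∈-map⁺ _ (allVecs-complete xs all m v) }) (all a))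

-- Cell sets are functions, so the enumeration contains a set only up to pointwise equality;
-- tabulating `S` gives its representative.
allCellSets-complete : ∀ n (S : CellSet n) → Σ (CellSet n) λ S' → S' ∈ allCellSets n × (∀ r c → S' r c ≡ S r c)
allCellSets-complete n S = _ , ∈.∈-map⁺ _ (allVecs-complete _ rows n table) , same
  where
  bools : ∀ (a : Bool) → a ∈ (true ∷ false ∷ [])
  bools true  = here refl
  bools false = there (here refl)
  rows : ∀ (v : Vec Bool n) → v ∈ allVecs (true ∷ false ∷ []) n
  rows = allVecs-complete _ bools n
  table : Vec (Vec Bool n) n
  table = tabulate (λ r → tabulate (S r))
  same : ∀ r c → Vec.lookup (Vec.lookup table r) c ≡ S r c
  same r c = trans (cong (λ v → Vec.lookup v c) (Vec.lookup∘tabulate (λ r → tabulate (S r)) r)) (Vec.lookup∘tabulate (S r) c)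

filterB-∈ : ∀ {A : Set} (p : A → Bool) {x} {xs} → x ∈ xs → p x ≡ true → x ∈ filterB p xs
filterB-∈ p {xs = y ∷ ys} (here refl) px rewrite px = here refl
filterB-∈ p {xs = y ∷ ys} (there x∈) px with p y
... | true  = there (filterB-∈ p x∈ px)
... | false = filterB-∈ p x∈ px

maxList-≥ : ∀ {k xs} → k ∈ xs → k ≤ maxList xs
maxList-≥ {xs = x ∷ xs} (here refl) = ℕ.m≤m⊔n x (maxList xs)
maxList-≥ {xs = x ∷ xs} (there k∈)  = ℕ.≤-trans (maxList-≥ k∈) (ℕ.m≤n⊔m x (maxList xs))

count-cong : ∀ {n} {f g : Fin n → Bool} → (∀ i → f i ≡ g i) → count f ≡ count g
count-cong {n} h = ∑-cong n (λ i → cong bit01 (h i))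

count≤1 : ∀ {n} (f : Fin n → Bool) → (∀ i j → f i ≡ true → f j ≡ true → i ≡ j) → count f ≤ 1
count≤1 {zero}  f h = z≤n
count≤1 {suc n} f h with f zero in eq
... | false = count≤1 (f ∘ suc) (λ i j p q → F.suc-injective (h (suc i) (suc j) p q))
... | true  = s≤s (ℕ.≤-reflexive (trans (∑-cong n none) (∑-0 n)))
  where
  none : ∀ i → bit01 (f (suc i)) ≡ 0
  none i with f (suc i) in e
  ... | false = refl
  ... | true  with () ← h zero (suc i) eq e

α-≥ : ∀ {n} (P : Array n) σ T S →
  (∀ r c c' → S r c ≡ true → S r c' ≡ true → c ≡ c') →
  (∀ r r' c → S r c ≡ true → S r' c ≡ true → r ≡ r') →
  (∀ r c → S r c ≡ true → T r c ≡ true) →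
  (∀ r c → S r c ≡ true → supports P σ r c ≡ true) → size S ≤ α P σ T
α-≥ {n} P σ T S rowInj colInj sub sup with allCellSets-complete n S
... | S' , S'∈ , same = subst (_≤ α P σ T) size-eq
  (maxList-≥ (∈.∈-map⁺ size (filterB-∈ (indepForIn P σ T) S'∈ good)))
  where
  size-eq : size S' ≡ size S
  size-eq = trans (size-∑ S') (trans (∑-cong n (λ r → count-cong (same r))) (sym (size-∑ S)))
  at-most-one : ∀ (f : Fin n → Bool) → (∀ i j → f i ≡ true → f j ≡ true → i ≡ j) → (countB f ≤ᵇ 1) ≡ true
  at-most-one f h with countB f ≤ᵇ 1 in eq
  ... | true  = refl
  ... | false = ⊥-elim (subst T′ eq (ℕ.≤⇒≤ᵇ (subst (_≤ 1) (sym (countB-count f)) (count≤1 f h))))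
    where
    T′ : Bool → Set
    T′ = Data.Bool.T
  implies : ∀ {a b} → (a ≡ true → b ≡ true) → (not a ∨ b) ≡ true
  implies {false} h = refl
  implies {true}  h = h refl
  good : indepForIn P σ T S' ≡ true
  good = ∧-true
    (∧-true (allB-intro λ r → at-most-one (S' r) λ c c' p q → rowInj r c c' (trans (sym (same r c)) p) (trans (sym (same r c')) q))
            (allB-intro λ c → at-most-one (λ r → S' r c) λ r r' p q → colInj r r' c (trans (sym (same r c)) p) (trans (sym (same r' c)) q)))
    (∧-true (allB-intro λ r → allB-intro λ c → implies λ p → sub r c (trans (sym (same r c)) p))
            (allB-intro λ r → allB-intro λ c → implies λ p → sup r c (trans (sym (same r c)) p)))

≡-bool : ∀ {n} → Fin n → Fin n → Bool
≡-bool i j = does (i F.≟ j)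

≡-bool-sound : ∀ {n} {i j : Fin n} → ≡-bool i j ≡ true → i ≡ j
≡-bool-sound {i = i} {j} eq with i F.≟ j
... | yes p = p
≡-bool-sound () | no _

≡-bool-refl : ∀ {n} (i : Fin n) → ≡-bool i i ≡ true
≡-bool-refl i = dec-true (i F.≟ i) refl

-- A half-integral relaxation of a completion: for every symbol σ two arrays, each of which
-- places σ as a completion would; the placements of all symbols together cover every cell twice.
record HalfCompletion {n} (P : Array n) : Set where
  field
    B       : Bool → Fin n → Fin n → Fin n → Fin n
    extends : ∀ m σ r c s → P r c ≡ just s → B m σ r c ≡ s
    rowInj  : ∀ m σ r c c' → B m σ r c ≡ σ → B m σ r c' ≡ σ → c ≡ c'
    colInj  : ∀ m σ r r' c → B m σ r c ≡ σ → B m σ r' c ≡ σ → r ≡ r'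
    cover   : ∀ r c → Σ (Bool × Fin n) λ u → Σ (Bool × Fin n) λ v → u ≢ v ×
                B (proj₁ u) (proj₂ u) r c ≡ proj₂ u × B (proj₁ v) (proj₂ v) r c ≡ proj₂ v

module _ {n} {P : Array n} (H : HalfCompletion P) where
  open HalfCompletion H

  halfCompletion⇒IsPLS : IsPLS P
  halfCompletion⇒IsPLS =
    (λ r c c' s p q → rowInj true s r c c' (extends true s r c s p) (extends true s r c' s q)) ,
    (λ r r' c s p q → colInj true s r r' c (extends true s r c s p) (extends true s r' c s q))

  -- A filled cell holds σ because `B m σ` extends `P`. In the row or column of an empty cell, a
  -- filled σ would recur in `B m σ` and contradict injectivity.
  supports-B : ∀ m σ r c → B m σ r c ≡ σ → supports P σ r c ≡ true
  supports-B m σ r c eq with P r c in Prc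
  ... | just s  rewrite trans (sym (extends m σ r c s Prc)) eq | ≡-bool-refl σ = refl
  ... | nothing = ∧-true (allB-intro inRow) (allB-intro inCol)
    where
    clash : ∀ {x : Maybe (Fin n)} → (∀ s → x ≡ just s → s ≡ σ → ⊥) → not (isSym x σ) ≡ true
    clash {nothing} h = refl
    clash {just s}  h with s F.≟ σ
    ... | yes p = ⊥-elim (h s refl p)
    ... | no _  = refl
    inRow : ∀ c' → not (isSym (P r c') σ) ≡ true
    inRow c' = clash λ { s p refl → filled (rowInj m σ r c c' eq (extends m σ r c' s p)) p }
      where
      filled : ∀ {c'} → c ≡ c' → ∀ {s} → P r c' ≡ just s → ⊥
      filled refl p with () ← trans (sym Prc) p
    inCol : ∀ r' → not (isSym (P r' c) σ) ≡ true
    inCol r' = clash λ { s p refl → filled (colInj m σ r r' c eq (extends m σ r' c s p)) p }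
      where
      filled : ∀ {r'} → r ≡ r' → ∀ {s} → P r' c ≡ just s → ⊥
      filled refl p with () ← trans (sym Prc) p

  -- Double counting: the cells of `X` where `B m σ` places σ form an independent set for σ, so the
  -- two modes together contribute at most `2 * α P σ X`, while over all σ every cell of `X` is
  -- counted at least twice. Cancelling 2 gives the condition.
  halfCompletion⇒Hall : HallCondition P
  halfCompletion⇒Hall X = ℕ.*-cancelˡ-≤ 2 (begin
    2 * size X                                                  ≡⟨ cong (2 *_) (size-∑ X) ⟩
    2 * ∑ n (λ r → count (X r))                                 ≡⟨ twice (∑ n (λ r → count (X r))) ⟩
    ∑ n (λ r → count (X r)) + ∑ n (λ r → count (X r))           ≡⟨ ∑-+ n _ _ ⟨
    ∑ n (λ r → count (X r) + count (X r))                       ≡⟨ ∑-cong n (λ r → sym (∑-+ n _ _)) ⟩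
    ∑ n (λ r → ∑ n (λ c → bit01 (X r c) + bit01 (X r c)))       ≤⟨ ∑-mono n (λ r → ∑-mono n (λ c → covered r c)) ⟩
    ∑ n (λ r → ∑ n (λ c → ∑ n (λ σ → hits σ r c)))              ≡⟨ ∑-cong n (λ r → ∑-swap n n (λ c σ → hits σ r c)) ⟩
    ∑ n (λ r → ∑ n (λ σ → ∑ n (λ c → hits σ r c)))              ≡⟨ ∑-swap n n (λ r σ → ∑ n (λ c → hits σ r c)) ⟩
    ∑ n (λ σ → ∑ n (λ r → ∑ n (λ c → hits σ r c)))              ≡⟨ ∑-cong n split ⟩
    ∑ n (λ σ → size (S false σ) + size (S true σ))              ≤⟨ ∑-mono n (λ σ → ℕ.+-mono-≤ (S≤α false σ) (S≤α true σ)) ⟩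
    ∑ n (λ σ → α P σ X + α P σ X)                               ≡⟨ ∑-+ n _ _ ⟩
    ∑ n (λ σ → α P σ X) + ∑ n (λ σ → α P σ X)                   ≡⟨ twice (∑ n (λ σ → α P σ X)) ⟨
    2 * ∑ n (λ σ → α P σ X)                                     ≡⟨ cong (2 *_) (sum-map-allFin n _) ⟨
    2 * sum (map (λ σ → α P σ X) (allFin n))                    ∎)
    where
    open ℕ.≤-Reasoning
    twice : ∀ a → 2 * a ≡ a + a
    twice = solve-∀
    S : Bool → Fin n → CellSet n
    S m σ r c = X r c ∧ ≡-bool (B m σ r c) σ
    hits : Fin n → Fin n → Fin n → ℕ
    hits σ r c = bit01 (S false σ r c) + bit01 (S true σ r c)
    S≤α : ∀ m σ → size (S m σ) ≤ α P σ X
    S≤α m σ = α-≥ P σ X (S m σ)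
      (λ r c c' p q → rowInj m σ r c c' (at r c p) (at r c' q))
      (λ r r' c p q → colInj m σ r r' c (at r c p) (at r' c q))
      (λ r c p → ∧-trueˡ p)
      (λ r c p → supports-B m σ r c (at r c p))
      where
      at : ∀ r c → S m σ r c ≡ true → B m σ r c ≡ σ
      at r c p = ≡-bool-sound (∧-trueʳ {X r c} p)
    split : ∀ σ → ∑ n (λ r → ∑ n (λ c → hits σ r c)) ≡ size (S false σ) + size (S true σ)
    split σ = trans (∑-cong n (λ r → ∑-+ n _ _)) (trans (∑-+ n _ _)
      (sym (cong₂ _+_ (size-∑ (S false σ)) (size-∑ (S true σ)))))
    hit : ∀ m σ r c → X r c ≡ true → B m σ r c ≡ σ → bit01 (S m σ r c) ≡ 1
    hit m σ r c x p rewrite x | p | ≡-bool-refl σ = refl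
    covered : ∀ r c → bit01 (X r c) + bit01 (X r c) ≤ ∑ n (λ σ → hits σ r c)
    covered r c with X r c in x
    ... | false = z≤n
    ... | true  with cover r c
    ... | (m , σ) , (m' , σ') , u≢v , p , q = subst (λ b → 2 ≤ ∑ n (λ σ → bit01 (b ∧ ≡-bool (B false σ r c) σ) + bit01 (b ∧ ≡-bool (B true σ r c) σ))) x (two (σ F.≟ σ'))
      where
      one≤ : ∀ m σ → B m σ r c ≡ σ → 1 ≤ hits σ r c
      one≤ false σ p rewrite hit false σ r c x p = s≤s z≤n
      one≤ true  σ p rewrite hit true σ r c x p = ℕ.m≤n+m 1 _
      both : ∀ m m' σ → m ≢ m' → B m σ r c ≡ σ → B m' σ r c ≡ σ → 2 ≤ hits σ r c
      both false false σ ne p q = ⊥-elim (ne refl)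
      both true  true  σ ne p q = ⊥-elim (ne refl)
      both false true  σ ne p q rewrite hit false σ r c x p | hit true σ r c x q = ℕ.≤-refl
      both true  false σ ne p q rewrite hit false σ r c x q | hit true σ r c x p = ℕ.≤-refl
      -- The two covering pairs either share the symbol, and then both modes count in one summand,
      -- or they lie in two different summands.
      two : Dec (σ ≡ σ') → 2 ≤ ∑ n (λ σ → hits σ r c)
      two (yes refl) = ℕ.≤-trans (both m m' σ (λ { refl → u≢v refl }) p q) (∑-term n (λ σ → hits σ r c) σ)
      two (no σ≢σ')  = ℕ.≤-trans (ℕ.+-mono-≤ (one≤ m σ p) (one≤ m' σ' q)) (∑-two n (λ σ → hits σ r c) σ σ' σ≢σ')

count-initial : ∀ {n} (f : Fin n → Bool) k → (∀ i → f i ≡ true → toℕ i < k) → count f ≤ k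
count-initial {zero}  f k       h = z≤n
count-initial {suc n} f zero    h = ℕ.≤-reflexive (trans (∑-cong (suc n) none) (∑-0 (suc n)))
  where
  none : ∀ i → bit01 (f i) ≡ 0
  none i with f i in e
  ... | false = refl
  ... | true  with () ← h i e
count-initial {suc n} f (suc k) h = ℕ.+-mono-≤ (b≤1 (f zero)) (count-initial (f ∘ suc) k (λ i p → ℕ.≤-pred (h (suc i) p)))
  where
  b≤1 : ∀ b → bit01 b ≤ 1
  b≤1 false = z≤n
  b≤1 true  = ℕ.≤-refl

∑-initial : ∀ n (f : Fin n → ℕ) k b → (∀ i → toℕ i < k → f i ≤ b) → (∀ i → k ≤ toℕ i → f i ≡ 0) → ∑ n f ≤ k * b
∑-initial zero    f k       b h z = z≤n
∑-initial (suc n) f zero    b h z = ℕ.≤-reflexive (trans (∑-cong (suc n) (λ i → z i z≤n)) (∑-0 (suc n)))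
∑-initial (suc n) f (suc k) b h z = ℕ.+-mono-≤ (h zero (s≤s z≤n))
  (∑-initial n (f ∘ suc) k b (λ i p → h (suc i) (s≤s p)) (λ i p → z (suc i) (s≤s p)))

∑-final : ∀ n (f : Fin n → ℕ) k b → (∀ i → k ≤ toℕ i → b ≤ f i) → n * b ≤ ∑ n f + k * b
∑-final zero    f k       b h = z≤n
∑-final (suc n) f zero    b h = ℕ.≤-trans (ℕ.+-mono-≤ (h zero z≤n) (∑-final n (f ∘ suc) 0 b (λ i _ → h (suc i) z≤n)))
  (ℕ.≤-reflexive (sym (ℕ.+-assoc (f zero) _ 0)))
∑-final (suc n) f (suc k) b h = begin
  b + n * b                              ≤⟨ ℕ.+-monoʳ-≤ b (∑-final n (f ∘ suc) k b (λ i p → h (suc i) (s≤s p))) ⟩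
  b + (∑ n (f ∘ suc) + k * b)            ≡⟨ swap b (∑ n (f ∘ suc)) (k * b) ⟩
  ∑ n (f ∘ suc) + (b + k * b)            ≤⟨ ℕ.+-monoˡ-≤ _ (ℕ.m≤n+m _ (f zero)) ⟩
  f zero + ∑ n (f ∘ suc) + (b + k * b)   ∎
  where
  open ℕ.≤-Reasoning
  swap : ∀ a b c → a + (b + c) ≡ b + (a + c)
  swap = solve-∀

numEmpty-corner : ∀ {N} (P : Array N) k → (∀ r c → P r c ≡ nothing → toℕ r < k × toℕ c < k) → numEmpty P ≤ k * k
numEmpty-corner {N} P k h = subst (_≤ k * k) (sym (size-∑ (λ r c → isEmpty (P r c)))) (∑-initial N _ k k
  (λ r _ → count-initial _ k (λ c e → proj₂ (h r c (isEmpty-nothing e))))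
  (λ r k≤ → trans (∑-cong N (none r k≤)) (∑-0 N)))
  where
  isEmpty-nothing : ∀ {x : Maybe (Fin N)} → isEmpty x ≡ true → x ≡ nothing
  isEmpty-nothing {nothing} _ = refl
  none : ∀ r → k ≤ toℕ r → ∀ c → bit01 (isEmpty (P r c)) ≡ 0
  none r k≤ c with P r c in e
  ... | just _  = refl
  ... | nothing = ⊥-elim (ℕ.<⇒≱ (proj₁ (h r c e)) k≤)

numEmpty-rows : ∀ {N} (P : Array N) k → (∀ r c → k ≤ toℕ r → P r c ≡ nothing) → N * N ≤ numEmpty P + k * N
numEmpty-rows {N} P k h = subst (λ z → N * N ≤ z + k * N) (sym (size-∑ (λ r c → isEmpty (P r c)))) (∑-final N _ k N
  (λ r k≤ → subst (_≤ count (λ c → isEmpty (P r c))) (full N) (∑-mono N (λ c → empty r c k≤))))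
  where
  full : ∀ n → ∑ n (λ _ → 1) ≡ n
  full zero    = refl
  full (suc n) = cong suc (full n)
  empty : ∀ r c → k ≤ toℕ r → 1 ≤ bit01 (isEmpty (P r c))
  empty r c k≤ rewrite h r c k≤ = ℕ.≤-refl

-- Arithmetic modulo suc n

module _ {n : ℕ} where
  private
    N : ℕ
    N = suc n

  opaque
    addF : Fin N → Fin N → Fin N
    addF a b = (toℕ a + toℕ b) ℕ.mod N

    subF : Fin N → Fin N → Fin N
    subF a b = (toℕ a + (N ∸ toℕ b)) ℕ.mod N

    toℕ-mod : ∀ m → toℕ (m ℕ.mod N) ≡ m ℕ.% N
    toℕ-mod m = F.toℕ-fromℕ< _

    toℕ-addF : ∀ a b → toℕ (addF a b) ≡ (toℕ a + toℕ b) ℕ.% N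
    toℕ-addF a b = toℕ-mod (toℕ a + toℕ b)

    %-absorb : ∀ (a b : ℕ) → (a ℕ.% N + b) ℕ.% N ≡ (a + b) ℕ.% N
    %-absorb a b = trans (ℕ.%-distribˡ-+ (a ℕ.% N) b N)
      (trans (cong (λ z → (z + b ℕ.% N) ℕ.% N) (ℕ.m%n%n≡m%n a N)) (sym (ℕ.%-distribˡ-+ a b N)))

    addF-comm : ∀ a b → addF a b ≡ addF b a
    addF-comm a b = cong (λ z → z ℕ.mod N) (ℕ.+-comm (toℕ a) (toℕ b))

    add-sub : ∀ x a → addF (subF x a) a ≡ x
    add-sub x a = F.toℕ-injective (begin
      toℕ (addF (subF x a) a)                           ≡⟨ toℕ-addF (subF x a) a ⟩
      (toℕ (subF x a) + toℕ a) ℕ.% N                    ≡⟨ cong (λ z → (z + toℕ a) ℕ.% N) (toℕ-mod (toℕ x + (N ∸ toℕ a))) ⟩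
      ((toℕ x + (N ∸ toℕ a)) ℕ.% N + toℕ a) ℕ.% N       ≡⟨ %-absorb (toℕ x + (N ∸ toℕ a)) (toℕ a) ⟩
      (toℕ x + (N ∸ toℕ a) + toℕ a) ℕ.% N               ≡⟨ cong (ℕ._% N) (ℕ.+-assoc (toℕ x) _ _) ⟩
      (toℕ x + (N ∸ toℕ a + toℕ a)) ℕ.% N               ≡⟨ cong (λ z → (toℕ x + z) ℕ.% N) (ℕ.m∸n+n≡m (ℕ.<⇒≤ (F.toℕ<n a))) ⟩
      (toℕ x + N) ℕ.% N                                 ≡⟨ ℕ.[m+n]%n≡m%n (toℕ x) N ⟩
      toℕ x ℕ.% N                                       ≡⟨ ℕ.m<n⇒m%n≡m (F.toℕ<n x) ⟩
      toℕ x                                             ∎)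
      where open ≡-Reasoning

    sub-add : ∀ s a → subF (addF s a) a ≡ s
    sub-add s a = F.toℕ-injective (begin
      toℕ (subF (addF s a) a)                           ≡⟨ toℕ-mod (toℕ (addF s a) + (N ∸ toℕ a)) ⟩
      (toℕ (addF s a) + (N ∸ toℕ a)) ℕ.% N              ≡⟨ cong (λ z → (z + (N ∸ toℕ a)) ℕ.% N) (toℕ-addF s a) ⟩
      ((toℕ s + toℕ a) ℕ.% N + (N ∸ toℕ a)) ℕ.% N       ≡⟨ %-absorb (toℕ s + toℕ a) _ ⟩
      (toℕ s + toℕ a + (N ∸ toℕ a)) ℕ.% N               ≡⟨ cong (ℕ._% N) (ℕ.+-assoc (toℕ s) _ _) ⟩
      (toℕ s + (toℕ a + (N ∸ toℕ a))) ℕ.% N             ≡⟨ cong (λ z → (toℕ s + z) ℕ.% N) (ℕ.m+[n∸m]≡n (ℕ.<⇒≤ (F.toℕ<n a))) ⟩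
      (toℕ s + N) ℕ.% N                                 ≡⟨ ℕ.[m+n]%n≡m%n (toℕ s) N ⟩
      toℕ s ℕ.% N                                       ≡⟨ ℕ.m<n⇒m%n≡m (F.toℕ<n s) ⟩
      toℕ s                                             ∎)
      where open ≡-Reasoning

    sub⇒add : ∀ {x a s} → subF x a ≡ s → x ≡ addF s a
    sub⇒add {x} {a} refl = sym (add-sub x a)

    add⇒sub : ∀ {x a s} → x ≡ addF s a → subF x a ≡ s
    add⇒sub refl = sub-add _ _

    sub-sub : ∀ x s → subF x (subF x s) ≡ s
    sub-sub x s = add⇒sub (trans (sym (add-sub x s)) (addF-comm (subF x s) s))

    subF-injˡ : ∀ {x x' a} → subF x a ≡ subF x' a → x ≡ x'
    subF-injˡ {x' = x'} {a} eq = trans (sub⇒add eq) (add-sub x' a)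

    subF-injʳ : ∀ {x a a'} → subF x a ≡ subF x a' → a ≡ a'
    subF-injʳ {x} {a} {a'} eq = trans (sym (sub-sub x a)) (trans (cong (subF x) eq) (sub-sub x a'))

    sub-self : ∀ x → subF x x ≡ zero
    sub-self x = add⇒sub {x} {x} {zero} (F.toℕ-injective (sym (trans (toℕ-addF zero x) (ℕ.m<n⇒m%n≡m (F.toℕ<n x)))))

    sub≡0 : ∀ {x a} → subF x a ≡ zero → a ≡ x
    sub≡0 {x} eq = subF-injʳ {x} (trans eq (sym (sub-self x)))

    sub-zeroʳ : ∀ x → subF x zero ≡ x
    sub-zeroʳ x = add⇒sub {x} {zero} {x} (F.toℕ-injective (sym (trans (toℕ-addF x zero)
      (trans (cong (ℕ._% N) (ℕ.+-identityʳ (toℕ x))) (ℕ.m<n⇒m%n≡m (F.toℕ<n x))))))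

    -- A disjunction of two equations without remainders: in this form (`subB`) the arithmetic
    -- expressions test which symbol stands in a cell.
    subF-spec : ∀ x a s → subF x a ≡ s ⇔ (toℕ s + toℕ a ≡ toℕ x ⊎ toℕ s + toℕ a ≡ toℕ x + N)
    subF-spec x a s = mk⇔ to from
      where
      to : subF x a ≡ s → toℕ s + toℕ a ≡ toℕ x ⊎ toℕ s + toℕ a ≡ toℕ x + N
      to eq with ℕ.<-≤-connex (toℕ s + toℕ a) N
      ... | inj₁ lt = inj₁ (trans (sym (ℕ.m<n⇒m%n≡m lt)) (trans (sym (toℕ-addF s a)) (sym (cong toℕ (sub⇒add {x} {a} eq)))))
      ... | inj₂ ge = inj₂ (trans (sym (ℕ.m∸n+n≡m ge)) (cong (_+ N) (trans (sym small) (trans (sym (toℕ-addF s a)) (sym (cong toℕ (sub⇒add {x} {a} eq)))))))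
        where
        d : ℕ
        d = toℕ s + toℕ a ∸ N
        d<N : d < N
        d<N = ℕ.+-cancelʳ-< N d N (subst (_< N + N) (sym (ℕ.m∸n+n≡m ge)) (ℕ.+-mono-< (F.toℕ<n s) (F.toℕ<n a)))
        small : (toℕ s + toℕ a) ℕ.% N ≡ d
        small = trans (cong (ℕ._% N) (sym (ℕ.m∸n+n≡m ge))) (trans (ℕ.[m+n]%n≡m%n d N) (ℕ.m<n⇒m%n≡m d<N))
      from : toℕ s + toℕ a ≡ toℕ x ⊎ toℕ s + toℕ a ≡ toℕ x + N → subF x a ≡ s
      from h = add⇒sub (F.toℕ-injective (sym (trans (toℕ-addF s a) (mod-x h))))
        where
        mod-x : toℕ s + toℕ a ≡ toℕ x ⊎ toℕ s + toℕ a ≡ toℕ x + N → (toℕ s + toℕ a) ℕ.% N ≡ toℕ x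
        mod-x (inj₁ p) = trans (cong (ℕ._% N) p) (ℕ.m<n⇒m%n≡m (F.toℕ<n x))
        mod-x (inj₂ p) = trans (cong (ℕ._% N) p) (trans (ℕ.[m+n]%n≡m%n (toℕ x) N) (ℕ.m<n⇒m%n≡m (F.toℕ<n x)))

    addF-assoc : ∀ a b c → addF (addF a b) c ≡ addF a (addF b c)
    addF-assoc a b c = F.toℕ-injective (begin
      toℕ (addF (addF a b) c)                       ≡⟨ toℕ-addF (addF a b) c ⟩
      (toℕ (addF a b) + toℕ c) ℕ.% N                ≡⟨ cong (λ z → (z + toℕ c) ℕ.% N) (toℕ-addF a b) ⟩
      ((toℕ a + toℕ b) ℕ.% N + toℕ c) ℕ.% N         ≡⟨ %-absorb (toℕ a + toℕ b) (toℕ c) ⟩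
      (toℕ a + toℕ b + toℕ c) ℕ.% N                 ≡⟨ cong (ℕ._% N) (trans (ℕ.+-assoc (toℕ a) _ _) (ℕ.+-comm (toℕ a) _)) ⟩
      (toℕ b + toℕ c + toℕ a) ℕ.% N                 ≡⟨ %-absorb (toℕ b + toℕ c) (toℕ a) ⟨
      ((toℕ b + toℕ c) ℕ.% N + toℕ a) ℕ.% N         ≡⟨ cong (λ z → (z + toℕ a) ℕ.% N) (toℕ-addF b c) ⟨
      (toℕ (addF b c) + toℕ a) ℕ.% N                ≡⟨ toℕ-addF (addF b c) a ⟨
      toℕ (addF (addF b c) a)                       ≡⟨ cong toℕ (addF-comm (addF b c) a) ⟩
      toℕ (addF a (addF b c))                       ∎)
      where open ≡-Reasoning

opaque
  unfolding subF

  subF-00 : subF {1} zero zero ≡ zero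
  subF-00 = refl
  subF-01 : subF {1} zero (suc zero) ≡ suc zero
  subF-01 = refl
  subF-10 : subF {1} (suc zero) zero ≡ suc zero
  subF-10 = refl
  subF-11 : subF {1} (suc zero) (suc zero) ≡ zero
  subF-11 = refl

0≢1₂ : ∀ {a : Fin 2} → a ≡ zero → a ≡ suc zero → ⊥
0≢1₂ refl ()

-- Gadgets in the subtraction table

data Role : Set where
  H0 H1 W1 : Role

-- A gadget with home h and wire w permutes the rows H0 = (0 , h), H1 = (1 , h), W1 = (1 , w); the permutation depends
-- on the second coordinate of the column.
next : Fin 2 → Role → Role
next zero    H0 = W1
next zero    W1 = H0
next zero    H1 = H1
next (suc _) H0 = H1
next (suc _) H1 = W1
next (suc _) W1 = H0

next-inj : ∀ t ρ ρ' → next t ρ ≡ next t ρ' → ρ ≡ ρ'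
next-inj zero    H0 H0 _ = refl
next-inj zero    H1 H1 _ = refl
next-inj zero    W1 W1 _ = refl
next-inj (suc _) H0 H0 _ = refl
next-inj (suc _) H1 H1 _ = refl
next-inj (suc _) W1 W1 _ = refl

-- A monotone CNF formula whose clauses are (some of) the residues j < p: clause j is purely positive or purely
-- negative, and In j y says that variable y occurs in it.  Two extra coordinates (of sizes suc M' and 2)
-- multiply the order of the square.
record Formula : Set₁ where
  field
    M' p' nv : ℕ
    Act      : ℕ → Set
    act?     : ∀ j → Dec (Act j)
    pos      : ℕ → Bool
    In       : ℕ → ℕ → Set
    in?      : ∀ j y → Dec (In j y)
    Keep     : ℕ → Set
    keep?    : ∀ i → Dec (Keep i)
    keep0    : Keep 0

module Square (Φ : Formula) where
  open Formula Φ public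

  -- `p` is at least 3 so that the third coordinates 0 and 1 of the wires and 2 of the variable
  -- homes differ. `q` equals `nv + p`: one residue per variable and one private residue `κ a` for
  -- each `a`, which keeps clause homes away from all wires.
  p q M : ℕ
  p = suc (suc (suc p'))
  q = suc (nv + suc (suc p'))
  M = suc M'

  XY TXY Ix : Set
  XY  = Fin p × Fin q
  TXY = Fin 2 × Fin p × Fin q
  Ix  = Fin M × TXY

  0t 1t : Fin 2
  0t = zero
  1t = suc zero

  one two : Fin p
  one = suc zero
  two = suc (suc zero)

  L : Ix → Ix → Ix
  L (i , t , x , y) (i' , t' , a , b) = subF i i' , subF t t' , subF x a , subF y b

  L-injˡ : ∀ {r r'} c → L r c ≡ L r' c → r ≡ r'
  L-injˡ {i , t , x , y} {i₁ , t₁ , x₁ , y₁} (i' , t' , a , b) eq =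
    cong₂ _,_ (subF-injˡ {x = i} {i₁} {i'} (cong proj₁ eq)) (cong₂ _,_ (subF-injˡ {x = t} {t₁} {t'} (cong (proj₁ ∘ proj₂) eq))
      (cong₂ _,_ (subF-injˡ {x = x} {x₁} {a} (cong (proj₁ ∘ proj₂ ∘ proj₂) eq)) (subF-injˡ {x = y} {y₁} {b} (cong (proj₂ ∘ proj₂ ∘ proj₂) eq))))

  L-injʳ : ∀ r {c c'} → L r c ≡ L r c' → c ≡ c'
  L-injʳ (i , t , x , y) {i' , t' , a , b} {i₁ , t₁ , a₁ , b₁} eq =
    cong₂ _,_ (subF-injʳ {x = i} {i'} {i₁} (cong proj₁ eq)) (cong₂ _,_ (subF-injʳ {x = t} {t'} {t₁} (cong (proj₁ ∘ proj₂) eq))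
      (cong₂ _,_ (subF-injʳ {x = x} {a} {a₁} (cong (proj₁ ∘ proj₂ ∘ proj₂) eq)) (subF-injʳ {x = y} {b} {b₁} (cong (proj₂ ∘ proj₂ ∘ proj₂) eq))))

  -- The wire coordinate of the truth value that clause `j` must avoid: `ε false` for a positive
  -- clause, `ε true` for a negative one.
  eN : ℕ → ℕ
  eN j = if pos j then 1 else 0

  e : Fin p → Fin p
  e j = if pos (toℕ j) then one else zero

  toℕ-e : ∀ j → toℕ (e j) ≡ eN (toℕ j)
  toℕ-e j with pos (toℕ j)
  ... | true  = refl
  ... | false = refl

  ε : Bool → Fin p
  ε true  = zero
  ε false = one

  ε≢two : ∀ u → ε u ≢ two
  ε≢two true  ()
  ε≢two false ()

  e≢two : ∀ a → e a ≢ two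
  e≢two a with pos (toℕ a)
  ... | true  = λ ()
  ... | false = λ ()

  IsVar : Fin q → Set
  IsVar b = toℕ b < nv

  κ : Fin p → Fin q
  κ a = fromℕ< {nv + toℕ a} (subst (nv + toℕ a <_) (ℕ.+-suc nv _) (ℕ.+-monoʳ-< nv (F.toℕ<n a)))

  toℕ-κ : ∀ a → toℕ (κ a) ≡ nv + toℕ a
  toℕ-κ a = F.toℕ-fromℕ< _

  κ-inj : ∀ {a a'} → κ a ≡ κ a' → a ≡ a'
  κ-inj {a} {a'} eq = F.toℕ-injective (ℕ.+-cancelˡ-≡ nv _ _ (trans (sym (toℕ-κ a)) (trans (cong toℕ eq) (toℕ-κ a'))))

  κ-notVar : ∀ {a b} → IsVar b → κ a ≢ b
  κ-notVar {a} v refl = ℕ.<⇒≱ v (subst (nv ≤_) (sym (toℕ-κ a)) (ℕ.m≤m+n nv _))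

  el : Role → XY → XY → TXY
  el H0 h w = 0t , h
  el H1 h w = 1t , h
  el W1 h w = 1t , w

  el-inj : ∀ {h w} → h ≢ w → ∀ ρ ρ' → el ρ h w ≡ el ρ' h w → ρ ≡ ρ'
  el-inj h≢w H0 H0 _  = refl
  el-inj h≢w H1 H1 _  = refl
  el-inj h≢w H1 W1 eq = ⊥-elim (h≢w (cong proj₂ eq))
  el-inj h≢w W1 H1 eq = ⊥-elim (h≢w (sym (cong proj₂ eq)))
  el-inj h≢w W1 W1 _  = refl

  -- Checked role by role on `next`: the rows `H0` and `H1` meet the parities 1, 0 in the columns
  -- `t = 0, 1`, and the row `W1` meets 0, 1. So the parity of a moved symbol tells in which of the
  -- two columns it stands.
  type-inj : ∀ ρ h w t t' → subF (proj₁ (el (next t ρ) h w)) t ≡ subF (proj₁ (el (next t' ρ) h w)) t' → t ≡ t'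
  type-inj ρ  h w zero       zero       _ = refl
  type-inj ρ  h w (suc zero) (suc zero) _ = refl
  type-inj H0 h w zero (suc zero) eq = ⊥-elim (0≢1₂ subF-11 (trans (sym eq) subF-10))
  type-inj H1 h w zero (suc zero) eq = ⊥-elim (0≢1₂ subF-11 (trans (sym eq) subF-10))
  type-inj W1 h w zero (suc zero) eq = ⊥-elim (0≢1₂ subF-00 (trans eq subF-01))
  type-inj H0 h w (suc zero) zero eq = ⊥-elim (0≢1₂ subF-11 (trans eq subF-10))
  type-inj H1 h w (suc zero) zero eq = ⊥-elim (0≢1₂ subF-11 (trans eq subF-10))
  type-inj W1 h w (suc zero) zero eq = ⊥-elim (0≢1₂ subF-00 (trans (sym eq) subF-01))

  _≟τ_ : (τ τ' : TXY) → Dec (τ ≡ τ')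
  (t , x , y) ≟τ (t' , x' , y') with t F.≟ t' | x F.≟ x' | y F.≟ y'
  ... | yes refl | yes refl | yes refl = yes refl
  ... | no ne    | _        | _        = no λ { refl → ne refl }
  ... | yes _    | no ne    | _        = no λ { refl → ne refl }
  ... | yes _    | yes _    | no ne    = no λ { refl → ne refl }

  role? : ∀ h w τ → Dec (Σ Role λ ρ → el ρ h w ≡ τ)
  role? h w τ with el H0 h w ≟τ τ | el H1 h w ≟τ τ | el W1 h w ≟τ τ
  ... | yes eq | _      | _      = yes (H0 , eq)
  ... | no _   | yes eq | _      = yes (H1 , eq)
  ... | no _   | no _   | yes eq = yes (W1 , eq)
  ... | no n0  | no n1  | no n2  = no λ { (H0 , eq) → n0 eq ; (H1 , eq) → n1 eq ; (W1 , eq) → n2 eq }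

  hv : Fin q → XY
  hv b = two , b

  hc : Fin p → XY
  hc a = e a , κ a

  InCorner : Fin M → Fin M → Set
  InCorner i i' = i ≡ zero × i' ≡ zero

  VarRole : Fin p → TXY → Fin q → Set
  VarRole w τ b = IsVar b × Σ Role λ ρ → el ρ (hv b) (w , b) ≡ τ

  ClauseRole : Fin q → TXY → Fin p → Set
  ClauseRole k τ a = Act (toℕ a) × Σ Role λ ρ → el ρ (hc a) (e a , k) ≡ τ

  -- In a column (0 , t' , a , b) variable b acts through the wire (w , b), w = 0 for true and w = 1 for false, and clause a
  -- acts through the wire (e a , k) of the variable k chosen to satisfy it.
  data Class (w : Fin p) (k : Fin q) : Ix → Ix → Set where
    outside : ∀ {i τ i' γ} → ¬ InCorner i i' → Class w k (i , τ) (i' , γ)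
    inVar   : ∀ {τ t' a b} ρ → IsVar b → el ρ (hv b) (w , b) ≡ τ → Class w k (zero , τ) (zero , t' , a , b)
    inCl    : ∀ {τ t' a b} ρ → ¬ VarRole w τ b → Act (toℕ a) → el ρ (hc a) (e a , k) ≡ τ → Class w k (zero , τ) (zero , t' , a , b)
    neither : ∀ {τ t' a b} → ¬ VarRole w τ b → ¬ ClauseRole k τ a → Class w k (zero , τ) (zero , t' , a , b)

  varRole? : ∀ w τ b → Dec (VarRole w τ b)
  varRole? w τ b = (toℕ b ℕ.<? nv) ×-dec role? (hv b) (w , b) τ

  clauseRole? : ∀ k τ a → Dec (ClauseRole k τ a)
  clauseRole? k τ a = act? (toℕ a) ×-dec role? (hc a) (e a , k) τ

  opaque
    class : ∀ w k r c → Class w k r c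
    class w k (suc i , τ) (i' , γ)     = outside λ ()
    class w k (zero , τ)  (suc i' , γ) = outside λ ()
    class w k (zero , τ)  (zero , t' , a , b) with varRole? w τ b | clauseRole? k τ a
    ... | yes (v , ρ , eq) | _                  = inVar ρ v eq
    ... | no ¬v            | yes (act , ρ , eq) = inCl ρ ¬v act eq
    ... | no ¬v            | no ¬c              = neither ¬v ¬c

  eff : ∀ {w k r c} → Class w k r c → Ix
  eff {r = r} (outside _) = r
  eff {w} (inVar {t' = t'} {b = b} ρ _ _)       = zero , el (next t' ρ) (hv b) (w , b)
  eff {k = k} (inCl {t' = t'} {a = a} ρ _ _ _)  = zero , el (next t' ρ) (hc a) (e a , k)
  eff {r = r} (neither _ _) = r

  -- Kept apart from `A` because a column sees the assignment only through the wire `w` of its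
  -- variable and the choice `k` of its clause.
  A₀ : Fin p → Fin q → Ix → Ix → Ix
  A₀ w k r c = L (eff (class w k r c)) c

  A : (Fin q → Bool) → (Fin p → Fin q) → Ix → Ix → Ix
  A X pk r c@(i' , t' , a , b) = A₀ (ε (X b)) (pk a) r c

  σx : Ix → Fin p
  σx (_ , _ , x , _) = x

  -- For a fixed symbol only the clauses j with subF (e j) j equal to its x-coordinate can cause a collision.
  NoConflict : (Fin q → Bool) → (Fin p → Fin q) → Fin p → Set
  NoConflict X pk s = ∀ a → Act (toℕ a) → subF (e a) a ≡ s → ε (X (pk a)) ≢ e a

  hv≢w : ∀ {u b} → hv b ≢ (ε u , b)
  hv≢w {u} eq = ε≢two u (sym (cong proj₁ eq))

  module _ (X : Fin q → Bool) (pk : Fin p → Fin q) (pk-var : ∀ a → Act (toℕ a) → IsVar (pk a)) where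

    hc≢w : ∀ {a} → Act (toℕ a) → hc a ≢ (e a , pk a)
    hc≢w {a} act eq = κ-notVar (pk-var a act) (cong proj₂ eq)

    -- the supports of a variable gadget and of a clause gadget can only meet in their W1 rows
    cross : ∀ {a b} → IsVar b → Act (toℕ a) → ∀ ρ ρ' →
      el ρ (hv b) (ε (X b) , b) ≡ el ρ' (hc a) (e a , pk a) → ρ ≡ W1 × ρ' ≡ W1 × ε (X (pk a)) ≡ e a
    cross {a} {b} v act H0 H0 eq = ⊥-elim (e≢two a (sym (cong (proj₁ ∘ proj₂) eq)))
    cross {a} {b} v act H1 H1 eq = ⊥-elim (e≢two a (sym (cong (proj₁ ∘ proj₂) eq)))
    cross {a} {b} v act H1 W1 eq = ⊥-elim (e≢two a (sym (cong (proj₁ ∘ proj₂) eq)))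
    cross {a} {b} v act W1 H1 eq = ⊥-elim (κ-notVar v (sym (cong (proj₂ ∘ proj₂) eq)))
    cross {a} {b} v act W1 W1 eq = refl , refl ,
      trans (cong (ε ∘ X) (sym (cong (proj₂ ∘ proj₂) eq))) (cong (proj₁ ∘ proj₂) eq)

    module _ {σ : Ix} (nc : NoConflict X pk (σx σ)) where

      private
        clash : ∀ {a b} ρ ρ' → IsVar b → Act (toℕ a) → subF (proj₁ (proj₂ (el ρ' (hc a) (e a , pk a)))) a ≡ σx σ →
          el ρ (hv b) (ε (X b) , b) ≡ el ρ' (hc a) (e a , pk a) → ⊥
        clash {a} ρ ρ' v act sx eq with cross v act ρ ρ' eq
        ... | refl , refl , ε≡e = nc a act sx ε≡e

      -- Within a column each gadget acts by a permutation of three rows. Two rows can receive the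
      -- same symbol only if both gadgets deliver the entry of a common `W1` row; the symbol then
      -- has third coordinate `e a - a`, and `nc` forbids the coincidence of the wires.
      A-colInj : ∀ r r' c → A X pk r c ≡ σ → A X pk r' c ≡ σ → r ≡ r'
      A-colInj (i , τ) (i₂ , τ') c@(i' , t' , a , b) eq eq' =
        go (class (ε (X b)) (pk a) (i , τ) c) (class (ε (X b)) (pk a) (i₂ , τ') c) eq eq'
        where
        go : ∀ {i i₂ i' τ τ'} (u : Class (ε (X b)) (pk a) (i , τ) (i' , t' , a , b)) (v : Class (ε (X b)) (pk a) (i₂ , τ') (i' , t' , a , b)) →
          L (eff u) (i' , t' , a , b) ≡ σ → L (eff v) (i' , t' , a , b) ≡ σ → (i , τ) ≡ (i₂ , τ')
        go {i' = i'} u v p p' with L-injˡ {eff u} {eff v} (i' , t' , a , b) (trans p (sym p'))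
        go (outside _) (outside _) p p' | eq = eq
        go (outside n) (inVar _ _ _) p p' | eq = ⊥-elim (n (cong proj₁ eq , refl))
        go (outside n) (inCl _ _ _ _) p p' | eq = ⊥-elim (n (cong proj₁ eq , refl))
        go (outside n) (neither _ _) p p' | eq = ⊥-elim (n (cong proj₁ eq , refl))
        go (inVar _ _ _) (outside n) p p' | eq = ⊥-elim (n (sym (cong proj₁ eq) , refl))
        go (inCl _ _ _ _) (outside n) p p' | eq = ⊥-elim (n (sym (cong proj₁ eq) , refl))
        go (neither _ _) (outside n) p p' | eq = ⊥-elim (n (sym (cong proj₁ eq) , refl))
        go (inVar ρ v refl) (inVar ρ' v' refl) p p' | eq
          with next-inj t' ρ ρ' (el-inj (hv≢w {X b}) (next t' ρ) (next t' ρ') (cong proj₂ eq))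
        ... | refl = refl
        go (inVar ρ v refl) (inCl ρ' _ act refl) p p' | eq =
          ⊥-elim (clash {a} {b} (next t' ρ) (next t' ρ') v act (cong σx p') (cong proj₂ eq))
        go (inCl ρ' _ act refl) (inVar ρ v refl) p p' | eq =
          ⊥-elim (clash {a} {b} (next t' ρ) (next t' ρ') v act (cong σx p) (sym (cong proj₂ eq)))
        go (inVar ρ v refl) (neither ¬v _) p p' | eq = ⊥-elim (¬v (v , next t' ρ , cong proj₂ eq))
        go (neither ¬v _) (inVar ρ v refl) p p' | eq = ⊥-elim (¬v (v , next t' ρ , sym (cong proj₂ eq)))
        go (inCl ρ _ act refl) (inCl ρ' _ act' refl) p p' | eq
          with next-inj t' ρ ρ' (el-inj (hc≢w act) (next t' ρ) (next t' ρ') (cong proj₂ eq))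
        ... | refl = refl
        go (inCl ρ _ act refl) (neither _ ¬c) p p' | eq = ⊥-elim (¬c (act , next t' ρ , cong proj₂ eq))
        go (neither _ ¬c) (inCl ρ _ act refl) p p' | eq = ⊥-elim (¬c (act , next t' ρ , sym (cong proj₂ eq)))
        go (neither _ _) (neither _ _) p p' | eq = eq

      private
        y-of-var : ∀ ρ b w → proj₂ (proj₂ (el ρ (hv b) (w , b))) ≡ b
        y-of-var H0 b w = refl
        y-of-var H1 b w = refl
        y-of-var W1 b w = refl
        x-of-cl : ∀ ρ a k → proj₁ (proj₂ (el ρ (hc a) (e a , k))) ≡ e a
        x-of-cl H0 a k = refl
        x-of-cl H1 a k = refl
        x-of-cl W1 a k = refl

      -- All rows of a variable gadget have last coordinate `b`, so a symbol it moves has last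
      -- coordinate 0 and can recur in the row only in a column with the same `b`. For a clause
      -- gadget the third coordinates `e a` of the row and `e a - a` of the symbol fix `a` in the
      -- same way. Inside one gadget `type-inj` fixes the parity of the column, and the rest of the
      -- column follows as in `L`.
      A-rowInj : ∀ r c c' → A X pk r c ≡ σ → A X pk r c' ≡ σ → c ≡ c'
      A-rowInj (i , t , x , y) (i₁ , t₁ , a₁ , b₁) (i₂ , t₂ , a₂ , b₂) eq eq' = go (class (ε (X b₁)) (pk a₁) (i , t , x , y) (i₁ , t₁ , a₁ , b₁)) (class (ε (X b₂)) (pk a₂) (i , t , x , y) (i₂ , t₂ , a₂ , b₂)) eq eq'
        where
        go : ∀ {i i₁ i₂ t x y t₁ t₂ a₁ a₂ b₁ b₂} →
          (u : Class (ε (X b₁)) (pk a₁) (i , t , x , y) (i₁ , t₁ , a₁ , b₁)) (v : Class (ε (X b₂)) (pk a₂) (i , t , x , y) (i₂ , t₂ , a₂ , b₂)) →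
          L (eff u) (i₁ , t₁ , a₁ , b₁) ≡ σ → L (eff v) (i₂ , t₂ , a₂ , b₂) ≡ σ → (i₁ , t₁ , a₁ , b₁) ≡ (i₂ , t₂ , a₂ , b₂)
        go u v p p' with trans p (sym p')
        go {i} {t = t} {x} {y} (outside n) (outside _) p p' | eq = L-injʳ (i , t , x , y) eq
        go {i₁ = i₁} (outside n) (inVar _ _ _) p p' | eq = ⊥-elim (n (refl , subF-injʳ {x = zero} {i₁} {zero} (cong proj₁ eq)))
        go {i₁ = i₁} (outside n) (inCl _ _ _ _) p p' | eq = ⊥-elim (n (refl , subF-injʳ {x = zero} {i₁} {zero} (cong proj₁ eq)))
        go {i₁ = i₁} (outside n) (neither _ _) p p' | eq = ⊥-elim (n (refl , subF-injʳ {x = zero} {i₁} {zero} (cong proj₁ eq)))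
        go {i₂ = i₂} (inVar _ _ _) (outside n) p p' | eq = ⊥-elim (n (refl , subF-injʳ {x = zero} {i₂} {zero} (sym (cong proj₁ eq))))
        go {i₂ = i₂} (inCl _ _ _ _) (outside n) p p' | eq = ⊥-elim (n (refl , subF-injʳ {x = zero} {i₂} {zero} (sym (cong proj₁ eq))))
        go {i₂ = i₂} (neither _ _) (outside n) p p' | eq = ⊥-elim (n (refl , subF-injʳ {x = zero} {i₂} {zero} (sym (cong proj₁ eq))))
        go {t = t} {x} {y} (neither _ _) (neither _ _) p p' | eq = L-injʳ (zero , t , x , y) eq
        go {y = y} {t₁ = t₁} {t₂ = t₂} {b₁ = b₁} {b₂ = b₂} (inVar ρ v τ≡) (inVar ρ' v' τ≡') p p' | eq
          with trans (sym (y-of-var ρ b₁ (ε (X b₁)))) (cong (proj₂ ∘ proj₂) τ≡) | trans (sym (y-of-var ρ' b₂ (ε (X b₂)))) (cong (proj₂ ∘ proj₂) τ≡')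
        ... | refl | refl with el-inj (hv≢w {X y}) ρ ρ' (trans τ≡ (sym τ≡'))
        ... | refl with type-inj ρ (hv y) (ε (X y) , y) t₁ t₂ (cong (proj₁ ∘ proj₂) eq)
        ... | refl = L-injʳ (zero , el (next t₁ ρ) (hv y) (ε (X y) , y)) eq
        go {x = x} {t₁ = t₁} {t₂ = t₂} {a₁ = a₁} {a₂ = a₂} (inCl ρ ¬v act τ≡) (inCl ρ' ¬v' act' τ≡') p p' | eq
          with trans (sym (x-of-cl ρ a₁ (pk a₁))) (cong (proj₁ ∘ proj₂) τ≡) | trans (sym (x-of-cl ρ' a₂ (pk a₂))) (cong (proj₁ ∘ proj₂) τ≡')
        ... | ex | ex' with subF-injʳ {x = x} {a₁} {a₂} (trans (cong (λ z → subF z a₁) (sym (trans (x-of-cl (next t₁ ρ) a₁ (pk a₁)) ex)))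
                             (trans (cong σx eq) (cong (λ z → subF z a₂) (trans (x-of-cl (next t₂ ρ') a₂ (pk a₂)) ex'))))
        ... | refl with el-inj (hc≢w act) ρ ρ' (trans τ≡ (sym τ≡'))
        ... | refl with type-inj ρ (hc a₁) (e a₁ , pk a₁) t₁ t₂ (cong (proj₁ ∘ proj₂) eq)
        ... | refl = L-injʳ (zero , el (next t₁ ρ) (hc a₁) (e a₁ , pk a₁)) eq
        go {y = y} {t₁ = t₁} {b₁ = b₁} {b₂ = b₂} (inVar ρ v τ≡) (neither ¬v _) p p' | eq with trans (sym (y-of-var ρ b₁ (ε (X b₁)))) (cong (proj₂ ∘ proj₂) τ≡)
        ... | refl with subF-injʳ {x = y} {y} {b₂} (trans (cong (λ z → subF z y) (sym (y-of-var (next t₁ ρ) y (ε (X y))))) (cong (proj₂ ∘ proj₂ ∘ proj₂) eq))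
        ... | refl = ⊥-elim (¬v (v , ρ , τ≡))
        go {y = y} {t₂ = t₁} {b₁ = b₂} {b₂ = b₁} (neither ¬v _) (inVar ρ v τ≡) p p' | eq with trans (sym (y-of-var ρ b₁ (ε (X b₁)))) (cong (proj₂ ∘ proj₂) τ≡)
        ... | refl with subF-injʳ {x = y} {y} {b₂} (trans (cong (λ z → subF z y) (sym (y-of-var (next t₁ ρ) y (ε (X y))))) (sym (cong (proj₂ ∘ proj₂ ∘ proj₂) eq)))
        ... | refl = ⊥-elim (¬v (v , ρ , τ≡))
        go {x = x} {t₁ = t₁} {a₁ = a₁} {a₂ = a₂} (inCl ρ ¬v act τ≡) (neither _ ¬c) p p' | eq with trans (sym (x-of-cl ρ a₁ (pk a₁))) (cong (proj₁ ∘ proj₂) τ≡)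
        ... | ex with subF-injʳ {x = x} {a₁} {a₂} (trans (cong (λ z → subF z a₁) (sym (trans (x-of-cl (next t₁ ρ) a₁ (pk a₁)) ex))) (cong σx eq))
        ... | refl = ⊥-elim (¬c (act , ρ , τ≡))
        go {x = x} {t₂ = t₁} {a₁ = a₂} {a₂ = a₁} (neither _ ¬c) (inCl ρ ¬v act τ≡) p p' | eq with trans (sym (x-of-cl ρ a₁ (pk a₁))) (cong (proj₁ ∘ proj₂) τ≡)
        ... | ex with subF-injʳ {x = x} {a₁} {a₂} (trans (cong (λ z → subF z a₁) (sym (trans (x-of-cl (next t₁ ρ) a₁ (pk a₁)) ex))) (sym (cong σx eq)))
        ... | refl = ⊥-elim (¬c (act , ρ , τ≡))
        -- The row belongs to a variable gadget in one column and to a clause gadget in the other.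
        -- The columns need not agree, but the symbol has third coordinate `e a₂ - a₂`, so `nc`
        -- applies again.
        go {t₂ = t₂} {a₂ = a₂} {b₁ = b₁} (inVar ρ v τ≡) (inCl ρ' _ act τ≡') p p' | eq with trans (sym (y-of-var ρ b₁ (ε (X b₁)))) (cong (proj₂ ∘ proj₂) τ≡)
        ... | refl = ⊥-elim (clash {a₂} {b₁} ρ ρ' v act
          (trans (cong (λ z → subF z a₂) (trans (x-of-cl ρ' a₂ (pk a₂)) (sym (x-of-cl (next t₂ ρ') a₂ (pk a₂))))) (cong σx p')) (trans τ≡ (sym τ≡')))
        go {t₁ = t₂} {a₁ = a₂} {b₂ = b₁} (inCl ρ' _ act τ≡') (inVar ρ v τ≡) p p' | eq with trans (sym (y-of-var ρ b₁ (ε (X b₁)))) (cong (proj₂ ∘ proj₂) τ≡)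
        ... | refl = ⊥-elim (clash {a₂} {b₁} ρ ρ' v act
          (trans (cong (λ z → subF z a₂) (trans (x-of-cl ρ' a₂ (pk a₂)) (sym (x-of-cl (next t₂ ρ') a₂ (pk a₂))))) (cong σx p)) (trans τ≡ (sym τ≡')))

-- The partial square and the arrays that extend it

module Partial (Φ : Formula) where
  open Square Φ public

  -- The place shared by `H0` and `H1`. Where the parities of row and column agree, the entry comes
  -- from the wire row and is left empty; `H0` in the columns `t' = 1` always receives the entry of
  -- `H1`. That displaced entry is prescribed through `FlipN`, so a completion cannot leave the
  -- gadget idle.
  HomeN : ℕ → ℕ → ℕ → ℕ → Set
  HomeN x y a b = (x ≡ 2 × y ≡ b × b < nv) ⊎ (Act a × x ≡ eN a × y ≡ nv + a)

  -- Every wire that some assignment could use: both truth values of the variable `b`, and every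
  -- member of clause `a`.
  WireN : ℕ → ℕ → ℕ → ℕ → Set
  WireN x y a b = x < 2 × y < nv × (y ≡ b ⊎ (Act a × x ≡ eN a × In a y))

  -- Outside the rows that are not kept, the empty cells are those whose content depends on the assignment; the cells of
  -- FlipN are moved by a gadget in the same way under every assignment.
  EmptyN : (i t x y i' t' a b : ℕ) → Set
  EmptyN i t x y i' t' a b = ¬ Keep i ⊎ (i ≡ 0 × i' ≡ 0 × ((t ≡ t' × HomeN x y a b) ⊎ (t ≡ 1 × WireN x y a b)))

  FlipN : (i t x y i' t' a b : ℕ) → Set
  FlipN i t x y i' t' a b = i ≡ 0 × i' ≡ 0 × t ≡ 0 × t' ≡ 1 × HomeN x y a b

  homeN? : ∀ x y a b → Dec (HomeN x y a b)
  homeN? x y a b = ((x ℕ.≟ 2) ×-dec (y ℕ.≟ b) ×-dec (b ℕ.<? nv)) ⊎-dec (act? a ×-dec (x ℕ.≟ eN a) ×-dec (y ℕ.≟ nv + a))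

  wireN? : ∀ x y a b → Dec (WireN x y a b)
  wireN? x y a b = (x ℕ.<? 2) ×-dec (y ℕ.<? nv) ×-dec ((y ℕ.≟ b) ⊎-dec (act? a ×-dec (x ℕ.≟ eN a) ×-dec in? a y))

  emptyN? : ∀ i t x y i' t' a b → Dec (EmptyN i t x y i' t' a b)
  emptyN? i t x y i' t' a b = ¬? (keep? i) ⊎-dec ((i ℕ.≟ 0) ×-dec (i' ℕ.≟ 0) ×-dec
    (((t ℕ.≟ t') ×-dec homeN? x y a b) ⊎-dec ((t ℕ.≟ 1) ×-dec wireN? x y a b)))

  flipN? : ∀ i t x y i' t' a b → Dec (FlipN i t x y i' t' a b)
  flipN? i t x y i' t' a b = (i ℕ.≟ 0) ×-dec (i' ℕ.≟ 0) ×-dec (t ℕ.≟ 0) ×-dec (t' ℕ.≟ 1) ×-dec homeN? x y a b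

  onIx : {R : Set₁} → ((i t x y i' t' a b : ℕ) → R) → Ix → Ix → R
  onIx f (i , t , x , y) (i' , t' , a , b) = f (toℕ i) (toℕ t) (toℕ x) (toℕ y) (toℕ i') (toℕ t') (toℕ a) (toℕ b)

  Empty Flip : Ix → Ix → Set
  Empty = onIx EmptyN
  Flip  = onIx FlipN

  empty? : ∀ r c → Dec (Empty r c)
  empty? (i , t , x , y) (i' , t' , a , b) = emptyN? (toℕ i) (toℕ t) (toℕ x) (toℕ y) (toℕ i') (toℕ t') (toℕ a) (toℕ b)

  flip? : ∀ r c → Dec (Flip r c)
  flip? (i , t , x , y) (i' , t' , a , b) = flipN? (toℕ i) (toℕ t) (toℕ x) (toℕ y) (toℕ i') (toℕ t') (toℕ a) (toℕ b)

  twin : Ix → Ix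
  twin (i , t , x , y) = i , 1t , x , y

  Pc : Ix → Ix → Maybe Ix
  Pc r c = if does (empty? r c) then nothing else just (if does (flip? r c) then L (twin r) c else L r c)

  data PView (r c : Ix) : Maybe Ix → Set where
    pE : Empty r c → PView r c nothing
    pF : ¬ Empty r c → Flip r c → PView r c (just (L (twin r) c))
    pN : ¬ Empty r c → ¬ Flip r c → PView r c (just (L r c))

  pview : ∀ r c → PView r c (Pc r c)
  pview r c = go (empty? r c) (flip? r c)
    where
    go : (em : Dec (Empty r c)) (fl : Dec (Flip r c)) → PView r c (if does em then nothing else just (if does fl then L (twin r) c else L r c))
    go (yes em) _        = pE em
    go (no ¬em) (yes fl) = pF ¬em fl
    go (no ¬em) (no ¬fl) = pN ¬em ¬fl

  toℕ-ε<2 : ∀ u → toℕ (ε u) < 2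
  toℕ-ε<2 true  = s≤s z≤n
  toℕ-ε<2 false = s≤s (s≤s z≤n)

  eN<2 : ∀ a → toℕ (e a) < 2
  eN<2 a with pos (toℕ a)
  ... | true  = s≤s (s≤s z≤n)
  ... | false = s≤s z≤n

  ε≢e : ∀ a u → u ≡ pos (toℕ a) → ε u ≢ e a
  ε≢e a u refl with pos (toℕ a)
  ... | true  = λ ()
  ... | false = λ ()

  ε≡e : ∀ a → ε (not (pos (toℕ a))) ≡ e a
  ε≡e a with pos (toℕ a)
  ... | true  = refl
  ... | false = refl

  home⇒ : ∀ {w k x y a b} → HomeN (toℕ x) (toℕ y) (toℕ a) (toℕ b) → VarRole w (0t , x , y) b ⊎ ClauseRole k (0t , x , y) a
  home⇒ {x = x} {y} {a} {b} (inj₁ (x≡ , y≡ , v)) with F.toℕ-injective {j = two} x≡ | F.toℕ-injective {i = y} {b} y≡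
  ... | refl | refl = inj₁ (v , H0 , refl)
  home⇒ {x = x} {y} {a} {b} (inj₂ (act , x≡ , y≡))
    with F.toℕ-injective {j = e a} (trans x≡ (sym (toℕ-e a))) | F.toℕ-injective {j = κ a} (trans y≡ (sym (toℕ-κ a)))
  ... | refl | refl = inj₂ (act , H0 , refl)

  homeV : ∀ {a : Fin p} {b : Fin q} → IsVar b → HomeN 2 (toℕ b) (toℕ a) (toℕ b)
  homeV v = inj₁ (refl , refl , v)

  homeC : ∀ {a : Fin p} {b : Fin q} → Act (toℕ a) → HomeN (toℕ (e a)) (toℕ (κ a)) (toℕ a) (toℕ b)
  homeC {a} act = inj₂ (act , toℕ-e a , toℕ-κ a)

  -- Only two roles of a gadget are filled: `H0` at `t' = 1`, which gets the entry of its twin, and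
  -- `H1` at `t' = 0`, which the transposition fixes. In all other roles the wire is involved and
  -- the cell is empty.
  A-extends : ∀ X pk → (∀ a → Act (toℕ a) → IsVar (pk a) × In (toℕ a) (toℕ (pk a))) →
    ∀ r c s → Pc r c ≡ just s → A X pk r c ≡ s
  A-extends X pk pk-in r@(i , τ) c@(i' , t' , a , b) s eq = go (pview r c) (class (ε (X b)) (pk a) r c) eq
    where
    go : ∀ {i τ i' t' z} → PView (i , τ) (i' , t' , a , b) z → (u : Class (ε (X b)) (pk a) (i , τ) (i' , t' , a , b)) →
      z ≡ just s → L (eff u) (i' , t' , a , b) ≡ s
    go (pE _) u ()
    go {i} {i' = i'} (pF _ (i0 , i0' , _)) (outside n) refl = ⊥-elim (n (F.toℕ-injective i0 , F.toℕ-injective i0'))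
    go {t' = suc zero} (pF _ (_ , _ , t0 , t1 , h)) (inVar H0 v refl) refl = refl
    go {t' = suc zero} (pF _ (_ , _ , t0 , t1 , h)) (inCl H0 ¬v act refl) refl = refl
    go (pF _ (_ , _ , () , t1 , h)) (inVar H1 v refl) refl
    go (pF _ (_ , _ , () , t1 , h)) (inVar W1 v refl) refl
    go (pF _ (_ , _ , () , t1 , h)) (inCl H1 ¬v act refl) refl
    go (pF _ (_ , _ , () , t1 , h)) (inCl W1 ¬v act refl) refl
    go {τ = zero , x , y} (pF _ (_ , _ , _ , t1 , h)) (neither ¬v ¬c) refl with home⇒ {ε (X b)} {pk a} {x} {y} {a} {b} h
    ... | inj₁ v = ⊥-elim (¬v v)
    ... | inj₂ c = ⊥-elim (¬c c)
    go {τ = suc _ , _} (pF _ (_ , _ , () , t1 , h)) (neither ¬v ¬c) refl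
    go (pN ¬em ¬fl) (outside _) refl = refl
    go (pN ¬em ¬fl) (neither _ _) refl = refl
    go {t' = zero}     (pN ¬em ¬fl) (inVar H0 v refl) refl = ⊥-elim (¬em (inj₂ (refl , refl , inj₁ (refl , homeV {a} v))))
    go {t' = suc zero} (pN ¬em ¬fl) (inVar H0 v refl) refl = ⊥-elim (¬fl (refl , refl , refl , refl , homeV {a} v))
    go {t' = zero}     (pN ¬em ¬fl) (inVar H1 v refl) refl = refl
    go {t' = suc zero} (pN ¬em ¬fl) (inVar H1 v refl) refl = ⊥-elim (¬em (inj₂ (refl , refl , inj₁ (refl , homeV {a} v))))
    go (pN ¬em ¬fl) (inVar W1 v refl) refl = ⊥-elim (¬em (inj₂ (refl , refl , inj₂ (refl , toℕ-ε<2 (X b) , v , inj₁ refl))))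
    go {t' = zero}     (pN ¬em ¬fl) (inCl H0 _ act refl) refl = ⊥-elim (¬em (inj₂ (refl , refl , inj₁ (refl , homeC {a} {b} act))))
    go {t' = suc zero} (pN ¬em ¬fl) (inCl H0 _ act refl) refl = ⊥-elim (¬fl (refl , refl , refl , refl , homeC {a} {b} act))
    go {t' = zero}     (pN ¬em ¬fl) (inCl H1 _ act refl) refl = refl
    go {t' = suc zero} (pN ¬em ¬fl) (inCl H1 _ act refl) refl = ⊥-elim (¬em (inj₂ (refl , refl , inj₁ (refl , homeC {a} {b} act))))
    go (pN ¬em ¬fl) (inCl W1 _ act refl) refl =
      ⊥-elim (¬em (inj₂ (refl , refl , inj₂ (refl , eN<2 a , proj₁ (pk-in a act) , inj₂ (act , toℕ-e a , proj₂ (pk-in a act))))))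

  -- A clash with clause `a` shows only in symbols with third coordinate `e a - a`; injectivity of
  -- this residue lets every symbol be handled with a single clause in mind.
  Separated : Set
  Separated = ∀ (a a' : Fin p) → Act (toℕ a) → Act (toℕ a') → subF (e a) a ≡ subF (e a') a' → a ≡ a'

  TwoMembers : Set
  TwoMembers = ∀ (a : Fin p) → Act (toℕ a) → Σ (Fin q) λ v → Σ (Fin q) λ v' →
    v ≢ v' × (IsVar v × In (toℕ a) (toℕ v)) × (IsVar v' × In (toℕ a) (toℕ v'))

  xor-cancel : ∀ u z → (u xor z) xor z ≡ u
  xor-cancel true  true  = refl
  xor-cancel true  false = refl
  xor-cancel false true  = refl
  xor-cancel false false = refl

  -- The half-integral certificate for Hall's Condition

  module Certificate (sep : Separated) (members : TwoMembers) where

    v1 v2 : Fin p → Fin q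
    v1 a with act? (toℕ a)
    ... | yes act = proj₁ (members a act)
    ... | no _    = zero
    v2 a with act? (toℕ a)
    ... | yes act = proj₁ (proj₂ (members a act))
    ... | no _    = zero

    v1≢v2 : ∀ a → Act (toℕ a) → v1 a ≢ v2 a
    v1≢v2 a act with act? (toℕ a)
    ... | yes act' = proj₁ (proj₂ (proj₂ (members a act')))
    ... | no ¬act  = ⊥-elim (¬act act)

    v1-in : ∀ a → Act (toℕ a) → IsVar (v1 a) × In (toℕ a) (toℕ (v1 a))
    v1-in a act with act? (toℕ a)
    ... | yes act' = proj₁ (proj₂ (proj₂ (proj₂ (members a act'))))
    ... | no ¬act  = ⊥-elim (¬act act)

    v2-in : ∀ a → Act (toℕ a) → IsVar (v2 a) × In (toℕ a) (toℕ (v2 a))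
    v2-in a act with act? (toℕ a)
    ... | yes act' = proj₂ (proj₂ (proj₂ (proj₂ (members a act'))))
    ... | no ¬act  = ⊥-elim (¬act act)

    -- A member of clause `a` picked from the value `u` of `v1 a` alone: `v1 a` if that value is
    -- right, otherwise `v2 a`. Ignoring the value of `v2 a` keeps most cells dependent on a single
    -- variable.
    choose : Fin p → Bool → Fin q
    choose a u = if u xor pos (toℕ a) then v2 a else v1 a

    pkOf : (Fin q → Bool) → Fin p → Fin q
    pkOf X a = choose a (X (v1 a))

    choose-in : ∀ a u → Act (toℕ a) → IsVar (choose a u) × In (toℕ a) (toℕ (choose a u))
    choose-in a u act with u xor pos (toℕ a)
    ... | true  = v2-in a act
    ... | false = v1-in a act

    Relevant : Fin p → Fin p → Set
    Relevant s a = Act (toℕ a) × subF (e a) a ≡ s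

    X₀? : ∀ s v → Dec (∃ λ a → Relevant s a × v1 a ≡ v)
    X₀? s v = F.any? (λ a → (act? (toℕ a) ×-dec (subF (e a) a F.≟ s)) ×-dec (v1 a F.≟ v))

    -- Two complementary assignments for each residue `s`. The relevant clause sees `v1 a` and
    -- `v2 a` with opposite values, so one of them is right whatever the sign of the clause and the
    -- mode.
    Xm : Bool → Fin p → Fin q → Bool
    Xm m s v = m xor does (X₀? s v)

    Xm-v1 : ∀ m s a → Relevant s a → Xm m s (v1 a) ≡ m xor true
    Xm-v1 m s a rel = cong (m xor_) (dec-true (X₀? s (v1 a)) (a , rel , refl))

    -- `Separated` enters here: `v2 a` could share the value of `v1 a` only by being `v1 a'` for
    -- another relevant clause `a'`.
    Xm-v2 : ∀ m s a → Relevant s a → Xm m s (v2 a) ≡ m xor false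
    Xm-v2 m s a rel@(act , eq) = cong (m xor_) (dec-false (X₀? s (v2 a)) λ { (a' , (act' , eq') , v≡) → v1≢v2 a act (other a' act' eq' v≡) })
      where
      other : ∀ a' → Act (toℕ a') → subF (e a') a' ≡ s → v1 a' ≡ v2 a → v1 a ≡ v2 a
      other a' act' eq' v≡ with sep a' a act' act (trans eq' (sym eq))
      ... | refl = v≡

    opposite : ∀ m s a → Relevant s a → Xm m s (v2 a) ≡ not (Xm m s (v1 a))
    opposite m s a rel rewrite Xm-v1 m s a rel | Xm-v2 m s a rel with m
    ... | true  = refl
    ... | false = refl

    choose-good : ∀ (X : Fin q → Bool) a → X (v2 a) ≡ not (X (v1 a)) → X (pkOf X a) ≡ pos (toℕ a)
    choose-good X a opp = go (X (v1 a)) (pos (toℕ a)) refl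
      where
      go : ∀ u w → X (v1 a) ≡ u → X (if u xor w then v2 a else v1 a) ≡ w
      go true  true  x1 = x1
      go false false x1 = x1
      go true  false x1 = trans opp (cong not x1)
      go false true  x1 = trans opp (cong not x1)

    noConflict : ∀ m s → NoConflict (Xm m s) (pkOf (Xm m s)) s
    noConflict m s a act eq = ε≢e a _ (choose-good (Xm m s) a (opposite m s a (act , eq)))

    AX : (Fin q → Bool) → Ix → Ix → Ix
    AX X = A X (pkOf X)

    B : Bool → Ix → Ix → Ix → Ix
    B m σ = AX (Xm m (σx σ))

    Covered : Ix → Ix → Set
    Covered r c = Σ (Bool × Ix) λ u → Σ (Bool × Ix) λ v → u ≢ v × B (proj₁ u) (proj₂ u) r c ≡ proj₂ u × B (proj₁ v) (proj₂ v) r c ≡ proj₂ v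

    -- If a cell depends on the assignment through one variable `v`, each value `u` gives a symbol
    -- `G u`, and the mode can be adjusted so that the assignment belonging to `G u` has value `u`
    -- at `v`. Should both symbols be equal, the two modes still differ.
    local : ∀ r c v (G : Bool → Ix) → (∀ X → AX X r c ≡ G (X v)) → Covered r c
    local r c v G h = (m false , G false) , (m true , G true) , ne , at false , at true
      where
      m : Bool → Bool
      m u = u xor does (X₀? (σx (G u)) v)
      at : ∀ u → B (m u) (G u) r c ≡ G u
      at u = trans (h (Xm (m u) (σx (G u)))) (cong G (xor-cancel u (does (X₀? (σx (G u)) v))))
      xor-inj : ∀ z → false xor z ≢ true xor z
      xor-inj true  ()
      xor-inj false ()
      ne : (m false , G false) ≢ (m true , G true)
      ne eq = xor-inj (does (X₀? (σx (G false)) v)) (trans (cong proj₁ eq) (cong (λ g → true xor does (X₀? (σx g) v)) (sym (cong proj₂ eq))))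

    hc≢ : ∀ {a a' : Fin p} {u} → Act (toℕ a) → hc a' ≢ (e a' , choose a u)
    hc≢ {a} {u = u} act eq = κ-notVar (proj₁ (choose-in a u act)) (cong proj₂ eq)

    -- The effective row is the same for every derivation of `Class`, so any derivation may replace
    -- the one computed by `class`.
    cell : ∀ {X r i' t' a b} → (u : Class (ε (X b)) (pkOf X a) r (i' , t' , a , b)) → AX X r (i' , t' , a , b) ≡ L (eff u) (i' , t' , a , b)
    cell {X} {r} {i'} {t'} {a} {b} u with class (ε (X b)) (pkOf X a) r (i' , t' , a , b) | u
    ... | outside _ | outside _ = refl
    ... | outside n | inVar _ _ _ = ⊥-elim (n (refl , refl))
    ... | outside n | inCl _ _ _ _ = ⊥-elim (n (refl , refl))
    ... | outside n | neither _ _ = ⊥-elim (n (refl , refl))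
    ... | inVar _ _ _ | outside n = ⊥-elim (n (refl , refl))
    ... | inCl _ _ _ _ | outside n = ⊥-elim (n (refl , refl))
    ... | neither _ _ | outside n = ⊥-elim (n (refl , refl))
    ... | inVar ρ _ eq | inVar ρ' _ eq' with el-inj (hv≢w {X b}) ρ ρ' (trans eq (sym eq'))
    ...   | refl = refl
    cell {X} {r} {i'} {t'} {a} {b} u | inCl ρ _ act eq | inCl ρ' _ _ eq' with el-inj (hc≢ {a} {a} {X (v1 a)} act) ρ ρ' (trans eq (sym eq'))
    ...   | refl = refl
    cell u | neither _ _ | neither _ _ = refl
    cell u | inVar ρ v eq | inCl _ ¬v _ _ = ⊥-elim (¬v (v , ρ , eq))
    cell u | inVar ρ v eq | neither ¬v _ = ⊥-elim (¬v (v , ρ , eq))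
    cell u | inCl _ ¬v _ _ | inVar ρ v eq = ⊥-elim (¬v (v , ρ , eq))
    cell u | neither ¬v _ | inVar ρ v eq = ⊥-elim (¬v (v , ρ , eq))
    cell u | inCl ρ _ act eq | neither _ ¬c = ⊥-elim (¬c (act , ρ , eq))
    cell u | neither _ ¬c | inCl ρ _ act eq = ⊥-elim (¬c (act , ρ , eq))

    -- a cell influenced only by the variable gadget of its column, resp. only by the clause gadget
    coveredV : ∀ τ t' a b → (∀ u k → (k ≡ v1 a ⊎ k ≡ v2 a) → ¬ VarRole (ε u) τ b → ¬ ClauseRole k τ a) → Covered (zero , τ) (zero , t' , a , b)
    coveredV τ t' a b never = local (zero , τ) (zero , t' , a , b) b (λ u → G u (varRole? (ε u) τ b)) (λ X → eq X (varRole? (ε (X b)) τ b))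
      where
      G : ∀ u → Dec (VarRole (ε u) τ b) → Ix
      G u (yes (v , ρ , _)) = L (zero , el (next t' ρ) (hv b) (ε u , b)) (zero , t' , a , b)
      G u (no _)            = L (zero , τ) (zero , t' , a , b)
      chosen : ∀ u → choose a u ≡ v1 a ⊎ choose a u ≡ v2 a
      chosen u with u xor pos (toℕ a)
      ... | true  = inj₂ refl
      ... | false = inj₁ refl
      eq : ∀ X d → AX X (zero , τ) (zero , t' , a , b) ≡ G (X b) d
      eq X (yes (v , ρ , e≡)) = cell {X} (inVar ρ v e≡)
      eq X (no ¬v)            = cell {X} (neither ¬v (never (X b) _ (chosen (X (v1 a))) ¬v))

    coveredC : ∀ τ t' a b → (∀ u → ¬ VarRole (ε u) τ b) → Covered (zero , τ) (zero , t' , a , b)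
    coveredC τ t' a b never = local (zero , τ) (zero , t' , a , b) (v1 a) (λ u → G u (clauseRole? (choose a u) τ a)) (λ X → eq X (clauseRole? (choose a (X (v1 a))) τ a))
      where
      G : ∀ u → Dec (ClauseRole (choose a u) τ a) → Ix
      G u (yes (act , ρ , _)) = L (zero , el (next t' ρ) (hc a) (e a , choose a u)) (zero , t' , a , b)
      G u (no _)              = L (zero , τ) (zero , t' , a , b)
      eq : ∀ X d → AX X (zero , τ) (zero , t' , a , b) ≡ G (X (v1 a)) d
      eq X (yes (act , ρ , e≡)) = cell {X} (inCl ρ (never (X b)) act e≡)
      eq X (no ¬c)              = cell {X} (neither (never (X b)) ¬c)

    -- The only kind of cell that depends on two variables, `v1 a` and `b = v2 a`. One cover is the
    -- move of the variable gadget when `b` has the wrong value. The other is the move of the clause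
    -- gadget: its symbol makes clause `a` relevant, so giving `b` the right value makes `v1 a`
    -- wrong and the choice falls on `b`.
    coveredBoth : ∀ t' a → Act (toℕ a) → Covered (zero , 1t , e a , v2 a) (zero , t' , a , v2 a)
    coveredBoth t' a act = (m₁ , g₁) , (m₂ , g₂) , ne , at₁ , at₂
      where
      b : Fin q
      b = v2 a
      c r : Ix
      c = zero , t' , a , b
      r = zero , 1t , e a , b
      g₁ g₂ : Ix
      g₁ = L (zero , 0t , hv b) c
      g₂ = L (zero , 0t , hc a) c
      mode : Bool → Ix → Bool
      mode u σ = u xor does (X₀? (σx σ) b)
      mode-ok : ∀ u σ → Xm (mode u σ) (σx σ) b ≡ u
      mode-ok u σ = xor-cancel u (does (X₀? (σx σ) b))
      m₁ m₂ : Bool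
      m₁ = mode (not (pos (toℕ a))) g₁
      m₂ = mode (pos (toℕ a)) g₂
      ne : (m₁ , g₁) ≢ (m₂ , g₂)
      ne eq = e≢two a (sym (subF-injˡ {x = two} {e a} {a} (cong σx (cong proj₂ eq))))
      W1-H0 : ∀ t' {h w} → el (next t' W1) h w ≡ (0t , h)
      W1-H0 zero    = refl
      W1-H0 (suc _) = refl
      at₁ : B m₁ g₁ r c ≡ g₁
      at₁ = trans (cell {Xm m₁ (σx g₁)} (inVar W1 (proj₁ (v2-in a act)) (cong (λ z → 1t , z , b) (trans (cong ε (mode-ok _ g₁)) (ε≡e a)))))
        (cong (λ z → L (zero , z) c) (W1-H0 t' {hv b}))
      rel : Relevant (σx g₂) a
      rel = act , refl
      X : Fin q → Bool
      X = Xm m₂ (σx g₂)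
      Xb : X b ≡ pos (toℕ a)
      Xb = mode-ok (pos (toℕ a)) g₂
      Xv1 : X (v1 a) ≡ not (pos (toℕ a))
      Xv1 = trans (sym (not-not _)) (cong not (trans (sym (opposite m₂ (σx g₂) a rel)) Xb))
        where
        not-not : ∀ u → not (not u) ≡ u
        not-not true  = refl
        not-not false = refl
      pick : pkOf X a ≡ b
      pick = trans (cong (choose a) Xv1) (second (pos (toℕ a)))
        where
        second : ∀ u → (if not u xor u then v2 a else v1 a) ≡ v2 a
        second true  = refl
        second false = refl
      notVar : ¬ VarRole (ε (X b)) (1t , e a , b) b
      notVar (_ , H1 , eq) = e≢two a (sym (cong (proj₁ ∘ proj₂) eq))
      notVar (_ , W1 , eq) = ε≢e a (X b) Xb (cong (proj₁ ∘ proj₂) eq)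
      at₂ : B m₂ g₂ r c ≡ g₂
      at₂ = trans (cell {X} (inCl W1 notVar act (cong (λ z → 1t , e a , z) pick))) (cong (λ z → L (zero , z) c) (W1-H0 t' {hc a}))

    -- The choice in clause `a` is a function of the value of `v1 a`, so in the columns of `v1 a`
    -- both gadgets are governed by this one variable.
    coveredFirst : ∀ τ t' a → Covered (zero , τ) (zero , t' , a , v1 a)
    coveredFirst τ t' a = local (zero , τ) (zero , t' , a , v1 a) (v1 a) (λ u → A₀ (ε u) (choose a u) (zero , τ) (zero , t' , a , v1 a)) (λ X → refl)

    -- On a wire row of `b`, the clause gadget has a role only if `x = e a` and `b` is the chosen
    -- member. Apart from the case of `coveredBoth`, the cell is therefore governed by the variable
    -- gadget alone.
    wired : ∀ {x t' a b} → IsVar b → Act (toℕ a) → b ≢ v1 a → Covered (zero , 1t , x , b) (zero , t' , a , b)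
    wired {x} {t'} {a} {b} v act b≢v1 with x F.≟ e a | b F.≟ v2 a
    ... | yes refl | yes refl = coveredBoth t' a act
    ... | no ne | _ = coveredV (1t , x , b) t' a b λ { u k _ _ (_ , H1 , eq) → ne (sym (cong (proj₁ ∘ proj₂) eq)) ; u k _ _ (_ , W1 , eq) → ne (sym (cong (proj₁ ∘ proj₂) eq)) }
    ... | yes _ | no b≢v2 = coveredV (1t , x , b) t' a b λ
      { u k _ _ (_ , H1 , eq) → κ-notVar v (cong (proj₂ ∘ proj₂) eq)
      ; u k (inj₁ k≡) _ (_ , W1 , eq) → b≢v1 (trans (sym (cong (proj₂ ∘ proj₂) eq)) k≡)
      ; u k (inj₂ k≡) _ (_ , W1 , eq) → b≢v2 (trans (sym (cong (proj₂ ∘ proj₂) eq)) k≡) }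

    cover : ∀ r c → Covered r c
    cover r@(suc i , τ) c = local r c zero (λ _ → L r c) (λ X → cell {X} (outside λ ()))
    cover r@(zero , τ) c@(suc i' , γ) = local r c zero (λ _ → L r c) (λ X → cell {X} (outside λ ()))
    cover (zero , τ) (zero , t' , a , b) = corner τ (b F.≟ v1 a) (act? (toℕ a)) (varRole? zero τ b) (varRole? one τ b)
      where
      corner : ∀ τ → Dec (b ≡ v1 a) → Dec (Act (toℕ a)) → Dec (VarRole zero τ b) → Dec (VarRole one τ b) → Covered (zero , τ) (zero , t' , a , b)
      corner τ (yes refl) _ _ _ = coveredFirst τ t' a
      corner τ (no _) (no ¬act) _ _ = coveredV τ t' a b (λ u k _ _ cr → ¬act (proj₁ cr))
      corner τ (no _) (yes _) (no n0) (no n1) = coveredC τ t' a b λ { true → n0 ; false → n1 }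
      corner τ (no _) (yes _) (yes (v , H0 , refl)) _ = coveredV τ t' a b λ { u k _ ¬v _ → ¬v (v , H0 , refl) }
      corner τ (no _) (yes _) (yes (v , H1 , refl)) _ = coveredV τ t' a b λ { u k _ ¬v _ → ¬v (v , H1 , refl) }
      corner τ (no _) (yes _) (no _) (yes (v , H0 , refl)) = coveredV τ t' a b λ { u k _ ¬v _ → ¬v (v , H0 , refl) }
      corner τ (no _) (yes _) (no _) (yes (v , H1 , refl)) = coveredV τ t' a b λ { u k _ ¬v _ → ¬v (v , H1 , refl) }
      corner τ (no b≢v1) (yes act) (yes (v , W1 , refl)) _ = wired v act b≢v1
      corner τ (no b≢v1) (yes act) (no _) (yes (v , W1 , refl)) = wired v act b≢v1

-- Correctness of the construction

injective⇒surjective : ∀ {n} (f : Fin n → Fin n) → (∀ i j → f i ≡ f j → i ≡ j) → ∀ s → Σ (Fin n) λ c → f c ≡ s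
injective⇒surjective {suc n} f inj s with F.any? (λ c → f c F.≟ s)
... | yes found = found
... | no none   = ⊥-elim (ℕ.<-irrefl refl (F.injective⇒≤ {f = λ c → F.punchOut (miss c)} λ {i} {j} eq → inj i j (F.punchOut-injective (miss i) (miss j) eq)))
  where
  miss : ∀ c → s ≢ f c
  miss c eq = none (c , sym eq)

module Radix (M n p q : ℕ) where

  Ix₄ : Set
  Ix₄ = Fin M × Fin n × Fin p × Fin q

  opaque
    N₄ : ℕ
    N₄ = M * (n * (p * q))

    N₄≡ : N₄ ≡ M * (n * (p * q))
    N₄≡ = refl

    enc₄ : Ix₄ → Fin N₄
    enc₄ (i , t , x , y) = combine i (combine t (combine x y))

    dec₄ : Fin N₄ → Ix₄
    dec₄ k = proj₁ a , proj₁ b , c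
      where
      a : Fin M × Fin (n * (p * q))
      a = remQuot {M} (n * (p * q)) k
      b : Fin n × Fin (p * q)
      b = remQuot {n} (p * q) (proj₂ a)
      c : Fin p × Fin q
      c = remQuot {p} q (proj₂ b)

    dec-enc₄ : ∀ r → dec₄ (enc₄ r) ≡ r
    dec-enc₄ (i , t , x , y) = trans (cong (λ a → proj₁ a , proj₁ (remQuot {n} (p * q) (proj₂ a)) , remQuot {p} q (proj₂ (remQuot {n} (p * q) (proj₂ a)))) (F.remQuot-combine {M} i (combine t (combine x y))))
      (trans (cong (λ b → i , proj₁ b , remQuot {p} q (proj₂ b)) (F.remQuot-combine {n} t (combine x y)))
        (cong (λ c → i , t , c) (F.remQuot-combine {p} x y)))

    enc-dec₄ : ∀ k → enc₄ (dec₄ k) ≡ k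
    enc-dec₄ k = trans (cong (λ z → combine (proj₁ a) (combine (proj₁ b) z)) (F.combine-remQuot {p} q (proj₂ b)))
      (trans (cong (combine (proj₁ a)) (F.combine-remQuot {n} (p * q) (proj₂ a))) (F.combine-remQuot {M} (n * (p * q)) k))
      where
      a : Fin M × Fin (n * (p * q))
      a = remQuot {M} (n * (p * q)) k
      b : Fin n × Fin (p * q)
      b = remQuot {n} (p * q) (proj₂ a)

    toℕ-enc₄ : ∀ i t x y → toℕ (enc₄ (i , t , x , y)) ≡ n * (p * q) * toℕ i + (p * q * toℕ t + (q * toℕ x + toℕ y))
    toℕ-enc₄ i t x y = trans (F.toℕ-combine i (combine t (combine x y))) (cong (n * (p * q) * toℕ i +_)
      (trans (F.toℕ-combine t (combine x y)) (cong (p * q * toℕ t +_) (F.toℕ-combine x y))))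

module Correct (Φ : Formula) where
  open Partial Φ public
  open Radix M 2 p q public renaming (N₄ to N; N₄≡ to N≡; enc₄ to enc; dec₄ to dec; dec-enc₄ to dec-enc; enc-dec₄ to enc-dec; toℕ-enc₄ to toℕ-enc) hiding (Ix₄)

  enc-inj : ∀ {r r'} → enc r ≡ enc r' → r ≡ r'
  enc-inj {r} {r'} eq = trans (sym (dec-enc r)) (trans (cong dec eq) (dec-enc r'))

  dec-inj : ∀ {k k'} → dec k ≡ dec k' → k ≡ k'
  dec-inj {k} {k'} eq = trans (sym (enc-dec k)) (trans (cong enc eq) (enc-dec k'))

  P : Array N
  P r c = Maybe.map enc (Pc (dec r) (dec c))

  unmap : ∀ {x : Maybe Ix} {s} → Maybe.map enc x ≡ just s → x ≡ just (dec s)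
  unmap {just z} refl = cong just (sym (dec-enc z))

  Satisfiable : Set
  Satisfiable = Σ (Fin q → Bool) λ X → ∀ (a : Fin p) → Act (toℕ a) →
    Σ (Fin q) λ b → (IsVar b × In (toℕ a) (toℕ b)) × X b ≡ pos (toℕ a)

  satisfiable⇒completable : Satisfiable → Completable P
  satisfiable⇒completable (X , sat) = K , (rows , cols) , ext
    where
    pk : Fin p → Fin q
    pk a with act? (toℕ a)
    ... | yes act = proj₁ (sat a act)
    ... | no _    = zero
    pk-ok : ∀ a → Act (toℕ a) → (IsVar (pk a) × In (toℕ a) (toℕ (pk a))) × X (pk a) ≡ pos (toℕ a)
    pk-ok a act with act? (toℕ a)
    ... | yes act' = proj₂ (sat a act')
    ... | no ¬act  = ⊥-elim (¬act act)
    nc : ∀ s → NoConflict X pk s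
    nc s a act _ = ε≢e a (X (pk a)) (proj₂ (pk-ok a act))
    K : Fin N → Fin N → Fin N
    K r c = enc (A X pk (dec r) (dec c))
    pk-var : ∀ a → Act (toℕ a) → IsVar (pk a)
    pk-var a act = proj₁ (proj₁ (pk-ok a act))
    rows : ∀ r c c' → K r c ≡ K r c' → c ≡ c'
    rows r c c' eq = dec-inj (A-rowInj X pk pk-var {A X pk (dec r) (dec c)} (nc _) (dec r) (dec c) (dec c') refl (sym (enc-inj eq)))
    cols : ∀ r r' c → K r c ≡ K r' c → r ≡ r'
    cols r r' c eq = dec-inj (A-colInj X pk pk-var {A X pk (dec r) (dec c)} (nc _) (dec r) (dec r') (dec c) refl (sym (enc-inj eq)))
    ext : ∀ r c s → P r c ≡ just s → K r c ≡ s
    ext r c s eq = trans (cong enc (A-extends X pk (λ a act → proj₁ (pk-ok a act)) (dec r) (dec c) (dec s) (unmap eq))) (enc-dec s)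

  halfCompletion : Separated → TwoMembers → HalfCompletion P
  halfCompletion sep two = record
    { B       = λ m σ r c → enc (B m (dec σ) (dec r) (dec c))
    ; extends = λ m σ r c s eq → trans (cong enc (A-extends (X m σ) (pkOf (X m σ)) (λ a act → choose-in a (X m σ (v1 a)) act) (dec r) (dec c) (dec s) (unmap eq))) (enc-dec s)
    ; rowInj  = λ m σ r c c' eq eq' → dec-inj (A-rowInj (X m σ) (pkOf (X m σ)) (λ a act → proj₁ (choose-in a (X m σ (v1 a)) act)) {dec σ} (noConflict m (σx (dec σ)))
                  (dec r) (dec c) (dec c') (un eq) (un eq'))
    ; colInj  = λ m σ r r' c eq eq' → dec-inj (A-colInj (X m σ) (pkOf (X m σ)) (λ a act → proj₁ (choose-in a (X m σ (v1 a)) act)) {dec σ} (noConflict m (σx (dec σ)))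
                  (dec r) (dec r') (dec c) (un eq) (un eq'))
    ; cover   = cov }
    where
    open Certificate sep two
    X : Bool → Fin N → Fin q → Bool
    X m σ = Xm m (σx (dec σ))
    un : ∀ {z σ} → enc z ≡ σ → z ≡ dec σ
    un {z} refl = sym (dec-enc z)
    cov : ∀ r c → Σ (Bool × Fin N) λ u → Σ (Bool × Fin N) λ v → u ≢ v ×
            enc (B (proj₁ u) (dec (proj₂ u)) (dec r) (dec c)) ≡ proj₂ u × enc (B (proj₁ v) (dec (proj₂ v)) (dec r) (dec c)) ≡ proj₂ v
    cov r c with cover (dec r) (dec c)
    ... | (m , σ) , (m' , σ') , ne , eq , eq' = (m , enc σ) , (m' , enc σ') ,
      (λ z → ne (cong₂ _,_ (cong proj₁ z) (enc-inj (cong proj₂ z)))) ,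
      cong enc (trans (cong (λ s → B m s (dec r) (dec c)) (dec-enc σ)) eq) ,
      cong enc (trans (cong (λ s → B m' s (dec r) (dec c)) (dec-enc σ')) eq')

  -- Reading an assignment off a completion

  module Sound (sep : Separated) (ℓ : Ix → Ix → Ix)
    (ext : ∀ r c s → Pc r c ≡ just s → ℓ r c ≡ s)
    (rowInj : ∀ r c c' → ℓ r c ≡ ℓ r c' → c ≡ c')
    (colInj : ∀ r r' c → ℓ r c ≡ ℓ r' c → r ≡ r')
    (surj : ∀ r s → Σ Ix λ c → ℓ r c ≡ s) where

    natural : ∀ r c → ¬ Empty r c → ¬ Flip r c → ℓ r c ≡ L r c
    natural r c ne nf = go (pview r c) refl
      where
      go : ∀ {z} → PView r c z → z ≡ Pc r c → ℓ r c ≡ L r c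
      go (pE em)   eq = ⊥-elim (ne em)
      go (pF _ fl) eq = ⊥-elim (nf fl)
      go (pN _ _)  eq = ext r c _ (sym eq)

    flipped : ∀ r c → ¬ Empty r c → Flip r c → ℓ r c ≡ L (twin r) c
    flipped r c ne fl = go (pview r c) refl
      where
      go : ∀ {z} → PView r c z → z ≡ Pc r c → ℓ r c ≡ L (twin r) c
      go (pE em)   eq = ⊥-elim (ne em)
      go (pF _ _)  eq = ext r c _ (sym eq)
      go (pN _ nf) eq = ⊥-elim (nf fl)

    colOf rowOf : Ix → Ix → Ix
    colOf (i , t , x , y) (si , st , sx , sy) = subF i si , subF t st , subF x sx , subF y sy
    rowOf (i' , t' , a , b) (si , st , sx , sy) = addF si i' , addF st t' , addF sx a , addF sy b

    L-colOf : ∀ r σ → L r (colOf r σ) ≡ σ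
    L-colOf (i , t , x , y) (si , st , sx , sy) = cong₂ _,_ (sub-sub i si) (cong₂ _,_ (sub-sub t st) (cong₂ _,_ (sub-sub x sx) (sub-sub y sy)))

    L-rowOf : ∀ c σ → L (rowOf c σ) c ≡ σ
    L-rowOf (i' , t' , a , b) (si , st , sx , sy) = cong₂ _,_ (sub-add si i') (cong₂ _,_ (sub-add st t') (cong₂ _,_ (sub-add sx a) (sub-add sy b)))

    -- The cell of row `r` where the table puts the symbol `ℓ r c`, if filled regularly, contains
    -- that symbol in `ℓ` too and must then be `c`. So an empty cell can only receive symbols whose
    -- natural cell is empty or displaced; `elimCol` is the same principle in a column.
    elimRow : ∀ r c → ¬ Empty r (colOf r (ℓ r c)) → ¬ Flip r (colOf r (ℓ r c)) → colOf r (ℓ r c) ≡ c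
    elimRow r c ne nf = rowInj r _ c (trans (natural r _ ne nf) (L-colOf r (ℓ r c)))

    elimCol : ∀ r c → ¬ Empty (rowOf c (ℓ r c)) c → ¬ Flip (rowOf c (ℓ r c)) c → rowOf c (ℓ r c) ≡ r
    elimCol r c ne nf = colInj _ r c (trans (natural _ c ne nf) (L-rowOf c (ℓ r c)))

    sub≡ : ∀ {n} {x s : Fin (suc n)} → subF x s ≡ x → s ≡ zero
    sub≡ {x = x} {s} eq = trans (sym (sub-sub x s)) (trans (cong (subF x) eq) (sub-self x))

    add≡ : ∀ {n} {s b : Fin (suc n)} → addF s b ≡ b → s ≡ zero
    add≡ {s = s} {b} eq = trans (sym (sub-add s b)) (trans (cong (λ z → subF z b) eq) (sub-self b))

    -- The entry that the wire row `(0 , 1 , ε u , b)` has by subtraction in the column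
    -- `(0 , 0 , a , b)`. A variable announces the value `u` by holding it in its home row.
    slot : Bool → Fin p → Ix
    slot u a = zero , 1t , subF (ε u) a , zero

    vRow : Fin q → Ix
    vRow v = zero , 0t , two , v

    low : Fin p → Set
    low x = Σ Bool λ u → x ≡ ε u

    low? : ∀ x → low x ⊎ ¬ (toℕ x < 2)
    low? zero          = inj₁ (true , refl)
    low? (suc zero)    = inj₁ (false , refl)
    low? (suc (suc x)) = inj₂ λ { (s≤s (s≤s ())) }

    pos≢2 : ∀ a → 2 ≢ eN a
    pos≢2 a with pos a
    ... | true  = λ ()
    ... | false = λ ()

    -- By `elimRow` the symbol has first and last coordinate 0. Parity 0 is excluded because the
    -- displaced entries prescribed in this row use up those symbols. With parity 1 only the two
    -- wires remain, since the rows `(0 , 1 , x , v)` with `x` at least 2 are filled in this column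
    -- and hold their own symbol.
    vRow-value : ∀ v → IsVar v → ∀ a → Σ Bool λ u → ℓ (vRow v) (zero , 0t , a , v) ≡ slot u a
    vRow-value v var a = go (ℓ r c) refl
      where
      r c : Ix
      r = vRow v
      c = zero , 0t , a , v
      home⇒v : ∀ {a' : Fin p} {b' : Fin q} → HomeN 2 (toℕ v) (toℕ a') (toℕ b') → b' ≡ v
      home⇒v (inj₁ (_ , eq , _)) = sym (F.toℕ-injective eq)
      home⇒v {a'} (inj₂ (_ , eq , _)) = ⊥-elim (pos≢2 (toℕ a') eq)
      filled : ∀ c' → Empty r c' ⊎ Flip r c' → proj₁ c' ≡ zero × proj₂ (proj₂ (proj₂ c')) ≡ v
      filled c' (inj₁ (inj₁ ¬k)) = ⊥-elim (¬k keep0)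
      filled (_ , _ , a' , _) (inj₁ (inj₂ (_ , i0 , inj₁ (_ , h)))) = F.toℕ-injective i0 , home⇒v {a'} h
      filled c' (inj₁ (inj₂ (_ , i0 , inj₂ (() , _))))
      filled (_ , _ , a' , _) (inj₂ (_ , i0 , _ , _ , h)) = F.toℕ-injective i0 , home⇒v {a'} h
      place : ∀ σ → ℓ r c ≡ σ → colOf r σ ≡ c ⊎ (proj₁ (colOf r σ) ≡ zero × proj₂ (proj₂ (proj₂ (colOf r σ))) ≡ v)
      place σ refl with empty? r (colOf r (ℓ r c)) | flip? r (colOf r (ℓ r c))
      ... | yes em | _      = inj₂ (filled (colOf r (ℓ r c)) (inj₁ em))
      ... | no _   | yes fl = inj₂ (filled (colOf r (ℓ r c)) (inj₂ fl))
      ... | no ne  | no nf  = inj₁ (elimRow r c ne nf)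
      corner : ∀ σ → ℓ r c ≡ σ → proj₁ σ ≡ zero × proj₂ (proj₂ (proj₂ σ)) ≡ zero
      corner σ eq with place σ eq
      ... | inj₁ c≡ = sub≡ (cong proj₁ c≡) , sub≡ (cong (proj₂ ∘ proj₂ ∘ proj₂) c≡)
      ... | inj₂ (i≡ , y≡) = sub≡ i≡ , sub≡ y≡
      go : ∀ σ → ℓ r c ≡ σ → Σ Bool λ u → ℓ r c ≡ slot u a
      go (si , st , sx , sy) eq with corner _ eq
      go (_ , zero , sx , _) eq | refl , refl = ⊥-elim (0≢1₂ {0t} refl (cong (proj₁ ∘ proj₂) (rowInj r c c' (trans eq (sym val)))))
        where
        -- A displaced cell of the same row whose prescribed entry is the symbol in question.
        c' : Ix
        c' = zero , 1t , subF two sx , v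
        val : ℓ r c' ≡ (zero , zero , sx , zero)
        val = trans (flipped r c' (λ { (inj₁ ¬k) → ¬k keep0 ; (inj₂ (_ , _ , inj₁ (() , _))) ; (inj₂ (_ , _ , inj₂ (() , _))) })
                (refl , refl , refl , refl , inj₁ (refl , refl , var)))
              (cong₂ _,_ (sub-self zero) (cong₂ _,_ subF-11 (cong₂ _,_ (sub-sub two sx) (sub-self v))))
      go (_ , suc zero , sx , _) eq | refl , refl with low? (addF sx a)
      ... | inj₁ (u , x≡) = u , trans eq (cong (λ z → zero , 1t , z , zero) (sym (add⇒sub {x = ε u} {a} {sx} (sym x≡))))
      ... | inj₂ high = ⊥-elim (0≢1₂ {0t} refl (cong (proj₁ ∘ proj₂) (colInj r r' c (trans eq (sym val)))))
        where
        r' : Ix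
        r' = zero , 1t , addF sx a , v
        val : ℓ r' c ≡ (zero , 1t , sx , zero)
        val = trans (natural r' c (λ { (inj₁ ¬k) → ¬k keep0 ; (inj₂ (_ , _ , inj₁ (() , _))) ; (inj₂ (_ , _ , inj₂ (_ , lt , _))) → high lt }) λ { (_ , _ , () , _) })
              (cong₂ _,_ (sub-self zero) (cong₂ _,_ subF-10 (cong₂ _,_ (sub-add sx a) (sub-self v))))

    wRow : Bool → Fin q → Ix
    wRow u b = zero , 1t , ε u , b

    e-eq : ∀ {x : Fin p} {a : Fin p} → toℕ x ≡ eN (toℕ a) → x ≡ e a
    e-eq {x} {a} eq = F.toℕ-injective (trans eq (sym (toℕ-e a)))

    -- `elimRow` would also allow a symbol belonging to a column of another clause `a'` that
    -- contains `b` and has `e a' = ε u`. In that case `elimCol` leaves `e a' - a' = e j - j` as the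
    -- only alternative to last coordinate 0, and `Separated` gives `a' = j`, against `b` not being
    -- in clause `j`. What remains is the home symbol of the variable or one of the two slots.
    wRow-value : ∀ j b → Act (toℕ j) → IsVar b → ¬ In (toℕ j) (toℕ b) → ∀ u →
      ℓ (wRow u b) (zero , 0t , j , b) ≡ (zero , 0t , subF two j , zero) ⊎ Σ Bool λ u' → ℓ (wRow u b) (zero , 0t , j , b) ≡ slot u' j
    wRow-value j b act var ¬in u = go (ℓ r c) refl
      where
      r c : Ix
      r = wRow u b
      c = zero , 0t , j , b
      rowEmpty : ∀ i' t' a' b' → Empty r (i' , t' , a' , b') ⊎ Flip r (i' , t' , a' , b') →
        i' ≡ zero × (b' ≡ b ⊎ (Act (toℕ a') × ε u ≡ e a' × In (toℕ a') (toℕ b)))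
      rowEmpty i' t' a' b' (inj₁ (inj₁ ¬k)) = ⊥-elim (¬k keep0)
      rowEmpty i' t' a' b' (inj₁ (inj₂ (_ , i0 , inj₁ (_ , inj₁ (x2 , _))))) = ⊥-elim (ε≢two u (F.toℕ-injective x2))
      rowEmpty i' t' a' b' (inj₁ (inj₂ (_ , i0 , inj₁ (_ , inj₂ (_ , _ , yκ))))) = ⊥-elim (ℕ.<⇒≱ var (subst (nv ≤_) (sym yκ) (ℕ.m≤m+n nv _)))
      rowEmpty i' t' a' b' (inj₁ (inj₂ (_ , i0 , inj₂ (_ , _ , _ , inj₁ y≡)))) = F.toℕ-injective i0 , inj₁ (sym (F.toℕ-injective y≡))
      rowEmpty i' t' a' b' (inj₁ (inj₂ (_ , i0 , inj₂ (_ , _ , _ , inj₂ (act' , x≡ , in'))))) = F.toℕ-injective i0 , inj₂ (act' , e-eq {ε u} {a'} x≡ , in')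
      rowEmpty i' t' a' b' (inj₂ (_ , _ , () , _))
      colEmpty : ∀ i'' t'' x'' y'' → Empty (i'' , t'' , x'' , y'') c ⊎ Flip (i'' , t'' , x'' , y'') c →
        i'' ≡ zero → y'' ≡ b ⊎ x'' ≡ e j
      colEmpty i'' t'' x'' y'' (inj₁ (inj₁ ¬k)) refl = ⊥-elim (¬k keep0)
      colEmpty i'' t'' x'' y'' (inj₁ (inj₂ (_ , _ , inj₁ (_ , inj₁ (_ , y≡ , _))))) _ = inj₁ (F.toℕ-injective y≡)
      colEmpty i'' t'' x'' y'' (inj₁ (inj₂ (_ , _ , inj₁ (_ , inj₂ (_ , x≡ , _))))) _ = inj₂ (e-eq {x''} {j} x≡)
      colEmpty i'' t'' x'' y'' (inj₁ (inj₂ (_ , _ , inj₂ (_ , _ , _ , inj₁ y≡)))) _ = inj₁ (F.toℕ-injective y≡)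
      colEmpty i'' t'' x'' y'' (inj₁ (inj₂ (_ , _ , inj₂ (_ , _ , _ , inj₂ (_ , x≡ , _))))) _ = inj₂ (e-eq {x''} {j} x≡)
      colEmpty i'' t'' x'' y'' (inj₂ (_ , _ , _ , () , _)) _
      byRow : ∀ σ → ℓ r c ≡ σ → colOf r σ ≡ c ⊎ (subF zero (proj₁ σ) ≡ zero × (subF b (proj₂ (proj₂ (proj₂ σ))) ≡ b ⊎
                (Act (toℕ (subF (ε u) (σx σ))) × ε u ≡ e (subF (ε u) (σx σ)) × In (toℕ (subF (ε u) (σx σ))) (toℕ b))))
      byRow σ refl with empty? r (colOf r (ℓ r c)) | flip? r (colOf r (ℓ r c))
      ... | yes em | _      = inj₂ (rowEmpty _ (subF 1t (proj₁ (proj₂ (ℓ r c)))) _ _ (inj₁ em))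
      ... | no _   | yes fl = inj₂ (rowEmpty _ (subF 1t (proj₁ (proj₂ (ℓ r c)))) _ _ (inj₂ fl))
      ... | no ne  | no nf  = inj₁ (elimRow r c ne nf)
      byCol : ∀ σ → ℓ r c ≡ σ → proj₁ σ ≡ zero → rowOf c σ ≡ r ⊎ (addF (proj₂ (proj₂ (proj₂ σ))) b ≡ b ⊎ addF (σx σ) j ≡ e j)
      byCol σ refl i0 with empty? (rowOf c (ℓ r c)) c | flip? (rowOf c (ℓ r c)) c
      ... | yes em | _      = inj₂ (colEmpty _ (addF (proj₁ (proj₂ (ℓ r c))) 0t) _ _ (inj₁ em) i00)
        where
        i00 : addF (proj₁ (ℓ r c)) zero ≡ zero
        i00 = trans (cong (λ z → addF z zero) i0) (sym (sub⇒add (sub-self zero)))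
      ... | no _   | yes fl = inj₂ (colEmpty _ (addF (proj₁ (proj₂ (ℓ r c))) 0t) _ _ (inj₂ fl) i00)
        where
        i00 : addF (proj₁ (ℓ r c)) zero ≡ zero
        i00 = trans (cong (λ z → addF z zero) i0) (sym (sub⇒add (sub-self zero)))
      ... | no ne  | no nf  = inj₁ (elimCol r c ne nf)
      sy0 : ∀ σ → ℓ r c ≡ σ → proj₁ σ ≡ zero × proj₂ (proj₂ (proj₂ σ)) ≡ zero
      sy0 σ eq with byRow σ eq
      ... | inj₁ c≡ = sub≡ (cong proj₁ c≡) , sub≡ (cong (proj₂ ∘ proj₂ ∘ proj₂) c≡)
      ... | inj₂ (i0 , inj₁ y≡) = sub≡ i0 , sub≡ y≡
      ... | inj₂ (i0 , inj₂ (act' , ε≡ , in')) with byCol σ eq (sub≡ i0)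
      ... | inj₁ r≡ = sub≡ i0 , add≡ (cong (proj₂ ∘ proj₂ ∘ proj₂) r≡)
      ... | inj₂ (inj₁ y≡) = sub≡ i0 , add≡ y≡
      ... | inj₂ (inj₂ x≡) = ⊥-elim (¬in (subst (λ z → In (toℕ z) (toℕ b)) (sep a' j act' act same) in'))
        where
        a' : Fin p
        a' = subF (ε u) (σx σ)
        same : subF (e a') a' ≡ subF (e j) j
        same = trans (cong (λ z → subF z a') (sym ε≡)) (trans (sub-sub (ε u) (σx σ)) (sym (add⇒sub {x = e j} {j} {σx σ} (sym x≡))))
      go : ∀ σ → ℓ r c ≡ σ → ℓ r c ≡ (zero , 0t , subF two j , zero) ⊎ Σ Bool λ u' → ℓ r c ≡ slot u' j
      go (si , st , sx , sy) eq with sy0 _ eq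
      go (_ , zero , sx , _) eq | refl , refl = f (empty? r' c)
        where
        r' : Ix
        r' = zero , 0t , addF sx j , b
        f : Dec (Empty r' c) → ℓ r c ≡ (zero , 0t , subF two j , zero) ⊎ Σ Bool λ u' → ℓ r c ≡ slot u' j
        f (yes (inj₁ ¬k)) = ⊥-elim (¬k keep0)
        f (yes (inj₂ (_ , _ , inj₁ (_ , inj₁ (x2 , _))))) = inj₁ (trans eq (cong (λ z → zero , 0t , z , zero)
          (sym (add⇒sub {x = two} {j} {sx} (sym (F.toℕ-injective x2))))))
        f (yes (inj₂ (_ , _ , inj₁ (_ , inj₂ (_ , _ , yκ))))) = ⊥-elim (ℕ.<⇒≱ var (subst (nv ≤_) (sym yκ) (ℕ.m≤m+n nv _)))
        f (yes (inj₂ (_ , _ , inj₂ (() , _))))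
        f (no ne) = ⊥-elim (0≢1₂ {0t} refl (cong (proj₁ ∘ proj₂) (colInj r' r c (trans (trans (natural r' c ne (λ { (_ , _ , _ , () , _) })) val) (sym eq)))))
          where
          val : L r' c ≡ (zero , 0t , sx , zero)
          val = cong₂ _,_ (sub-self zero) (cong₂ _,_ subF-00 (cong₂ _,_ (sub-add sx j) (sub-self b)))
      go (_ , suc zero , sx , _) eq | refl , refl with low? (addF sx j)
      ... | inj₁ (u' , x≡) = inj₂ (u' , trans eq (cong (λ z → zero , 1t , z , zero) (sym (add⇒sub {x = ε u'} {j} {sx} (sym x≡)))))
      ... | inj₂ high = ⊥-elim (high (subst (λ z → toℕ z < 2) (sym (cong (proj₁ ∘ proj₂ ∘ proj₂) (colInj r' r c (trans val (sym eq))))) (toℕ-ε<2 u)))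
        where
        r' : Ix
        r' = zero , 1t , addF sx j , b
        val : ℓ r' c ≡ (zero , 1t , sx , zero)
        val = trans (natural r' c (λ { (inj₁ ¬k) → ¬k keep0 ; (inj₂ (_ , _ , inj₁ (() , _))) ; (inj₂ (_ , _ , inj₂ (_ , lt , _))) → high lt }) λ { (_ , _ , () , _) })
              (cong₂ _,_ (sub-self zero) (cong₂ _,_ subF-10 (cong₂ _,_ (sub-add sx j) (sub-self b))))

    cRow : Fin p → Ix
    cRow j = zero , 0t , e j , κ j

    goal : Fin p → Ix
    goal j = zero , 1t , subF (e j) j , zero

    -- In the home row of clause `j` the natural cells of `goal j` carry displaced entries, so the
    -- symbol has to stand in an empty cell of the row, in a column `(0 , 0 , j , b)`. If `b` were
    -- not a variable, the row `(0 , 1 , e j , b)` would be filled there and hold this symbol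
    -- already.
    cRow-place : ∀ j → Act (toℕ j) → Σ (Fin q) λ b → IsVar b × ℓ (cRow j) (zero , 0t , j , b) ≡ goal j
    cRow-place j act with surj (cRow j) (goal j)
    ... | c , eq = go c eq (empty? (cRow j) c) (flip? (cRow j) c)
      where
      go : ∀ c → ℓ (cRow j) c ≡ goal j → Dec (Empty (cRow j) c) → Dec (Flip (cRow j) c) → Σ (Fin q) λ b → IsVar b × ℓ (cRow j) (zero , 0t , j , b) ≡ goal j
      go c eq (no ne) (yes fl@(_ , _ , _ , t1 , _)) =
        ⊥-elim (0≢1₂ (trans (cong (subF 1t) (F.toℕ-injective {j = 1t} t1)) subF-11) (cong (proj₁ ∘ proj₂) (trans (sym (flipped (cRow j) c ne fl)) eq)))
      go (i' , t' , a , b) eq (no ne) (no nf) = ⊥-elim (unflipped i' t' a b (sub≡0 {x = zero} (cong proj₁ val)) (subF-injʳ {x = 0t} (trans (cong (proj₁ ∘ proj₂) val) (sym subF-01))) (subF-injʳ {x = e j} (cong σx val)) nf)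
        where
        val : L (cRow j) (i' , t' , a , b) ≡ goal j
        val = trans (sym (natural (cRow j) (i' , t' , a , b) ne nf)) eq
        unflipped : ∀ i' t' a b → i' ≡ zero → t' ≡ 1t → a ≡ j → ¬ Flip (cRow j) (i' , t' , a , b) → ⊥
        unflipped i' t' a b refl refl refl nf = nf (refl , refl , refl , refl , homeC {j} {b} act)
      go c eq (yes (inj₁ ¬k)) _ = ⊥-elim (¬k keep0)
      go (i' , t' , a , b) eq (yes (inj₂ (_ , _ , inj₂ (() , _)))) _
      go (i' , t' , a , b) eq (yes (inj₂ (_ , _ , inj₁ (_ , inj₁ (x2 , _))))) _ = ⊥-elim (e≢two j (F.toℕ-injective x2))
      go (i' , t' , a , b) eq (yes (inj₂ (_ , i0 , inj₁ (t0 , inj₂ (_ , _ , yκ))))) _ =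
        found i' t' a b (F.toℕ-injective i0) (F.toℕ-injective (sym t0)) (κ-inj {j} {a} (F.toℕ-injective (trans yκ (sym (toℕ-κ a))))) eq (toℕ b ℕ.<? nv)
        where
        found : ∀ i' t' a b → i' ≡ zero → t' ≡ 0t → j ≡ a → ℓ (cRow j) (i' , t' , a , b) ≡ goal j → Dec (IsVar b) → Σ (Fin q) λ b → IsVar b × ℓ (cRow j) (zero , 0t , j , b) ≡ goal j
        found i' t' a b refl refl refl eq (yes var) = b , var , eq
        found i' t' a b refl refl refl eq (no ¬var) = ⊥-elim (0≢1₂ {0t} refl (cong (proj₁ ∘ proj₂) (colInj (cRow j) r' (zero , 0t , j , b) (trans eq (sym val)))))
          where
          r' : Ix
          r' = zero , 1t , e j , b
          val : ℓ r' (zero , 0t , j , b) ≡ goal j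
          val = trans (natural r' (zero , 0t , j , b) (λ { (inj₁ ¬k) → ¬k keep0 ; (inj₂ (_ , _ , inj₁ (() , _))) ; (inj₂ (_ , _ , inj₂ (_ , _ , lt , _))) → ¬var lt }) λ { (_ , _ , () , _) })
                (cong₂ _,_ (sub-self zero) (cong₂ _,_ subF-10 (cong₂ _,_ refl (sub-self b))))

    ε-inj : ∀ u u' → ε u ≡ ε u' → u ≡ u'
    ε-inj true  true  _ = refl
    ε-inj false false _ = refl

    slot-inj : ∀ u u' a → slot u a ≡ slot u' a → u ≡ u'
    slot-inj u u' a eq = ε-inj u u' (subF-injˡ {x = ε u} {ε u'} {a} (cong σx eq))

    goal-slot : ∀ j → goal j ≡ slot (not (pos (toℕ j))) j
    goal-slot j = cong (λ z → zero , 1t , subF z j , zero) (sym (ε≡e j))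

    flip-bool : ∀ {u w} → u ≢ not w → u ≡ w
    flip-bool {true}  {true}  _ = refl
    flip-bool {false} {false} _ = refl
    flip-bool {true}  {false} h = ⊥-elim (h refl)
    flip-bool {false} {true}  h = ⊥-elim (h refl)

    module _ (j : Fin p) (act : Act (toℕ j)) (b : Fin q) (var : IsVar b) (placed : ℓ (cRow j) (zero , 0t , j , b) ≡ goal j) where
      private
        c : Ix
        c = zero , 0t , j , b
      atC : ℓ (cRow j) c ≡ slot (not (pos (toℕ j))) j
      atC = trans placed (goal-slot j)
      -- The clause home occupies the slot of the wrong value, so the variable home must announce
      -- the right one.
      v-value : ℓ (vRow b) c ≡ slot (pos (toℕ j)) j
      v-value with vRow-value b var j
      ... | u , eq = trans eq (cong (λ z → slot z j) (flip-bool λ { refl →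
        e≢two j (sym (cong (proj₁ ∘ proj₂ ∘ proj₂) (colInj (vRow b) (cRow j) c (trans eq (sym atC))))) }))

      -- Pigeonhole in column `c`: the home rows of clause and variable occupy both slots, so by
      -- `wRow-value` both wire rows of `b` would have to hold the one remaining symbol.
      member : In (toℕ j) (toℕ b)
      member with in? (toℕ j) (toℕ b)
      ... | yes i = i
      ... | no ¬i = ⊥-elim (0≢one (cong (proj₁ ∘ proj₂ ∘ proj₂) (colInj (wRow true b) (wRow false b) c (trans (w true) (sym (w false))))))
        where
        0≢one : _≢_ {A = Fin p} zero one
        0≢one ()
        w : ∀ u → ℓ (wRow u b) c ≡ (zero , 0t , subF two j , zero)
        w u with wRow-value j b act var ¬i u
        ... | inj₁ eq = eq
        ... | inj₂ (u' , eq) with u' 𝔹.≟ pos (toℕ j)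
        ... | yes refl = ⊥-elim (0≢1₂ {1t} (cong (proj₁ ∘ proj₂) (colInj (wRow u b) (vRow b) c (trans eq (sym v-value)))) refl)
        ... | no ne = ⊥-elim (0≢1₂ {1t} (cong (proj₁ ∘ proj₂) (colInj (wRow u b) (cRow j) c
                (trans eq (trans (cong (λ z → slot z j) (flip-bool {u'} {not (pos (toℕ j))} (λ z → ne (trans z (𝔹.not-involutive _))))) (sym atC))))) refl)

    value : ∀ v → IsVar v → Fin p → Bool
    value v var a = proj₁ (vRow-value v var a)

    -- Since `0 - a = 1 - (a + 1)`, announcing true at `a` and false at `a + 1` would repeat a
    -- symbol in the home row. Going around the cycle modulo `p` then makes the value the same for
    -- all `a`.
    value-next : ∀ v var a → value v var a ≡ true → value v var (addF a one) ≡ true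
    value-next v var a eq with value v var (addF a one) in eq'
    ... | true  = refl
    ... | false = ⊥-elim (one≢0 (subF-injʳ {x = a} (trans (add⇒sub {x = a} {one} {a} a≡) (sym (sub-zeroʳ a)))))
      where
      one≢0 : _≢_ {A = Fin p} one zero
      one≢0 ()
      same : subF zero a ≡ subF one (addF a one)
      same = sym (add⇒sub {x = one} {addF a one} {subF zero a} (sym (trans (sym (addF-assoc (subF zero a) a one))
        (trans (cong (λ z → addF z one) (add-sub zero a)) (trans (addF-comm zero one) (sym (sub⇒add (sub-zeroʳ one))))))))
      val : ∀ a {u} → value v var a ≡ u → ℓ (vRow v) (zero , 0t , a , v) ≡ slot u a
      val a refl = proj₂ (vRow-value v var a)
      a≡ : a ≡ addF a one
      a≡ = cong (proj₁ ∘ proj₂ ∘ proj₂) (rowInj (vRow v) (zero , 0t , a , v) (zero , 0t , addF a one , v)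
        (trans (val a eq) (trans (cong (λ z → zero , 1t , z , zero) same) (sym (val (addF a one) eq')))))

    shift : ℕ → Fin p → Fin p
    shift zero    a = a
    shift (suc k) a = addF (shift k a) one

    value-shift : ∀ v var a k → value v var a ≡ true → value v var (shift k a) ≡ true
    value-shift v var a zero    eq = eq
    value-shift v var a (suc k) eq = value-next v var (shift k a) (value-shift v var a k eq)

    toℕ-shift : ∀ k a → toℕ (shift k a) ≡ (toℕ a + k) ℕ.% p
    toℕ-shift zero    a = sym (trans (cong (ℕ._% p) (ℕ.+-identityʳ (toℕ a))) (ℕ.m<n⇒m%n≡m (F.toℕ<n a)))
    toℕ-shift (suc k) a = trans (toℕ-addF (shift k a) one) (trans (cong (λ z → (z + 1) ℕ.% p) (toℕ-shift k a))
      (trans (%-absorb (toℕ a + k) 1) (cong (ℕ._% p) (trans (ℕ.+-assoc (toℕ a) k 1) (cong (toℕ a +_) (ℕ.+-comm k 1))))))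

    value-const : ∀ v var a → value v var a ≡ value v var zero
    value-const v var a with value v var zero in eq0 | value v var a in eqa
    ... | true  | true  = refl
    ... | false | false = refl
    ... | true  | false = trans (sym eqa) (subst (λ z → value v var z ≡ true)
        (F.toℕ-injective (trans (toℕ-shift (toℕ a) zero) (ℕ.m<n⇒m%n≡m (F.toℕ<n a)))) (value-shift v var zero (toℕ a) eq0))
    ... | false | true  = trans (sym (subst (λ z → value v var z ≡ true)
        (F.toℕ-injective {j = zero} (trans (toℕ-shift (p ∸ toℕ a) a) (trans (cong (ℕ._% p) (ℕ.m+[n∸m]≡n (ℕ.<⇒≤ (F.toℕ<n a)))) (ℕ.n%n≡0 p))))
        (value-shift v var a (p ∸ toℕ a) eqa))) eq0

    satisfiable : Satisfiable
    satisfiable = X , λ a act → pick a act (cRow-place a act)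
      where
      X : Fin q → Bool
      X v with toℕ v ℕ.<? nv
      ... | yes var = value v var zero
      ... | no _    = true
      X-var : ∀ v var → X v ≡ value v var zero
      X-var v var with toℕ v ℕ.<? nv
      ... | yes var' = cong (λ z → value v z zero) (ℕ.<-irrelevant var' var)
      ... | no ¬var  = ⊥-elim (¬var var)
      pick : ∀ a (act : Act (toℕ a)) → Σ (Fin q) (λ b → IsVar b × ℓ (cRow a) (zero , 0t , a , b) ≡ goal a) →
        Σ (Fin q) λ b → (IsVar b × In (toℕ a) (toℕ b)) × X b ≡ pos (toℕ a)
      pick a act (b , var , placed) = b , (var , member a act b var placed) ,
        trans (X-var b var) (trans (sym (value-const b var a)) (slot-inj (value b var a) (pos (toℕ a)) a (trans (sym (proj₂ (vRow-value b var a))) (v-value a act b var placed))))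

  completable⇒satisfiable : Separated → Completable P → Satisfiable
  completable⇒satisfiable sep (K , (rows , cols) , ext) = Sound.satisfiable sep
    (λ r c → dec (K (enc r) (enc c)))
    (λ r c s eq → trans (cong dec (ext (enc r) (enc c) (enc s) (trans (cong₂ (λ x y → Maybe.map enc (Pc x y)) (dec-enc r) (dec-enc c)) (cong (Maybe.map enc) eq)))) (dec-enc s))
    (λ r c c' eq → enc-inj (rows (enc r) (enc c) (enc c') (dec-inj eq)))
    (λ r r' c eq → enc-inj (cols (enc r) (enc r') (enc c) (dec-inj eq)))
    (λ r s → let (c , eq) = injective⇒surjective (K (enc r)) (rows (enc r)) (enc s) in
      dec c , trans (cong (λ z → dec (K (enc r) z)) (enc-dec c)) (trans (cong dec eq) (dec-enc s)))

-- The tableau of a verifier as a monotone formula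

nthB : List Bool → ℕ → Bool
nthB []       _       = false
nthB (b ∷ bs) zero    = b
nthB (b ∷ bs) (suc i) = nthB bs i

nthS : List Sym → ℕ → Sym
nthS []       _       = blank
nthS (s ∷ ss) zero    = s
nthS (s ∷ ss) (suc i) = nthS ss i

-- Times relative to the instance `(t , i)` of a rule: time 0, the final time `T`, or `t + d`;
-- `IPos` does the same for positions. Rules can thus form a finite list that depends on the
-- verifier only.
data TPos : Set where
  tz te : TPos
  tr    : Fin 2 → TPos

data IPos : Set where
  iz : IPos
  ir : Fin 2 → IPos

ival : IPos → ℕ → ℕ
ival iz     i = 0
ival (ir d) i = toℕ d + i

pattern H = zero
pattern ◁ = suc zero
pattern ▷ = suc (suc zero)

-- the symbol under the head (H), or i cells beyond the one next to it on the left (◁) or right (▷)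
look : Tape → Fin 3 → ℕ → Sym
look t H i = hd t
look t ◁ i = nthS (lft t) i
look t ▷ i = nthS (rgt t) i

data Op : Set where
  mv   : Sym → Move → Op
  wipe : Op

applyOp : Op → Tape → Tape
applyOp (mv s m) t = moveTape m (writeTape s t)
applyOp wipe     t = blankTape

-- Cells are addressed relative to the head, so a move shifts the two half-tapes instead of changing
-- a head position. A step is described by the cells that receive a known symbol and, in `copies`,
-- by those that take over another cell.
consts : Op → List (Fin 3 × IPos × Sym)
consts (mv s mL) = (▷ , iz , s) ∷ []
consts (mv s mR) = (◁ , iz , s) ∷ []
consts (mv s mS) = (H , iz , s) ∷ []
consts wipe      = (H , iz , blank) ∷ (◁ , ir zero , blank) ∷ (▷ , ir zero , blank) ∷ []

copies : Op → List ((Fin 3 × IPos) × (Fin 3 × IPos))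
copies (mv s mL) = ((◁ , iz) , (H , iz)) ∷ ((◁ , ir (suc zero)) , (◁ , ir zero)) ∷ ((▷ , ir zero) , (▷ , ir (suc zero))) ∷ []
copies (mv s mR) = ((▷ , iz) , (H , iz)) ∷ ((▷ , ir (suc zero)) , (▷ , ir zero)) ∷ ((◁ , ir zero) , (◁ , ir (suc zero))) ∷ []
copies (mv s mS) = ((◁ , ir zero) , (◁ , ir zero)) ∷ ((▷ , ir zero) , (▷ , ir zero)) ∷ []
copies wipe      = []

consts-ok : ∀ op → All (λ (side , ip , s) → ∀ i t → look (applyOp op t) side (ival ip i) ≡ s) (consts op)
consts-ok (mv s mL) = (λ { i (tape [] h r) → refl ; i (tape (_ ∷ _) h r) → refl }) ∷ []
consts-ok (mv s mR) = (λ { i (tape l h []) → refl ; i (tape l h (_ ∷ _)) → refl }) ∷ []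
consts-ok (mv s mS) = (λ i t → refl) ∷ []
consts-ok wipe      = (λ i t → refl) ∷ (λ i t → refl) ∷ (λ i t → refl) ∷ []

copies-ok : ∀ op → All (λ ((src , ip) , (dst , ip')) → ∀ i t → look (applyOp op t) dst (ival ip' i) ≡ look t src (ival ip i)) (copies op)
copies-ok (mv s mL) =
  (λ { i (tape [] h r) → refl ; i (tape (_ ∷ _) h r) → refl }) ∷
  (λ { i (tape [] h r) → refl ; i (tape (x ∷ l) h r) → refl }) ∷
  (λ { i (tape [] h r) → refl ; i (tape (x ∷ l) h r) → refl }) ∷ []
copies-ok (mv s mR) =
  (λ { i (tape l h []) → refl ; i (tape l h (_ ∷ _)) → refl }) ∷
  (λ { i (tape l h []) → refl ; i (tape l h (x ∷ r)) → refl }) ∷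
  (λ { i (tape l h []) → refl ; i (tape l h (x ∷ r)) → refl }) ∷ []
copies-ok (mv s mS) = (λ i t → refl) ∷ (λ i t → refl) ∷ []
copies-ok wipe      = []

-- every cell of the new tape is described by some instance of a constant or a copying rule
Described : Op → Fin 3 → ℕ → Set
Described op side i =
  (Σ (Fin 3 × IPos × Sym) λ c → c ∈ consts op × Σ ℕ λ j → j ≤ i × proj₁ c ≡ side × ival (proj₁ (proj₂ c)) j ≡ i) ⊎
  (Σ ((Fin 3 × IPos) × (Fin 3 × IPos)) λ c → c ∈ copies op × Σ ℕ λ j → j ≤ i × proj₁ (proj₂ c) ≡ side × ival (proj₂ (proj₂ c)) j ≡ i ×
    ival (proj₂ (proj₁ c)) j ≤ suc i × (proj₁ (proj₁ c) ≡ H → ival (proj₂ (proj₁ c)) j ≡ 0))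

-- The bound `suc i` on the source index matters later: a step looks at most one cell further out,
-- so the known part of the tape shrinks by at most one cell per step.
described : ∀ op side i → (side ≡ H → i ≡ 0) → Described op side i
described (mv s mL) H i h rewrite h refl = inj₂ (_ , here refl , 0 , z≤n , refl , refl , z≤n , λ ())
described (mv s mL) ◁ i h = inj₂ (_ , there (here refl) , i , ℕ.≤-refl , refl , refl , ℕ.≤-refl , λ ())
described (mv s mL) ▷ zero h = inj₁ (_ , here refl , 0 , z≤n , refl , refl)
described (mv s mL) ▷ (suc i) h = inj₂ (_ , there (there (here refl)) , i , ℕ.n≤1+n i , refl , refl , ℕ.≤-trans (ℕ.n≤1+n i) (ℕ.n≤1+n _) , λ ())
described (mv s mR) H i h rewrite h refl = inj₂ (_ , here refl , 0 , z≤n , refl , refl , z≤n , λ ())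
described (mv s mR) ▷ i h = inj₂ (_ , there (here refl) , i , ℕ.≤-refl , refl , refl , ℕ.≤-refl , λ ())
described (mv s mR) ◁ zero h = inj₁ (_ , here refl , 0 , z≤n , refl , refl)
described (mv s mR) ◁ (suc i) h = inj₂ (_ , there (there (here refl)) , i , ℕ.n≤1+n i , refl , refl , ℕ.≤-trans (ℕ.n≤1+n i) (ℕ.n≤1+n _) , λ ())
described (mv s mS) H i h rewrite h refl = inj₁ (_ , here refl , 0 , z≤n , refl , refl)
described (mv s mS) ◁ i h = inj₂ (_ , here refl , i , ℕ.≤-refl , refl , refl , ℕ.n≤1+n i , λ ())
described (mv s mS) ▷ i h = inj₂ (_ , there (here refl) , i , ℕ.≤-refl , refl , refl , ℕ.n≤1+n i , λ ())
described wipe H i h rewrite h refl = inj₁ (_ , here refl , 0 , z≤n , refl , refl)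
described wipe ◁ i h = inj₁ (_ , there (here refl) , i , ℕ.≤-refl , refl , refl)
described wipe ▷ i h = inj₁ (_ , there (there (here refl)) , i , ℕ.≤-refl , refl , refl)

All-concatMap : ∀ {A B : Set} {P : B → Set} (f : A → List B) → (∀ x → All P (f x)) → ∀ xs → All P (concatMap f xs)
All-concatMap f h []       = []
All-concatMap f h (x ∷ xs) = All.++⁺ (h x) (All-concatMap f h xs)

All-mapFin : ∀ {n} {B : Set} {P : B → Set} (f : Fin n → B) → (∀ u → P (f u)) → All P (map f (allFin n))
All-mapFin f h = All.map⁺ {f = f} (All.tabulate (λ {u} _ → h u))

∈-cm : ∀ {A B : Set} (f : A → List B) {x y xs} → x ∈ xs → y ∈ f x → y ∈ concatMap f xs
∈-cm f x∈ y∈ = ∈.∈-concatMap⁺ f (Any.map (λ { refl → y∈ }) x∈)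

module Rules (V : OTM) where

  -- Halting states idle, and a query is answered no and clears the query tape, because verifiers
  -- run with `noOracle`.
  effect : Fin (nQ V) → Sym → Sym → Fin (nQ V) × Op × Op
  effect k a b =
    if eqQ k (acc V) ∨ eqQ k (rej V) then (k , mv a mS , mv b mS)
    else if eqQ k (qry V) then (OTM.no V , mv a mS , wipe)
    else act (δ V k a b)
    where
    act : Fin (nQ V) × Sym × Sym × Move × Move → Fin (nQ V) × Op × Op
    act (k' , a' , b' , m , m') = k' , mv a' m , mv b' m'

  step-effect : ∀ k w t → step V noOracle (cfg k w t) ≡
    cfg (proj₁ (effect k (hd w) (hd t))) (applyOp (proj₁ (proj₂ (effect k (hd w) (hd t)))) w) (applyOp (proj₂ (proj₂ (effect k (hd w) (hd t)))) t)
  step-effect k w t with eqQ k (acc V) ∨ eqQ k (rej V)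
  ... | true  = refl
  ... | false with eqQ k (qry V)
  ... | true  = refl
  ... | false = refl

  -- spec 0 is a variable forced to be true; spec 1 and spec 2 only serve to force it
  data Kind : Set where
    spec : Fin 4 → Kind
    cell : Fin 3 → Fin 2 → Sym → Kind
    st   : Fin (nQ V) → Kind

  opaque
    K : ℕ
    K = 4 + (24 + nQ V)

    kind# : Kind → Fin K
    kind# (spec s)     = s F.↑ˡ (24 + nQ V)
    kind# (cell s τ a) = 4 F.↑ʳ (combine s (combine τ a) F.↑ˡ nQ V)
    kind# (st k)       = 4 F.↑ʳ (24 F.↑ʳ k)

    toKind : Fin K → Kind
    toKind κ = [ spec , (λ κ' → [ (λ c → cell (proj₁ (remQuot {3} 8 c)) (proj₁ (remQuot {2} 4 (proj₂ (remQuot {3} 8 c)))) (proj₂ (remQuot {2} 4 (proj₂ (remQuot {3} 8 c))))) , st ]′ (F.splitAt 24 κ')) ]′ (F.splitAt 4 κ)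

    toKind-kind# : ∀ κ → toKind (kind# κ) ≡ κ
    toKind-kind# (spec s) rewrite F.splitAt-↑ˡ 4 s (24 + nQ V) = refl
    toKind-kind# (cell s τ a) rewrite F.splitAt-↑ʳ 4 (24 + nQ V) (combine s (combine τ a) F.↑ˡ nQ V)
      | F.splitAt-↑ˡ 24 (combine s (combine τ a)) (nQ V) =
        trans (cong (λ z → cell (proj₁ z) (proj₁ (remQuot {2} 4 (proj₂ z))) (proj₂ (remQuot {2} 4 (proj₂ z)))) (F.remQuot-combine {3} s (combine τ a)))
          (cong (λ z → cell s (proj₁ z) (proj₂ z)) (F.remQuot-combine {2} τ a))
    toKind-kind# (st k) rewrite F.splitAt-↑ʳ 4 (24 + nQ V) (24 F.↑ʳ k) | F.splitAt-↑ʳ 24 (nQ V) k = refl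

    0<K : 0 < K
    0<K = s≤s z≤n

  kind#-inj : ∀ {κ κ'} → kind# κ ≡ kind# κ' → κ ≡ κ'
  kind#-inj {κ} {κ'} eq = trans (sym (toKind-kind# κ)) (trans (cong toKind eq) (toKind-kind# κ'))

  kind≢ : ∀ {κ κ'} → κ ≢ κ' → kind# κ ≢ kind# κ'
  kind≢ ne eq = ne (kind#-inj eq)

  allKinds : List Kind
  allKinds = map toKind (allFin K)

  ∈-allKinds : ∀ κ → κ ∈ allKinds
  ∈-allKinds κ = subst (_∈ allKinds) (toKind-kind# κ) (∈.∈-map⁺ toKind (∈.∈-allFin (kind# κ)))

  Atom Guard Rule : Set
  Atom  = TPos × IPos × Kind
  Guard = Maybe (IPos × Sym)

  -- A barred literal is a second variable for the negated fact (the clauses must stay monotone); a guarded literal is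
  -- present only where the verifier's input may carry the given symbol.
  record Lit : Set where
    constructor lit
    field
      barred : Bool
      tpos   : TPos
      ipos   : IPos
      kind   : Kind
      guard  : Guard

  Rule = List Lit

  plain barr : Atom → Lit
  plain (t , i , κ) = lit false t i κ nothing
  barr  (t , i , κ) = lit true t i κ nothing

  unit : Atom
  unit = tz , iz , spec zero

  imp : List Atom → List Lit → Rule
  imp bodies heads = heads ++ map barr bodies

  guarded : IPos → (Sym → Atom) → Sym → Lit
  guarded p at s = let (t , i , κ) = at s in lit false t i κ (just (p , s))

  0b 1b : Fin 2
  0b = zero
  1b = suc zero

  -- The first two rules, with the first of `negRules`, force `unit`: otherwise both auxiliary
  -- variables would be true. The two guarded rules guess the verifier's input, one allowed symbol
  -- per position, and the last rule keeps everything after a blank blank, so that the guess is a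
  -- word.
  initRules : List Rule
  initRules =
    (plain unit ∷ plain (tz , iz , spec (suc zero)) ∷ []) ∷
    (plain unit ∷ plain (tz , iz , spec (suc (suc zero))) ∷ []) ∷
    imp (unit ∷ []) (plain (tz , iz , st (start V)) ∷ []) ∷
    imp (unit ∷ []) (map (guarded iz (λ a → tz , iz , cell H 0b a)) (allFin 4)) ∷
    imp (unit ∷ []) (map (guarded (ir 1b) (λ a → tz , ir 0b , cell ▷ 0b a)) (allFin 4)) ∷
    imp (unit ∷ []) (plain (tz , ir 0b , cell ◁ 0b blank) ∷ []) ∷
    imp (unit ∷ []) (plain (tz , iz , cell H 1b blank) ∷ []) ∷
    imp (unit ∷ []) (plain (tz , ir 0b , cell ◁ 1b blank) ∷ []) ∷
    imp (unit ∷ []) (plain (tz , ir 0b , cell ▷ 1b blank) ∷ []) ∷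
    imp ((tz , ir 0b , cell ▷ 0b blank) ∷ []) (plain (tz , ir 1b , cell ▷ 0b blank) ∷ []) ∷ []

  situation : Fin (nQ V) → Sym → Sym → List Atom
  situation k a b = (tr 0b , iz , st k) ∷ (tr 0b , iz , cell H 0b a) ∷ (tr 0b , iz , cell H 1b b) ∷ []

  constRule : List Atom → Fin 2 → Fin 3 × IPos × Sym → Rule
  constRule bodies τ (side , ip , s) = imp bodies (plain (tr 1b , ip , cell side τ s) ∷ [])

  copyRule : List Atom → Fin 2 → (Fin 3 × IPos) × (Fin 3 × IPos) → Sym → Rule
  copyRule bodies τ ((src , ip) , (dst , ip')) u = imp ((tr 0b , ip , cell src τ u) ∷ bodies) (plain (tr 1b , ip' , cell dst τ u) ∷ [])

  copyRules : List Atom → Fin 2 → (Fin 3 × IPos) × (Fin 3 × IPos) → List Rule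
  copyRules bodies τ c = map (copyRule bodies τ c) (allFin 4)

  tapeRules : List Atom → Fin 2 → Op → List Rule
  tapeRules bodies τ op = map (constRule bodies τ) (consts op) ++ concatMap (copyRules bodies τ) (copies op)

  transRules : Fin (nQ V) → Sym → Sym → List Rule
  transRules k a b = let (k' , op , op') = effect k a b in
    imp (situation k a b) (plain (tr 1b , iz , st k') ∷ []) ∷
    (tapeRules (situation k a b) 0b op ++ tapeRules (situation k a b) 1b op')

  -- Excludes a fact and its bar from holding together. A body that holds thereby switches off its
  -- barred literal in a positive clause, and the heads have to fire.
  consistencyRule : Kind → Fin 2 → Rule
  consistencyRule κ d = plain (tr 0b , ir d , κ) ∷ barr (tr 0b , ir d , κ) ∷ []

  consistencyRules : Kind → List Rule
  consistencyRules κ = map (consistencyRule κ) (allFin 2)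

  -- Rejects every final state other than acceptance; `unit` stands beside it because each clause
  -- has to contain two variables.
  finalRules : Fin (nQ V) → List Rule
  finalRules k = if eqQ k (acc V) then [] else ((plain unit ∷ plain (te , iz , st k) ∷ []) ∷ [])

  transRules₂ : Fin (nQ V) → Sym → List Rule
  transRules₂ k a = concatMap (transRules k a) (allFin 4)

  transRules₁ : Fin (nQ V) → List Rule
  transRules₁ k = concatMap (transRules₂ k) (allFin 4)

  posRules negRules : List Rule
  posRules = initRules ++ concatMap transRules₁ (allFin (nQ V))
  negRules =
    (plain (tz , iz , spec (suc zero)) ∷ plain (tz , iz , spec (suc (suc zero))) ∷ []) ∷
    (concatMap consistencyRules allKinds ++ concatMap finalRules (allFin (nQ V)))

  module Tableau (x : List Bool) (W T I : ℕ) where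

    l : ℕ
    l = length x

    -- which symbols may stand at a given position of the verifier's input x # w, |w| ≤ W
    Allowed : ℕ → ℕ → Set
    Allowed n s = (n < l × s ≡ suc (bit01 (nthB x n))) ⊎ (n ≡ l × s ≡ 3) ⊎ (l < n × n ≤ l + W × s < 3) ⊎ (l + W < n × s ≡ 0)

    allowed? : ∀ n s → Dec (Allowed n s)
    allowed? n s = ((n ℕ.<? l) ×-dec (s ℕ.≟ suc (bit01 (nthB x n)))) ⊎-dec (((n ℕ.≟ l) ×-dec (s ℕ.≟ 3)) ⊎-dec
      (((l ℕ.<? n) ×-dec (n ℕ.≤? l + W) ×-dec (s ℕ.<? 3)) ⊎-dec ((l + W ℕ.<? n) ×-dec (s ℕ.≟ 0))))

    tval : TPos → ℕ → ℕ
    tval tz     t = 0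
    tval te     t = T
    tval (tr d) t = toℕ d + t

    GuardOK : Guard → ℕ → Set
    GuardOK nothing        i = ⊤
    GuardOK (just (p , s)) i = Allowed (ival p i) (toℕ s)

    Assignment : Set
    Assignment = Bool → ℕ → ℕ → ℕ → Bool

    evalLit : Assignment → ℕ → ℕ → Lit → Bool
    evalLit X t i (lit b tp ip κ g) = X b (tval tp t) (ival ip i) (toℕ (kind# κ))

    Good : Bool → Assignment → ℕ → ℕ → Rule → Set
    Good u X t i = Any (λ ℓ → GuardOK (Lit.guard ℓ) i × evalLit X t i ℓ ≡ u)

    record Satisfies (X : Assignment) : Set where
      field
        positive : ∀ t i → t < T → i < I → All (Good true X t i) posRules
        negative : ∀ t i → t < T → i < I → All (Good false X t i) negRules

    config : List Bool → ℕ → Config V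
    config w zero    = initCfg V (verifierInput x w)
    config w (suc t) = step V noOracle (config w t)

    run-config : ∀ w k t → run V noOracle k (config w t) ≡ result V (config w (t + k))
    run-config w zero    t = cong (λ z → result V (config w z)) (sym (ℕ.+-identityʳ t))
    run-config w (suc k) t = trans (run-config w k (suc t)) (cong (λ z → result V (config w z)) (sym (ℕ.+-suc t k)))

    tapeOf : Config V → Fin 2 → Tape
    tapeOf C zero    = Config.work C
    tapeOf C (suc _) = Config.query C

    init-look : ∀ ss → look (initTape ss) H 0 ≡ nthS ss 0 × (∀ i → look (initTape ss) ▷ i ≡ nthS ss (suc i)) × (∀ i → look (initTape ss) ◁ i ≡ blank)
    init-look []       = refl , (λ i → refl) , (λ i → refl)
    init-look (s ∷ ss) = refl , (λ i → refl) , (λ i → refl)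

    input : List Bool → ℕ → Sym
    input w n = nthS (verifierInput x w) n

    nth-map : ∀ (bs : List Bool) ss n → n < length bs → toℕ (nthS (map bitSym bs ++ ss) n) ≡ suc (bit01 (nthB bs n))
    nth-map (false ∷ bs) ss zero    lt = refl
    nth-map (true ∷ bs)  ss zero    lt = refl
    nth-map (b ∷ bs)     ss (suc n) lt = nth-map bs ss n (ℕ.≤-pred lt)

    nth-skip : ∀ (bs : List Bool) ss n → nthS (map bitSym bs ++ ss) (length bs + n) ≡ nthS ss n
    nth-skip []       ss n = refl
    nth-skip (b ∷ bs) ss n = nth-skip bs ss n

    nth-end : ∀ (bs : List Bool) n → length bs ≤ n → nthS (map bitSym bs) n ≡ blank
    nth-end []       n       le = refl
    nth-end (b ∷ bs) (suc n) le = nth-end bs n (ℕ.≤-pred le)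

    nth-bit : ∀ (bs : List Bool) n → toℕ (nthS (map bitSym bs) n) < 3
    nth-bit []           n       = s≤s z≤n
    nth-bit (false ∷ bs) zero    = s≤s (s≤s z≤n)
    nth-bit (true ∷ bs)  zero    = s≤s (s≤s (s≤s z≤n))
    nth-bit (b ∷ bs)     (suc n) = nth-bit bs n

    data Region (n : ℕ) : Set where
      inX  : n < l → Region n
      atS  : n ≡ l → Region n
      past : ∀ k → n ≡ l + suc k → Region n

    region : ∀ n → Region n
    region n with ℕ.<-cmp n l
    ... | Relation.Binary.tri< lt _ _ = inX lt
    ... | Relation.Binary.tri≈ _ eq _ = atS eq
    ... | Relation.Binary.tri> _ _ gt = past (n ∸ suc l) (sym (trans (ℕ.+-suc l _) (ℕ.m+[n∸m]≡n gt)))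

    input-past : ∀ w k → input w (l + suc k) ≡ nthS (map bitSym w) k
    input-past w k = nth-skip x (sep ∷ map bitSym w) (suc k)

    input-allowed : ∀ w → length w ≤ W → ∀ n → Allowed n (toℕ (input w n))
    input-allowed w len n with region n
    ... | inX lt   = inj₁ (lt , nth-map x _ n lt)
    ... | atS refl = inj₂ (inj₁ (refl , cong toℕ (trans (cong (input w) (sym (ℕ.+-identityʳ l))) (nth-skip x (sep ∷ map bitSym w) 0))))
    ... | past k refl with suc k ℕ.≤? W
    ... | yes le = inj₂ (inj₂ (inj₁ (ℕ.m<m+n l (s≤s z≤n) , ℕ.+-monoʳ-≤ l le , subst (λ z → toℕ z < 3) (sym (input-past w k)) (nth-bit w k))))
    ... | no nle = inj₂ (inj₂ (inj₂ (ℕ.+-monoʳ-< l (ℕ.≰⇒> nle) ,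
            cong toℕ (trans (input-past w k) (nth-end w k (ℕ.≤-trans len (ℕ.≤-pred (ℕ.≰⇒> nle))))))))

-- Satisfying assignments of the tableau and accepting runs

xor-falseʳ : ∀ u → (u xor false) ≡ u
xor-falseʳ true  = refl
xor-falseʳ false = refl

xor-trueʳ : ∀ u → (u xor true) ≡ not u
xor-trueʳ true  = refl
xor-trueʳ false = refl

module Simulation (V : OTM) (x : List Bool) (W T I : ℕ) where
  open Rules V
  open Tableau x W T I

  init∈ : ∀ {ρ} → ρ ∈ initRules → ρ ∈ posRules
  init∈ = ∈.∈-++⁺ˡ

  trans∈ : ∀ {ρ} k a b → ρ ∈ transRules k a b → ρ ∈ posRules
  trans∈ k a b ρ∈ = ∈.∈-++⁺ʳ initRules
    (∈-cm transRules₁ (∈.∈-allFin k) (∈-cm (transRules₂ k) (∈.∈-allFin a) (∈-cm (transRules k a) (∈.∈-allFin b) ρ∈)))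

  const∈ : ∀ bodies τ op {c} → c ∈ consts op → constRule bodies τ c ∈ tapeRules bodies τ op
  const∈ bodies τ op c∈ = ∈.∈-++⁺ˡ (∈.∈-map⁺ (constRule bodies τ) c∈)

  copy∈ : ∀ bodies τ op {c} u → c ∈ copies op → copyRule bodies τ c u ∈ tapeRules bodies τ op
  copy∈ bodies τ op {c} u c∈ = ∈.∈-++⁺ʳ (map (constRule bodies τ) (consts op))
    (∈-cm (copyRules bodies τ) c∈ (∈.∈-map⁺ (copyRule bodies τ c) (∈.∈-allFin u)))

  opOf : Fin 2 → Op × Op → Op
  opOf zero    (op , op') = op
  opOf (suc _) (op , op') = op'

  tape∈ : ∀ {ρ} k a b τ → ρ ∈ tapeRules (situation k a b) τ (opOf τ (proj₂ (effect k a b))) → ρ ∈ transRules k a b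
  tape∈ k a b zero       ρ∈ = there (∈.∈-++⁺ˡ ρ∈)
  tape∈ k a b (suc zero) ρ∈ = there (∈.∈-++⁺ʳ (tapeRules (situation k a b) 0b (proj₁ (proj₂ (effect k a b)))) ρ∈)

  tape-step : ∀ (C : Config V) τ → tapeOf (step V noOracle C) τ ≡
    applyOp (opOf τ (proj₂ (effect (Config.state C) (hd (Config.work C)) (hd (Config.query C))))) (tapeOf C τ)
  tape-step (cfg k w t) zero       = cong Config.work (step-effect k w t)
  tape-step (cfg k w t) (suc zero) = cong Config.query (step-effect k w t)

  state-step : ∀ (C : Config V) → Config.state (step V noOracle C) ≡ proj₁ (effect (Config.state C) (hd (Config.work C)) (hd (Config.query C)))
  state-step (cfg k w t) = cong Config.state (step-effect k w t)

  module FromAssignment (0<T : 0 < T) (T≤I : T ≤ I) (lW≤I : suc (l + W) ≤ I) (X : Assignment) (sat : Satisfies X) where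
    open Satisfies sat

    0<I : 0 < I
    0<I = ℕ.≤-trans 0<T T≤I

    Holds : ℕ → ℕ → Atom → Set
    Holds t i (tp , ip , κ) = X false (tval tp t) (ival ip i) (toℕ (kind# κ)) ≡ true

    Current : Atom → Set
    Current (tp , _ , _) = tp ≡ tz ⊎ tp ≡ tr 0b

    consistent : ∀ t i κ d → t < T → i < I → X false t (toℕ {2} d + i) (toℕ (kind# κ)) ≡ true → X true t (toℕ d + i) (toℕ (kind# κ)) ≡ false
    consistent t i κ d t< i< h with All.lookup (negative t i t< i<)
      (there (∈.∈-++⁺ˡ (∈-cm consistencyRules (∈-allKinds κ)
        (∈.∈-map⁺ (consistencyRule κ) (∈.∈-allFin d)))))
    ... | here (_ , eq) with () ← trans (sym h) eq
    ... | there (here (_ , eq)) = eq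

    unbarred : ∀ t i → t < T → i < I → ∀ a → Current a → Holds t i a → evalLit X t i (barr a) ≡ false
    unbarred t i t< i< (_ , iz , κ)   (inj₁ refl) h = consistent 0 0 κ zero 0<T 0<I h
    unbarred t i t< i< (_ , ir d , κ) (inj₁ refl) h = consistent 0 i κ d 0<T i< h
    unbarred t i t< i< (_ , iz , κ)   (inj₂ refl) h = consistent t 0 κ zero t< 0<I h
    unbarred t i t< i< (_ , ir d , κ) (inj₂ refl) h = consistent t i κ d t< i< h

    fire : ∀ t i → t < T → i < I → ∀ bodies heads → imp bodies heads ∈ posRules →
      All (λ a → Current a × Holds t i a) bodies → Good true X t i heads
    fire t i t< i< bodies heads ρ∈ hyp with Any.++⁻ heads (All.lookup (positive t i t< i<) ρ∈)
    ... | inj₁ h = h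
    ... | inj₂ b = ⊥-elim (none bodies hyp b)
      where
      none : ∀ bodies → All (λ a → Current a × Holds t i a) bodies → Good true X t i (map barr bodies) → ⊥
      none (a ∷ as) ((cur , h) ∷ hs) (here (_ , eq)) with () ← trans (sym eq) (unbarred t i t< i< a cur h)
      none (a ∷ as) (_ ∷ hs) (there g) = none as hs g

    fire₁ : ∀ t i → t < T → i < I → ∀ bodies a → imp bodies (plain a ∷ []) ∈ posRules →
      All (λ a → Current a × Holds t i a) bodies → Holds t i a
    fire₁ t i t< i< bodies a ρ∈ hyp with fire t i t< i< bodies (plain a ∷ []) ρ∈ hyp
    ... | here (_ , eq) = eq

    -- If `unit` were false, the first two positive rules would make both auxiliary variables true,
    -- which the first negative rule forbids.
    unit-holds : ∀ t i → Holds t i unit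
    unit-holds t i with X false 0 0 (toℕ (kind# (spec zero))) in u
    ... | true  = refl
    ... | false with All.lookup (positive 0 0 0<T 0<I) (init∈ (here refl)) | All.lookup (positive 0 0 0<T 0<I) (init∈ (there (here refl))) | All.lookup (negative 0 0 0<T 0<I) (here refl)
    ... | here (_ , eq) | _ | _ with () ← trans (sym u) eq
    unit-holds t i | false | there (here _) | here (_ , eq) | _ with () ← trans (sym u) eq
    unit-holds t i | false | there (here (_ , y)) | there (here _) | here (_ , eq) with () ← trans (sym y) eq
    unit-holds t i | false | there (here _) | there (here (_ , y)) | there (here (_ , eq)) with () ← trans (sym y) eq

    given-unit : ∀ t i → All (λ a → Current a × Holds t i a) (unit ∷ [])
    given-unit t i = (inj₁ refl , unit-holds t i) ∷ []

    InputFact : ℕ → Sym → Set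
    InputFact zero    s = Holds 0 0 (tz , iz , cell H 0b s)
    InputFact (suc i) s = Holds 0 i (tz , ir 0b , cell ▷ 0b s)

    read-heads : ∀ i p (at : Sym → Atom) → Good true X 0 i (map (guarded p at) (allFin 4)) → Σ Sym λ s → Allowed (ival p i) (toℕ s) × Holds 0 i (at s)
    read-heads i p at g with Any.map⁻ {f = guarded p at} {xs = allFin 4} g
    ... | h with find h
    ... | s , _ , al , eq = s , al , eq

    guess : ∀ n → n ≤ I → Σ Sym λ s → Allowed n (toℕ s) × InputFact n s
    guess zero    _ = read-heads 0 iz (λ a → tz , iz , cell H 0b a)
      (fire 0 0 0<T 0<I (unit ∷ []) _ (init∈ (there (there (there (here refl))))) (given-unit 0 0))
    guess (suc i) i< = read-heads i (ir 1b) (λ a → tz , ir 0b , cell ▷ 0b a)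
      (fire 0 i 0<T i< (unit ∷ []) _ (init∈ (there (there (there (there (here refl)))))) (given-unit 0 i))

    blanks : ∀ n k → suc n + k ≤ I → InputFact (suc n) blank → InputFact (suc n + k) blank
    blanks n zero    le h = subst (λ z → InputFact (suc z) blank) (sym (ℕ.+-identityʳ n)) h
    blanks n (suc k) le h = subst (λ z → InputFact (suc z) blank) (sym (ℕ.+-suc n k))
      (fire₁ 0 (n + k) 0<T (ℕ.≤-trans (ℕ.≤-reflexive (sym (ℕ.+-suc n k))) (ℕ.≤-pred (ℕ.≤-trans le (ℕ.n≤1+n I)))) ((tz , ir 0b , cell ▷ 0b blank) ∷ []) (tz , ir 1b , cell ▷ 0b blank)
        (init∈ (there (there (there (there (there (there (there (there (there (here refl)))))))))))
        ((inj₁ refl , blanks n k (ℕ.≤-trans (ℕ.≤-reflexive (sym (ℕ.+-suc n k))) (ℕ.≤-pred (ℕ.≤-trans le (ℕ.n≤1+n I)))) h) ∷ []))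

    -- Reads the guessed bits behind the separator up to the first symbol that is not a bit; `f`
    -- counts the positions from `n` to `l + W`, beyond which only blanks are allowed.
    word : ∀ f n → n + f ≡ suc (l + W) → List Bool
    word zero    n _  = []
    word (suc f) n eq with guess n (ℕ.≤-trans (ℕ.≤-trans (ℕ.m≤m+n n (suc f)) (ℕ.≤-reflexive eq)) lW≤I)
    ... | suc zero , _             = false ∷ word f (suc n) (trans (sym (ℕ.+-suc n f)) eq)
    ... | suc (suc zero) , _       = true ∷ word f (suc n) (trans (sym (ℕ.+-suc n f)) eq)
    ... | _ , _                    = []

    word-length : ∀ f n eq → length (word f n eq) ≤ f
    word-length zero    n _  = z≤n
    word-length (suc f) n eq with guess n (ℕ.≤-trans (ℕ.≤-trans (ℕ.m≤m+n n (suc f)) (ℕ.≤-reflexive eq)) lW≤I)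
    ... | suc zero , _             = s≤s (word-length f (suc n) _)
    ... | suc (suc zero) , _       = s≤s (word-length f (suc n) _)
    ... | zero , _                 = z≤n
    ... | suc (suc (suc _)) , _    = z≤n

    -- Where the reading stops the guess is blank, either by its position or because a separator is
    -- not allowed there, and the blank rule extends this to all later cells.
    word-facts : ∀ f n eq → l < n → ∀ k → n + k ≤ I → InputFact (n + k) (nthS (map bitSym (word f n eq)) k)
    word-facts zero n@(suc n') eq lt k le with guess n (ℕ.≤-trans (ℕ.m≤m+n n k) le)
    ... | s , al , h = blanks n' k le (subst (InputFact n) (s≡0 s al) h)
      where
      lW<n : l + W < n
      lW<n = ℕ.≤-reflexive (trans (sym eq) (ℕ.+-identityʳ n))
      s≡0 : ∀ s → Allowed n (toℕ s) → s ≡ blank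
      s≡0 s (inj₁ (a , _)) = ⊥-elim (ℕ.<-asym lt a)
      s≡0 s (inj₂ (inj₁ (a , _))) = ⊥-elim (ℕ.<-irrefl (sym a) lt)
      s≡0 s (inj₂ (inj₂ (inj₁ (_ , a , _)))) = ⊥-elim (ℕ.<⇒≱ lW<n a)
      s≡0 s (inj₂ (inj₂ (inj₂ (_ , a)))) = F.toℕ-injective a
    word-facts (suc f) n@(suc n') eq lt k le with guess n (ℕ.≤-trans (ℕ.≤-trans (ℕ.m≤m+n n (suc f)) (ℕ.≤-reflexive eq)) lW≤I)
    ... | zero , al , h = blanks n' k le h
    ... | suc zero , al , h = next-fact k le
      where
      next-fact : ∀ k → n + k ≤ I → InputFact (n + k) (nthS (map bitSym (false ∷ word f (suc n) (trans (sym (ℕ.+-suc n f)) eq))) k)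
      next-fact zero    le = subst (λ z → InputFact z (suc zero)) (sym (ℕ.+-identityʳ n)) h
      next-fact (suc k) le = subst (λ z → InputFact z (nthS (map bitSym (word f (suc n) (trans (sym (ℕ.+-suc n f)) eq))) k)) (sym (ℕ.+-suc n k))
        (word-facts f (suc n) _ (ℕ.m<n⇒m<1+n lt) k (ℕ.≤-trans (ℕ.≤-reflexive (sym (ℕ.+-suc n k))) le))
    ... | suc (suc zero) , al , h = next-fact k le
      where
      next-fact : ∀ k → n + k ≤ I → InputFact (n + k) (nthS (map bitSym (true ∷ word f (suc n) (trans (sym (ℕ.+-suc n f)) eq))) k)
      next-fact zero    le = subst (λ z → InputFact z (suc (suc zero))) (sym (ℕ.+-identityʳ n)) h
      next-fact (suc k) le = subst (λ z → InputFact z (nthS (map bitSym (word f (suc n) (trans (sym (ℕ.+-suc n f)) eq))) k)) (sym (ℕ.+-suc n k))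
        (word-facts f (suc n) _ (ℕ.m<n⇒m<1+n lt) k (ℕ.≤-trans (ℕ.≤-reflexive (sym (ℕ.+-suc n k))) le))
    ... | suc (suc (suc zero)) , al , h = ⊥-elim (not-sep al)
      where
      not-sep : ¬ Allowed n 3
      not-sep (inj₁ (a , _)) = ℕ.<-asym lt a
      not-sep (inj₂ (inj₁ (a , _))) = ℕ.<-irrefl (sym a) lt
      not-sep (inj₂ (inj₂ (inj₁ (_ , _ , s≤s (s≤s (s≤s ()))))))
      not-sep (inj₂ (inj₂ (inj₂ (_ , ()))))

    w : List Bool
    w = word W (suc l) refl

    input-facts : ∀ n → n ≤ I → InputFact n (input w n)
    input-facts n le with guess n le | region n
    ... | s , al , h | inX lt = subst (InputFact n) (F.toℕ-injective (trans (s≡ al) (sym (nth-map x _ n lt)))) h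
      where
      s≡ : Allowed n (toℕ s) → toℕ s ≡ suc (bit01 (nthB x n))
      s≡ (inj₁ (_ , eq)) = eq
      s≡ (inj₂ (inj₁ (a , _))) = ⊥-elim (ℕ.<-irrefl a lt)
      s≡ (inj₂ (inj₂ (inj₁ (a , _)))) = ⊥-elim (ℕ.<-asym lt a)
      s≡ (inj₂ (inj₂ (inj₂ (a , _)))) = ⊥-elim (ℕ.<-asym lt (ℕ.≤-trans (s≤s (ℕ.m≤m+n l W)) a))
    ... | s , al , h | atS refl = subst (InputFact n) (F.toℕ-injective (trans (s≡ al) (sym (cong toℕ (trans (cong (input w) (sym (ℕ.+-identityʳ l))) (nth-skip x (sep ∷ map bitSym w) 0)))))) h
      where
      s≡ : Allowed l (toℕ s) → toℕ s ≡ 3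
      s≡ (inj₁ (a , _)) = ⊥-elim (ℕ.<-irrefl refl a)
      s≡ (inj₂ (inj₁ (_ , eq))) = eq
      s≡ (inj₂ (inj₂ (inj₁ (a , _)))) = ⊥-elim (ℕ.<-irrefl refl a)
      s≡ (inj₂ (inj₂ (inj₂ (a , _)))) = ⊥-elim (ℕ.<⇒≱ a (ℕ.m≤m+n l W))
    ... | _ | past k refl = subst₂ InputFact (sym (ℕ.+-suc l k)) (sym (input-past w k))
      (word-facts W (suc l) refl ℕ.≤-refl k (ℕ.≤-trans (ℕ.≤-reflexive (sym (ℕ.+-suc l k))) le))

    C : ℕ → Config V
    C = config w

    -- The restriction `i + t < I` accommodates the loss of one known cell at the far end per step.
    Invariant : ℕ → Set
    Invariant t = X false t 0 (toℕ (kind# (st (Config.state (C t))))) ≡ true ×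
      (∀ τ side i → i + t < I → (side ≡ H → i ≡ 0) → X false t i (toℕ (kind# (cell side τ (look (tapeOf (C t) τ) side i)))) ≡ true)

    invariant₀ : Invariant 0
    invariant₀ = fire₁ 0 0 0<T 0<I (unit ∷ []) _ (init∈ (there (there (here refl)))) (given-unit 0 0) , cells
      where
      ss : List Sym
      ss = verifierInput x w
      <I : ∀ i → i + 0 < I → i < I
      <I i = subst (_< I) (ℕ.+-identityʳ i)
      cells : ∀ τ side i → i + 0 < I → (side ≡ H → i ≡ 0) → X false 0 i (toℕ (kind# (cell side τ (look (tapeOf (C 0) τ) side i)))) ≡ true
      cells zero H i i< h rewrite h refl | proj₁ (init-look ss) = input-facts 0 z≤n
      cells zero ◁ i i< h rewrite proj₂ (proj₂ (init-look ss)) i =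
        fire₁ 0 i 0<T (<I i i<) (unit ∷ []) (tz , ir 0b , cell ◁ 0b blank) (init∈ (there (there (there (there (there (here refl))))))) (given-unit 0 i)
      cells zero ▷ i i< h rewrite proj₁ (proj₂ (init-look ss)) i = input-facts (suc i) (<I i i<)
      cells (suc zero) H i i< h rewrite h refl =
        fire₁ 0 0 0<T 0<I (unit ∷ []) (tz , iz , cell H 1b blank) (init∈ (there (there (there (there (there (there (here refl)))))))) (given-unit 0 0)
      cells (suc zero) ◁ i i< h =
        fire₁ 0 i 0<T (<I i i<) (unit ∷ []) (tz , ir 0b , cell ◁ 1b blank) (init∈ (there (there (there (there (there (there (there (here refl))))))))) (given-unit 0 i)
      cells (suc zero) ▷ i i< h =
        fire₁ 0 i 0<T (<I i i<) (unit ∷ []) (tz , ir 0b , cell ▷ 1b blank) (init∈ (there (there (there (there (there (there (there (there (here refl)))))))))) (given-unit 0 i)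

    invariant-step : ∀ t → t < T → Invariant t → Invariant (suc t)
    invariant-step t t< (stt , cells) = subst (λ z → X false (suc t) 0 (toℕ (kind# (st z))) ≡ true) (sym (state-step (C t)))
        (fire₁ t 0 t< 0<I sit (tr 1b , iz , st (proj₁ eff)) (trans∈ k a b (here refl)) (sit-holds 0)) , new
      where
      k = Config.state (C t)
      a b : Sym
      a = hd (Config.work (C t))
      b = hd (Config.query (C t))
      sit : List Atom
      sit = situation k a b
      eff : Fin (nQ V) × Op × Op
      eff = effect k a b
      t<I : t < I
      t<I = ℕ.≤-trans t< T≤I
      sit-holds : ∀ i → All (λ a → Current a × Holds t i a) sit
      sit-holds i = (inj₂ refl , stt) ∷ (inj₂ refl , cells zero H 0 t<I (λ _ → refl)) ∷ (inj₂ refl , cells (suc zero) H 0 t<I (λ _ → refl)) ∷ []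
      new : ∀ τ side i → i + suc t < I → (side ≡ H → i ≡ 0) → X false (suc t) i (toℕ (kind# (cell side τ (look (tapeOf (C (suc t)) τ) side i)))) ≡ true
      new τ side i i< h rewrite tape-step (C t) τ = go (described op side i h)
        where
        op = opOf τ (proj₂ eff)
        old = tapeOf (C t) τ
        i+t : suc i + t < I
        i+t = subst (_< I) (ℕ.+-suc i t) i<
        i<I : i < I
        i<I = ℕ.≤-trans (s≤s (ℕ.m≤m+n i (suc t))) i<
        go : Described op side i → X false (suc t) i (toℕ (kind# (cell side τ (look (applyOp op old) side i)))) ≡ true
        go (inj₁ ((_ , ip , s) , c∈ , j , j≤ , refl , refl)) =
          subst (λ z → X false (suc t) (ival ip j) (toℕ (kind# (cell side τ z))) ≡ true) (sym (All.lookup (consts-ok op) c∈ j old))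
            (fire₁ t j t< (ℕ.≤-trans (s≤s j≤) i<I) sit (tr 1b , ip , cell side τ s)
              (trans∈ k a b (tape∈ k a b τ (const∈ sit τ op c∈))) (sit-holds j))
        go (inj₂ (((src , ip) , (_ , ip')) , c∈ , j , j≤ , refl , refl , idx , h0)) =
          subst (λ z → X false (suc t) (ival ip' j) (toℕ (kind# (cell side τ z))) ≡ true) (sym (All.lookup (copies-ok op) c∈ j old))
            (fire₁ t j t< (ℕ.≤-trans (s≤s j≤) i<I) ((tr 0b , ip , cell src τ u) ∷ sit) (tr 1b , ip' , cell side τ u)
              (trans∈ k a b (tape∈ k a b τ (copy∈ sit τ op u c∈)))
              ((inj₂ refl , cells τ src (ival ip j) (ℕ.≤-trans (s≤s (ℕ.+-monoˡ-≤ t idx)) i+t) h0) ∷ sit-holds j))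
          where
          u : Sym
          u = look old src (ival ip j)

    invariant : ∀ t → t ≤ T → Invariant t
    invariant zero    _  = invariant₀
    invariant (suc t) t< = invariant-step t t< (invariant t (ℕ.≤-trans (ℕ.n≤1+n t) t<))

    accepts : length w ≤ W × result V (config w T) ≡ just true
    accepts = word-length W (suc l) refl , res
      where
      k = Config.state (C T)
      res : result V (config w T) ≡ just true
      res with eqQ k (acc V) in eq
      ... | true  = refl
      ... | false with All.lookup (negative 0 0 0<T 0<I) {plain unit ∷ plain (te , iz , st k) ∷ []}
                    (there (∈.∈-++⁺ʳ (concatMap consistencyRules allKinds)
                      (∈-cm finalRules (∈.∈-allFin k)
                        (subst (λ z → (plain unit ∷ plain (te , iz , st k) ∷ []) ∈ (if z then [] else ((plain unit ∷ plain (te , iz , st k) ∷ []) ∷ []))) (sym eq) (here refl)))))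
      ... | here (_ , u) with () ← trans (sym (unit-holds 0 0)) u
      ... | there (here (_ , s)) with () ← trans (sym (proj₁ (invariant T ℕ.≤-refl))) s

  module FromRun (w : List Bool) (len : length w ≤ W) (accepting : result V (config w T) ≡ just true) where

    C : ℕ → Config V
    C = config w

    -- Of the two auxiliary variables one is true and one false, which satisfies the negative clause
    -- on them.
    holds : ℕ → ℕ → Kind → Bool
    holds t i (spec zero)       = true
    holds t i (spec (suc zero)) = true
    holds t i (spec _)          = false
    holds t i (cell side τ a)   = does (look (tapeOf (C t) τ) side i F.≟ a)
    holds t i (st k)            = does (Config.state (C t) F.≟ k)

    X : Assignment
    X b t i κ with κ ℕ.<? K
    ... | yes lt = holds t i (toKind (fromℕ< lt)) xor b
    ... | no _   = false

    X-kind : ∀ b t i κ → X b t i (toℕ (kind# κ)) ≡ holds t i κ xor b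
    X-kind b t i κ with toℕ (kind# κ) ℕ.<? K
    ... | yes lt = cong (λ z → holds t i z xor b) (trans (cong toKind (F.fromℕ<-toℕ (kind# κ) lt)) (toKind-kind# κ))
    ... | no nlt = ⊥-elim (nlt (F.toℕ<n (kind# κ)))

    True : ℕ → ℕ → Atom → Set
    True t i (tp , ip , κ) = holds (tval tp t) (ival ip i) κ ≡ true

    plain-true : ∀ t i a → True t i a → evalLit X t i (plain a) ≡ true
    plain-true t i (tp , ip , κ) h = trans (X-kind false (tval tp t) (ival ip i) κ) (trans (xor-falseʳ _) h)

    imp-good : ∀ t i bodies heads → (All (True t i) bodies → Good true X t i heads) → Good true X t i (imp bodies heads)
    imp-good t i bodies heads h with falsified bodies
      where
      falsified : ∀ bodies → All (True t i) bodies ⊎ Good true X t i (map barr bodies)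
      falsified [] = inj₁ []
      falsified ((tp , ip , κ) ∷ as) with holds (tval tp t) (ival ip i) κ in eq
      ... | false = inj₂ (here (tt , trans (X-kind true (tval tp t) (ival ip i) κ) (trans (xor-trueʳ _) (cong not eq))))
      ... | true with falsified as
      ... | inj₁ hs = inj₁ (eq ∷ hs)
      ... | inj₂ g  = inj₂ (there g)
    ... | inj₁ hs = Any.++⁺ˡ (h hs)
    ... | inj₂ g  = Any.++⁺ʳ heads g

    imp₁-good : ∀ t i bodies a → (All (True t i) bodies → True t i a) → Good true X t i (imp bodies (plain a ∷ []))
    imp₁-good t i bodies a h = imp-good t i bodies (plain a ∷ []) (λ hs → here (tt , plain-true t i a (h hs)))

    fact : ∀ {n} {u v : Fin n} → u ≡ v → does (u F.≟ v) ≡ true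
    fact {u = u} refl = ≡-bool-refl u

    heads-good : ∀ t i p (at : Sym → IPos × Kind) s → Allowed (ival p i) (toℕ s) → True t i (tz , at s) →
      Good true X t i (map (guarded p (λ s → tz , at s)) (allFin 4))
    heads-good t i p at s al ok = Any.map⁺ {f = guarded p (λ s → tz , at s)} (lose (∈.∈-allFin s) (al , plain-true t i (tz , at s) ok))

    situation-elim : ∀ {t i k a b} → All (True t i) (situation k a b) → k ≡ Config.state (C t) × a ≡ hd (Config.work (C t)) × b ≡ hd (Config.query (C t))
    situation-elim (h₁ ∷ h₂ ∷ h₃ ∷ []) = sym (≡-bool-sound h₁) , sym (≡-bool-sound h₂) , sym (≡-bool-sound h₃)

    tape-good : ∀ t i k a b τ → All (Good true X t i) (tapeRules (situation k a b) τ (opOf τ (proj₂ (effect k a b))))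
    tape-good t i k a b τ = All.++⁺
      (All.map⁺ {f = constRule (situation k a b) τ} (All.map (λ {c} → const-good {c}) (consts-ok op)))
      (All.concat⁺ (All.map⁺ {f = copyRules (situation k a b) τ} (All.map (λ {c} ok → All-mapFin (copyRule (situation k a b) τ c) (copy-good {c} ok)) (copies-ok op))))
      where
      op : Op
      op = opOf τ (proj₂ (effect k a b))
      new-tape : All (True t i) (situation k a b) → tapeOf (C (suc t)) τ ≡ applyOp op (tapeOf (C t) τ)
      new-tape hs with situation-elim {t} {i} hs
      ... | refl , refl , refl = tape-step (C t) τ
      const-good : ∀ {c} → (∀ i t → look (applyOp op t) (proj₁ c) (ival (proj₁ (proj₂ c)) i) ≡ proj₂ (proj₂ c)) →
        Good true X t i (constRule (situation k a b) τ c)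
      const-good {side , ip , s} ok = imp₁-good t i (situation k a b) _ λ hs →
        fact (trans (cong (λ z → look z side (ival ip i)) (new-tape hs)) (ok i (tapeOf (C t) τ)))
      copy-good : ∀ {c} → (∀ i t → look (applyOp op t) (proj₁ (proj₂ c)) (ival (proj₂ (proj₂ c)) i) ≡ look t (proj₁ (proj₁ c)) (ival (proj₂ (proj₁ c)) i)) →
        ∀ u → Good true X t i (copyRule (situation k a b) τ c u)
      copy-good {(src , ip) , (dst , ip')} ok u = imp₁-good t i ((tr 0b , ip , cell src τ u) ∷ situation k a b) _ λ { (h ∷ hs) →
        fact (trans (cong (λ z → look z dst (ival ip' i)) (new-tape hs)) (trans (ok i (tapeOf (C t) τ)) (≡-bool-sound h))) }

    trans-good : ∀ t i k a b → All (Good true X t i) (transRules k a b)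
    trans-good t i k a b =
      imp₁-good t i (situation k a b) (tr 1b , iz , st (proj₁ (effect k a b))) new-state ∷
      All.++⁺ (tape-good t i k a b zero) (tape-good t i k a b (suc zero))
      where
      new-state : All (True t i) (situation k a b) → True t i (tr 1b , iz , st (proj₁ (effect k a b)))
      new-state hs with situation-elim {t} {i} hs
      ... | refl , refl , refl = fact (state-step (C t))

    init-good : ∀ t i → All (Good true X t i) initRules
    init-good t i =
      here (tt , plain-true t i unit refl) ∷
      here (tt , plain-true t i unit refl) ∷
      imp₁-good t i (unit ∷ []) _ (λ _ → fact {u = start V} refl) ∷
      imp-good t i (unit ∷ []) _ (λ _ → heads-good t i iz (λ a → iz , cell H 0b a) (input w 0) (input-allowed w len 0)
        (fact (proj₁ (init-look ss)))) ∷
      imp-good t i (unit ∷ []) _ (λ _ → heads-good t i (ir 1b) (λ a → ir 0b , cell ▷ 0b a) (input w (suc i)) (input-allowed w len (suc i))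
        (fact (proj₁ (proj₂ (init-look ss)) i))) ∷
      imp₁-good t i (unit ∷ []) _ (λ _ → fact (proj₂ (proj₂ (init-look ss)) i)) ∷
      imp₁-good t i (unit ∷ []) _ (λ _ → refl) ∷
      imp₁-good t i (unit ∷ []) _ (λ _ → refl) ∷
      imp₁-good t i (unit ∷ []) _ (λ _ → refl) ∷
      imp₁-good t i ((tz , ir 0b , cell ▷ 0b blank) ∷ []) _ (λ { (h ∷ []) →
        fact (trans (proj₁ (proj₂ (init-look ss)) (suc i)) (still-blank i (trans (sym (proj₁ (proj₂ (init-look ss)) i)) (≡-bool-sound h)))) }) ∷ []
      where
      ss : List Sym
      ss = verifierInput x w
      still-blank : ∀ i → input w (suc i) ≡ blank → input w (suc (suc i)) ≡ blank
      still-blank i eq = go x i eq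
        where
        tail-blank : ∀ bs n → nthS (map bitSym bs) n ≡ blank → nthS (map bitSym bs) (suc n) ≡ blank
        tail-blank []           n       eq = refl
        tail-blank (false ∷ bs) zero    ()
        tail-blank (true ∷ bs)  zero    ()
        tail-blank (b ∷ bs)     (suc n) eq = tail-blank bs n eq
        whole : ∀ bs n → nthS (map bitSym bs ++ sep ∷ map bitSym w) n ≡ blank → nthS (map bitSym bs ++ sep ∷ map bitSym w) (suc n) ≡ blank
        whole []           zero    ()
        whole []           (suc n) eq = tail-blank w n eq
        whole (false ∷ bs) zero    ()
        whole (true ∷ bs)  zero    ()
        whole (b ∷ bs)     (suc n) eq = whole bs n eq
        go : ∀ bs n → nthS (map bitSym bs ++ sep ∷ map bitSym w) (suc n) ≡ blank → nthS (map bitSym bs ++ sep ∷ map bitSym w) (suc (suc n)) ≡ blank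
        go bs n = whole bs (suc n)

    barred-false : ∀ t i κ → holds t i κ ≡ true → X true t i (toℕ (kind# κ)) ≡ false
    barred-false t i κ h = trans (X-kind true t i κ) (trans (xor-trueʳ _) (cong not h))

    satisfies : Satisfies X
    satisfies = record
      { positive = λ t i _ _ → All.++⁺ (init-good t i)
          (All-concatMap transRules₁ (λ k → All-concatMap (transRules₂ k) (λ a → All-concatMap (transRules k a) (λ b → trans-good t i k a b) (allFin 4)) (allFin 4)) (allFin (nQ V)))
      ; negative = λ t i _ _ → there (here (tt , X-kind false 0 0 (spec (suc (suc zero))))) ∷
          All.++⁺ (All-concatMap consistencyRules (λ κ → All-mapFin (consistencyRule κ) (either t i κ)) allKinds)
            (All-concatMap finalRules (λ k → final k) (allFin (nQ V))) }
      where
      either : ∀ t i κ (d : Fin 2) → Good false X t i (plain (tr 0b , ir d , κ) ∷ barr (tr 0b , ir d , κ) ∷ [])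
      either t i κ d with holds t (toℕ d + i) κ in eq
      ... | false = here (tt , trans (X-kind false t (toℕ d + i) κ) (trans (xor-falseʳ _) eq))
      ... | true  = there (here (tt , barred-false t (toℕ d + i) κ eq))
      final : ∀ {t i} k → All (Good false X t i) (finalRules k)
      final k with eqQ k (acc V) in eq
      ... | true  = []
      ... | false = there (here (tt , trans (X-kind false T 0 (st k)) (trans (xor-falseʳ _) (dec-false (Config.state (C T) F.≟ k) other)))) ∷ []
        where
        accepted : ∀ u v → (if u then just true else if v then just false else nothing) ≡ just true → u ≡ true
        accepted true  _     _ = refl
        accepted false true  ()
        accepted false false ()
        other : Config.state (C T) ≢ k
        other refl with () ← trans (sym (accepted _ _ accepting)) eq

  -- Supplies `TwoMembers`. The two literals are told apart by bar or kind, which do not change with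
  -- `t` and `i`; their times or positions may coincide in particular instances.
  TwoLits : ℕ → ℕ → Rule → Set
  TwoLits t i ρ = Σ Lit λ u → Σ Lit λ v → (u ∈ ρ × GuardOK (Lit.guard u) i) × (v ∈ ρ × GuardOK (Lit.guard v) i) ×
    (Lit.barred u ≢ Lit.barred v ⊎ kind# (Lit.kind u) ≢ kind# (Lit.kind v))

  two-imp : ∀ t i b bodies h → TwoLits t i (imp (b ∷ bodies) (plain h ∷ []))
  two-imp t i b bodies h = plain h , barr b , (here refl , tt) , (there (here refl) , tt) , inj₁ λ ()

  -- The input belonging to the empty witness provides an allowed symbol at every position, hence a
  -- guarded head that is present; the barred `unit` is the second literal.
  two-guarded : ∀ t i p at → TwoLits t i (imp (unit ∷ []) (map (guarded p at) (allFin 4)))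
  two-guarded t i p at = guarded p at s , barr unit ,
    (∈.∈-++⁺ˡ (∈.∈-map⁺ (guarded p at) (∈.∈-allFin s)) , input-allowed [] z≤n (ival p i)) ,
    (∈.∈-++⁺ʳ (map (guarded p at) (allFin 4)) (here refl) , tt) , inj₁ λ ()
    where
    s : Sym
    s = input [] (ival p i)

  two-positive : ∀ t i → All (TwoLits t i) posRules
  two-positive t i = All.++⁺
    ((_ , _ , (here refl , tt) , (there (here refl) , tt) , inj₂ (kind≢ λ ())) ∷
     (_ , _ , (here refl , tt) , (there (here refl) , tt) , inj₂ (kind≢ λ ())) ∷
     two-imp t i unit [] _ ∷ two-guarded t i iz (λ a → tz , iz , cell H 0b a) ∷ two-guarded t i (ir 1b) (λ a → tz , ir 0b , cell ▷ 0b a) ∷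
     two-imp t i unit [] _ ∷ two-imp t i unit [] _ ∷ two-imp t i unit [] _ ∷ two-imp t i unit [] _ ∷ two-imp t i _ [] _ ∷ [])
    (All-concatMap transRules₁ (λ k → All-concatMap (transRules₂ k) (λ a → All-concatMap (transRules k a) (λ b → trans-two k a b) (allFin 4)) (allFin 4)) (allFin (nQ V)))
    where
    tape-two : ∀ k a b τ op → All (TwoLits t i) (tapeRules (situation k a b) τ op)
    tape-two k a b τ op = All.++⁺
      (All.map⁺ {f = constRule (situation k a b) τ} (All.tabulate (λ {c} _ → two-imp t i (tr 0b , iz , st k) _ (tr 1b , proj₁ (proj₂ c) , cell (proj₁ c) τ (proj₂ (proj₂ c))))))
      (All-concatMap (copyRules (situation k a b) τ) (λ c → All-mapFin (copyRule (situation k a b) τ c)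
        (λ u → two-imp t i (tr 0b , proj₂ (proj₁ c) , cell (proj₁ (proj₁ c)) τ u) (situation k a b) (tr 1b , proj₂ (proj₂ c) , cell (proj₁ (proj₂ c)) τ u))) (copies op))
    trans-two : ∀ k a b → All (TwoLits t i) (transRules k a b)
    trans-two k a b = two-imp t i (tr 0b , iz , st k) _ (tr 1b , iz , st (proj₁ (effect k a b))) ∷ All.++⁺ (tape-two k a b 0b (proj₁ (proj₂ (effect k a b)))) (tape-two k a b 1b (proj₂ (proj₂ (effect k a b))))

  two-negative : ∀ t i → All (TwoLits t i) negRules
  two-negative t i = (_ , _ , (here refl , tt) , (there (here refl) , tt) , inj₂ (kind≢ λ ())) ∷
    All.++⁺ (All-concatMap consistencyRules (λ κ → All-mapFin (consistencyRule κ) (λ d → plain (tr 0b , ir d , κ) , barr (tr 0b , ir d , κ) , (here refl , tt) , (there (here refl) , tt) , inj₁ λ ())) allKinds)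
      (All-concatMap finalRules final (allFin (nQ V)))
    where
    final : ∀ k → All (TwoLits t i) (finalRules k)
    final k with eqQ k (acc V)
    ... | true  = []
    ... | false = (_ , _ , (here refl , tt) , (there (here refl) , tt) , inj₂ (kind≢ λ ())) ∷ []

-- Structured programs and the machines that run them

infixr 5 _⨾_

-- a program reads and rewrites the first tape and appends bits to the second
data Prog : Set where
  tick   : (Sym → Sym × Move) → Prog
  emit   : Bool → Prog
  _⨾_    : Prog → Prog → Prog
  branch : (Sym → Bool) → Prog → Prog → Prog
  while  : (Sym → Bool) → Prog → Prog

St : Set
St = Tape × Tape

emitTape : Bool → Tape → Tape
emitTape b t = moveTape mR (writeTape (bitSym b) t)

data Exec : Prog → St → ℕ → St → Set where
  x-tick : ∀ {f w t} → Exec (tick f) (w , t) 1 (moveTape (proj₂ (f (hd w))) (writeTape (proj₁ (f (hd w))) w) , t)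
  x-emit : ∀ {b w t} → Exec (emit b) (w , t) 1 (w , emitTape b t)
  x-seq  : ∀ {p p' s s' s'' k k'} → Exec p s k s' → Exec p' s' k' s'' → Exec (p ⨾ p') s (k + k') s''
  x-then : ∀ {f p p' s s' k} → f (hd (proj₁ s)) ≡ true → Exec p s k s' → Exec (branch f p p') s (suc k) s'
  x-else : ∀ {f p p' s s' k} → f (hd (proj₁ s)) ≡ false → Exec p' s k s' → Exec (branch f p p') s (suc k) s'
  x-stop : ∀ {f p s} → f (hd (proj₁ s)) ≡ false → Exec (while f p) s 1 s
  x-loop : ∀ {f p s s' s'' k k'} → f (hd (proj₁ s)) ≡ true → Exec p s k s' → Exec (while f p) s' k' s'' → Exec (while f p) s (suc (k + k')) s''

psize : Prog → ℕ
psize (tick _)       = 1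
psize (emit _)       = 1
psize (p ⨾ p')       = psize p + psize p'
psize (branch _ p p') = suc (psize p + psize p')
psize (while _ p)    = suc (psize p)

entry : ∀ p → Fin (psize p)
entry (tick _)        = zero
entry (emit _)        = zero
entry (p ⨾ p')        = entry p F.↑ˡ psize p'
entry (branch _ _ _)  = zero
entry (while _ _)     = zero

-- the next control state (nothing on exit) and the effect on the two tapes
Action : ℕ → Set
Action n = Maybe (Fin n) × Sym × Move × Maybe Bool

redirect : ∀ {m n} → (Fin m → Fin n) → Maybe (Fin n) → Action m → Action n
redirect φ e (just i  , rest) = just (φ i) , rest
redirect φ e (nothing , rest) = e , rest

ctrl : ∀ p → Fin (psize p) → Sym → Action (psize p)
ctrl (tick f) _ s = nothing , proj₁ (f s) , proj₂ (f s) , nothing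
ctrl (emit b) _ s = nothing , s , mS , just b
ctrl (p ⨾ p') i s = [ (λ j → redirect (F._↑ˡ psize p') (just (psize p F.↑ʳ entry p')) (ctrl p j s)) , (λ j → redirect (psize p F.↑ʳ_) nothing (ctrl p' j s)) ]′ (F.splitAt (psize p) i)
ctrl (branch f p p') zero s = just (if f s then suc (entry p F.↑ˡ psize p') else suc (psize p F.↑ʳ entry p')) , s , mS , nothing
ctrl (branch f p p') (suc i) s = [ (λ j → redirect (λ z → suc (z F.↑ˡ psize p')) nothing (ctrl p j s)) , (λ j → redirect (λ z → suc (psize p F.↑ʳ z)) nothing (ctrl p' j s)) ]′ (F.splitAt (psize p) i)
ctrl (while f p) zero s = (if f s then just (suc (entry p)) else nothing) , s , mS , nothing
ctrl (while f p) (suc i) s = redirect suc (just zero) (ctrl p i s)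

emitMaybe : Maybe Bool → Tape → Tape
emitMaybe nothing  t = t
emitMaybe (just b) t = emitTape b t

apply : ∀ {n} → Action n → St → St
apply (_ , a , m , eb) (w , t) = moveTape m (writeTape a w) , emitMaybe eb t

data Reach (p : Prog) : Maybe (Fin (psize p)) → St → ℕ → St → Set where
  exit : ∀ {s} → Reach p nothing s 0 s
  more : ∀ {i s k s'} → Reach p (proj₁ (ctrl p i (hd (proj₁ s)))) (apply (ctrl p i (hd (proj₁ s))) s) k s' → Reach p (just i) s (suc k) s'

-- A run of a component is a run of the compound program once its exit is redirected to `e`; every
-- compound case of `exec⇒reach` is an instance.
embed : ∀ {p r} (φ : Fin (psize p) → Fin (psize r)) e → (∀ i s → ctrl r (φ i) s ≡ redirect φ e (ctrl p i s)) →
  ∀ {i s k s' k' s''} → Reach p (just i) s k s' → Reach r e s' k' s'' → Reach r (just (φ i)) s (k + k') s''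
embed {p} {r} φ e h {i} {s} {k' = k'} {s''} (more {k = k} x) cont with ctrl p i (hd (proj₁ s)) in eq | h i (hd (proj₁ s)) | x
... | just j  , rest | h' | x' = more (subst (λ a → Reach r (proj₁ a) (apply a s) (k + k') s'') (sym h') (embed φ e h x' cont))
... | nothing , rest | h' | exit = more (subst (λ a → Reach r (proj₁ a) (apply a s) (k + k') s'') (sym h') cont)

exec⇒reach : ∀ {p s k s'} → Exec p s k s' → Reach p (just (entry p)) s k s'
exec⇒reach x-tick = more exit
exec⇒reach x-emit = more exit
exec⇒reach {p ⨾ p'} (x-seq {k' = k'} x y) = embed (F._↑ˡ psize p') (just (psize p F.↑ʳ entry p'))
    (λ i s → cong [ _ , _ ]′ (F.splitAt-↑ˡ (psize p) i (psize p'))) (exec⇒reach x)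
  (subst (λ k → Reach (p ⨾ p') _ _ k _) (ℕ.+-identityʳ k')
    (embed (psize p F.↑ʳ_) nothing (λ i s → cong [ _ , _ ]′ (F.splitAt-↑ʳ (psize p) (psize p') i)) (exec⇒reach y) exit))
exec⇒reach {branch f p p'} {s} {s' = s'} (x-then {k = k} b x) = more (subst₂ (λ u k → Reach (branch f p p') (just (if u then suc (entry p F.↑ˡ psize p') else suc (psize p F.↑ʳ entry p'))) s k s') (sym b) (ℕ.+-identityʳ k)
  (embed (λ z → suc (z F.↑ˡ psize p')) nothing (λ i s → cong [ _ , _ ]′ (F.splitAt-↑ˡ (psize p) i (psize p'))) (exec⇒reach x) exit))
exec⇒reach {branch f p p'} {s} {s' = s'} (x-else {k = k} b x) = more (subst₂ (λ u k → Reach (branch f p p') (just (if u then suc (entry p F.↑ˡ psize p') else suc (psize p F.↑ʳ entry p'))) s k s') (sym b) (ℕ.+-identityʳ k)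
  (embed (λ z → suc (psize p F.↑ʳ z)) nothing (λ i s → cong [ _ , _ ]′ (F.splitAt-↑ʳ (psize p) (psize p') i)) (exec⇒reach x) exit))
exec⇒reach {while f p} {s} (x-stop b) = more (subst (λ u → Reach (while f p) (if u then just (suc (entry p)) else nothing) s 0 s) (sym b) exit)
exec⇒reach {while f p} {s} {s' = s''} (x-loop {k = k} {k'} b x y) = more (subst (λ u → Reach (while f p) (if u then just (suc (entry p)) else nothing) s (k + k') s'') (sym b)
  (embed suc (just zero) (λ i s → refl) (exec⇒reach x) (exec⇒reach y)))

-- Leaving the program means entering the query state, and the two answer states are the accepting
-- and the rejecting state. So the machine writes one query and returns the oracle's answer.
machine : Prog → OTM
machine p = record
  { nQ = 3 + psize p ; start = 3 F.↑ʳ entry p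
  ; acc = zero ; rej = suc zero ; qry = suc (suc zero) ; yes = zero ; no = suc zero
  ; δ = delta }
  where
  delta : Fin (3 + psize p) → Sym → Sym → Fin (3 + psize p) × Sym × Sym × Move × Move
  delta (suc (suc (suc i))) a b with ctrl p i a
  ... | c , a' , m , nothing = Maybe.maybe′ (3 F.↑ʳ_) (suc (suc zero)) c , a' , b , m , mS
  ... | c , a' , m , just e  = Maybe.maybe′ (3 F.↑ʳ_) (suc (suc zero)) c , a' , bitSym e , m , mR
  delta k a b = k , a , b , mS , mS

module _ (p : Prog) (O : Oracle) where
  private
    M : OTM
    M = machine p

  steps : ℕ → Config M → Config M
  steps zero    c = c
  steps (suc k) c = steps k (step M O c)

  run-steps : ∀ k j c → run M O (k + j) c ≡ run M O j (steps k c)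
  run-steps zero    j c = refl
  run-steps (suc k) j c = run-steps k j (step M O c)

  control : Maybe (Fin (psize p)) → Fin (3 + psize p)
  control = Maybe.maybe′ (3 F.↑ʳ_) (suc (suc zero))

  step-ctrl : ∀ i w t → step M O (cfg (3 F.↑ʳ i) w t) ≡
    cfg (control (proj₁ (ctrl p i (hd w)))) (proj₁ (apply (ctrl p i (hd w)) (w , t))) (proj₂ (apply (ctrl p i (hd w)) (w , t)))
  step-ctrl i w t with ctrl p i (hd w)
  ... | c , a' , m , nothing = refl
  ... | c , a' , m , just e  = refl

  reach-steps : ∀ {c w t k s'} → Reach p c (w , t) k s' → steps k (cfg (control c) w t) ≡ cfg (suc (suc zero)) (proj₁ s') (proj₂ s')
  reach-steps exit = refl
  reach-steps {just i} {w} {t} (more {k = k} x) = trans (cong (steps k) (step-ctrl i w t)) (reach-steps x)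

  halted : ∀ j b w t → run M O j (cfg (if b then zero else suc zero) w t) ≡ just b
  halted zero    true  w t = refl
  halted zero    false w t = refl
  halted (suc j) true  w t = halted j true w t
  halted (suc j) false w t = halted j false w t

  machine-answer : ∀ input {k w t} B → Exec p (initTape input , blankTape) k (w , t) → k < B →
    run M O B (initCfg M input) ≡ just (O (symBits (contents t)))
  machine-answer input {k} {w} {t} B x k<B = begin
    run M O B (initCfg M input)                        ≡⟨ cong (λ z → run M O z (initCfg M input)) (sym (trans (ℕ.+-suc k _) (ℕ.m+[n∸m]≡n k<B))) ⟩
    run M O (k + suc (B ∸ suc k)) (initCfg M input)    ≡⟨ run-steps k _ (initCfg M input) ⟩
    run M O (suc (B ∸ suc k)) (steps k (initCfg M input)) ≡⟨ cong (run M O (suc (B ∸ suc k))) (reach-steps (exec⇒reach x)) ⟩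
    run M O (suc (B ∸ suc k)) (cfg (suc (suc zero)) w t) ≡⟨ halted (B ∸ suc k) (O (symBits (contents t))) w blankTape ⟩
    just (O (symBits (contents t)))                    ∎
    where open ≡-Reasoning

-- A stack of unary numbers on the work tape

pattern 0̂ = suc zero
pattern 1̂ = suc (suc zero)
pattern ▮ = suc (suc (suc zero))

isOne isZero isBit nonblank : Sym → Bool
isOne 1̂ = true
isOne _ = false
isZero 0̂ = true
isZero _ = false
isBit 0̂ = true
isBit 1̂ = true
isBit _ = false
nonblank zero = false
nonblank _    = true

write : Sym → Move → Prog
write a m = tick (λ _ → a , m)

right left : Prog
right = tick (λ s → s , mR)
left  = tick (λ s → s , mL)

goHome : Prog
goHome = while nonblank left

cur curL : List Sym → List Sym → Tape
cur L []      = tape L blank []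
cur L (y ∷ R) = tape L y R
curL [] R      = tape [] blank R
curL (x ∷ L) R = tape L x R

move-right : ∀ L h R → moveTape mR (tape L h R) ≡ cur (h ∷ L) R
move-right L h []      = refl
move-right L h (_ ∷ _) = refl

move-left : ∀ L h R → moveTape mL (tape L h R) ≡ curL L (h ∷ R)
move-left []      h R = refl
move-left (_ ∷ _) h R = refl

blanks^ : ℕ → List Sym
blanks^ k = replicate k blank

-- The head rests on a blank in front of the stack. Dropping symbols leaves blanks behind, so the
-- number `k` of blanks further left varies.
home : ℕ → List Sym → Tape
home k S = tape (blanks^ k) blank S

ones zeros : ℕ → List Sym
ones n  = replicate n 1̂
zeros n = replicate n 0̂

Holding : (Sym → Bool) → List Sym → Set
Holding f = All (λ s → f s ≡ true)

holding-replicate : ∀ f s n → f s ≡ true → Holding f (replicate n s)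
holding-replicate f s zero    h = []
holding-replicate f s (suc n) h = h ∷ holding-replicate f s n h

replicate-ʳ++ : ∀ n (s : Sym) R → replicate n s ʳ++ R ≡ replicate n s ++ R
replicate-ʳ++ zero    s R = refl
replicate-ʳ++ (suc n) s R = trans (replicate-ʳ++ n s (s ∷ R)) (snoc n)
  where
  snoc : ∀ n → replicate n s ++ s ∷ R ≡ s ∷ replicate n s ++ R
  snoc zero    = refl
  snoc (suc n) = cong (s ∷_) (snoc n)

replicate-snoc : ∀ n (s : Sym) R → replicate n s ++ s ∷ R ≡ s ∷ replicate n s ++ R
replicate-snoc zero    s R = refl
replicate-snoc (suc n) s R = cong (s ∷_) (replicate-snoc n s R)

ones-+ : ∀ a b S → ones a ++ ones b ++ S ≡ ones (a + b) ++ S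
ones-+ zero    b S = refl
ones-+ (suc a) b S = cong (1̂ ∷_) (ones-+ a b S)

-- a unary number on the stack is terminated by ▮; the top of the stack is leftmost
encs : List ℕ → List Sym
encs []       = []
encs (a ∷ as) = ones a ++ ▮ ∷ encs as

encs-nonblank : ∀ as → Holding nonblank (encs as)
encs-nonblank []       = []
encs-nonblank (a ∷ as) = All.++⁺ (holding-replicate nonblank 1̂ a refl) (refl ∷ encs-nonblank as)

ʳ++-All : ∀ {P : Sym → Set} {xs ys} → All P xs → All P ys → All P (xs ʳ++ ys)
ʳ++-All []       q = q
ʳ++-All (p ∷ ps) q = ʳ++-All ps (p ∷ q)

data Run (p : Prog) (s : St) (B : ℕ) (s' : St) : Set where
  run-of : ∀ {k} → k ≤ B → Exec p s k s' → Run p s B s'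

run-weaken : ∀ {p s B B' s'} → B ≤ B' → Run p s B s' → Run p s B' s'
run-weaken le (run-of k≤ x) = run-of (ℕ.≤-trans k≤ le) x

run-seq : ∀ {p p' s s' s'' B B'} → Run p s B s' → Run p' s' B' s'' → Run (p ⨾ p') s (B + B') s''
run-seq (run-of k≤ x) (run-of k≤' y) = run-of (ℕ.+-mono-≤ k≤ k≤') (x-seq x y)

run-tick : ∀ {f w t w'} → moveTape (proj₂ (f (hd w))) (writeTape (proj₁ (f (hd w))) w) ≡ w' → Run (tick f) (w , t) 1 (w' , t)
run-tick refl = run-of ℕ.≤-refl x-tick

run-stop : ∀ {f p s} → f (hd (proj₁ s)) ≡ false → Run (while f p) s 1 s
run-stop h = run-of ℕ.≤-refl (x-stop h)

run-loop : ∀ {f p s s' s'' B B'} → f (hd (proj₁ s)) ≡ true → Run p s B s' → Run (while f p) s' B' s'' → Run (while f p) s (suc (B + B')) s''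
run-loop h (run-of k≤ x) (run-of k≤' y) = run-of (s≤s (ℕ.+-mono-≤ k≤ k≤')) (x-loop h x y)

run-then : ∀ {f p p' s s' B} → f (hd (proj₁ s)) ≡ true → Run p s B s' → Run (branch f p p') s (suc B) s'
run-then h (run-of k≤ x) = run-of (s≤s k≤) (x-then h x)

run-else : ∀ {f p p' s s' B} → f (hd (proj₁ s)) ≡ false → Run p' s B s' → Run (branch f p p') s (suc B) s'
run-else h (run-of k≤ x) = run-of (s≤s k≤) (x-else h x)

run-right : ∀ {L h R t} → Run right (tape L h R , t) 1 (cur (h ∷ L) R , t)
run-right {L} {h} {R} = run-tick (move-right L h R)

run-left : ∀ {L h R t} → Run left (tape L h R , t) 1 (curL L (h ∷ R) , t)
run-left {L} {h} {R} = run-tick (move-left L h R)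

run-writeL : ∀ {a L h R t} → Run (write a mL) (tape L h R , t) 1 (curL L (a ∷ R) , t)
run-writeL {a} {L} {h} {R} = run-tick (move-left L a R)

run-writeR : ∀ {a L h R t} → Run (write a mR) (tape L h R , t) 1 (cur (a ∷ L) R , t)
run-writeR {a} {L} {h} {R} = run-tick (move-right L a R)

run-writeS : ∀ {a L h R t} → Run (write a mS) (tape L h R , t) 1 (tape L a R , t)
run-writeS = run-tick refl

walk-right : ∀ f xs {y L R t} → Holding f xs → f y ≡ false → Run (while f right) (cur L (xs ++ y ∷ R) , t) (1 + 2 * length xs) (tape (xs ʳ++ L) y R , t)
walk-right f []       []       fy = run-stop fy
walk-right f (x ∷ xs) (h ∷ hs) fy = run-weaken (ℕ.≤-reflexive (eq (length xs))) (run-loop h run-right (walk-right f xs hs fy))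
  where
  eq : ∀ n → suc (1 + (1 + 2 * n)) ≡ 1 + 2 * suc n
  eq = solve-∀

-- The walk stops on the nearest of the `k` blanks and leaves `pred k` beyond it; for `k = 0` the
-- end of the tape supplies the blank.
walk-home : ∀ xs {k R t} → Holding nonblank xs → Run goHome (curL (xs ++ blanks^ k) R , t) (1 + 2 * length xs) (home (pred k) (xs ʳ++ R) , t)
walk-home [] {zero}  [] = run-stop refl
walk-home [] {suc k} [] = run-stop refl
walk-home (x ∷ xs) (h ∷ hs) = run-weaken (ℕ.≤-reflexive (eq (length xs))) (run-loop h run-left (walk-home xs hs))
  where
  eq : ∀ n → suc (1 + (1 + 2 * n)) ≡ 1 + 2 * suc n
  eq = solve-∀

push0 : Prog
push0 = write ▮ mL

inc : Prog
inc = write 1̂ mL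

drop₁ : Prog
drop₁ = right ⨾ write blank mS

add : Prog
add = right ⨾ while isOne right ⨾ write 1̂ mL ⨾ goHome ⨾ drop₁

enter : Prog
enter = right ⨾ while isOne right ⨾ right

moveSep : Prog
moveSep = write ▮ mL ⨾ write 1̂ mL ⨾ goHome

backHome : Prog
backHome = left ⨾ goHome

-- Each round takes one unit off both numbers: `moveSep` shifts the separator, which moves a unit
-- from the second number to the first, and two units are dropped in front. Once the second number
-- is 0 only the first shrinks, which realises the truncation.
monus : Prog
monus = right ⨾ while isOne (while isOne right ⨾ right ⨾ branch isOne (moveSep ⨾ drop₁ ⨾ drop₁ ⨾ right) (backHome ⨾ drop₁ ⨾ right)) ⨾ write blank mS

popEmit : Prog
popEmit = right ⨾ branch isOne (emit true) (emit false) ⨾ while isOne (write blank mR) ⨾ write blank mS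

skip : Prog
skip = while isOne right ⨾ right

skips : ℕ → Prog
skips zero    = skip
skips (suc n) = skip ⨾ skips n

module Timed (Z : ℕ) (1≤Z : 1 ≤ Z) where

  -- Time in units of `Z`, a bound on the part of the tape in use: a single step fits into one unit
  -- and a walk across a stretch of at most `Z` cells into three, so time is bounded by counting
  -- steps and walks.
  R : Prog → St → ℕ → St → Set
  R p s m s' = Run p s (m * Z) s'

  infixr 4 _▹_
  _▹_ : ∀ {p p' s s' s'' m m'} → R p s m s' → R p' s' m' s'' → R (p ⨾ p') s (m + m') s''
  _▹_ {m = m} {m'} x y = run-weaken (ℕ.≤-reflexive (sym (ℕ.*-distribʳ-+ Z m m'))) (run-seq x y)

  unit≤ : 1 ≤ 1 * Z
  unit≤ = subst (1 ≤_) (sym (ℕ.*-identityˡ Z)) 1≤Z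

  one-step : ∀ {p s s'} → Run p s 1 s' → R p s 1 s'
  one-step = run-weaken unit≤

  walk≤ : ∀ n → n ≤ Z → 1 + 2 * n ≤ 3 * Z
  walk≤ n n≤ = ℕ.+-mono-≤ 1≤Z (ℕ.*-monoʳ-≤ 2 n≤)

  rights : ∀ f xs {y L R' t} → length xs ≤ Z → Holding f xs → f y ≡ false → R (while f right) (cur L (xs ++ y ∷ R') , t) 3 (tape (xs ʳ++ L) y R' , t)
  rights f xs le h fy = run-weaken (walk≤ _ le) (walk-right f xs h fy)

  homeward : ∀ xs {k R' S' t} → length xs ≤ Z → Holding nonblank xs → xs ʳ++ R' ≡ S' → R goHome (curL (xs ++ blanks^ k) R' , t) 3 (home (pred k) S' , t)
  homeward xs le h refl = run-weaken (walk≤ _ le) (walk-home xs h)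

  over-ones : ∀ a {L S t} → a ≤ Z → R (while isOne right) (cur L (ones a ++ ▮ ∷ S) , t) 3 (tape (ones a ++ L) ▮ S , t)
  over-ones a {L} {S} {t} a≤ = subst (λ L' → R (while isOne right) (cur L (ones a ++ ▮ ∷ S) , t) 3 (tape L' ▮ S , t)) (replicate-ʳ++ a 1̂ L)
    (rights isOne (ones a) (subst (_≤ Z) (sym (List.length-replicate a)) a≤) (holding-replicate isOne 1̂ a refl) refl)

  -- an unspecified number of blanks precedes the stack
  HomeRun : Prog → List Sym → Tape → ℕ → List Sym → Tape → Set
  HomeRun p S t m S' t' = ∀ k → ∃ λ k' → R p (home k S , t) m (home k' S' , t')

  infixr 4 _▸_
  _▸_ : ∀ {p p' S S' S'' t t' t'' m m'} → HomeRun p S t m S' t' → HomeRun p' S' t' m' S'' t'' → HomeRun (p ⨾ p') S t (m + m') S'' t''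
  _▸_ {m = m} {m'} x y k = let (k₁ , u) = x k ; (k₂ , v) = y k₁ in k₂ , (_▹_ {m = m} {m'} u v)

  push0-run : ∀ S t → HomeRun push0 S t 1 (▮ ∷ S) t
  push0-run S t zero    = _ , one-step run-writeL
  push0-run S t (suc k) = _ , one-step run-writeL

  inc-run : ∀ S t → HomeRun inc S t 1 (1̂ ∷ S) t
  inc-run S t zero    = _ , one-step run-writeL
  inc-run S t (suc k) = _ , one-step run-writeL

  drop₁-run : ∀ s S t → HomeRun drop₁ (s ∷ S) t 2 S t
  drop₁-run s S t k = suc k , (_▹_ {m = 1} {1} (one-step run-right) (one-step run-writeS))

  ones-nonblank : ∀ n → Holding nonblank (ones n)
  ones-nonblank n = holding-replicate nonblank 1̂ n refl

  ones-one : ∀ n → Holding isOne (ones n)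
  ones-one n = holding-replicate isOne 1̂ n refl

  len-ones : ∀ n → length (ones n) ≡ n
  len-ones n = List.length-replicate n

  add-run : ∀ a b S t → a ≤ Z → HomeRun add (ones a ++ ▮ ∷ ones b ++ ▮ ∷ S) t 10 (ones (a + b) ++ ▮ ∷ S) t
  add-run a b S t a≤ k = proj₁ d , (_▹_ {m = 1} {9} (one-step run-right)
    (_▹_ {m = 3} {6} (over-ones a a≤)
    (_▹_ {m = 1} {5} (one-step run-writeL)
    (_▹_ {m = 3} {2} (homeward (ones a) {suc k} {1̂ ∷ ones b ++ ▮ ∷ S} (subst (_≤ Z) (sym (len-ones a)) a≤) (ones-nonblank a) eq₀)
      (subst (λ S₁ → R drop₁ (home k (1̂ ∷ ones a ++ ones b ++ ▮ ∷ S) , t) 2 (home (proj₁ d) S₁ , t)) eq₁ (proj₂ d))))))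
    where
    d = drop₁-run 1̂ (ones a ++ ones b ++ ▮ ∷ S) t k
    eq₀ : ones a ʳ++ (1̂ ∷ ones b ++ ▮ ∷ S) ≡ 1̂ ∷ ones a ++ ones b ++ ▮ ∷ S
    eq₀ = trans (replicate-ʳ++ a 1̂ _) (replicate-snoc a 1̂ _)
    eq₁ : ones a ++ ones b ++ ▮ ∷ S ≡ ones (a + b) ++ ▮ ∷ S
    eq₁ = ones-+ a b (▮ ∷ S)

  enter-run : ∀ a S t k → a ≤ Z → R enter (home k (ones a ++ ▮ ∷ S) , t) 5 (cur (▮ ∷ ones a ++ blanks^ (suc k)) S , t)
  enter-run a S t k a≤ = _▹_ {m = 1} {4} (one-step run-right) (_▹_ {m = 3} {1} (over-ones a a≤) (one-step run-right))

  -- from the first cell of a positive second entry: decrement it by moving the separator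
  moveSep-run : ∀ a S t k → a ≤ Z → ∃ λ k' → R moveSep (cur (▮ ∷ ones a ++ blanks^ (suc k)) (1̂ ∷ S) , t) 5 (home k' (ones (suc a) ++ ▮ ∷ S) , t)
  moveSep-run a S t k a≤ = k , (_▹_ {m = 1} {4} (one-step run-writeL) (_▹_ {m = 1} {3} (one-step run-writeL)
    (homeward (ones a) {suc k} {1̂ ∷ ▮ ∷ S} (subst (_≤ Z) (sym (len-ones a)) a≤) (ones-nonblank a) (trans (replicate-ʳ++ a 1̂ _) (replicate-snoc a 1̂ _)))))

  backHome-run : ∀ a y S t k → a ≤ Z → ∃ λ k' → R backHome (cur (▮ ∷ ones a ++ blanks^ (suc k)) (y ∷ S) , t) 9 (home k' (ones a ++ ▮ ∷ y ∷ S) , t)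
  backHome-run a y S t k a≤ = k , run-weaken (bound a a≤) (run-seq run-left
    (subst (λ S₁ → Run goHome (curL (▮ ∷ ones a ++ blanks^ (suc k)) (y ∷ S) , t) (1 + 2 * length (▮ ∷ ones a)) (home k S₁ , t)) (replicate-ʳ++ a 1̂ (▮ ∷ y ∷ S))
      (walk-home (▮ ∷ ones a) {suc k} {y ∷ S} (refl ∷ ones-nonblank a))))
    where
    eq : ∀ a → 1 + (1 + 2 * suc a) ≡ 4 + 2 * a
    eq = solve-∀
    bound : ∀ a → a ≤ Z → 1 + (1 + 2 * length (▮ ∷ ones a)) ≤ 9 * Z
    bound a a≤ rewrite len-ones a = ℕ.≤-trans (ℕ.≤-reflexive (eq a)) (ℕ.≤-trans (ℕ.+-mono-≤ {4} {4 * Z} {2 * a} {2 * Z} (ℕ.*-monoʳ-≤ 4 1≤Z) (ℕ.*-monoʳ-≤ 2 a≤))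
      (ℕ.≤-trans (ℕ.≤-reflexive (sym (ℕ.*-distribʳ-+ Z 4 2))) (ℕ.*-monoˡ-≤ Z {6} {9} (ℕ.m≤m+n 6 3))))

  monus-run : ∀ b a S t → b ≤ Z → HomeRun monus (ones b ++ ▮ ∷ ones a ++ ▮ ∷ S) t (3 + b * 20) (ones (a ∸ b) ++ ▮ ∷ S) t
  monus-run b a S t b≤ k = proj₁ l , (_▹_ {m = 1} {2 + b * 20} (one-step run-right) (run-weaken (ℕ.≤-reflexive (cong (_* Z) (ℕ.+-comm (1 + b * 20) 1))) (_▹_ {m = 1 + b * 20} {1} (proj₂ l) (one-step run-writeS))))
    where
    body : Prog
    body = while isOne right ⨾ right ⨾ branch isOne (moveSep ⨾ drop₁ ⨾ drop₁ ⨾ right) (backHome ⨾ drop₁ ⨾ right)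
    inner : ∀ b a k → b < Z → ∃ λ k' → R body (cur (blanks^ (suc k)) (ones (suc b) ++ ▮ ∷ ones a ++ ▮ ∷ S) , t) 19 (cur (blanks^ (suc k')) (ones b ++ ▮ ∷ ones (pred a) ++ ▮ ∷ S) , t)
    inner b a k b< = proj₁ (br a) , _▹_ {m = 3} {16} (over-ones (suc b) b<) (_▹_ {m = 1} {15} (one-step run-right) (proj₂ (br a)))
      where
      br : ∀ a → ∃ λ k' → R (branch isOne (moveSep ⨾ drop₁ ⨾ drop₁ ⨾ right) (backHome ⨾ drop₁ ⨾ right))
        (cur (▮ ∷ ones (suc b) ++ blanks^ (suc k)) (ones a ++ ▮ ∷ S) , t) 15 (cur (blanks^ (suc k')) (ones b ++ ▮ ∷ ones (pred a) ++ ▮ ∷ S) , t)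
      br zero = proj₁ d , run-weaken (ℕ.≤-trans (ℕ.+-monoˡ-≤ (12 * Z) 1≤Z) (ℕ.*-monoˡ-≤ Z {13} {15} (ℕ.m≤m+n 13 2)))
        (run-else refl (_▹_ {m = 9} {3} (proj₂ h) (_▹_ {m = 2} {1} (proj₂ d) (one-step run-right))))
        where
        h = backHome-run (suc b) ▮ S t k b<
        d = drop₁-run 1̂ (ones b ++ ▮ ∷ ▮ ∷ S) t (proj₁ h)
      br (suc a) = proj₁ d' , run-weaken (ℕ.≤-trans (ℕ.+-monoˡ-≤ (10 * Z) 1≤Z) (ℕ.*-monoˡ-≤ Z {11} {15} (ℕ.m≤m+n 11 4)))
        (run-then refl (_▹_ {m = 5} {5} (proj₂ h) (_▹_ {m = 2} {3} (proj₂ d) (_▹_ {m = 2} {1} (proj₂ d') (one-step run-right)))))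
        where
        h = moveSep-run (suc b) (ones a ++ ▮ ∷ S) t k b<
        d = drop₁-run 1̂ (ones (suc b) ++ ▮ ∷ ones a ++ ▮ ∷ S) t (proj₁ h)
        d' = drop₁-run 1̂ (ones b ++ ▮ ∷ ones a ++ ▮ ∷ S) t (proj₁ d)
    monus-pred : ∀ a b → pred a ∸ b ≡ a ∸ suc b
    monus-pred zero    b = ℕ.0∸n≡0 b
    monus-pred (suc a) b = refl
    loop : ∀ b a k → b ≤ Z → ∃ λ k' → R (while isOne body) (cur (blanks^ (suc k)) (ones b ++ ▮ ∷ ones a ++ ▮ ∷ S) , t) (1 + b * 20) (tape (blanks^ k') ▮ (ones (a ∸ b) ++ ▮ ∷ S) , t)
    loop zero    a k b≤ = suc k , one-step (run-stop refl)
    loop (suc b) a k b≤ with inner b a k b≤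
    ... | k₁ , x with loop b (pred a) k₁ (ℕ.≤-trans (ℕ.n≤1+n b) b≤)
    ... | k₂ , y = k₂ , subst (λ z → R (while isOne body) (cur (blanks^ (suc k)) (ones (suc b) ++ ▮ ∷ ones a ++ ▮ ∷ S) , t) (1 + suc b * 20) (tape (blanks^ k₂) ▮ (ones z ++ ▮ ∷ S) , t)) (monus-pred a b)
      (run-weaken (ℕ.≤-trans (ℕ.+-monoˡ-≤ _ 1≤Z) (ℕ.≤-reflexive (eq b Z))) (run-loop refl x y))
      where
      eq : ∀ b Z → Z + (19 * Z + (1 + b * 20) * Z) ≡ (1 + suc b * 20) * Z
      eq = solve-∀
    l = loop b a (k) b≤

  positive : ℕ → Bool
  positive zero    = false
  positive (suc _) = true

  popEmit-run : ∀ a S t → a ≤ Z → HomeRun popEmit (ones a ++ ▮ ∷ S) t 7 S (emitTape (positive a) t)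
  popEmit-run a S t a≤ k = proj₁ (er a k) , _▹_ {m = 1} {6} (one-step run-right) (_▹_ {m = 2} {4} (em a) (_▹_ {m = 3} {1} (run-weaken (walk≤ a a≤) (proj₂ (er a k))) (one-step run-writeS)))
    where
    em : ∀ a → R (branch isOne (emit true) (emit false)) (cur (blanks^ (suc k)) (ones a ++ ▮ ∷ S) , t) 2 (cur (blanks^ (suc k)) (ones a ++ ▮ ∷ S) , emitTape (positive a) t)
    em zero    = run-weaken (ℕ.*-monoʳ-≤ 2 1≤Z) (run-else refl (run-of ℕ.≤-refl x-emit))
    em (suc a) = run-weaken (ℕ.*-monoʳ-≤ 2 1≤Z) (run-then refl (run-of ℕ.≤-refl x-emit))
    er : ∀ a k {t} → ∃ λ k' → Run (while isOne (write blank mR)) (cur (blanks^ (suc k)) (ones a ++ ▮ ∷ S) , t) (1 + 2 * a) (tape (blanks^ k') ▮ S , t)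
    er zero    k = suc k , run-stop refl
    er (suc a) k with er a (suc k)
    ... | k' , x = k' , run-weaken (ℕ.≤-reflexive (eq a)) (run-loop refl run-writeR x)
      where
      eq : ∀ n → suc (1 + (1 + 2 * n)) ≡ 1 + 2 * suc n
      eq = solve-∀

  skip-run : ∀ a L S t → a ≤ Z → R skip (cur L (ones a ++ ▮ ∷ S) , t) 4 (cur (▮ ∷ (ones a ʳ++ L)) S , t)
  skip-run a L S t a≤ = _▹_ {m = 3} {1} (rights isOne (ones a) (subst (_≤ Z) (sym (len-ones a)) a≤) (ones-one a) refl) (one-step run-right)

  skips-run : ∀ a as L S t → length (encs (a ∷ as)) ≤ Z → R (skips (length as)) (cur L (encs (a ∷ as) ++ S) , t) ((1 + length as) * 4) (cur (encs (a ∷ as) ʳ++ L) S , t)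
  skips-run a as L S t le = subst₂ (λ A B → R (skips (length as)) (cur L A , t) ((1 + length as) * 4) (cur B S , t))
    (sym (List.++-assoc (ones a) (▮ ∷ encs as) S)) (sym (List.++-ʳ++ (ones a) {▮ ∷ encs as} {L})) (go as (ℕ.m+n≤o⇒n≤o a (ℕ.≤-trans (ℕ.n≤1+n _) le')))
    where
    len : length (encs (a ∷ as)) ≡ a + suc (length (encs as))
    len = trans (List.length-++ (ones a)) (cong (_+ suc (length (encs as))) (len-ones a))
    a≤ : a ≤ Z
    a≤ = ℕ.≤-trans (ℕ.m≤m+n a _) (subst (_≤ Z) len le)
    le' : suc (a + length (encs as)) ≤ Z
    le' = subst (_≤ Z) (trans len (ℕ.+-suc a _)) le
    go : ∀ as → length (encs as) ≤ Z → R (skips (length as)) (cur L (ones a ++ ▮ ∷ (encs as ++ S)) , t) ((1 + length as) * 4) (cur (encs as ʳ++ (▮ ∷ (ones a ʳ++ L))) S , t)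
    go []       _   = skip-run a L S t a≤
    go (b ∷ bs) le₂ = _▹_ {m = 4} {(1 + length bs) * 4} (skip-run a L (encs (b ∷ bs) ++ S) t a≤) (skips-run b bs (▮ ∷ (ones a ʳ++ L)) S t le₂)

bits : List Bool → List Sym
bits = map bitSym

-- the input with the blank marker between u and v, followed by a sentinel
bot : List Bool → List Bool → List Sym
bot u v = bits u ++ blank ∷ bits v ++ ▮ ∷ []

bits-nonblank : ∀ u → Holding nonblank (bits u)
bits-nonblank []          = []
bits-nonblank (false ∷ u) = refl ∷ bits-nonblank u
bits-nonblank (true ∷ u)  = refl ∷ bits-nonblank u

encs-last : ∀ c es L → Σ (List Sym) λ L₁ → encs (c ∷ es) ʳ++ L ≡ ▮ ∷ L₁
encs-last c []       L = _ , List.++-ʳ++ (ones c) {▮ ∷ []} {L}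
encs-last c (d ∷ es) L with encs-last d es (▮ ∷ (ones c ʳ++ L))
... | L₁ , eq = L₁ , trans (List.++-ʳ++ (ones c) {▮ ∷ encs (d ∷ es)} {L}) eq

-- The counter lies beneath the top entry. `moveSep` moves one unit from it to the top entry and
-- `drop₁` discards that unit, so the counter decreases while `p` finds the top entry unchanged.
loop : Prog → Prog
loop p = enter ⨾ while isOne (moveSep ⨾ drop₁ ⨾ p ⨾ enter) ⨾ backHome

-- A counted `1̂` becomes `0̂`, a digit foreign to stack entries, so that after the trip to the top
-- the next uncounted unit can be found again.
markCopy : ℕ → Prog
markCopy n = write 0̂ mL ⨾ goHome ⨾ inc ⨾ right ⨾ skips n ⨾ while isZero right

copy : ℕ → Prog
copy n = push0 ⨾ right ⨾ skips n ⨾ while isOne (markCopy n) ⨾ left ⨾ while isZero (write 1̂ mL) ⨾ goHome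

toMark : Prog
toMark = right ⨾ while nonblank right

shiftBit : Prog
shiftBit = branch isZero (write blank mL ⨾ write 0̂ mR) (write blank mL ⨾ write 1̂ mR)

-- Exchanges the marker with the bit on its right. At the sentinel nothing changes, so an index past
-- the end leaves the marker at the end.
advance : Prog
advance = toMark ⨾ right ⨾ branch isBit shiftBit left ⨾ left ⨾ goHome

unshift : Prog
unshift = branch isZero (write blank mR ⨾ write 0̂ mL) (write blank mR ⨾ write 1̂ mL) ⨾ left

restore : Prog
restore = left ⨾ left ⨾ while isBit unshift ⨾ goHome

module Timed₂ (Z : ℕ) (1≤Z : 1 ≤ Z) where
  open Timed Z 1≤Z public

  home-path : ∀ path {k R' t} → length path ≤ Z → Holding nonblank path → R goHome (curL (path ʳ++ blanks^ k) R' , t) 3 (home (pred k) (path ++ R') , t)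
  home-path path {k} {R'} {t} le h = subst (λ L → R goHome (curL L R' , t) 3 (home (pred k) (path ++ R') , t)) (sym (List.ʳ++-defn path))
    (homeward (reverse path) (subst (_≤ Z) (sym (List.length-reverse path)) le) (ʳ++-All h []) (List.ʳ++-ʳ++ path))

  -- `A` and `q` give the top entry and the output tape as functions of the remaining counter, which
  -- is why the body leads from `suc v` to `v`.
  loop-run : ∀ p n S (A : ℕ → ℕ) (q : ℕ → Tape) mB → (∀ v → v ≤ n → A v ≤ Z) →
    (∀ v → v < n → HomeRun p (ones (A (suc v)) ++ ▮ ∷ ones v ++ ▮ ∷ S) (q (suc v)) mB (ones (A v) ++ ▮ ∷ ones v ++ ▮ ∷ S) (q v)) →
    HomeRun (loop p) (ones (A n) ++ ▮ ∷ ones n ++ ▮ ∷ S) (q n) (15 + n * (13 + mB)) (ones (A 0) ++ ▮ ∷ ▮ ∷ S) (q 0)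
  loop-run p n S A q mB A≤ body k = proj₁ h , run-weaken (ℕ.≤-reflexive (cong (_* Z) (eq (n * (13 + mB)))))
      (_▹_ {m = 5} {(1 + n * (13 + mB)) + 9} (enter-run (A n) (ones n ++ ▮ ∷ S) (q n) k (A≤ n ℕ.≤-refl)) (_▹_ {m = 1 + n * (13 + mB)} {9} (proj₂ w) (proj₂ h)))
    where
    eq : ∀ x → 5 + ((1 + x) + 9) ≡ 15 + x
    eq = solve-∀
    at : ℕ → ℕ → Tape
    at k v = cur (▮ ∷ ones (A v) ++ blanks^ (suc k)) (ones v ++ ▮ ∷ S)
    go : ∀ v k → v ≤ n → ∃ λ k' → R (while isOne (moveSep ⨾ drop₁ ⨾ p ⨾ enter)) (at k v , q v) (1 + v * (13 + mB)) (at k' 0 , q 0)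
    go zero    k _  = k , run-weaken (ℕ.≤-trans 1≤Z (ℕ.≤-reflexive (sym (ℕ.*-identityˡ Z)))) (run-stop refl)
    go (suc v) k v< with moveSep-run (A (suc v)) (ones v ++ ▮ ∷ S) (q (suc v)) k (A≤ (suc v) v<)
    ... | k₁ , x₁ with drop₁-run 1̂ (ones (A (suc v)) ++ ▮ ∷ ones v ++ ▮ ∷ S) (q (suc v)) k₁
    ... | k₂ , x₂ with body v v< k₂
    ... | k₃ , x₃ with go v k₃ (ℕ.≤-trans (ℕ.n≤1+n v) v<)
    ... | k₄ , x₄ = k₄ , run-weaken (ℕ.≤-trans (ℕ.+-monoˡ-≤ _ 1≤Z) (ℕ.≤-reflexive (eq' v mB Z)))
      (run-loop refl (_▹_ {m = 5} {2 + (mB + 5)} x₁ (_▹_ {m = 2} {mB + 5} x₂ (_▹_ {m = mB} {5} x₃ (enter-run (A v) (ones v ++ ▮ ∷ S) (q v) k₃ (A≤ v (ℕ.≤-trans (ℕ.n≤1+n v) v<)))))) x₄)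
      where
      eq' : ∀ v mB Z → Z + ((5 + (2 + (mB + 5))) * Z + (1 + v * (13 + mB)) * Z) ≡ (1 + suc v * (13 + mB)) * Z
      eq' = solve-∀
    w = go n k ℕ.≤-refl
    h = backHome-run (A 0) ▮ S (q 0) (proj₁ w) (A≤ 0 z≤n)

  copyTime : ℕ → ℕ → ℕ
  copyTime n a = 10 + (1 + n) * 4 + a * (10 + (1 + n) * 4)

  copy-run : ∀ es a S t → suc (a + a + length (encs es)) ≤ Z →
    HomeRun (copy (length es)) (encs es ++ ones a ++ ▮ ∷ S) t (copyTime (length es) a) (ones a ++ ▮ ∷ encs es ++ ones a ++ ▮ ∷ S) t
  copy-run es a S t le k = proj₁ lp , run-weaken (ℕ.≤-reflexive (cong (_* Z) (eq₀ (length es) a)))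
      (_▹_ {m = 1} {1 + ((1 + n) * 4 + ((1 + a * (10 + (1 + n) * 4)) + (1 + (3 + 3))))} (proj₂ p0)
      (_▹_ {m = 1} {(1 + n) * 4 + ((1 + a * (10 + (1 + n) * 4)) + (1 + (3 + 3)))} (one-step run-right)
      (_▹_ {m = (1 + n) * 4} {(1 + a * (10 + (1 + n) * 4)) + (1 + (3 + 3))} (skips-run 0 es (blanks^ (suc (proj₁ p0))) (ones a ++ ▮ ∷ S) t (len≤ 0 z≤n))
      (_▹_ {m = 1 + a * (10 + (1 + n) * 4)} {1 + (3 + 3)} (proj₂ lp)
      (_▹_ {m = 1} {3 + 3} (one-step run-left)
      (_▹_ {m = 3} {3} (run-weaken (walk≤ a a≤) (unmark a (▮ ∷ S)))
        (subst (λ S₁ → R goHome (curL (encs (a ∷ es) ʳ++ blanks^ (suc (proj₁ lp))) (ones a ++ ▮ ∷ S) , t) 3 (home (proj₁ lp) S₁ , t))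
          (List.++-assoc (ones a) (▮ ∷ encs es) (ones a ++ ▮ ∷ S)) (home-path (encs (a ∷ es)) (len≤ a ℕ.≤-refl) (encs-nonblank (a ∷ es))))))))))
    where
    n = length es
    eq₀ : ∀ n a → 1 + (1 + ((1 + n) * 4 + ((1 + a * (10 + (1 + n) * 4)) + (1 + (3 + 3))))) ≡ 10 + (1 + n) * 4 + a * (10 + (1 + n) * 4)
    eq₀ = solve-∀
    p0 = push0-run (encs es ++ ones a ++ ▮ ∷ S) t k
    a≤ : a ≤ Z
    a≤ = ℕ.≤-trans (ℕ.m≤m+n a _) (ℕ.≤-trans (ℕ.≤-reflexive (sym (ℕ.+-assoc a a _))) (ℕ.≤-trans (ℕ.n≤1+n _) le))
    len : ∀ c → length (encs (c ∷ es)) ≡ suc (c + length (encs es))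
    len c = trans (List.length-++ (ones c)) (trans (cong (_+ suc (length (encs es))) (len-ones c)) (ℕ.+-suc c _))
    len≤ : ∀ c → c ≤ a → length (encs (c ∷ es)) ≤ Z
    len≤ c c≤ = ℕ.≤-trans (ℕ.≤-reflexive (len c)) (ℕ.≤-trans (s≤s (ℕ.+-monoˡ-≤ _ (ℕ.≤-trans c≤ (ℕ.m≤m+n a a)))) le)
    path≤ : ∀ c → c ≤ a → length (encs (c ∷ es) ++ zeros c) ≤ Z
    path≤ c c≤ = ℕ.≤-trans (ℕ.≤-reflexive (trans (List.length-++ (encs (c ∷ es))) (trans (cong₂ _+_ (len c) (List.length-replicate c)) (eq c _))))
        (ℕ.≤-trans (s≤s (ℕ.+-monoˡ-≤ _ (ℕ.+-mono-≤ c≤ c≤))) le)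
      where
      eq : ∀ c x → suc (c + x) + c ≡ suc (c + c + x)
      eq = solve-∀
    L₀ : ℕ → ℕ → List Sym
    L₀ c k = encs (c ∷ es) ʳ++ blanks^ (suc k)
    round : ∀ c m k → suc c ≤ a → ∃ λ k' → R (markCopy n) (cur (zeros c ʳ++ L₀ c k) (1̂ ∷ ones m ++ ▮ ∷ S) , t) (9 + (1 + n) * 4) (cur (zeros (suc c) ʳ++ L₀ (suc c) k') (ones m ++ ▮ ∷ S) , t)
    round c m k c< = proj₁ i , run-weaken (ℕ.≤-reflexive (cong (_* Z) (eq n)))
      (_▹_ {m = 1} {3 + (1 + (1 + ((1 + n) * 4 + 3)))} (one-step run-writeL)
      (_▹_ {m = 3} {1 + (1 + ((1 + n) * 4 + 3))} (subst (λ L → R goHome (curL L (0̂ ∷ ones m ++ ▮ ∷ S) , t) 3 (home k ((encs (c ∷ es) ++ zeros c) ++ 0̂ ∷ ones m ++ ▮ ∷ S) , t)) (List.++-ʳ++ (encs (c ∷ es)) {zeros c} {blanks^ (suc k)})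
          (home-path (encs (c ∷ es) ++ zeros c) (path≤ c (ℕ.≤-trans (ℕ.n≤1+n c) c<)) (All.++⁺ (encs-nonblank (c ∷ es)) (holding-replicate nonblank 0̂ c refl))))
      (_▹_ {m = 1} {1 + ((1 + n) * 4 + 3)} (proj₂ i)
      (_▹_ {m = 1} {(1 + n) * 4 + 3} (one-step run-right)
      (_▹_ {m = (1 + n) * 4} {3} (subst (λ z → R (skips n) (cur (blanks^ (suc (proj₁ i))) z , t) ((1 + n) * 4) (cur (L₀ (suc c) (proj₁ i)) (zeros (suc c) ++ ones m ++ ▮ ∷ S) , t)) reshape
          (skips-run (suc c) es (blanks^ (suc (proj₁ i))) (zeros (suc c) ++ ones m ++ ▮ ∷ S) t (len≤ (suc c) c<)))
        (over m))))))
      where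
      i = inc-run ((encs (c ∷ es) ++ zeros c) ++ 0̂ ∷ ones m ++ ▮ ∷ S) t k
      eq : ∀ n → 1 + (3 + (1 + (1 + ((1 + n) * 4 + 3)))) ≡ 9 + (1 + n) * 4
      eq = solve-∀
      reshape : encs (suc c ∷ es) ++ zeros (suc c) ++ ones m ++ ▮ ∷ S ≡ 1̂ ∷ (encs (c ∷ es) ++ zeros c) ++ 0̂ ∷ ones m ++ ▮ ∷ S
      reshape = cong (1̂ ∷_) (trans (cong (encs (c ∷ es) ++_) (sym (replicate-snoc c 0̂ (ones m ++ ▮ ∷ S)))) (sym (List.++-assoc (encs (c ∷ es)) (zeros c) _)))
      zs≤ : length (zeros (suc c)) ≤ Z
      zs≤ = ℕ.≤-trans (ℕ.≤-reflexive (List.length-replicate (suc c))) (ℕ.≤-trans c< a≤)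
      over : ∀ m → R (while isZero right) (cur (L₀ (suc c) (proj₁ i)) (zeros (suc c) ++ ones m ++ ▮ ∷ S) , t) 3 (cur (zeros (suc c) ʳ++ L₀ (suc c) (proj₁ i)) (ones m ++ ▮ ∷ S) , t)
      over zero    = rights isZero (zeros (suc c)) zs≤ (holding-replicate isZero 0̂ (suc c) refl) refl
      over (suc m) = rights isZero (zeros (suc c)) zs≤ (holding-replicate isZero 0̂ (suc c) refl) refl
    rounds : ∀ m c k → c + m ≡ a → ∃ λ k' → R (while isOne (markCopy n)) (cur (zeros c ʳ++ L₀ c k) (ones m ++ ▮ ∷ S) , t) (1 + m * (10 + (1 + n) * 4)) (tape (zeros a ʳ++ L₀ a k') ▮ S , t)
    rounds zero c k eq with trans (sym (ℕ.+-identityʳ c)) eq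
    ... | refl = k , one-step (run-stop refl)
    rounds (suc m) c k eq with round c m k (ℕ.≤-trans (ℕ.m≤m+n (suc c) m) (ℕ.≤-reflexive (trans (sym (ℕ.+-suc c m)) eq)))
    ... | k₁ , x with rounds m (suc c) k₁ (trans (sym (ℕ.+-suc c m)) eq)
    ... | k₂ , y = k₂ , run-weaken (ℕ.≤-trans (ℕ.+-monoˡ-≤ _ 1≤Z) (ℕ.≤-reflexive (eq' m ((1 + n) * 4) Z))) (run-loop refl x y)
      where
      eq' : ∀ m x Z → Z + ((9 + x) * Z + (1 + m * (10 + x)) * Z) ≡ (1 + suc m * (10 + x)) * Z
      eq' = solve-∀
    lp = rounds a 0 (proj₁ p0) refl
    unmark : ∀ c X {k} → Run (while isZero (write 1̂ mL)) (curL (zeros c ʳ++ L₀ a k) X , t) (1 + 2 * c) (curL (L₀ a k) (ones c ++ X) , t)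
    unmark c X {k} = subst (λ L → Run (while isZero (write 1̂ mL)) (curL L X , t) (1 + 2 * c) (curL (L₀ a k) (ones c ++ X) , t)) (sym (replicate-ʳ++ c 0̂ (L₀ a k))) (go c X)
      where
      go : ∀ c X → Run (while isZero (write 1̂ mL)) (curL (zeros c ++ L₀ a k) X , t) (1 + 2 * c) (curL (L₀ a k) (ones c ++ X) , t)
      go zero X with encs-last a es (blanks^ (suc k))
      ... | L₁ , eq rewrite eq = run-stop refl
      go (suc c) X = run-weaken (ℕ.≤-reflexive (eq c)) (run-loop refl run-writeL (subst (λ Y → Run (while isZero (write 1̂ mL)) (curL (zeros c ++ L₀ a k) (1̂ ∷ X) , t) (1 + 2 * c) (curL (L₀ a k) Y , t)) (replicate-snoc c 1̂ X) (go c (1̂ ∷ X))))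
        where
        eq : ∀ n → suc (1 + (1 + 2 * n)) ≡ 1 + 2 * suc n
        eq = solve-∀

  toMark-run : ∀ path Y t k → length path ≤ Z → Holding nonblank path → R toMark (home k (path ++ blank ∷ Y) , t) 4 (tape (path ʳ++ blanks^ (suc k)) blank Y , t)
  toMark-run path Y t k le h = _▹_ {m = 1} {3} (one-step run-right) (rights nonblank path le h refl)

  shiftBit-run : ∀ b L Y t → R shiftBit (tape (blank ∷ L) (bitSym b) Y , t) 3 (tape (bitSym b ∷ L) blank Y , t)
  shiftBit-run false L Y t = run-weaken (ℕ.*-monoʳ-≤ 3 1≤Z) (run-then refl (run-seq run-writeL run-writeR))
  shiftBit-run true  L Y t = run-weaken (ℕ.*-monoʳ-≤ 3 1≤Z) (run-else refl (run-seq run-writeL run-writeR))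

  isBit-bitSym : ∀ b → isBit (bitSym b) ≡ true
  isBit-bitSym false = refl
  isBit-bitSym true  = refl

  nonblank-bitSym : ∀ b → nonblank (bitSym b) ≡ true
  nonblank-bitSym false = refl
  nonblank-bitSym true  = refl

  advance-end : ∀ path t → suc (length path) ≤ Z → Holding nonblank path → HomeRun advance (path ++ blank ∷ ▮ ∷ []) t 13 (path ++ blank ∷ ▮ ∷ []) t
  advance-end path t le h k = k , _▹_ {m = 4} {9} (toMark-run path (▮ ∷ []) t k le₁ h) (_▹_ {m = 1} {8} (one-step run-right)
    (_▹_ {m = 4} {4} (run-weaken (ℕ.≤-trans (ℕ.*-monoʳ-≤ 2 1≤Z) (ℕ.*-monoˡ-≤ Z {2} {4} (ℕ.m≤m+n 2 2))) (run-else refl run-left)) (_▹_ {m = 1} {3} (one-step run-left) (home-path path le₁ h))))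
    where
    le₁ : length path ≤ Z
    le₁ = ℕ.≤-trans (ℕ.n≤1+n _) le

  advance-bit : ∀ path b Y t → suc (length path) ≤ Z → Holding nonblank path → HomeRun advance (path ++ blank ∷ bitSym b ∷ Y) t 13 ((path ++ bitSym b ∷ []) ++ blank ∷ Y) t
  advance-bit path b Y t le h k = k , _▹_ {m = 4} {9} (toMark-run path (bitSym b ∷ Y) t k (ℕ.≤-trans (ℕ.n≤1+n _) le) h) (_▹_ {m = 1} {8} (one-step run-right)
    (_▹_ {m = 4} {4} (run-weaken (ℕ.+-monoˡ-≤ (3 * Z) 1≤Z) (run-then (isBit-bitSym b) (shiftBit-run b (path ʳ++ blanks^ (suc k)) Y t)))
      (_▹_ {m = 1} {3} (one-step run-left) (subst (λ L → R goHome (curL L (blank ∷ Y) , t) 3 (home k ((path ++ bitSym b ∷ []) ++ blank ∷ Y) , t)) (List.++-ʳ++ path)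
        (home-path (path ++ bitSym b ∷ []) (subst (_≤ Z) (sym (trans (List.length-++ path) (ℕ.+-comm _ 1))) le) (All.++⁺ h (nonblank-bitSym b ∷ [])))))))

  unshift-run : ∀ b L Y t → Run unshift (tape L (bitSym b) (blank ∷ Y) , t) 4 (curL L (blank ∷ bitSym b ∷ Y) , t)
  unshift-run false L Y t = run-seq {B = 3} (run-then refl (run-seq run-writeR run-writeL)) run-left
  unshift-run true  L Y t = run-seq {B = 3} (run-else refl (run-seq run-writeR run-writeL)) run-left

  unshifts-run : ∀ us L₁ Y t → Run (while isBit unshift) (curL (bits us ++ ▮ ∷ L₁) (blank ∷ Y) , t) (1 + 5 * length us) (curL (▮ ∷ L₁) (blank ∷ bits us ʳ++ Y) , t)
  unshifts-run []       L₁ Y t = run-stop refl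
  unshifts-run (u ∷ us) L₁ Y t = run-weaken (ℕ.≤-reflexive (eq (length us))) (run-loop (isBit-bitSym u) (unshift-run u (bits us ++ ▮ ∷ L₁) Y t) (unshifts-run us L₁ (bitSym u ∷ Y) t))
    where
    eq : ∀ n → suc (4 + (1 + 5 * n)) ≡ 1 + 5 * suc n
    eq = solve-∀

  bits-ʳ++ : ∀ u L → bits u ʳ++ L ≡ bits (reverse u) ++ L
  bits-ʳ++ u L = trans (List.ʳ++-defn (bits u)) (cong (_++ L) (sym (List.map-ʳ++ bitSym u {[]})))

  restore-run : ∀ c es u v t k → length (encs (c ∷ es)) ≤ Z → length u ≤ Z →
    R restore (cur (blank ∷ (encs (c ∷ es) ++ bits u) ʳ++ blanks^ (suc k)) (bits v ++ ▮ ∷ []) , t) 11 (home k (encs (c ∷ es) ++ bot [] (u ++ v)) , t)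
  restore-run c es u v t k le le' = _▹_ {m = 1} {10} (step₁ v) (_▹_ {m = 1} {9} (one-step run-left) (_▹_ {m = 6} {3} (run-weaken bound mid) fin))
    where
    L₀ : List Sym
    L₀ = encs (c ∷ es) ʳ++ blanks^ (suc k)
    L₁ : List Sym
    L₁ = proj₁ (encs-last c es (blanks^ (suc k)))
    eqL : L₀ ≡ ▮ ∷ L₁
    eqL = proj₂ (encs-last c es (blanks^ (suc k)))
    step₁ : ∀ v → R left (cur (blank ∷ (encs (c ∷ es) ++ bits u) ʳ++ blanks^ (suc k)) (bits v ++ ▮ ∷ []) , t) 1 (tape ((encs (c ∷ es) ++ bits u) ʳ++ blanks^ (suc k)) blank (bits v ++ ▮ ∷ []) , t)
    step₁ []      = one-step run-left
    step₁ (_ ∷ _) = one-step run-left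
    bound : 1 + 5 * length (reverse u) ≤ 6 * Z
    bound = ℕ.+-mono-≤ 1≤Z (ℕ.*-monoʳ-≤ 5 (subst (_≤ Z) (sym (List.length-reverse u)) le'))
    shape : (encs (c ∷ es) ++ bits u) ʳ++ blanks^ (suc k) ≡ bits (reverse u) ++ ▮ ∷ L₁
    shape = trans (List.++-ʳ++ (encs (c ∷ es))) (trans (bits-ʳ++ u L₀) (cong (bits (reverse u) ++_) eqL))
    mid : Run (while isBit unshift) (curL ((encs (c ∷ es) ++ bits u) ʳ++ blanks^ (suc k)) (blank ∷ bits v ++ ▮ ∷ []) , t) (1 + 5 * length (reverse u)) (curL L₀ (blank ∷ bits (u ++ v) ++ ▮ ∷ []) , t)
    mid = subst₂ (λ A B → Run (while isBit unshift) (curL A (blank ∷ bits v ++ ▮ ∷ []) , t) (1 + 5 * length (reverse u)) B) (sym shape)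
      (cong (_, t) (cong₂ curL (sym eqL) (cong (blank ∷_) back))) (unshifts-run (reverse u) L₁ (bits v ++ ▮ ∷ []) t)
      where
      back : bits (reverse u) ʳ++ (bits v ++ ▮ ∷ []) ≡ bits (u ++ v) ++ ▮ ∷ []
      back = trans (bits-ʳ++ (reverse u) _) (trans (cong (λ z → bits z ++ bits v ++ ▮ ∷ []) (List.reverse-involutive u))
        (trans (sym (List.++-assoc (bits u) (bits v) _)) (cong (_++ ▮ ∷ []) (sym (List.map-++ bitSym u v)))))
    fin : R goHome (curL L₀ (blank ∷ bits (u ++ v) ++ ▮ ∷ []) , t) 3 (home k (encs (c ∷ es) ++ bot [] (u ++ v)) , t)
    fin = home-path (encs (c ∷ es)) le (encs-nonblank (c ∷ es))

-- Arithmetic expressions and their compilation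

data At : List ℕ → ℕ → ℕ → Set where
  top   : ∀ {a as} → At (a ∷ as) 0 a
  under : ∀ {a b as n} → At as n a → At (b ∷ as) (suc n) a

data Expr (k : ℕ) : Set where
  var     : Fin k → Expr k
  lit#    : ℕ → Expr k
  _⊕_ _⊖_ : Expr k → Expr k → Expr k
  Σ<      : Expr k → Expr (suc k) → Expr k
  bit#    : Expr k → Expr k

sumTo : ℕ → (ℕ → ℕ) → ℕ
sumTo zero    f = 0
sumTo (suc n) f = f n + sumTo n f

⟦_⟧ : ∀ {k} → Expr k → List Bool → Vec ℕ k → ℕ
⟦ var v ⟧  x ρ = Vec.lookup ρ v
⟦ lit# n ⟧ x ρ = n
⟦ a ⊕ b ⟧  x ρ = ⟦ a ⟧ x ρ + ⟦ b ⟧ x ρ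
⟦ a ⊖ b ⟧  x ρ = ⟦ a ⟧ x ρ ∸ ⟦ b ⟧ x ρ
⟦ Σ< a b ⟧ x ρ = sumTo (⟦ a ⟧ x ρ) (λ v → ⟦ b ⟧ x (v Vec.∷ ρ))
⟦ bit# a ⟧ x ρ = bit01 (nthB x (⟦ a ⟧ x ρ))

sumTo-mono : ∀ {v n} f → v ≤ n → sumTo v f ≤ sumTo n f
sumTo-mono {v} {n} f v≤n with ℕ.≤⇒≤‴ v≤n
... | d = go d
  where
  go : ∀ {v n} → v Data.Nat.≤‴ n → sumTo v f ≤ sumTo n f
  go Data.Nat.≤‴-refl = ℕ.≤-refl
  go {v} (Data.Nat.≤‴-step d) = ℕ.≤-trans (ℕ.m≤n+m _ (f v)) (go d)

sumTo-bound : ∀ n f b → (∀ v → v < n → f v ≤ b) → sumTo n f ≤ n * b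
sumTo-bound zero    f b h = z≤n
sumTo-bound (suc n) f b h = ℕ.+-mono-≤ (h n ℕ.≤-refl) (sumTo-bound n f b (λ v v< → h v (ℕ.m<n⇒m<1+n v<)))

-- bounds in terms of a common bound m for the variables and the length of the tape
val : ∀ {k} → Expr k → ℕ → ℕ
val (var v)  m = m
val (lit# n) m = n
val (a ⊕ b)  m = val a m + val b m
val (a ⊖ b)  m = val a m
val (Σ< a b) m = val a m * val b (m + val a m)
val (bit# a) m = 1

val-ok : ∀ {k} (e : Expr k) x ρ m → (∀ v → Vec.lookup ρ v ≤ m) → ⟦ e ⟧ x ρ ≤ val e m
val-ok (var v)  x ρ m h = h v
val-ok (lit# n) x ρ m h = ℕ.≤-refl
val-ok (a ⊕ b)  x ρ m h = ℕ.+-mono-≤ (val-ok a x ρ m h) (val-ok b x ρ m h)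
val-ok (a ⊖ b)  x ρ m h = ℕ.≤-trans (ℕ.m∸n≤m (⟦ a ⟧ x ρ) (⟦ b ⟧ x ρ)) (val-ok a x ρ m h)
val-ok (Σ< a b) x ρ m h = ℕ.≤-trans
  (sumTo-bound (⟦ a ⟧ x ρ) _ (val b (m + val a m)) (λ v v< → val-ok b x (v Vec.∷ ρ) (m + val a m) (h' v v<)))
  (ℕ.*-monoˡ-≤ _ (val-ok a x ρ m h))
  where
  h' : ∀ v → v < ⟦ a ⟧ x ρ → ∀ u → Vec.lookup (v Vec.∷ ρ) u ≤ m + val a m
  h' v v< zero    = ℕ.≤-trans (ℕ.<⇒≤ v<) (ℕ.≤-trans (val-ok a x ρ m h) (ℕ.m≤n+m _ m))
  h' v v< (suc u) = ℕ.≤-trans (h u) (ℕ.m≤m+n m _)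
val-ok (bit# a) x ρ m h with nthB x (⟦ a ⟧ x ρ)
... | true  = ℕ.≤-refl
... | false = z≤n

-- A bound for the used tape once the value of `a` has been pushed together with its separator.
m₁ : ∀ {k} → Expr k → ℕ → ℕ
m₁ a m = m + suc (val a m)

room : ∀ {k} → Expr k → ℕ → ℕ
room (var v)  m = suc (m + m + m)
room (lit# n) m = 1
room (a ⊕ b)  m = room a m + room b (m₁ a m) + val b m
room (a ⊖ b)  m = room a m + room b (m₁ a m) + val b m
room (Σ< a b) m = room a m + room b (m₁ a m + suc (val (Σ< a b) m)) + (val b (m + val a m) + val (Σ< a b) m)
room (bit# a) m = room a m + (4 + (m + val a m))

Depth : ℕ → Set
Depth k = Fin k → ℕ

-- Inside a loop one entry lies above the loop variable (the accumulator in a sum), so the loop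
-- variable has depth 1 and older variables move down by two.
deeper : ∀ {k} → Depth k → Depth (suc k)
deeper pos zero    = 1
deeper pos (suc v) = 2 + pos v

cost : ∀ {k} → Expr k → Depth k → ℕ → ℕ
cost (var v)  pos m = 10 + (1 + pos v) * 4 + m * (10 + (1 + pos v) * 4)
cost (lit# n) pos m = 1 + n
cost (a ⊕ b)  pos m = cost a pos m + (cost b (suc ∘ pos) (m₁ a m) + 10)
cost (a ⊖ b)  pos m = cost a pos m + (cost b (suc ∘ pos) (m₁ a m) + (3 + val b m * 20))
cost (Σ< a b) pos m = cost a pos m + (1 + ((15 + val a m * (13 + (cost b (deeper pos) (m₁ a m + suc (val (Σ< a b) m)) + 10))) + 10))
cost (bit# a) pos m = cost a pos m + (22 + val a m * 16)

-- The index on top is erased unit by unit while the marker advances; the wanted bit then stands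
-- right of the marker. At the sentinel the answer is 0, in agreement with the default `false` of
-- `nthB`.
readBit : Prog
readBit = right ⨾ while isOne (write blank mS ⨾ advance ⨾ right) ⨾ write blank mS ⨾ toMark ⨾ right ⨾ branch isOne (restore ⨾ push0 ⨾ inc) (restore ⨾ push0)

pushN : ℕ → Prog
pushN zero    = push0
pushN (suc n) = pushN n ⨾ inc

comp : ∀ {k} → Expr k → Depth k → Prog
comp (var v)  pos = copy (pos v)
comp (lit# n) pos = pushN n
comp (a ⊕ b)  pos = comp a pos ⨾ comp b (suc ∘ pos) ⨾ add
comp (a ⊖ b)  pos = comp a pos ⨾ comp b (suc ∘ pos) ⨾ monus
comp (Σ< a b) pos = comp a pos ⨾ push0 ⨾ loop (comp b (deeper pos) ⨾ add) ⨾ add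
comp (bit# a) pos = comp a pos ⨾ readBit

module Compiler (x : List Bool) (Z : ℕ) (1≤Z : 1 ≤ Z) where
  open Timed₂ Z 1≤Z public

  stack : List ℕ → List Sym
  stack as = encs as ++ bot [] x

  -- the length of the part of the tape in use
  len : List ℕ → ℕ
  len as = length (encs as) + length x

  encs-++ : ∀ a as S → encs (a ∷ as) ++ S ≡ ones a ++ ▮ ∷ encs as ++ S
  encs-++ a as S = List.++-assoc (ones a) (▮ ∷ encs as) S

  encs-length : ∀ a as → length (encs (a ∷ as)) ≡ suc a + length (encs as)
  encs-length a as = trans (List.length-++ (ones a)) (trans (cong (_+ suc (length (encs as))) (len-ones a)) (ℕ.+-suc a _))

  len-∷ : ∀ a as → len (a ∷ as) ≡ suc a + len as
  len-∷ a as = trans (cong (_+ length x) (encs-length a as)) (ℕ.+-assoc (suc a) _ _)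

  SRun : Prog → List ℕ → Tape → ℕ → List ℕ → Tape → Set
  SRun p as t m as' t' = HomeRun p (stack as) t m (stack as') t'

  weaken : ∀ m m' {p S S' t t'} → m ≤ m' → HomeRun p S t m S' t' → HomeRun p S t m' S' t'
  weaken m m' le h k = proj₁ (h k) , run-weaken (ℕ.*-monoˡ-≤ Z le) (proj₂ (h k))

  reshape : ∀ m {p S S₁ S' S'₁ t t'} → S ≡ S₁ → S' ≡ S'₁ → HomeRun p S₁ t m S'₁ t' → HomeRun p S t m S' t'
  reshape m refl refl h = h

  add-stack : ∀ a b as t → a ≤ Z → SRun add (a ∷ b ∷ as) t 10 (a + b ∷ as) t
  add-stack a b as t le = reshape 10 (trans (encs-++ a (b ∷ as) _) (cong (λ z → ones a ++ ▮ ∷ z) (encs-++ b as _))) (encs-++ (a + b) as _) (add-run a b (stack as) t le)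

  monus-stack : ∀ b a as t → b ≤ Z → SRun monus (b ∷ a ∷ as) t (3 + b * 20) (a ∸ b ∷ as) t
  monus-stack b a as t le = reshape (3 + b * 20) (trans (encs-++ b (a ∷ as) _) (cong (λ z → ones b ++ ▮ ∷ z) (encs-++ a as _))) (encs-++ (a ∸ b) as _) (monus-run b a (stack as) t le)

  split-at : ∀ {as n a} → At as n a → Σ (List ℕ) λ es → Σ (List ℕ) λ rest → as ≡ es ++ a ∷ rest × length es ≡ n
  split-at top = [] , _ , refl , refl
  split-at (under {b = b} at) with split-at at
  ... | es , rest , refl , refl = b ∷ es , rest , refl , refl

  encs-app : ∀ es as S → encs (es ++ as) ++ S ≡ encs es ++ encs as ++ S
  encs-app []       as S = refl
  encs-app (e ∷ es) as S = trans (encs-++ e (es ++ as) S) (trans (cong (λ z → ones e ++ ▮ ∷ z) (encs-app es as S)) (sym (encs-++ e es _)))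

  at-len : ∀ {as n a} → At as n a → a ≤ length (encs as)
  at-len {a ∷ as} top = ℕ.≤-trans (ℕ.m≤m+n a _) (ℕ.≤-trans (ℕ.n≤1+n _) (ℕ.≤-reflexive (sym (encs-length a as))))
  at-len {b ∷ as} (under at) = ℕ.≤-trans (at-len at) (ℕ.≤-trans (ℕ.m≤n+m _ (suc b)) (ℕ.≤-reflexive (sym (encs-length b as))))

  copy-stack : ∀ {as n a} t → At as n a → suc (a + a + length (encs as)) ≤ Z → SRun (copy n) as t (copyTime n a) (a ∷ as) t
  copy-stack {as} {n} {a} t at le with split-at at
  ... | es , rest , refl , refl = reshape (copyTime (length es) a) shape (trans (encs-++ a (es ++ a ∷ rest) _) (cong (λ z → ones a ++ ▮ ∷ z) shape))
      (copy-run es a (stack rest) t (ℕ.≤-trans (s≤s (ℕ.+-monoʳ-≤ (a + a) (prefix es))) le))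
    where
    shape : stack (es ++ a ∷ rest) ≡ encs es ++ ones a ++ ▮ ∷ stack rest
    shape = trans (encs-app es (a ∷ rest) _) (cong (encs es ++_) (encs-++ a rest _))
    prefix : ∀ es → length (encs es) ≤ length (encs (es ++ a ∷ rest))
    prefix []       = z≤n
    prefix (e ∷ es) = ℕ.≤-trans (ℕ.≤-reflexive (encs-length e es)) (ℕ.≤-trans (ℕ.+-monoʳ-≤ (suc e) (prefix es)) (ℕ.≤-reflexive (sym (encs-length e (es ++ a ∷ rest)))))

  nextU : List Bool → List Bool → List Bool
  nextU u []      = u
  nextU u (b ∷ v) = u ++ b ∷ []

  nextV : List Bool → List Bool
  nextV []      = []
  nextV (b ∷ v) = v

  next-++ : ∀ u v → nextU u v ++ nextV v ≡ u ++ v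
  next-++ u []      = refl
  next-++ u (b ∷ v) = List.++-assoc u (b ∷ []) v

  path-shape : ∀ as u Y → encs as ++ bits u ++ Y ≡ (encs as ++ bits u) ++ Y
  path-shape as u Y = sym (List.++-assoc (encs as) (bits u) Y)

  path-nonblank : ∀ as u → Holding nonblank (encs as ++ bits u)
  path-nonblank as u = All.++⁺ (encs-nonblank as) (bits-nonblank u)

  path-length : ∀ as u → length (encs as ++ bits u) ≡ length (encs as) + length u
  path-length as u = trans (List.length-++ (encs as)) (cong (length (encs as) +_) (List.length-map bitSym u))

  advance-stack : ∀ as u v t → suc (length (encs as) + length u) ≤ Z → HomeRun advance (encs as ++ bot u v) t 13 (encs as ++ bot (nextU u v) (nextV v)) t
  advance-stack as u []      t le = reshape 13 (path-shape as u _) (path-shape as u _) (advance-end (encs as ++ bits u) t (subst (λ z → suc z ≤ Z) (sym (path-length as u)) le) (path-nonblank as u))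
  advance-stack as u (b ∷ v) t le = reshape 13 (path-shape as u _)
    (trans (cong (encs as ++_) (trans (cong (_++ blank ∷ bits v ++ ▮ ∷ []) (List.map-++ bitSym u (b ∷ []))) (List.++-assoc (bits u) _ _)))
      (trans (path-shape as u _) (sym (List.++-assoc (encs as ++ bits u) _ _))))
    (advance-bit (encs as ++ bits u) b (bits v ++ ▮ ∷ []) t (subst (λ z → suc z ≤ Z) (sym (path-length as u)) le) (path-nonblank as u))

  nthB-drop : ∀ e v → nthB (List.drop e v) 0 ≡ nthB v e
  nthB-drop zero    v       = refl
  nthB-drop (suc e) []      = refl
  nthB-drop (suc e) (b ∷ v) = nthB-drop e v

  readBit-run : ∀ e c es t → suc (len (e ∷ c ∷ es)) ≤ Z → SRun readBit (e ∷ c ∷ es) t (22 + e * 16) (bit01 (nthB x e) ∷ c ∷ es) t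
  readBit-run e c es t le k = proj₁ r , run-weaken (ℕ.≤-reflexive (cong (_* Z) (eq₀ e)))
      (_▹_ {m = 1} {(1 + e * 16) + (1 + (4 + (1 + 14)))} (one-step run-right)
      (_▹_ {m = 1 + e * 16} {1 + (4 + (1 + 14))} (loopR lp)
      (_▹_ {m = 1} {4 + (1 + 14)} (one-step run-writeS)
      (_▹_ {m = 4} {1 + 14} (subst (λ S → R toMark (home k₁ S , t) 4 (tape ((encs (c ∷ es) ++ bits u) ʳ++ blanks^ (suc k₁)) blank (bits v ++ ▮ ∷ []) , t)) (sym (path-shape (c ∷ es) u _))
          (toMark-run (encs (c ∷ es) ++ bits u) (bits v ++ ▮ ∷ []) t k₁ (subst (_≤ Z) (sym (path-length (c ∷ es) u)) path≤) (path-nonblank (c ∷ es) u)))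
      (_▹_ {m = 1} {14} (one-step run-right) (proj₂ r))))))
    where
    eq₀ : ∀ e → 1 + ((1 + e * 16) + (1 + (4 + (1 + 14)))) ≡ 22 + e * 16
    eq₀ = solve-∀
    L : ℕ
    L = length (encs (c ∷ es))
    room-for : ∀ {e'} u v → e' < e → u ++ v ≡ x → suc (length (encs (e' ∷ c ∷ es)) + length u) ≤ Z
    room-for {e'} u v lt uv = ℕ.≤-trans (s≤s (ℕ.+-mono-≤ (ℕ.≤-trans (ℕ.≤-reflexive (encs-length e' (c ∷ es)))
        (ℕ.≤-trans (ℕ.+-monoˡ-≤ L (s≤s (ℕ.<⇒≤ lt))) (ℕ.≤-reflexive (sym (encs-length e (c ∷ es))))))
        (ℕ.≤-trans (ℕ.m≤m+n (length u) (length v)) (ℕ.≤-reflexive (trans (sym (List.length-++ u)) (cong length uv)))))) le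
    go : ∀ e' k u v → e' ≤ e → u ++ v ≡ x → Σ ℕ λ k' → Σ (List Bool) λ u' → u' ++ List.drop e' v ≡ x ×
      R (while isOne (write blank mS ⨾ advance ⨾ right)) (cur (blanks^ (suc k)) (encs (e' ∷ c ∷ es) ++ bot u v) , t) (1 + e' * 16) (tape (blanks^ k') ▮ (encs (c ∷ es) ++ bot u' (List.drop e' v)) , t)
    go zero     k u v le uv = suc k , u , uv , one-step (run-stop refl)
    go (suc e') k u v le uv with advance-stack (e' ∷ c ∷ es) u v t (room-for u v le uv) (suc k)
    ... | k₁ , xs with go e' k₁ (nextU u v) (nextV v) (ℕ.≤-trans (ℕ.n≤1+n e') le) (trans (next-++ u v) uv)
    ... | k₂ , u' , uv' , ys = k₂ , u' , trans (cong (u' ++_) (drop-next v)) uv' ,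
      run-weaken (ℕ.≤-trans (ℕ.+-monoˡ-≤ _ 1≤Z) (ℕ.≤-reflexive (eq e' Z))) (run-loop refl (_▹_ {m = 1} {14} (one-step run-writeS) (_▹_ {m = 13} {1} xs (one-step run-right)))
        (subst (λ w → R (while isOne (write blank mS ⨾ advance ⨾ right)) (cur (blanks^ (suc k₁)) (encs (e' ∷ c ∷ es) ++ bot (nextU u v) (nextV v)) , t) (1 + e' * 16) (tape (blanks^ k₂) ▮ (encs (c ∷ es) ++ bot u' w) , t)) (sym (drop-next v)) ys))
      where
      eq : ∀ e Z → Z + ((1 + 14) * Z + (1 + e * 16) * Z) ≡ (1 + suc e * 16) * Z
      eq = solve-∀
      drop-next : ∀ v → List.drop (suc e') v ≡ List.drop e' (nextV v)
      drop-next []      = sym (List.drop-[] e')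
      drop-next (b ∷ v) = refl
    lp = go e k [] x ℕ.≤-refl refl
    k₀ : ℕ
    k₀ = proj₁ lp
    u v : List Bool
    u = proj₁ (proj₂ lp)
    v = List.drop e x
    uv : u ++ v ≡ x
    uv = proj₁ (proj₂ (proj₂ lp))
    k₁ : ℕ
    k₁ = k₀
    loopR : (l : Σ ℕ λ k' → Σ (List Bool) λ u' → u' ++ List.drop e x ≡ x × R (while isOne (write blank mS ⨾ advance ⨾ right)) (cur (blanks^ (suc k)) (encs (e ∷ c ∷ es) ++ bot [] x) , t) (1 + e * 16) (tape (blanks^ k') ▮ (encs (c ∷ es) ++ bot u' (List.drop e x)) , t)) →
      R (while isOne (write blank mS ⨾ advance ⨾ right)) (cur (blanks^ (suc k)) (encs (e ∷ c ∷ es) ++ bot [] x) , t) (1 + e * 16) (tape (blanks^ (proj₁ l)) ▮ (encs (c ∷ es) ++ bot (proj₁ (proj₂ l)) (List.drop e x)) , t)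
    loopR l = proj₂ (proj₂ (proj₂ l))
    u≤ : length u ≤ length x
    u≤ = ℕ.≤-trans (ℕ.m≤m+n (length u) (length v)) (ℕ.≤-reflexive (trans (sym (List.length-++ u)) (cong length uv)))
    path≤ : L + length u ≤ Z
    path≤ = ℕ.≤-trans (ℕ.+-mono-≤ (ℕ.≤-trans (ℕ.m≤n+m L (suc e)) (ℕ.≤-reflexive (sym (encs-length e (c ∷ es))))) u≤) (ℕ.≤-trans (ℕ.n≤1+n _) le)
    done : ∀ b → R restore (cur (blank ∷ (encs (c ∷ es) ++ bits u) ʳ++ blanks^ (suc k₁)) (bits v ++ ▮ ∷ []) , t) 11 (home k₁ (stack (c ∷ es)) , t)
    done b = subst (λ w → R restore (cur (blank ∷ (encs (c ∷ es) ++ bits u) ʳ++ blanks^ (suc k₁)) (bits v ++ ▮ ∷ []) , t) 11 (home k₁ (encs (c ∷ es) ++ bot [] w) , t)) uv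
      (restore-run c es u v t k₁ (ℕ.≤-trans (ℕ.m≤m+n L _) path≤) (ℕ.≤-trans (ℕ.m≤n+m _ L) path≤))
    read : ∀ v → R restore (cur (blank ∷ (encs (c ∷ es) ++ bits u) ʳ++ blanks^ (suc k₁)) (bits v ++ ▮ ∷ []) , t) 11 (home k₁ (stack (c ∷ es)) , t) →
      ∃ λ k' → R (branch isOne (restore ⨾ push0 ⨾ inc) (restore ⨾ push0)) (cur (blank ∷ (encs (c ∷ es) ++ bits u) ʳ++ blanks^ (suc k₁)) (bits v ++ ▮ ∷ []) , t) 14 (home k' (encs (bit01 (nthB v 0) ∷ c ∷ es) ++ bot [] x) , t)
    read []          d = proj₁ p , run-weaken (ℕ.≤-trans (ℕ.+-monoˡ-≤ _ 1≤Z) (ℕ.*-monoˡ-≤ Z {13} {14} (ℕ.m≤m+n 13 1))) (run-else refl (_▹_ {m = 11} {1} d (proj₂ p)))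
      where p = push0-run (stack (c ∷ es)) t k₁
    read (false ∷ v) d = proj₁ p , run-weaken (ℕ.≤-trans (ℕ.+-monoˡ-≤ _ 1≤Z) (ℕ.*-monoˡ-≤ Z {13} {14} (ℕ.m≤m+n 13 1))) (run-else refl (_▹_ {m = 11} {1} d (proj₂ p)))
      where p = push0-run (stack (c ∷ es)) t k₁
    read (true ∷ v)  d = proj₁ i , run-weaken (ℕ.+-monoˡ-≤ _ 1≤Z) (run-then refl (_▹_ {m = 11} {2} d (_▹_ {m = 1} {1} (proj₂ p) (proj₂ i))))
      where
      p = push0-run (stack (c ∷ es)) t k₁
      i = inc-run (▮ ∷ stack (c ∷ es)) t (proj₁ p)
    r : ∃ λ k' → R (branch isOne (restore ⨾ push0 ⨾ inc) (restore ⨾ push0)) (cur (blank ∷ (encs (c ∷ es) ++ bits u) ʳ++ blanks^ (suc k₁)) (bits v ++ ▮ ∷ []) , t) 14 (home k' (encs (bit01 (nthB x e) ∷ c ∷ es) ++ bot [] x) , t)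
    r = subst (λ b → ∃ λ k' → R (branch isOne (restore ⨾ push0 ⨾ inc) (restore ⨾ push0)) (cur (blank ∷ (encs (c ∷ es) ++ bits u) ʳ++ blanks^ (suc k₁)) (bits v ++ ▮ ∷ []) , t) 14 (home k' (encs (bit01 b ∷ c ∷ es) ++ bot [] x) , t)) (nthB-drop e x) (read v (done true))

  pushN-run : ∀ n as t → SRun (pushN n) as t (1 + n) (n ∷ as) t
  pushN-run zero    as t = push0-run (stack as) t
  pushN-run (suc n) as t = weaken (1 + n + 1) (2 + n) (ℕ.≤-reflexive (ℕ.+-comm (1 + n) 1)) (_▸_ {m = 1 + n} {1} (pushN-run n as t) (inc-run (stack (n ∷ as)) t))

  loop-stack : ∀ p n as (A : ℕ → ℕ) (q : ℕ → Tape) mB → (∀ v → v ≤ n → A v ≤ Z) →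
    (∀ v → v < n → SRun p (A (suc v) ∷ v ∷ as) (q (suc v)) mB (A v ∷ v ∷ as) (q v)) →
    SRun (loop p) (A n ∷ n ∷ as) (q n) (15 + n * (13 + mB)) (A 0 ∷ 0 ∷ as) (q 0)
  loop-stack p n as A q mB A≤ h = reshape (15 + n * (13 + mB)) (two (A n) n) (encs-++ (A 0) (0 ∷ as) _)
      (loop-run p n (stack as) A q mB A≤ (λ v v< → reshape mB (sym (two (A (suc v)) v)) (sym (two (A v) v)) (h v v<)))
    where
    two : ∀ a b → stack (a ∷ b ∷ as) ≡ ones a ++ ▮ ∷ ones b ++ ▮ ∷ stack as
    two a b = trans (encs-++ a (b ∷ as) _) (cong (λ z → ones a ++ ▮ ∷ z) (encs-++ b as _))

  -- The stack is kept nonempty because `restore` recognises the end of its way back over the input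
  -- by the separator of the bottom entry; the length of the input will lie there.
  comp-run : ∀ {k} (e : Expr k) pos ρ c es t m → (∀ v → At (c ∷ es) (pos v) (Vec.lookup ρ v)) → len (c ∷ es) ≤ m → room e m ≤ Z →
    SRun (comp e pos) (c ∷ es) t (cost e pos m) (⟦ e ⟧ x ρ ∷ c ∷ es) t

  bounded : ∀ {k} {pos : Depth k} {ρ c es m} → (∀ v → At (c ∷ es) (pos v) (Vec.lookup ρ v)) → len (c ∷ es) ≤ m → ∀ v → Vec.lookup ρ v ≤ m
  bounded at le v = ℕ.≤-trans (at-len (at v)) (ℕ.≤-trans (ℕ.m≤m+n _ _) le)

  comp-run (var v) pos ρ c es t m at le le' = weaken (copyTime (pos v) (Vec.lookup ρ v)) (cost (var v) pos m) (ℕ.+-monoʳ-≤ (10 + (1 + pos v) * 4) (ℕ.*-monoˡ-≤ _ (bounded {pos = pos} {ρ} at le v)))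
    (copy-stack t (at v) (ℕ.≤-trans (s≤s (ℕ.+-mono-≤ (ℕ.+-mono-≤ b b) (ℕ.≤-trans (ℕ.m≤m+n _ _) le))) le'))
    where b = bounded {pos = pos} {ρ} at le v
  comp-run (lit# n) pos ρ c es t m at le le' = pushN-run n (c ∷ es) t
  comp-run (a ⊕ b) pos ρ c es t m at le le' = _▸_ {m = cost a pos m} {cost b (suc ∘ pos) (m₁ a m) + 10}
    (comp-run a pos ρ c es t m at le (ℕ.≤-trans (ℕ.m≤m+n _ _) (ℕ.≤-trans (ℕ.m≤m+n _ _) le')))
    (_▸_ {m = cost b (suc ∘ pos) (m₁ a m)} {10} (comp-run b (suc ∘ pos) ρ (⟦ a ⟧ x ρ) (c ∷ es) t (m₁ a m) (under ∘ at) len₁ (ℕ.≤-trans (ℕ.m≤n+m _ (room a m)) (ℕ.≤-trans (ℕ.m≤m+n _ _) le')))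
      (reshape 10 {S₁ = stack (⟦ b ⟧ x ρ ∷ ⟦ a ⟧ x ρ ∷ c ∷ es)} {S'₁ = stack (⟦ b ⟧ x ρ + ⟦ a ⟧ x ρ ∷ c ∷ es)} refl (cong (λ z → stack (z ∷ c ∷ es)) (ℕ.+-comm (⟦ a ⟧ x ρ) (⟦ b ⟧ x ρ)))
        (add-stack (⟦ b ⟧ x ρ) (⟦ a ⟧ x ρ) (c ∷ es) t (ℕ.≤-trans (val-ok b x ρ m (bounded {pos = pos} {ρ} at le)) (ℕ.≤-trans (ℕ.m≤n+m _ (room a m + room b (m₁ a m))) le')))))
    where
    len₁ : len (⟦ a ⟧ x ρ ∷ c ∷ es) ≤ m₁ a m
    len₁ = ℕ.≤-trans (ℕ.≤-reflexive (trans (len-∷ (⟦ a ⟧ x ρ) (c ∷ es)) (ℕ.+-comm _ (len (c ∷ es))))) (ℕ.+-mono-≤ le (s≤s (val-ok a x ρ m (bounded {pos = pos} {ρ} at le))))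
  comp-run (a ⊖ b) pos ρ c es t m at le le' = _▸_ {m = cost a pos m} {cost b (suc ∘ pos) (m₁ a m) + (3 + val b m * 20)}
    (comp-run a pos ρ c es t m at le (ℕ.≤-trans (ℕ.m≤m+n _ _) (ℕ.≤-trans (ℕ.m≤m+n _ _) le')))
    (_▸_ {m = cost b (suc ∘ pos) (m₁ a m)} {3 + val b m * 20} (comp-run b (suc ∘ pos) ρ (⟦ a ⟧ x ρ) (c ∷ es) t (m₁ a m) (under ∘ at) len₁ (ℕ.≤-trans (ℕ.m≤n+m _ (room a m)) (ℕ.≤-trans (ℕ.m≤m+n _ _) le')))
      (weaken (3 + ⟦ b ⟧ x ρ * 20) (3 + val b m * 20) (ℕ.+-monoʳ-≤ 3 (ℕ.*-monoˡ-≤ 20 b≤))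
        (monus-stack (⟦ b ⟧ x ρ) (⟦ a ⟧ x ρ) (c ∷ es) t (ℕ.≤-trans b≤ (ℕ.≤-trans (ℕ.m≤n+m _ (room a m + room b (m₁ a m))) le')))))
    where
    b≤ : ⟦ b ⟧ x ρ ≤ val b m
    b≤ = val-ok b x ρ m (bounded {pos = pos} {ρ} at le)
    len₁ : len (⟦ a ⟧ x ρ ∷ c ∷ es) ≤ m₁ a m
    len₁ = ℕ.≤-trans (ℕ.≤-reflexive (trans (len-∷ (⟦ a ⟧ x ρ) (c ∷ es)) (ℕ.+-comm _ (len (c ∷ es))))) (ℕ.+-mono-≤ le (s≤s (val-ok a x ρ m (bounded {pos = pos} {ρ} at le))))
  comp-run (Σ< a b) pos ρ c es t m at le le' = _▸_ {m = cost a pos m} {1 + ((15 + val a m * (13 + mB)) + 10)}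
    (comp-run a pos ρ c es t m at le (ℕ.≤-trans (ℕ.m≤m+n _ _) (ℕ.≤-trans (ℕ.m≤m+n _ _) le')))
    (_▸_ {m = 1} {(15 + val a m * (13 + mB)) + 10} (push0-run (stack (n ∷ c ∷ es)) t)
      (_▸_ {m = 15 + val a m * (13 + mB)} {10}
        (weaken (15 + n * (13 + mB)) (15 + val a m * (13 + mB)) (ℕ.+-monoʳ-≤ 15 (ℕ.*-monoˡ-≤ (13 + mB) n≤))
          (reshape (15 + n * (13 + mB)) {S₁ = stack (A n ∷ n ∷ c ∷ es)} (cong (λ z → stack (z ∷ n ∷ c ∷ es)) (sym (ℕ.n∸n≡0 (sumTo n f)))) refl
            (loop-stack (comp b (deeper pos) ⨾ add) n (c ∷ es) A (λ _ → t) mB (λ v _ → ℕ.≤-trans (A≤ v) total≤Z) body)))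
        (reshape 10 {S₁ = stack (A 0 ∷ 0 ∷ c ∷ es)} {S'₁ = stack (A 0 + 0 ∷ c ∷ es)} refl (cong (λ z → stack (z ∷ c ∷ es)) (sym (ℕ.+-identityʳ (sumTo n f))))
          (add-stack (A 0) 0 (c ∷ es) t (ℕ.≤-trans (A≤ 0) total≤Z)))))
    where
    n : ℕ
    n = ⟦ a ⟧ x ρ
    f : ℕ → ℕ
    f v = ⟦ b ⟧ x (v Vec.∷ ρ)
    -- The sum of the terms already processed when the counter is `v`, as the loop runs downwards
    -- from `n`.
    A : ℕ → ℕ
    A v = sumTo n f ∸ sumTo v f
    M : ℕ
    M = m₁ a m + suc (val (Σ< a b) m)
    mB : ℕ
    mB = cost b (deeper pos) M + 10
    n≤ : n ≤ val a m
    n≤ = val-ok a x ρ m (bounded {pos = pos} {ρ} at le)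
    total≤ : sumTo n f ≤ val (Σ< a b) m
    total≤ = val-ok (Σ< a b) x ρ m (bounded {pos = pos} {ρ} at le)
    A≤ : ∀ v → A v ≤ val (Σ< a b) m
    A≤ v = ℕ.≤-trans (ℕ.m∸n≤m (sumTo n f) (sumTo v f)) total≤
    total≤Z : val (Σ< a b) m ≤ Z
    total≤Z = ℕ.≤-trans (ℕ.m≤n+m _ (val b (m + val a m))) (ℕ.≤-trans (ℕ.m≤n+m _ (room a m + room b M)) le')
    A-step : ∀ v → v < n → f v + A (suc v) ≡ A v
    A-step v v< = begin
      f v + (sumTo n f ∸ (f v + sumTo v f))   ≡⟨ ℕ.+-∸-assoc (f v) (sumTo-mono f v<) ⟨
      (f v + sumTo n f) ∸ (f v + sumTo v f)   ≡⟨ ℕ.[m+n]∸[m+o]≡n∸o (f v) (sumTo n f) (sumTo v f) ⟩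
      sumTo n f ∸ sumTo v f                   ∎
      where open ≡-Reasoning
    body : ∀ v → v < n → SRun (comp b (deeper pos) ⨾ add) (A (suc v) ∷ v ∷ c ∷ es) t mB (A v ∷ v ∷ c ∷ es) t
    body v v< = _▸_ {m = cost b (deeper pos) M} {10}
        (comp-run b (deeper pos) (v Vec.∷ ρ) (A (suc v)) (v ∷ c ∷ es) t M at' len' (ℕ.≤-trans (ℕ.m≤n+m _ (room a m)) (ℕ.≤-trans (ℕ.m≤m+n _ _) le')))
        (reshape 10 {S₁ = stack (f v ∷ A (suc v) ∷ v ∷ c ∷ es)} {S'₁ = stack (f v + A (suc v) ∷ v ∷ c ∷ es)} refl (cong (λ z → stack (z ∷ v ∷ c ∷ es)) (sym (A-step v v<)))
          (add-stack (f v) (A (suc v)) (v ∷ c ∷ es) t f≤))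
      where
      at' : ∀ u → At (A (suc v) ∷ v ∷ c ∷ es) (deeper pos u) (Vec.lookup (v Vec.∷ ρ) u)
      at' zero    = under top
      at' (suc u) = under (under (at u))
      env≤ : ∀ u → Vec.lookup (v Vec.∷ ρ) u ≤ m + val a m
      env≤ zero    = ℕ.≤-trans (ℕ.<⇒≤ v<) (ℕ.≤-trans n≤ (ℕ.m≤n+m _ m))
      env≤ (suc u) = ℕ.≤-trans (bounded {pos = pos} {ρ} at le u) (ℕ.m≤m+n m _)
      f≤ : f v ≤ Z
      f≤ = ℕ.≤-trans (val-ok b x (v Vec.∷ ρ) (m + val a m) env≤) (ℕ.≤-trans (ℕ.m≤m+n _ _) (ℕ.≤-trans (ℕ.m≤n+m _ (room a m + room b M)) le'))
      len' : len (A (suc v) ∷ v ∷ c ∷ es) ≤ M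
      len' = ℕ.≤-trans (ℕ.≤-reflexive (trans (len-∷ (A (suc v)) (v ∷ c ∷ es)) (trans (cong (suc (A (suc v)) +_) (len-∷ v (c ∷ es))) (eq (A (suc v)) v (len (c ∷ es))))))
        (ℕ.+-mono-≤ (ℕ.+-mono-≤ le (s≤s (ℕ.≤-trans (ℕ.<⇒≤ v<) n≤))) (s≤s (A≤ (suc v))))
        where
        eq : ∀ a b c → suc a + (suc b + c) ≡ (c + suc b) + suc a
        eq = solve-∀
  comp-run (bit# a) pos ρ c es t m at le le' = _▸_ {m = cost a pos m} {22 + val a m * 16}
    (comp-run a pos ρ c es t m at le (ℕ.≤-trans (ℕ.m≤m+n _ _) le'))
    (weaken (22 + ⟦ a ⟧ x ρ * 16) (22 + val a m * 16) (ℕ.+-monoʳ-≤ 22 (ℕ.*-monoˡ-≤ 16 a≤)) (readBit-run (⟦ a ⟧ x ρ) c es t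
      (ℕ.≤-trans (s≤s (ℕ.≤-reflexive (len-∷ (⟦ a ⟧ x ρ) (c ∷ es)))) (ℕ.≤-trans (s≤s (s≤s (ℕ.+-mono-≤ a≤ le))) (ℕ.≤-trans (ℕ.≤-trans (ℕ.≤-reflexive (eq (val a m) m)) (ℕ.m≤n+m _ 2)) (ℕ.≤-trans (ℕ.m≤n+m _ (room a m)) le'))))))
    where
    a≤ : ⟦ a ⟧ x ρ ≤ val a m
    a≤ = val-ok a x ρ m (bounded {pos = pos} {ρ} at le)
    eq : ∀ a m → suc (suc (a + m)) ≡ 2 + (m + a)
    eq = solve-∀

-- Programs printing a word, and polynomial time bounds

infixr 5 _⨟_

data Out (k : ℕ) : Set where
  emit# : Expr k → Out k
  _⨟_   : Out k → Out k → Out k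
  for#  : Expr k → Out (suc k) → Out k

concatTo : ∀ {A : Set} → ℕ → (ℕ → List A) → List A
concatTo zero    f = []
concatTo (suc n) f = concatTo n f ++ f n

positiveB : ℕ → Bool
positiveB zero    = false
positiveB (suc _) = true

-- the loop variable runs downwards from n ∸ 1 to 0
⟦_⟧ₒ : ∀ {k} → Out k → List Bool → Vec ℕ k → List Bool
⟦ emit# e ⟧ₒ  x ρ = positiveB (⟦ e ⟧ x ρ) ∷ []
⟦ o ⨟ o' ⟧ₒ   x ρ = ⟦ o ⟧ₒ x ρ ++ ⟦ o' ⟧ₒ x ρ
⟦ for# e o ⟧ₒ x ρ = concatTo (⟦ e ⟧ x ρ) (λ d → ⟦ o ⟧ₒ x ((⟦ e ⟧ x ρ ∸ suc d) Vec.∷ ρ))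

roomₒ : ∀ {k} → Out k → ℕ → ℕ
roomₒ (emit# e)  m = room e m + val e m
roomₒ (o ⨟ o')   m = roomₒ o m + roomₒ o' m
roomₒ (for# e o) m = room e m + roomₒ o (m₁ e m + 1)

costₒ : ∀ {k} → Out k → Depth k → ℕ → ℕ
costₒ (emit# e)  pos m = cost e pos m + 7
costₒ (o ⨟ o')   pos m = costₒ o pos m + costₒ o' pos m
costₒ (for# e o) pos m = cost e pos m + (1 + ((15 + val e m * (13 + costₒ o (deeper pos) (m₁ e m + 1))) + (2 + 2)))

emits : List Bool → Tape → Tape
emits []       t = t
emits (b ∷ bs) t = emits bs (emitTape b t)

emits-++ : ∀ bs bs' t → emits (bs ++ bs') t ≡ emits bs' (emits bs t)
emits-++ []       bs' t = refl
emits-++ (b ∷ bs) bs' t = emits-++ bs bs' (emitTape b t)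

compₒ : ∀ {k} → Out k → Depth k → Prog
compₒ (emit# e)  pos = comp e pos ⨾ popEmit
compₒ (o ⨟ o')   pos = compₒ o pos ⨾ compₒ o' pos
compₒ (for# e o) pos = comp e pos ⨾ push0 ⨾ loop (compₒ o (deeper pos)) ⨾ drop₁ ⨾ drop₁

countRound : Prog
countRound = shiftBit ⨾ left ⨾ goHome ⨾ inc ⨾ toMark ⨾ right

-- Places the sentinel behind the input and an entry 0 in front of the marker. Each `countRound`
-- carries the marker over one bit and increments that entry, so the length of the input becomes the
-- bottom of the stack.
prelude : Prog
prelude = (while isBit right ⨾ write ▮ mL ⨾ goHome ⨾ left ⨾ write ▮ mL) ⨾ toMark ⨾ right ⨾ while isBit countRound ⨾ restore

whole : Out 1 → Prog
whole o = prelude ⨾ compₒ o (λ _ → 0)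

module Compilerₒ (x : List Bool) (Z : ℕ) (1≤Z : 1 ≤ Z) where
  open Compiler x Z 1≤Z public

  positive≡ : ∀ n → positive n ≡ positiveB n
  positive≡ zero    = refl
  positive≡ (suc n) = refl

  compₒ-run : ∀ {k} (o : Out k) pos ρ c es t m → (∀ v → At (c ∷ es) (pos v) (Vec.lookup ρ v)) → len (c ∷ es) ≤ m → roomₒ o m ≤ Z →
    SRun (compₒ o pos) (c ∷ es) t (costₒ o pos m) (c ∷ es) (emits (⟦ o ⟧ₒ x ρ) t)
  compₒ-run (emit# e) pos ρ c es t m at le le' = _▸_ {m = cost e pos m} {7} (comp-run e pos ρ c es t m at le (ℕ.≤-trans (ℕ.m≤m+n _ _) le'))
    (reshape 7 (encs-++ (⟦ e ⟧ x ρ) (c ∷ es) (bot [] x)) refl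
      (subst (λ b → HomeRun popEmit (ones (⟦ e ⟧ x ρ) ++ ▮ ∷ stack (c ∷ es)) t 7 (stack (c ∷ es)) (emitTape b t)) (positive≡ (⟦ e ⟧ x ρ))
        (popEmit-run (⟦ e ⟧ x ρ) (stack (c ∷ es)) t (ℕ.≤-trans (val-ok e x ρ m (bounded {pos = pos} {ρ} at le)) (ℕ.≤-trans (ℕ.m≤n+m _ (room e m)) le')))))
  compₒ-run (o ⨟ o') pos ρ c es t m at le le' = subst (λ t' → SRun (compₒ (o ⨟ o') pos) (c ∷ es) t (costₒ (o ⨟ o') pos m) (c ∷ es) t') (sym (emits-++ (⟦ o ⟧ₒ x ρ) (⟦ o' ⟧ₒ x ρ) t))
    (_▸_ {m = costₒ o pos m} {costₒ o' pos m} (compₒ-run o pos ρ c es t m at le (ℕ.≤-trans (ℕ.m≤m+n _ _) le'))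
      (compₒ-run o' pos ρ c es _ m at le (ℕ.≤-trans (ℕ.m≤n+m _ (roomₒ o m)) le')))
  compₒ-run (for# e o) pos ρ c es t m at le le' = _▸_ {m = cost e pos m} {1 + ((15 + val e m * (13 + mB)) + 4)}
    (comp-run e pos ρ c es t m at le (ℕ.≤-trans (ℕ.m≤m+n _ _) le'))
    (_▸_ {m = 1} {(15 + val e m * (13 + mB)) + 4} (push0-run (stack (n ∷ c ∷ es)) t)
      (_▸_ {m = 15 + val e m * (13 + mB)} {4} (weaken (15 + n * (13 + mB)) (15 + val e m * (13 + mB)) (ℕ.+-monoʳ-≤ 15 (ℕ.*-monoˡ-≤ (13 + mB) n≤))
          (subst (λ t₀ → SRun (loop (compₒ o (deeper pos))) (0 ∷ n ∷ c ∷ es) t₀ (15 + n * (13 + mB)) (0 ∷ 0 ∷ c ∷ es) (q 0)) q-start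
            (loop-stack (compₒ o (deeper pos)) n (c ∷ es) (λ _ → 0) q mB (λ _ _ → z≤n) body)))
        (_▸_ {m = 2} {2} (drop₁-run ▮ (▮ ∷ stack (c ∷ es)) (q 0)) (drop₁-run ▮ (stack (c ∷ es)) (q 0)))))
    where
    n : ℕ
    n = ⟦ e ⟧ x ρ
    f : ℕ → List Bool
    f d = ⟦ o ⟧ₒ x ((n ∸ suc d) Vec.∷ ρ)
    -- The output when the counter is `v`: the iterations with loop variable from `n - 1` down to
    -- `v` have been printed.
    q : ℕ → Tape
    q v = emits (concatTo (n ∸ v) f) t
    q-start : q n ≡ t
    q-start = cong (λ d → emits (concatTo d f) t) (ℕ.n∸n≡0 n)
    M : ℕ
    M = m₁ e m + 1
    mB : ℕ
    mB = costₒ o (deeper pos) M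
    n≤ : n ≤ val e m
    n≤ = val-ok e x ρ m (bounded {pos = pos} {ρ} at le)
    body : ∀ v → v < n → SRun (compₒ o (deeper pos)) (0 ∷ v ∷ c ∷ es) (q (suc v)) mB (0 ∷ v ∷ c ∷ es) (q v)
    body v v< = subst (λ t' → SRun (compₒ o (deeper pos)) (0 ∷ v ∷ c ∷ es) (q (suc v)) mB (0 ∷ v ∷ c ∷ es) t') out
      (compₒ-run o (deeper pos) (v Vec.∷ ρ) 0 (v ∷ c ∷ es) (q (suc v)) M at' len' (ℕ.≤-trans (ℕ.m≤n+m _ (room e m)) le'))
      where
      at' : ∀ u → At (0 ∷ v ∷ c ∷ es) (deeper pos u) (Vec.lookup (v Vec.∷ ρ) u)
      at' zero    = under top
      at' (suc u) = under (under (at u))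
      len' : len (0 ∷ v ∷ c ∷ es) ≤ M
      len' = ℕ.≤-trans (ℕ.≤-reflexive (trans (len-∷ 0 (v ∷ c ∷ es)) (trans (cong suc (len-∷ v (c ∷ es))) (eq v (len (c ∷ es))))))
        (ℕ.+-monoˡ-≤ 1 (ℕ.+-mono-≤ le (s≤s (ℕ.≤-trans (ℕ.<⇒≤ v<) n≤))))
        where
        eq : ∀ v l → suc (suc v + l) ≡ l + suc v + 1
        eq = solve-∀
      out : emits (⟦ o ⟧ₒ x (v Vec.∷ ρ)) (q (suc v)) ≡ q v
      out = trans (sym (emits-++ (concatTo (n ∸ suc v) f) (⟦ o ⟧ₒ x (v Vec.∷ ρ)) t))
        (cong (λ bs → emits bs t) (trans (cong (λ w → concatTo (n ∸ suc v) f ++ ⟦ o ⟧ₒ x (w Vec.∷ ρ)) (sym back)) (cong (λ d → concatTo d f) (sym step'))))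
        where
        step' : n ∸ v ≡ suc (n ∸ suc v)
        step' = ℕ.+-∸-assoc 1 v<
        back : n ∸ suc (n ∸ suc v) ≡ v
        back = trans (cong (n ∸_) (sym step')) (ℕ.m∸[m∸n]≡n (ℕ.<⇒≤ v<))

  walk-end : ∀ u L t → Run (while isBit right) (cur L (bits u) , t) (1 + 2 * length u) (tape (bits u ʳ++ L) blank [] , t)
  walk-end []      L t = run-stop refl
  walk-end (b ∷ u) L t = run-weaken (ℕ.≤-reflexive (eq (length u))) (run-loop (isBit-bitSym b) run-right (walk-end u (bitSym b ∷ L) t))
    where
    eq : ∀ n → suc (1 + (1 + 2 * n)) ≡ 1 + 2 * suc n
    eq = solve-∀

  initTape-cur : ∀ ss → initTape ss ≡ cur [] ss
  initTape-cur []      = refl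
  initTape-cur (_ ∷ _) = refl

  counting : ℕ → List Bool → List Bool → ℕ → Tape
  counting c u v k = cur (blank ∷ (encs (c ∷ []) ++ bits u) ʳ++ blanks^ (suc k)) (bits v ++ ▮ ∷ [])

  round-run : ∀ c u b v t k → suc (suc c + suc (length u)) ≤ Z → ∃ λ k' → R countRound (counting c u (b ∷ v) k , t) 13 (counting (suc c) (u ++ b ∷ []) v k' , t)
  round-run c u b v t k le = proj₁ i , _▹_ {m = 3} {10} (shiftBit-run b (path ʳ++ blanks^ (suc k)) (bits v ++ ▮ ∷ []) t)
    (_▹_ {m = 1} {9} (one-step run-left)
    (_▹_ {m = 3} {6} (subst (λ L → R goHome (curL L (blank ∷ bits v ++ ▮ ∷ []) , t) 3 (home k (path' ++ blank ∷ bits v ++ ▮ ∷ []) , t)) (List.++-ʳ++ path)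
        (home-path path' (ℕ.≤-trans (ℕ.n≤1+n _) path'≤) nb'))
    (_▹_ {m = 1} {5} (proj₂ i)
    (_▹_ {m = 4} {1} (toMark-run (1̂ ∷ path') (bits v ++ ▮ ∷ []) t (proj₁ i) path'≤ (refl ∷ nb'))
      (subst (λ p → R right (tape ((1̂ ∷ path') ʳ++ blanks^ (suc (proj₁ i))) blank (bits v ++ ▮ ∷ []) , t) 1 (cur (blank ∷ p ʳ++ blanks^ (suc (proj₁ i))) (bits v ++ ▮ ∷ []) , t)) same (one-step run-right))))))
    where
    path path' : List Sym
    path = encs (c ∷ []) ++ bits u
    path' = path ++ bitSym b ∷ []
    i = inc-run (path' ++ blank ∷ bits v ++ ▮ ∷ []) t k
    nb' : Holding nonblank path'
    nb' = All.++⁺ (path-nonblank (c ∷ []) u) (nonblank-bitSym b ∷ [])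
    path'≤ : suc (length path') ≤ Z
    path'≤ = ℕ.≤-trans (s≤s (ℕ.≤-reflexive (trans (List.length-++ path) (trans (cong (_+ 1) (trans (path-length (c ∷ []) u) (cong (_+ length u) (trans (encs-length c []) (ℕ.+-identityʳ (suc c)))))) (eq c (length u)))))) le
      where
      eq : ∀ c u → suc c + u + 1 ≡ suc c + suc u
      eq = solve-∀
    same : 1̂ ∷ path' ≡ encs (suc c ∷ []) ++ bits (u ++ b ∷ [])
    same = cong (1̂ ∷_) (trans (List.++-assoc (encs (c ∷ [])) (bits u) _) (cong (encs (c ∷ []) ++_) (sym (List.map-++ bitSym u (b ∷ [])))))

  count-run : ∀ c u v t k → c ≡ length u → suc (suc (suc (length (u ++ v) + length (u ++ v)))) ≤ Z →
    ∃ λ k' → R (while isBit countRound) (counting c u v k , t) (1 + length v * 14) (counting (length (u ++ v)) (u ++ v) [] k' , t)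
  count-run c u [] t k refl le = k , one-step (subst (λ w → Run (while isBit countRound) (counting (length u) u [] k , t) 1 (counting (length w) w [] k , t)) (sym (List.++-identityʳ u)) (run-stop refl))
  count-run c u (b ∷ v) t k refl le with round-run (length u) u b v t k (ℕ.≤-trans (s≤s (s≤s (ℕ.≤-trans (ℕ.≤-reflexive (ℕ.+-suc _ _)) (s≤s (ℕ.+-mono-≤ lu lu))))) le)
    where
    lu : length u ≤ length (u ++ b ∷ v)
    lu = ℕ.≤-trans (ℕ.m≤m+n _ _) (ℕ.≤-reflexive (sym (List.length-++ u)))
  ... | k₁ , xs with count-run (suc (length u)) (u ++ b ∷ []) v t k₁ (sym (trans (List.length-++ u) (ℕ.+-comm _ 1))) (subst (λ w → suc (suc (suc (length w + length w))) ≤ Z) (sym (List.++-assoc u (b ∷ []) v)) le)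
  ... | k₂ , ys = k₂ , run-weaken (ℕ.≤-trans (ℕ.+-monoˡ-≤ _ 1≤Z) (ℕ.≤-reflexive (eq (length v) Z)))
      (run-loop (isBit-bitSym b) xs (subst (λ w → R (while isBit countRound) (counting (suc (length u)) (u ++ b ∷ []) v k₁ , t) (1 + length v * 14) (counting (length w) w [] k₂ , t)) (List.++-assoc u (b ∷ []) v) ys))
    where
    eq : ∀ n Z → Z + (13 * Z + (1 + n * 14) * Z) ≡ (1 + suc n * 14) * Z
    eq = solve-∀

  place-run : ∀ t → length x ≤ Z → R (while isBit right ⨾ write ▮ mL ⨾ goHome ⨾ left ⨾ write ▮ mL) (initTape (bits x) , t) 9 (home 0 (▮ ∷ blank ∷ bits x ++ ▮ ∷ []) , t)
  place-run t lx =
    _▹_ {m = 3} {6} first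
    (_▹_ {m = 1} {5} (one-step run-writeL)
    (_▹_ {m = 3} {2} second
    (_▹_ {m = 1} {1} (one-step run-left) (one-step run-writeL))))
    where
    first : R (while isBit right) (initTape (bits x) , t) 3 (tape (bits x ʳ++ []) blank [] , t)
    first = subst (λ T₀ → R (while isBit right) (T₀ , t) 3 (tape (bits x ʳ++ []) blank [] , t)) (sym (initTape-cur (bits x))) (run-weaken (walk≤ (length x) lx) (walk-end x [] t))
    second : R goHome (curL (bits x ʳ++ []) (▮ ∷ []) , t) 3 (home 0 (bits x ++ ▮ ∷ []) , t)
    second = home-path (bits x) {0} {▮ ∷ []} (subst (_≤ Z) (sym (List.length-map bitSym x)) lx) (bits-nonblank x)

  countAll-run : ∀ t → suc (suc (suc (length x + length x))) ≤ Z →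
    ∃ λ k → R (toMark ⨾ right ⨾ while isBit countRound ⨾ restore) (home 0 (▮ ∷ blank ∷ bits x ++ ▮ ∷ []) , t) (17 + length x * 14) (home k (stack (length x ∷ [])) , t)
  countAll-run t le = go (count-run 0 [] x t 0 refl le)
    where
    lx : length x ≤ Z
    lx = ℕ.≤-trans (ℕ.m≤m+n (length x) (length x)) (ℕ.≤-trans (ℕ.m≤n+m (length x + length x) 3) le)
    ends : length (encs (length x ∷ [])) ≤ Z
    ends = ℕ.≤-trans (ℕ.≤-reflexive (trans (encs-length (length x) []) (ℕ.+-identityʳ (suc (length x))))) (ℕ.≤-trans (s≤s (ℕ.m≤m+n (length x) (length x))) (ℕ.≤-trans (ℕ.m≤n+m (suc (length x + length x)) 2) le))
    eq : ∀ n → 4 + (1 + ((1 + n * 14) + 11)) ≡ 17 + n * 14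
    eq = solve-∀
    go : (∃ λ k' → R (while isBit countRound) (counting 0 [] x 0 , t) (1 + length x * 14) (counting (length x) x [] k' , t)) →
      ∃ λ k → R (toMark ⨾ right ⨾ while isBit countRound ⨾ restore) (home 0 (▮ ∷ blank ∷ bits x ++ ▮ ∷ []) , t) (17 + length x * 14) (home k (stack (length x ∷ [])) , t)
    go (k , counted) = k , run-weaken (ℕ.≤-reflexive (cong (_* Z) (eq (length x))))
      (_▹_ {m = 4} {1 + ((1 + length x * 14) + 11)} (toMark-run (▮ ∷ []) (bits x ++ ▮ ∷ []) t 0 (ℕ.≤-trans (s≤s z≤n) le) (refl ∷ []))
      (_▹_ {m = 1} {(1 + length x * 14) + 11} (one-step run-right)
      (_▹_ {m = 1 + length x * 14} {11} counted restored)))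
      where
      restored : R restore (counting (length x) x [] k , t) 11 (home k (stack (length x ∷ [])) , t)
      restored = subst (λ w → R restore (counting (length x) x [] k , t) 11 (home k (encs (length x ∷ []) ++ bot [] w) , t)) (List.++-identityʳ x)
        (restore-run (length x) [] x [] t k ends lx)

  whole-run : ∀ o t m → suc (length x + length x) ≡ m → suc (suc m) ≤ Z → roomₒ o m ≤ Z →
    ∃ λ k → R (whole o) (initTape (bits x) , t) ((9 + (17 + length x * 14)) + costₒ o (λ _ → 0) m) (home k (stack (length x ∷ [])) , emits (⟦ o ⟧ₒ x (length x Vec.∷ Vec.[])) t)
  whole-run o t m eq le le' = join (countAll-run t (subst (λ z → suc (suc z) ≤ Z) (sym eq) le))
    where
    as : List ℕ
    as = length x ∷ []
    t' : Tape
    t' = emits (⟦ o ⟧ₒ x (length x Vec.∷ Vec.[])) t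
    main : SRun (compₒ o (λ _ → 0)) as t (costₒ o (λ _ → 0) m) as t'
    main = compₒ-run o (λ _ → 0) (length x Vec.∷ Vec.[]) (length x) [] t m (λ { zero → top }) (ℕ.≤-reflexive (trans (len-∷ (length x) []) eq)) le'
    lx : length x ≤ Z
    lx = ℕ.≤-trans (ℕ.m≤m+n (length x) (length x)) (ℕ.≤-trans (ℕ.≤-trans (ℕ.n≤1+n _) (ℕ.≤-reflexive eq)) (ℕ.≤-trans (ℕ.m≤n+m m 2) le))
    join : (∃ λ k → R (toMark ⨾ right ⨾ while isBit countRound ⨾ restore) (home 0 (▮ ∷ blank ∷ bits x ++ ▮ ∷ []) , t) (17 + length x * 14) (home k (stack as) , t)) →
      ∃ λ k → R (whole o) (initTape (bits x) , t) ((9 + (17 + length x * 14)) + costₒ o (λ _ → 0) m) (home k (stack as) , t')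
    join (k , xs) = proj₁ (main k) , _▹_ {m = 9 + (17 + length x * 14)} {costₒ o (λ _ → 0) m} (_▹_ {m = 9} {17 + length x * 14} (place-run t lx) xs) (proj₂ (main k))

-- The base `2 + n` is at least 2, so a constant `c` is below `2 ^ c` and the factor 2 of a sum
-- costs one exponent. The class is closed under sums, products and composition with no separate
-- coefficients to carry along.
PB : (ℕ → ℕ) → Set
PB f = Σ ℕ λ k → ∀ n → f n ≤ (2 + n) ^ k

pow-pos : ∀ k n → 1 ≤ (2 + n) ^ k
pow-pos k n = ℕ.m^n>0 (2 + n) k

pb-const : ∀ c → PB (λ _ → c)
pb-const c = c , λ n → ℕ.≤-trans (go c) (ℕ.^-monoˡ-≤ c (ℕ.m≤m+n 2 n))
  where
  go : ∀ c → c ≤ 2 ^ c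
  go zero    = z≤n
  go (suc c) = ℕ.≤-trans (ℕ.+-mono-≤ (ℕ.m^n>0 2 c) (go c)) (ℕ.≤-reflexive (cong (2 ^ c +_) (sym (ℕ.+-identityʳ (2 ^ c)))))

pb-id : PB (λ n → n)
pb-id = 1 , λ n → ℕ.≤-trans (ℕ.m≤n+m n 2) (ℕ.≤-reflexive (sym (ℕ.*-identityʳ (2 + n))))

pb-* : ∀ {f g} → PB f → PB g → PB (λ n → f n * g n)
pb-* (i , p) (j , q) = i + j , λ n → ℕ.≤-trans (ℕ.*-mono-≤ (p n) (q n)) (ℕ.≤-reflexive (sym (ℕ.^-distribˡ-+-* (2 + n) i j)))

pb-+ : ∀ {f g} → PB f → PB g → PB (λ n → f n + g n)
pb-+ {f} {g} (i , p) (j , q) = suc (i + j) , λ n → begin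
  f n + g n                                        ≤⟨ ℕ.+-mono-≤ (ℕ.≤-trans (p n) (up i j n)) (ℕ.≤-trans (q n) (ℕ.≤-trans (up j i n) (ℕ.≤-reflexive (cong ((2 + n) ^_) (ℕ.+-comm j i))))) ⟩
  (2 + n) ^ (i + j) + (2 + n) ^ (i + j)            ≡⟨ cong ((2 + n) ^ (i + j) +_) (sym (ℕ.+-identityʳ ((2 + n) ^ (i + j)))) ⟩
  2 * (2 + n) ^ (i + j)                            ≤⟨ ℕ.*-monoˡ-≤ ((2 + n) ^ (i + j)) (ℕ.m≤m+n 2 n) ⟩
  (2 + n) ^ suc (i + j)                            ∎
  where
  open ℕ.≤-Reasoning
  up : ∀ i j n → (2 + n) ^ i ≤ (2 + n) ^ (i + j)
  up i j n = ℕ.^-monoʳ-≤ (2 + n) (ℕ.m≤m+n i j)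

pb-∘ : ∀ {f g} → PB f → PB g → PB (λ n → f (g n))
pb-∘ {f} {g} (i , p) (j , q) = suc (suc j) * i , λ n → begin
  f (g n)                       ≤⟨ p (g n) ⟩
  (2 + g n) ^ i                 ≤⟨ ℕ.^-monoˡ-≤ i (two+ n) ⟩
  ((2 + n) ^ suc (suc j)) ^ i   ≡⟨ ℕ.^-*-assoc (2 + n) (suc (suc j)) i ⟩
  (2 + n) ^ (suc (suc j) * i)   ∎
  where
  open ℕ.≤-Reasoning
  four : ∀ X → 1 ≤ X → 2 + X ≤ 2 * (2 * X)
  four X le = ℕ.≤-trans (ℕ.+-mono-≤ (ℕ.+-mono-≤ le le) (ℕ.m≤m+n X X)) (ℕ.≤-reflexive (eq X))
    where
    eq : ∀ X → X + X + (X + X) ≡ 2 * (2 * X)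
    eq = solve-∀
  two+ : ∀ n → 2 + g n ≤ (2 + n) ^ suc (suc j)
  two+ n = ℕ.≤-trans (ℕ.+-monoʳ-≤ 2 (q n)) (ℕ.≤-trans (four ((2 + n) ^ j) (pow-pos j n)) (ℕ.*-mono-≤ (ℕ.m≤m+n 2 n) (ℕ.*-monoˡ-≤ ((2 + n) ^ j) (ℕ.m≤m+n 2 n))))

pb-suc : ∀ {f} → PB f → PB (λ n → suc (f n))
pb-suc = pb-+ (pb-const 1)

pb-val : ∀ {k} (e : Expr k) → PB (val e)
pb-val (var v)  = pb-id
pb-val (lit# n) = pb-const n
pb-val (a ⊕ b)  = pb-+ (pb-val a) (pb-val b)
pb-val (a ⊖ b)  = pb-val a
pb-val (Σ< a b) = pb-* (pb-val a) (pb-∘ (pb-val b) (pb-+ pb-id (pb-val a)))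
pb-val (bit# a) = pb-const 1

pb-m₁ : ∀ {k} (e : Expr k) → PB (m₁ e)
pb-m₁ e = pb-+ pb-id (pb-suc (pb-val e))

pb-room : ∀ {k} (e : Expr k) → PB (room e)
pb-room (var v)  = pb-suc (pb-+ (pb-+ pb-id pb-id) pb-id)
pb-room (lit# n) = pb-const 1
pb-room (a ⊕ b)  = pb-+ (pb-+ (pb-room a) (pb-∘ (pb-room b) (pb-m₁ a))) (pb-val b)
pb-room (a ⊖ b)  = pb-+ (pb-+ (pb-room a) (pb-∘ (pb-room b) (pb-m₁ a))) (pb-val b)
pb-room (Σ< a b) = pb-+ (pb-+ (pb-room a) (pb-∘ (pb-room b) (pb-+ (pb-m₁ a) (pb-suc (pb-val (Σ< a b)))))) (pb-+ (pb-∘ (pb-val b) (pb-+ pb-id (pb-val a))) (pb-val (Σ< a b)))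
pb-room (bit# a) = pb-+ (pb-room a) (pb-+ (pb-const 4) (pb-+ pb-id (pb-val a)))

pb-cost : ∀ {k} (e : Expr k) pos → PB (cost e pos)
pb-cost (var v)  pos = pb-+ (pb-const (10 + (1 + pos v) * 4)) (pb-* pb-id (pb-const (10 + (1 + pos v) * 4)))
pb-cost (lit# n) pos = pb-const (1 + n)
pb-cost (a ⊕ b)  pos = pb-+ (pb-cost a pos) (pb-+ (pb-∘ (pb-cost b (suc ∘ pos)) (pb-m₁ a)) (pb-const 10))
pb-cost (a ⊖ b)  pos = pb-+ (pb-cost a pos) (pb-+ (pb-∘ (pb-cost b (suc ∘ pos)) (pb-m₁ a)) (pb-+ (pb-const 3) (pb-* (pb-val b) (pb-const 20))))
pb-cost (Σ< a b) pos = pb-+ (pb-cost a pos) (pb-suc (pb-+ (pb-+ (pb-const 15) (pb-* (pb-val a) (pb-+ (pb-const 13) (pb-+ (pb-∘ (pb-cost b (deeper pos)) (pb-+ (pb-m₁ a) (pb-suc (pb-val (Σ< a b))))) (pb-const 10))))) (pb-const 10)))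
pb-cost (bit# a) pos = pb-+ (pb-cost a pos) (pb-+ (pb-const 22) (pb-* (pb-val a) (pb-const 16)))

pb-roomₒ : ∀ {k} (o : Out k) → PB (roomₒ o)
pb-roomₒ (emit# e)  = pb-+ (pb-room e) (pb-val e)
pb-roomₒ (o ⨟ o')   = pb-+ (pb-roomₒ o) (pb-roomₒ o')
pb-roomₒ (for# e o) = pb-+ (pb-room e) (pb-∘ (pb-roomₒ o) (pb-+ (pb-m₁ e) (pb-const 1)))

pb-costₒ : ∀ {k} (o : Out k) pos → PB (costₒ o pos)
pb-costₒ (emit# e)  pos = pb-+ (pb-cost e pos) (pb-const 7)
pb-costₒ (o ⨟ o')   pos = pb-+ (pb-costₒ o pos) (pb-costₒ o' pos)
pb-costₒ (for# e o) pos = pb-+ (pb-cost e pos) (pb-suc (pb-+ (pb-+ (pb-const 15) (pb-* (pb-val e) (pb-+ (pb-const 13) (pb-∘ (pb-costₒ o (deeper pos)) (pb-+ (pb-m₁ e) (pb-const 1)))))) (pb-const 4)))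

pow-* : ∀ a b k → (a * b) ^ k ≡ a ^ k * b ^ k
pow-* a b zero    = refl
pow-* a b (suc k) = trans (cong (a * b *_) (pow-* a b k)) (eq a b (a ^ k) (b ^ k))
  where
  eq : ∀ a b c d → a * b * (c * d) ≡ a * c * (b * d)
  eq = solve-∀

pb-poly : ∀ {f} → PB f → Σ ℕ λ c → Σ ℕ λ k → ∀ n → f n ≤ poly c k n
pb-poly {f} (k , p) = 3 ^ k , k , λ n → ℕ.≤-trans (p n) (go n)
  where
  go : ∀ n → (2 + n) ^ k ≤ poly (3 ^ k) k n
  go zero    = ℕ.≤-trans (ℕ.^-monoˡ-≤ k (ℕ.m≤m+n 2 1)) (ℕ.m≤n+m (3 ^ k) _)
  go (suc n) = ℕ.≤-trans (ℕ.^-monoˡ-≤ k (ℕ.≤-trans (ℕ.m≤m+n (3 + n) (n + n)) (ℕ.≤-reflexive (eq n))))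
    (ℕ.≤-trans (ℕ.≤-reflexive (pow-* 3 (suc n) k)) (ℕ.m≤m+n _ (3 ^ k)))
    where
    eq : ∀ n → 3 + n + (n + n) ≡ 3 * suc n
    eq = solve-∀

symBits-skip : ∀ bs L → symBits (reverse (bits bs ʳ++ L)) ≡ symBits (reverse L) ++ bs
symBits-skip []       L = sym (List.++-identityʳ _)
symBits-skip (b ∷ bs) L = trans (symBits-skip bs (bitSym b ∷ L)) (trans (cong (_++ bs) (snoc b)) (List.++-assoc (symBits (reverse L)) (b ∷ []) bs))
  where
  symBits-++ : ∀ xs ys → symBits (xs ++ ys) ≡ symBits xs ++ symBits ys
  symBits-++ []                       ys = refl
  symBits-++ (zero ∷ xs)              ys = symBits-++ xs ys
  symBits-++ (0̂ ∷ xs)                 ys = cong (false ∷_) (symBits-++ xs ys)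
  symBits-++ (1̂ ∷ xs)                 ys = cong (true ∷_) (symBits-++ xs ys)
  symBits-++ (suc (suc (suc _)) ∷ xs) ys = symBits-++ xs ys
  one-bit : ∀ b → symBits (bitSym b ∷ []) ≡ b ∷ []
  one-bit false = refl
  one-bit true  = refl
  snoc : ∀ b → symBits (reverse (bitSym b ∷ L)) ≡ symBits (reverse L) ++ b ∷ []
  snoc b = trans (cong symBits (List.unfold-reverse (bitSym b) L)) (trans (symBits-++ (reverse L) _) (cong (symBits (reverse L) ++_) (one-bit b)))

emits-tape : ∀ bs L → emits bs (tape L blank []) ≡ tape (bits bs ʳ++ L) blank []
emits-tape []       L = refl
emits-tape (b ∷ bs) L = emits-tape bs (bitSym b ∷ L)

emitted : ∀ bs → symBits (contents (emits bs blankTape)) ≡ bs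
emitted bs = trans (cong (symBits ∘ contents) (emits-tape bs [])) (trans (drop-blank (reverse (bits bs ʳ++ []))) (symBits-skip bs []))
  where
  drop-blank : ∀ xs → symBits (xs ++ blank ∷ []) ≡ symBits xs
  drop-blank []                       = refl
  drop-blank (zero ∷ xs)              = drop-blank xs
  drop-blank (0̂ ∷ xs)                 = cong (false ∷_) (drop-blank xs)
  drop-blank (1̂ ∷ xs)                 = cong (true ∷_) (drop-blank xs)
  drop-blank (suc (suc (suc _)) ∷ xs) = drop-blank xs

run-answer : ∀ p (O : Oracle) input B {w t m} → Run p (initTape input , blankTape) m (w , t) → m < B →
  run (machine p) O B (initCfg (machine p) input) ≡ just (O (symBits (contents t)))
run-answer p O input B (run-of k≤ ex) lt = machine-answer p O input B ex (ℕ.≤-trans (s≤s k≤) lt)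

module _ (o : Out 1) where
  private
    m Z time : ℕ → ℕ
    -- The tape in use after the prelude: the entry `n` with its separator, and the `n` input bits.
    m n = suc (n + n)
    Z n = suc (suc (m n)) + roomₒ o (m n)
    time n = ((9 + (17 + n * 14)) + costₒ o (λ _ → 0) (m n)) * Z n

    pb-m : PB m
    pb-m = pb-suc (pb-+ pb-id pb-id)

    pb-time : PB (λ n → suc (time n))
    pb-time = pb-suc (pb-* (pb-+ (pb-+ (pb-const 9) (pb-+ (pb-const 17) (pb-* pb-id (pb-const 14)))) (pb-∘ (pb-costₒ o (λ _ → 0)) pb-m))
      (pb-+ (pb-suc (pb-suc pb-m)) (pb-∘ (pb-roomₒ o) pb-m)))

  query-correct : ∀ B (O : Oracle) x → suc (time (length x)) ≤ B →
    run (machine (whole o)) O B (initCfg (machine (whole o)) (map bitSym x)) ≡ just (O (⟦ o ⟧ₒ x (length x Vec.∷ Vec.[])))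
  query-correct B O x le = trans
    (run-answer (whole o) O (map bitSym x) B (proj₂ (Compilerₒ.whole-run x (Z (length x)) (s≤s z≤n) o blankTape (m (length x)) refl (ℕ.m≤m+n (suc (suc (m (length x)))) (roomₒ o (m (length x)))) (ℕ.m≤n+m (roomₒ o (m (length x))) (suc (suc (m (length x))))))) le)
    (cong (just ∘ O) (emitted (⟦ o ⟧ₒ x (length x Vec.∷ Vec.[]))))

  query-machine : Σ OTM λ M → Σ ℕ λ c → Σ ℕ λ k → ∀ (O : Oracle) x →
    run M O (poly c k (length x)) (initCfg M (map bitSym x)) ≡ just (O (⟦ o ⟧ₒ x (length x Vec.∷ Vec.[])))
  query-machine = let (c , k , bound) = pb-poly {λ n → suc (time n)} pb-time in
    machine (whole o) , c , k , λ O x → query-correct (poly c k (length x)) O x (bound (length x))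

-- Arithmetic expressions for functions of the input

-- The quotient as the number of positive multiples of `n` up to `a`, a form available to
-- expressions built from sums and comparisons.
divS modS : ℕ → ℕ → ℕ
divS a n = sumTo a (λ k → bit01 (suc k * n ≤ᵇ a))
modS a n = a ∸ n * divS a n

sumTo-cong : ∀ n {f g} → (∀ v → v < n → f v ≡ g v) → sumTo n f ≡ sumTo n g
sumTo-cong zero    h = refl
sumTo-cong (suc n) h = cong₂ _+_ (h n ℕ.≤-refl) (sumTo-cong n (λ v lt → h v (ℕ.m<n⇒m<1+n lt)))

sumTo-const : ∀ n c → sumTo n (λ _ → c) ≡ n * c
sumTo-const zero    c = refl
sumTo-const (suc n) c = cong (c +_) (sumTo-const n c)

≤ᵇ-true : ∀ {m n} → m ≤ n → (m ≤ᵇ n) ≡ true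
≤ᵇ-true {m} {n} le = dec-true (m ℕ.≤? n) le

≤ᵇ-false : ∀ {m n} → n < m → (m ≤ᵇ n) ≡ false
≤ᵇ-false {m} {n} lt = dec-false (m ℕ.≤? n) (ℕ.<⇒≱ lt)

divS-spec : ∀ n i j → j < n → divS (n * i + j) n ≡ i
divS-spec n i j j<n = trans (count-below (n * i + j) i≤) refl
  where
  a : ℕ
  a = n * i + j
  i≤ : i ≤ a
  i≤ = ℕ.≤-trans (small n j<n) (ℕ.m≤m+n _ j)
    where
    small : ∀ n → j < n → i ≤ n * i
    small (suc n) _ = ℕ.m≤m+n i _
  value : ∀ k → bit01 (suc k * n ≤ᵇ a) ≡ bit01 (suc k ≤ᵇ i)
  value k with suc k ℕ.≤? i
  ... | yes le = cong bit01 (trans (≤ᵇ-true (ℕ.≤-trans (ℕ.*-monoˡ-≤ n le) (ℕ.≤-trans (ℕ.≤-reflexive (ℕ.*-comm i n)) (ℕ.m≤m+n _ j)))) (sym (≤ᵇ-true le)))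
  ... | no nle = cong bit01 (trans (≤ᵇ-false (ℕ.<-≤-trans (ℕ.+-monoʳ-< (n * i) j<n) (ℕ.≤-trans (ℕ.≤-reflexive (eq n i)) (ℕ.*-monoˡ-≤ n (ℕ.≰⇒> nle))))) (sym (≤ᵇ-false (ℕ.≰⇒> nle))))
    where
    eq : ∀ n i → n * i + n ≡ suc i * n
    eq = solve-∀
  count-below : ∀ m → i ≤ m → sumTo m (λ k → bit01 (suc k * n ≤ᵇ a)) ≡ i
  count-below m le = trans (sumTo-cong m (λ k _ → value k)) (go m le)
    where
    all-ones : ∀ m → m ≤ i → sumTo m (λ k → bit01 (suc k ≤ᵇ i)) ≡ m
    all-ones zero    _  = refl
    all-ones (suc m) le = cong₂ _+_ (cong bit01 (≤ᵇ-true le)) (all-ones m (ℕ.≤-trans (ℕ.n≤1+n m) le))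
    go : ∀ m → i ≤ m → sumTo m (λ k → bit01 (suc k ≤ᵇ i)) ≡ i
    go m le with ℕ.m≤n⇒m<n∨m≡n le
    ... | inj₂ refl = all-ones m ℕ.≤-refl
    go (suc m) le | inj₁ (s≤s lt) = trans (cong (λ b → bit01 b + sumTo m (λ k → bit01 (suc k ≤ᵇ i))) (≤ᵇ-false (s≤s lt))) (go m lt)

modS-spec : ∀ n i j → j < n → modS (n * i + j) n ≡ j
modS-spec n i j j<n = trans (cong (λ d → n * i + j ∸ n * d) (divS-spec n i j j<n)) (ℕ.m+n∸m≡n (n * i) j)

divS-≡ : ∀ a n → 0 < n → a ≡ n * divS a n + modS a n × modS a n < n
divS-≡ a n@(suc n') _ = subst (λ z → z ≡ n * divS z n + modS z n × modS z n < n) (sym a≡)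
  (cong₂ (λ u v → n * u + v) (sym (divS-spec n i j j<)) (sym (modS-spec n i j j<)) , subst (_< n) (sym (modS-spec n i j j<)) j<)
  where
  i j : ℕ
  i = a ℕ./ n
  j = a ℕ.% n
  j< : j < n
  j< = ℕ.m%n<n a n
  a≡ : a ≡ n * i + j
  a≡ = trans (ℕ.m≡m%n+[m/n]*n a n) (trans (ℕ.+-comm j (i * n)) (cong (_+ j) (ℕ.*-comm i n)))

-- the length of the input is always available as the last variable
module Computable where

  env : ∀ {n} → List Bool → Vec ℕ n → Vec ℕ (n + 1)
  env x ρ = ρ Vec.++ (length x Vec.∷ Vec.[])

  -- The expression is chosen before the input `x`; this uniformity is what turns the reduction into
  -- a single machine.
  NC : ∀ n → (List Bool → Vec ℕ n → ℕ) → Set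
  NC n f = Σ (Expr (n + 1)) λ e → ∀ x ρ → ⟦ e ⟧ x (env x ρ) ≡ f x ρ

  BC : ∀ n → (List Bool → Vec ℕ n → Bool) → Set
  BC n g = NC n (λ x ρ → bit01 (g x ρ))

  module _ {n : ℕ} where

    cLit : ∀ c → NC n (λ _ _ → c)
    cLit c = lit# c , λ _ _ → refl

    cVar : ∀ i → NC n (λ _ ρ → Vec.lookup ρ i)
    cVar i = var (i F.↑ˡ 1) , λ x ρ → Vec.lookup-++ˡ ρ (length x Vec.∷ Vec.[]) i

    cLen : NC n (λ x _ → length x)
    cLen = var (n F.↑ʳ zero) , λ x ρ → Vec.lookup-++ʳ ρ (length x Vec.∷ Vec.[]) zero

    _+ᶜ_ : ∀ {f g} → NC n f → NC n g → NC n (λ x ρ → f x ρ + g x ρ)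
    (e , h) +ᶜ (e' , h') = e ⊕ e' , λ x ρ → cong₂ _+_ (h x ρ) (h' x ρ)

    _∸ᶜ_ : ∀ {f g} → NC n f → NC n g → NC n (λ x ρ → f x ρ ∸ g x ρ)
    (e , h) ∸ᶜ (e' , h') = e ⊖ e' , λ x ρ → cong₂ _∸_ (h x ρ) (h' x ρ)

    Σᶜ : ∀ {f g} → NC n f → NC (suc n) g → NC n (λ x ρ → sumTo (f x ρ) (λ v → g x (v Vec.∷ ρ)))
    Σᶜ {f} {g} (e , h) (e' , h') = Σ< e e' , λ x ρ → trans (cong (λ m → sumTo m (λ v → ⟦ e' ⟧ x (v Vec.∷ env x ρ))) (h x ρ))
      (sumTo-cong (f x ρ) (λ v _ → h' x (v Vec.∷ ρ)))

    bitᶜ : ∀ {f} → NC n f → NC n (λ x ρ → bit01 (nthB x (f x ρ)))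
    bitᶜ (e , h) = bit# e , λ x ρ → cong (bit01 ∘ nthB x) (h x ρ)

    sucᶜ : ∀ {f} → NC n f → NC n (λ x ρ → suc (f x ρ))
    sucᶜ f = cLit 1 +ᶜ f

  weakenE : ∀ {m n} → (Fin m → Fin n) → Expr m → Expr n
  weakenE φ (var v)  = var (φ v)
  weakenE φ (lit# c) = lit# c
  weakenE φ (a ⊕ b)  = weakenE φ a ⊕ weakenE φ b
  weakenE φ (a ⊖ b)  = weakenE φ a ⊖ weakenE φ b
  weakenE φ (Σ< a b) = Σ< (weakenE φ a) (weakenE (F.lift 1 φ) b)
  weakenE φ (bit# a) = bit# (weakenE φ a)

  weakenE-ok : ∀ {m n} (φ : Fin m → Fin n) e x ρ ρ' → (∀ v → Vec.lookup ρ' (φ v) ≡ Vec.lookup ρ v) → ⟦ weakenE φ e ⟧ x ρ' ≡ ⟦ e ⟧ x ρ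
  weakenE-ok φ (var v)  x ρ ρ' h = h v
  weakenE-ok φ (lit# c) x ρ ρ' h = refl
  weakenE-ok φ (a ⊕ b)  x ρ ρ' h = cong₂ _+_ (weakenE-ok φ a x ρ ρ' h) (weakenE-ok φ b x ρ ρ' h)
  weakenE-ok φ (a ⊖ b)  x ρ ρ' h = cong₂ _∸_ (weakenE-ok φ a x ρ ρ' h) (weakenE-ok φ b x ρ ρ' h)
  weakenE-ok φ (Σ< a b) x ρ ρ' h = trans (cong (λ m → sumTo m _) (weakenE-ok φ a x ρ ρ' h))
    (sumTo-cong (⟦ a ⟧ x ρ) (λ v _ → weakenE-ok (F.lift 1 φ) b x (v Vec.∷ ρ) (v Vec.∷ ρ') (λ { zero → refl ; (suc u) → h u })))
  weakenE-ok φ (bit# a) x ρ ρ' h = cong (bit01 ∘ nthB x) (weakenE-ok φ a x ρ ρ' h)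

  ↑ᶜ : ∀ {n f} → NC n f → NC (suc n) (λ x ρ → f x (Vec.tail ρ))
  ↑ᶜ (e , h) = weakenE suc e , λ { x (v Vec.∷ ρ) → trans (weakenE-ok suc e x (env x ρ) (v Vec.∷ env x ρ) (λ _ → refl)) (h x ρ) }

  convert : ∀ {n f g} → (∀ x ρ → f x ρ ≡ g x ρ) → NC n f → NC n g
  convert eq (e , h) = e , λ x ρ → trans (h x ρ) (eq x ρ)

  module _ {n : ℕ} where

    _*ᶜ_ : ∀ {f g} → NC n f → NC n g → NC n (λ x ρ → f x ρ * g x ρ)
    _*ᶜ_ {f} {g} a b = convert (λ x ρ → sumTo-const (f x ρ) (g x ρ)) (Σᶜ a (↑ᶜ b))

    _^ᶜ_ : ∀ {f} → NC n f → ∀ k → NC n (λ x ρ → f x ρ ^ k)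
    a ^ᶜ zero  = cLit 1
    a ^ᶜ suc k = a *ᶜ (a ^ᶜ k)

    polyᶜ : ∀ c k {f} → NC n f → NC n (λ x ρ → poly c k (f x ρ))
    polyᶜ c k a = (cLit c *ᶜ (a ^ᶜ k)) +ᶜ cLit c

    trueᶜ : BC n (λ _ _ → true)
    trueᶜ = cLit 1

    falseᶜ : BC n (λ _ _ → false)
    falseᶜ = cLit 0

    notᶜ : ∀ {f} → BC n f → BC n (λ x ρ → not (f x ρ))
    notᶜ {f} a = convert (λ x ρ → eq (f x ρ)) (cLit 1 ∸ᶜ a)
      where
      eq : ∀ b → 1 ∸ bit01 b ≡ bit01 (not b)
      eq true  = refl
      eq false = refl

    infixr 6 _∧ᶜ_
    infixr 5 _∨ᶜ_

    _∧ᶜ_ : ∀ {f g} → BC n f → BC n g → BC n (λ x ρ → f x ρ ∧ g x ρ)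
    _∧ᶜ_ {f} {g} a b = convert (λ x ρ → eq (f x ρ) (g x ρ)) (a *ᶜ b)
      where
      eq : ∀ u v → bit01 u * bit01 v ≡ bit01 (u ∧ v)
      eq true  true  = refl
      eq true  false = refl
      eq false v     = refl

    _∨ᶜ_ : ∀ {f g} → BC n f → BC n g → BC n (λ x ρ → f x ρ ∨ g x ρ)
    _∨ᶜ_ {f} {g} a b = convert (λ x ρ → eq (f x ρ) (g x ρ)) (cLit 1 ∸ᶜ (cLit 1 ∸ᶜ (a +ᶜ b)))
      where
      eq : ∀ u v → 1 ∸ (1 ∸ (bit01 u + bit01 v)) ≡ bit01 (u ∨ v)
      eq true  v     = cong (1 ∸_) (ℕ.0∸n≡0 (bit01 v))
      eq false true  = refl
      eq false false = refl

    _≤ᶜ_ : ∀ {f g} → NC n f → NC n g → BC n (λ x ρ → f x ρ ≤ᵇ g x ρ)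
    _≤ᶜ_ {f} {g} a b = convert (λ x ρ → eq (f x ρ) (g x ρ)) (cLit 1 ∸ᶜ (a ∸ᶜ b))
      where
      eq : ∀ u v → 1 ∸ (u ∸ v) ≡ bit01 (u ≤ᵇ v)
      eq u v with u ℕ.≤? v
      ... | yes le = trans (cong (1 ∸_) (ℕ.m≤n⇒m∸n≡0 le)) (sym (cong bit01 (≤ᵇ-true le)))
      ... | no nle = trans (one-minus (u ∸ v) (ℕ.m<n⇒0<n∸m (ℕ.≰⇒> nle))) (sym (cong bit01 (≤ᵇ-false (ℕ.≰⇒> nle))))
        where
        one-minus : ∀ d → 0 < d → 1 ∸ d ≡ 0
        one-minus (suc d) _ = ℕ.0∸n≡0 d

    _<ᶜ_ : ∀ {f g} → NC n f → NC n g → BC n (λ x ρ → f x ρ <ᵇ g x ρ)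
    _<ᶜ_ {f} {g} a b = convert (λ x ρ → refl) (sucᶜ a ≤ᶜ b)

    _≡ᶜ_ : ∀ {f g} → NC n f → NC n g → BC n (λ x ρ → f x ρ ≡ᵇ g x ρ)
    _≡ᶜ_ {f} {g} a b = convert (λ x ρ → eq (f x ρ) (g x ρ)) ((a ≤ᶜ b) ∧ᶜ (b ≤ᶜ a))
      where
      eq : ∀ u v → bit01 ((u ≤ᵇ v) ∧ (v ≤ᵇ u)) ≡ bit01 (u ≡ᵇ v)
      eq u v = cong bit01 (does-⇔ (mk⇔ (λ (p , q) → ℕ.≤-antisym p q) (λ { refl → ℕ.≤-refl , ℕ.≤-refl })) ((u ℕ.≤? v) ×-dec (v ℕ.≤? u)) (u ℕ.≟ v))

  module _ {n : ℕ} where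

    divᶜ : ∀ {f g} → NC n f → NC n g → NC n (λ x ρ → divS (f x ρ) (g x ρ))
    divᶜ {f} {g} a b = convert (λ x ρ → refl) (Σᶜ a (((sucᶜ (cVar zero)) *ᶜ ↑ᶜ b) ≤ᶜ ↑ᶜ a))

    modᶜ : ∀ {f g} → NC n f → NC n g → NC n (λ x ρ → modS (f x ρ) (g x ρ))
    modᶜ a b = a ∸ᶜ (b *ᶜ divᶜ a b)

-- The formula of a verifier and an input

nthR : {A : Set} → List (List A) → ℕ → List A
nthR []       _       = []
nthR (r ∷ rs) zero    = r
nthR (r ∷ rs) (suc n) = nthR rs n

nthR-∈ : ∀ {A : Set} (rs : List (List A)) n → n < length rs → nthR rs n ∈ rs
nthR-∈ (r ∷ rs) zero    _        = here refl
nthR-∈ (r ∷ rs) (suc n) (s≤s lt) = there (nthR-∈ rs n lt)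

nthR-++ˡ : ∀ {A : Set} (rs rs' : List (List A)) n → n < length rs → nthR (rs ++ rs') n ≡ nthR rs n
nthR-++ˡ (r ∷ rs) rs' zero    _        = refl
nthR-++ˡ (r ∷ rs) rs' (suc n) (s≤s lt) = nthR-++ˡ rs rs' n lt

nthR-++ʳ : ∀ {A : Set} (rs rs' : List (List A)) n → nthR (rs ++ rs') (length rs + n) ≡ nthR rs' n
nthR-++ʳ []       rs' n = refl
nthR-++ʳ (r ∷ rs) rs' n = nthR-++ʳ rs rs' n

index-of : ∀ {A : Set} {r : List A} {rs} → r ∈ rs → Σ ℕ λ n → n < length rs × nthR rs n ≡ r
index-of (here refl) = 0 , s≤s z≤n , refl
index-of (there r∈) with index-of r∈
... | n , lt , eq = suc n , s≤s lt , eq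

radix< : ∀ n {m i j} → i < m → j < n → n * i + j < m * n
radix< n {m} {i} {j} i< j< = ℕ.<-≤-trans (ℕ.+-monoʳ-< (n * i) j<) (ℕ.≤-trans (ℕ.≤-reflexive (eq n i)) (ℕ.*-monoˡ-≤ n i<))
  where
  eq : ∀ n i → n * i + n ≡ suc i * n
  eq = solve-∀

Keepₚ : Bool → ℕ → Set
Keepₚ few i = if few then ⊤ else (i ≡ 0)

keepₚ? : ∀ few i → Dec (Keepₚ few i)
keepₚ? true  i = yes tt
keepₚ? false i = i ℕ.≟ 0

keepₚ0 : ∀ few → Keepₚ few 0
keepₚ0 true  = tt
keepₚ0 false = refl

divS-mono : ∀ n {i j} → 0 < n → i ≤ j → divS i n ≤ divS j n
divS-mono n {i} {j} 0<n i≤j = ℕ.≤-pred (ℕ.*-cancelˡ-< n (divS i n) (suc (divS j n)) (begin-strict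
  n * divS i n             ≤⟨ ℕ.m≤m+n _ (modS i n) ⟩
  n * divS i n + modS i n  ≡⟨ proj₁ (divS-≡ i n 0<n) ⟨
  i                        ≤⟨ i≤j ⟩
  j                        ≡⟨ proj₁ (divS-≡ j n 0<n) ⟩
  n * divS j n + modS j n  <⟨ ℕ.+-monoʳ-< (n * divS j n) (proj₂ (divS-≡ j n 0<n)) ⟩
  n * divS j n + n         ≡⟨ ℕ.+-comm (n * divS j n) n ⟩
  n + n * divS j n         ≡⟨ ℕ.*-suc n (divS j n) ⟨
  n * suc (divS j n)       ∎))
  where open ℕ.≤-Reasoning

sub-0-1 : ∀ {n} (j j' : Fin (suc (suc n))) → subF zero j ≡ subF (suc zero) j' → j' ≡ addF j (suc zero)
sub-0-1 {n} j j' eq = trans (sym (sub-add j' s)) (trans (cong (λ z → subF z s) (trans (addF-comm j' s) (trans (sym one≡) (sym both)))) (sub-add (addF j one) s))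
  where
  one s : Fin (suc (suc n))
  one = suc zero
  s = subF zero j
  one≡ : one ≡ addF s j'
  one≡ = sub⇒add {x = one} {j'} {s} (sym eq)
  both : addF (addF j one) s ≡ one
  both = trans (addF-comm (addF j one) s) (trans (sym (addF-assoc s j one)) (trans (cong (λ z → addF z one) (add-sub zero j))
    (trans (addF-comm zero one) (sym (sub⇒add {x = one} {zero} {one} (sub-zeroʳ one))))))

<ᵇ-sound : ∀ m n → (m <ᵇ n) ≡ true → m < n
<ᵇ-sound m n eq = ℕ.<ᵇ⇒< m n (subst Data.Bool.T (sym eq) tt)

<ᵇ-false⇒≥ : ∀ m n → (m <ᵇ n) ≡ false → n ≤ m
<ᵇ-false⇒≥ m n eq = ℕ.≮⇒≥ λ lt → true≢false (trans (sym (≤ᵇ-true lt)) eq)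
  where
  true≢false : true ≢ false
  true≢false ()

-- a positive clause a' and a negative clause a could only collide if a' = a + 1
collide : ∀ {n} (a a' : Fin (suc (suc n))) u u' → subF (if u then suc zero else zero) a ≡ subF (if u' then suc zero else zero) a' →
  (u ≡ false → u' ≡ true → toℕ a' ≤ toℕ a × suc (toℕ a) < suc (suc n)) → (u ≡ true → u' ≡ false → toℕ a ≤ toℕ a' × suc (toℕ a') < suc (suc n)) → a ≡ a'
collide a a' true  true  eq _ _ = subF-injʳ {x = suc zero} eq
collide a a' false false eq _ _ = subF-injʳ {x = zero} eq
collide {n} a a' false true  eq h _ = ⊥-elim (clash-next a a' (sub-0-1 a a' eq) (h refl refl))
  where
  clash-next : ∀ (a a' : Fin (suc (suc n))) → a' ≡ addF a (suc zero) → toℕ a' ≤ toℕ a × suc (toℕ a) < suc (suc n) → ⊥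
  clash-next a a' eq (le , lt) = ℕ.<⇒≱ (subst (toℕ a <_) (sym a'≡) (ℕ.n<1+n (toℕ a))) le
    where
    a'≡ : toℕ a' ≡ suc (toℕ a)
    a'≡ = trans (cong toℕ eq) (trans (toℕ-addF a (suc zero)) (trans (cong (ℕ._% suc (suc n)) (ℕ.+-comm (toℕ a) 1)) (ℕ.m<n⇒m%n≡m lt)))
collide {n} a a' true  false eq _ h = sym (collide a' a false true (sym eq) (λ _ _ → h refl refl) (λ ()))

module Instance (V : OTM) (x : List Bool) (W T I : ℕ) (0<T : 0 < T) (0<I : 0 < I) (few : Bool) (b : ℕ)
  (posR negR : List (Rules.Rule V))
  (two⁺ : ∀ t i → All (Simulation.TwoLits V x W T I t i) posR) (two⁻ : ∀ t i → All (Simulation.TwoLits V x W T I t i) negR) where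
  open Rules V
  open Tableau x W T I

  rules : List Rule
  rules = posR ++ negR

  R⁺ Rₙ : ℕ
  R⁺ = length posR
  Rₙ = length rules

  nv₁ nv₂ nv₃ nv : ℕ
  nv₁ = K
  nv₂ = suc I * nv₁
  nv₃ = suc T * nv₂
  nv  = 2 * nv₃

  -- A clause number in mixed radix: rule, time, position. The rule is the leading digit, so the
  -- clauses of positive rules precede those of negative ones.
  jρ jt ji : ℕ → ℕ
  jρ j = divS j (T * I)
  jt j = divS (modS j (T * I)) I
  ji j = modS (modS j (T * I)) I

  vb vt vi vκ : ℕ → ℕ
  vb v = divS v nv₃
  vt v = divS (modS v nv₃) nv₂
  vi v = divS (modS (modS v nv₃) nv₂) nv₁
  vκ v = modS (modS (modS v nv₃) nv₂) nv₁

  guardOK? : ∀ g i → Dec (GuardOK g i)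
  guardOK? nothing        i = yes tt
  guardOK? (just (p , s)) i = allowed? (ival p i) (toℕ s)

  Match : Lit → (t i b' t' i' κ' : ℕ) → Set
  Match (lit u tp ip κ g) t i b' t' i' κ' =
    b' ≡ bit01 u × t' ≡ tval tp t × i' ≡ ival ip i × κ' ≡ toℕ (kind# κ) × GuardOK g i

  match? : ∀ ℓ t i b' t' i' κ' → Dec (Match ℓ t i b' t' i' κ')
  match? (lit u tp ip κ g) t i b' t' i' κ' =
    (b' ℕ.≟ bit01 u) ×-dec (t' ℕ.≟ tval tp t) ×-dec (i' ℕ.≟ ival ip i) ×-dec (κ' ℕ.≟ toℕ (kind# κ)) ×-dec guardOK? g i

  InRule : Rule → (t i b' t' i' κ' : ℕ) → Set
  InRule []      t i b' t' i' κ' = ⊥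
  InRule (ℓ ∷ r) t i b' t' i' κ' = Match ℓ t i b' t' i' κ' ⊎ InRule r t i b' t' i' κ'

  inRule? : ∀ r t i b' t' i' κ' → Dec (InRule r t i b' t' i' κ')
  inRule? []      t i b' t' i' κ' = no λ ()
  inRule? (ℓ ∷ r) t i b' t' i' κ' = match? ℓ t i b' t' i' κ' ⊎-dec inRule? r t i b' t' i' κ'

  InRules : List Rule → ℕ → (ρ t i b' t' i' κ' : ℕ) → Set
  InRules []       n ρ t i b' t' i' κ' = ⊥
  InRules (r ∷ rs) n ρ t i b' t' i' κ' = (ρ ≡ n × InRule r t i b' t' i' κ') ⊎ InRules rs (suc n) ρ t i b' t' i' κ'

  inRules? : ∀ rs n ρ t i b' t' i' κ' → Dec (InRules rs n ρ t i b' t' i' κ')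
  inRules? []       n ρ t i b' t' i' κ' = no λ ()
  inRules? (r ∷ rs) n ρ t i b' t' i' κ' = ((ρ ℕ.≟ n) ×-dec inRule? r t i b' t' i' κ') ⊎-dec inRules? rs (suc n) ρ t i b' t' i' κ'

  InRule-find : ∀ r {t i b' t' i' κ'} → InRule r t i b' t' i' κ' → Σ Lit λ ℓ → ℓ ∈ r × Match ℓ t i b' t' i' κ'
  InRule-find (ℓ ∷ r) (inj₁ m) = ℓ , here refl , m
  InRule-find (ℓ ∷ r) (inj₂ h) with InRule-find r h
  ... | ℓ' , ℓ∈ , m = ℓ' , there ℓ∈ , m

  InRule-lose : ∀ {r ℓ t i b' t' i' κ'} → ℓ ∈ r → Match ℓ t i b' t' i' κ' → InRule r t i b' t' i' κ'
  InRule-lose (here refl) m = inj₁ m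
  InRule-lose (there ℓ∈)  m = inj₂ (InRule-lose ℓ∈ m)

  InRules-out : ∀ rs n d {t i b' t' i' κ'} → InRules rs n (n + d) t i b' t' i' κ' → InRule (nthR rs d) t i b' t' i' κ'
  InRules-out (r ∷ rs) n zero    (inj₁ (_ , h)) = h
  InRules-out (r ∷ rs) n (suc d) (inj₁ (eq , h)) = ⊥-elim (ℕ.<-irrefl (sym eq) (ℕ.m<m+n n (s≤s z≤n)))
  InRules-out (r ∷ rs) n zero    {t} {i} {b'} {t'} {i'} {κ'} (inj₂ h) = ⊥-elim (none rs (suc n) (ℕ.≤-reflexive (cong suc (ℕ.+-identityʳ n))) h)
    where
    none : ∀ rs m → n + 0 < m → InRules rs m (n + 0) t i b' t' i' κ' → ⊥
    none (r ∷ rs) m lt (inj₁ (eq , _)) = ℕ.<-irrefl eq lt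
    none (r ∷ rs) m lt (inj₂ h) = none rs (suc m) (ℕ.m<n⇒m<1+n lt) h
  InRules-out (r ∷ rs) n (suc d) {t} {i} {b'} {t'} {i'} {κ'} (inj₂ h) = InRules-out rs (suc n) d (subst (λ z → InRules rs (suc n) z t i b' t' i' κ') (ℕ.+-suc n d) h)

  InRules-in : ∀ rs n d {t i b' t' i' κ'} → InRule (nthR rs d) t i b' t' i' κ' → InRules rs n (n + d) t i b' t' i' κ'
  InRules-in (r ∷ rs) n zero    h = inj₁ (ℕ.+-identityʳ n , h)
  InRules-in (r ∷ rs) n (suc d) {t} {i} {b'} {t'} {i'} {κ'} h = inj₂ (subst (λ z → InRules rs (suc n) z t i b' t' i' κ') (sym (ℕ.+-suc n d)) (InRules-in rs (suc n) d h))

  InN : ℕ → ℕ → Set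
  InN j v = InRules rules 0 (jρ j) (jt j) (ji j) (vb v) (vt v) (vi v) (vκ v)

  inN? : ∀ j v → Dec (InN j v)
  inN? j v = inRules? rules 0 (jρ j) (jt j) (ji j) (vb v) (vt v) (vi v) (vκ v)

  Φ : Formula
  Φ = record
    -- `M = b + 1` blocks will settle the proportions for `a / b`. `p` exceeds the number of clauses
    -- by 3, which also prevents a wrap-around in `separated`.
    { M' = b ; p' = Rₙ * (T * I) ; nv = nv
    ; Act = λ j → jρ j < Rₙ ; act? = λ j → jρ j ℕ.<? Rₙ
    ; pos = λ j → jρ j <ᵇ R⁺
    ; In = InN ; in? = inN?
    ; Keep = Keepₚ few ; keep? = keepₚ? few ; keep0 = keepₚ0 few }

  open Correct Φ using (P; N; p; q; IsVar; Satisfiable; Separated; TwoMembers; one; e; satisfiable⇒completable; completable⇒satisfiable; halfCompletion) public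

  TI>0 : 0 < T * I
  TI>0 = ℕ.*-mono-≤ 0<T 0<I

  clause# : ℕ → ℕ → ℕ → ℕ
  clause# ρ t i = (T * I) * ρ + (I * t + i)

  clause-parts : ∀ {ρ t i} → t < T → i < I → jρ (clause# ρ t i) ≡ ρ × jt (clause# ρ t i) ≡ t × ji (clause# ρ t i) ≡ i
  clause-parts {ρ} {t} {i} t< i< = divS-spec (T * I) ρ _ lt ,
    trans (cong (λ z → divS z I) (modS-spec (T * I) ρ _ lt)) (divS-spec I t i i<) ,
    trans (cong (λ z → modS z I) (modS-spec (T * I) ρ _ lt)) (modS-spec I t i i<)
    where
    lt : I * t + i < T * I
    lt = radix< I t< i<

  clause< : ∀ {ρ t i} → ρ < Rₙ → t < T → i < I → clause# ρ t i < p
  clause< ρ< t< i< = ℕ.≤-trans (radix< (T * I) ρ< (radix< I t< i<)) (ℕ.m≤n+m _ 3)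

  parts< : ∀ j → jt j < T × ji j < I
  parts< j = t< , proj₂ (divS-≡ (modS j (T * I)) I 0<I)
    where
    r = modS j (T * I)
    t< : divS r I < T
    t< = ℕ.*-cancelˡ-< I (divS r I) T (ℕ.≤-<-trans (ℕ.m≤m+n _ (modS r I)) (ℕ.<-≤-trans (subst (_< T * I) (proj₁ (divS-≡ r I 0<I)) (proj₂ (divS-≡ j (T * I) TI>0))) (ℕ.≤-reflexive (ℕ.*-comm T I))))

  var# : ℕ → ℕ → ℕ → ℕ → ℕ
  var# b t i κ = nv₃ * b + (nv₂ * t + (nv₁ * i + κ))

  module _ {b t i κ : ℕ} (t< : t < suc T) (i< : i < suc I) (κ< : κ < K) where

    private
      lt₁ : nv₁ * i + κ < nv₂
      lt₁ = radix< nv₁ i< κ<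
      lt₂ : nv₂ * t + (nv₁ * i + κ) < nv₃
      lt₂ = radix< nv₂ t< lt₁

    var-parts : vb (var# b t i κ) ≡ b × vt (var# b t i κ) ≡ t × vi (var# b t i κ) ≡ i × vκ (var# b t i κ) ≡ κ
    var-parts = divS-spec nv₃ b _ lt₂ , trans (cong (λ z → divS z nv₂) m₁≡) (divS-spec nv₂ t _ lt₁) ,
      trans (cong (λ z → divS z nv₁) m₂≡) (divS-spec nv₁ i κ κ<) , trans (cong (λ z → modS z nv₁) m₂≡) (modS-spec nv₁ i κ κ<)
      where
      m₁≡ = modS-spec nv₃ b _ lt₂
      m₂≡ : modS (modS (var# b t i κ) nv₃) nv₂ ≡ nv₁ * i + κ
      m₂≡ = trans (cong (λ z → modS z nv₂) m₁≡) (modS-spec nv₂ t _ lt₁)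

    var-isVar : b < 2 → var# b t i κ < nv
    var-isVar b< = radix< nv₃ b< lt₂

  nv₂>0 : 0 < nv₂
  nv₂>0 = ℕ.≤-trans 0<K (ℕ.m≤m+n K (I * K))

  nv₃>0 : 0 < nv₃
  nv₃>0 = ℕ.≤-trans nv₂>0 (ℕ.m≤m+n nv₂ (T * nv₂))

  var-compose : ∀ v → v ≡ var# (vb v) (vt v) (vi v) (vκ v)
  var-compose v = trans (proj₁ (divS-≡ v nv₃ nv₃>0)) (cong (nv₃ * vb v +_)
    (trans (proj₁ (divS-≡ (modS v nv₃) nv₂ nv₂>0)) (cong (nv₂ * vt v +_) (proj₁ (divS-≡ (modS (modS v nv₃) nv₂) nv₁ 0<K)))))

  q≡ : q ≡ nv + p
  q≡ = sym (ℕ.+-suc nv _)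

  nv≤q : nv ≤ q
  nv≤q = subst (nv ≤_) (sym q≡) (ℕ.m≤m+n nv p)

  tval-ok : ∀ tp {t} → t < T → tval tp t < suc T
  tval-ok tz     t< = s≤s z≤n
  tval-ok te     t< = ℕ.≤-refl
  tval-ok (tr d) {t} t< = ℕ.<-≤-trans (ℕ.+-monoʳ-< (toℕ d) t<) (ℕ.+-monoˡ-≤ T (ℕ.≤-pred (F.toℕ<n d)))

  ival-ok : ∀ ip {i} → i < I → ival ip i < suc I
  ival-ok iz     i< = s≤s z≤n
  ival-ok (ir d) {i} i< = ℕ.<-≤-trans (ℕ.+-monoʳ-< (toℕ d) i<) (ℕ.+-monoˡ-≤ I (ℕ.≤-pred (F.toℕ<n d)))

  bit<2 : ∀ u → bit01 u < 2
  bit<2 true  = s≤s (s≤s z≤n)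
  bit<2 false = s≤s z≤n

  module _ (ℓ : Lit) {t i : ℕ} (t< : t < T) (i< : i < I) where
    open Lit ℓ

    litN : ℕ
    litN = var# (bit01 barred) (tval tpos t) (ival ipos i) (toℕ (kind# kind))

    lit-isVar : litN < nv
    lit-isVar = var-isVar (tval-ok tpos t<) (ival-ok ipos i<) (F.toℕ<n (kind# kind)) (bit<2 barred)

    litF : Fin q
    litF = fromℕ< (ℕ.<-≤-trans lit-isVar nv≤q)

    toℕ-litF : toℕ litF ≡ litN
    toℕ-litF = F.toℕ-fromℕ< _

    lit-parts : vb (toℕ litF) ≡ bit01 barred × vt (toℕ litF) ≡ tval tpos t × vi (toℕ litF) ≡ ival ipos i × vκ (toℕ litF) ≡ toℕ (kind# kind)
    lit-parts = subst (λ z → vb z ≡ bit01 barred × vt z ≡ tval tpos t × vi z ≡ ival ipos i × vκ z ≡ toℕ (kind# kind)) (sym toℕ-litF)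
      (var-parts (tval-ok tpos t<) (ival-ok ipos i<) (F.toℕ<n (kind# kind)))

    lit-match : GuardOK guard i → Match ℓ t i (vb (toℕ litF)) (vt (toℕ litF)) (vi (toℕ litF)) (vκ (toℕ litF))
    lit-match g = let (p₁ , p₂ , p₃ , p₄) = lit-parts in p₁ , p₂ , p₃ , p₄ , g

  ruleOf : ℕ → Rule
  ruleOf j = nthR rules (jρ j)

  data RuleKind (j : ℕ) : Set where
    posK : ruleOf j ∈ posR → (jρ j <ᵇ R⁺) ≡ true → RuleKind j
    negK : ruleOf j ∈ negR → (jρ j <ᵇ R⁺) ≡ false → RuleKind j

  ruleKind : ∀ j → jρ j < Rₙ → RuleKind j
  ruleKind j lt with jρ j ℕ.<? R⁺
  ... | yes lt⁺ = posK (subst (_∈ posR) (sym (nthR-++ˡ posR negR (jρ j) lt⁺)) (nthR-∈ posR (jρ j) lt⁺)) (≤ᵇ-true lt⁺)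
  ... | no nlt = negK (subst (λ z → nthR rules z ∈ negR) eq (subst (_∈ negR) (sym (nthR-++ʳ posR negR d)) (nthR-∈ negR d d<))) (≤ᵇ-false (s≤s (ℕ.≮⇒≥ nlt)))
    where
    d : ℕ
    d = jρ j ∸ R⁺
    eq : R⁺ + d ≡ jρ j
    eq = ℕ.m+[n∸m]≡n (ℕ.≮⇒≥ nlt)
    d< : d < length negR
    d< = ℕ.+-cancelˡ-< R⁺ d (length negR) (subst₂ _<_ (sym eq) (List.length-++ posR) lt)

  two-lits : ∀ j → jρ j < Rₙ → Simulation.TwoLits V x W T I (jt j) (ji j) (ruleOf j)
  two-lits j lt with ruleKind j lt
  ... | posK r∈ _ = All.lookup (two⁺ (jt j) (ji j)) r∈
  ... | negK r∈ _ = All.lookup (two⁻ (jt j) (ji j)) r∈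

  twoMembers : TwoMembers
  twoMembers a act with two-lits (toℕ a) act
  ... | u , v , (u∈ , gu) , (v∈ , gv) , diff = litF u t< i< , litF v t< i< , distinct diff ,
      (subst (_< nv) (sym (toℕ-litF u t< i<)) (lit-isVar u t< i<) , InRules-in rules 0 (jρ (toℕ a)) (InRule-lose u∈ (lit-match u t< i< gu))) ,
      (subst (_< nv) (sym (toℕ-litF v t< i<)) (lit-isVar v t< i<) , InRules-in rules 0 (jρ (toℕ a)) (InRule-lose v∈ (lit-match v t< i< gv)))
    where
    t< = proj₁ (parts< (toℕ a))
    i< = proj₂ (parts< (toℕ a))
    bit01-inj : ∀ u v → bit01 u ≡ bit01 v → u ≡ v
    bit01-inj true  true  _ = refl
    bit01-inj false false _ = refl
    distinct : Lit.barred u ≢ Lit.barred v ⊎ kind# (Lit.kind u) ≢ kind# (Lit.kind v) → litF u t< i< ≢ litF v t< i<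
    distinct (inj₁ ne) eq = ne (bit01-inj _ _ (trans (sym (proj₁ (lit-parts u t< i<))) (trans (cong (vb ∘ toℕ) eq) (proj₁ (lit-parts v t< i<)))))
    distinct (inj₂ ne) eq = ne (F.toℕ-injective (trans (sym (proj₂ (proj₂ (proj₂ (lit-parts u t< i<))))) (trans (cong (vκ ∘ toℕ) eq) (proj₂ (proj₂ (proj₂ (lit-parts v t< i<)))))))

  -- For clauses of equal sign subtraction is injective. For opposite signs only a negative clause
  -- followed immediately by a positive one could agree; the order of the rules excludes that, and
  -- the spare residues exclude a step from the last clause around to the first.
  separated : Separated
  separated a a' act act' eq = collide a a' (jρ (toℕ a) <ᵇ R⁺) (jρ (toℕ a') <ᵇ R⁺) eq (later (toℕ a) (toℕ a') act) (λ p p' → later (toℕ a') (toℕ a) act' p' p)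
    where
    active< : ∀ j → jρ j < Rₙ → j < Rₙ * (T * I)
    active< j lt = subst (_< Rₙ * (T * I)) (sym (proj₁ (divS-≡ j (T * I) TI>0))) (radix< (T * I) lt (proj₂ (divS-≡ j (T * I) TI>0)))
    later : ∀ j j' → jρ j < Rₙ → (jρ j <ᵇ R⁺) ≡ false → (jρ j' <ᵇ R⁺) ≡ true → j' ≤ j × suc j < p
    later j j' act neg ps = ℕ.≮⇒≥ (λ lt → ℕ.<⇒≱ (ℕ.<-≤-trans (<ᵇ-sound (jρ j') R⁺ ps) (<ᵇ-false⇒≥ (jρ j) R⁺ neg)) (divS-mono (T * I) TI>0 (ℕ.<⇒≤ lt))) ,
      s≤s (ℕ.≤-trans (active< j act) (ℕ.m≤n+m (Rₙ * (T * I)) 2))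

  Positive Negative : Assignment → Set
  Positive X = ∀ t i → t < T → i < I → All (Good true X t i) posR
  Negative X = ∀ t i → t < T → i < I → All (Good false X t i) negR

  satisfies⇒satisfiable : ∀ {X} → Positive X → Negative X → Satisfiable
  satisfies⇒satisfiable {X} positive negative = Y , λ a act → go a act (ruleKind (toℕ a) act)
    where
    Y : Fin q → Bool
    Y v = X (vb (toℕ v) ≡ᵇ 1) (vt (toℕ v)) (vi (toℕ v)) (vκ (toℕ v))
    bar : ∀ u → (bit01 u ≡ᵇ 1) ≡ u
    bar true  = refl
    bar false = refl
    X-cong : ∀ {b u t t' i i' κ κ'} → b ≡ bit01 u → t ≡ t' → i ≡ i' → κ ≡ κ' → X (b ≡ᵇ 1) t i κ ≡ X u t' i' κ'
    X-cong {u = u} {t} {_} {i} {_} {κ} refl refl refl refl = cong (λ z → X z t i κ) (bar u)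
    Y-lit : ∀ ℓ {t i} (t< : t < T) (i< : i < I) → Y (litF ℓ t< i<) ≡ evalLit X t i ℓ
    Y-lit ℓ t< i< = let (p₁ , p₂ , p₃ , p₄) = lit-parts ℓ t< i< in X-cong {vb (toℕ (litF ℓ t< i<))} {Lit.barred ℓ} p₁ p₂ p₃ p₄
    Goal : Fin p → Set
    Goal a = Σ (Fin q) λ v → (IsVar v × InN (toℕ a) (toℕ v)) × Y v ≡ (jρ (toℕ a) <ᵇ R⁺)
    use′ : ∀ u a ℓ (t< : jt (toℕ a) < T) (i< : ji (toℕ a) < I) → ℓ ∈ ruleOf (toℕ a) → GuardOK (Lit.guard ℓ) (ji (toℕ a)) →
      evalLit X (jt (toℕ a)) (ji (toℕ a)) ℓ ≡ u → (jρ (toℕ a) <ᵇ R⁺) ≡ u → Goal a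
    use′ u a ℓ t< i< ℓ∈ guard ev ps = litF ℓ t< i< , (subst (_< nv) (sym (toℕ-litF ℓ t< i<)) (lit-isVar ℓ t< i<) ,
        InRules-in rules 0 (jρ (toℕ a)) (InRule-lose ℓ∈ (lit-match ℓ t< i< guard))) , trans (Y-lit ℓ t< i<) (trans ev (sym ps))
    use : ∀ u a → Good u X (jt (toℕ a)) (ji (toℕ a)) (ruleOf (toℕ a)) → (jρ (toℕ a) <ᵇ R⁺) ≡ u → Goal a
    use u a g ps = let (ℓ , ℓ∈ , guard , ev) = find g in use′ u a ℓ (proj₁ (parts< (toℕ a))) (proj₂ (parts< (toℕ a))) ℓ∈ guard ev ps
    go : ∀ (a : Fin p) → jρ (toℕ a) < Rₙ → RuleKind (toℕ a) → Goal a
    go a act (posK r∈ ps) = use true a (All.lookup (positive (jt (toℕ a)) (ji (toℕ a)) (proj₁ (parts< (toℕ a))) (proj₂ (parts< (toℕ a)))) r∈) ps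
    go a act (negK r∈ ps) = use false a (All.lookup (negative (jt (toℕ a)) (ji (toℕ a)) (proj₁ (parts< (toℕ a))) (proj₂ (parts< (toℕ a)))) r∈) ps

  satisfiable⇒satisfies : Satisfiable → Σ Assignment λ X → Positive X × Negative X
  satisfiable⇒satisfies (Y , sat) = X ,
      (λ t i t< i< → All.tabulate (λ {r} r∈ → pos-good t i t< i< r r∈)) ,
      (λ t i t< i< → All.tabulate (λ {r} r∈ → neg-good t i t< i< r r∈))
    where
    Y' : ℕ → Bool
    Y' n with n ℕ.<? q
    ... | yes lt = Y (fromℕ< lt)
    ... | no _   = false
    Y'-toℕ : ∀ v → Y' (toℕ v) ≡ Y v
    Y'-toℕ v with toℕ v ℕ.<? q
    ... | yes lt = cong Y (F.fromℕ<-toℕ v lt)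
    ... | no nlt = ⊥-elim (nlt (F.toℕ<n v))
    X : Assignment
    X u t i κ = Y' (var# (bit01 u) t i κ)
    finish : ∀ t i n v ℓ → ℓ ∈ nthR rules n → Match ℓ t i (vb (toℕ v)) (vt (toℕ v)) (vi (toℕ v)) (vκ (toℕ v)) → Y v ≡ (n <ᵇ R⁺) →
      Good (n <ᵇ R⁺) X t i (nthR rules n)
    finish t i n v ℓ@(lit u tp ip κ g) ℓ∈ (m₁ , m₂ , m₃ , m₄ , guard) Yv = lose ℓ∈ (guard , trans (cong Y' same) (trans (Y'-toℕ v) Yv))
      where
      same : var# (bit01 u) (tval tp t) (ival ip i) (toℕ (kind# κ)) ≡ toℕ v
      same = sym (trans (var-compose (toℕ v)) (trans (cong (λ z → var# z (vt (toℕ v)) (vi (toℕ v)) (vκ (toℕ v))) m₁)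
        (trans (cong (λ z → var# (bit01 u) z (vi (toℕ v)) (vκ (toℕ v))) m₂)
        (trans (cong (λ z → var# (bit01 u) (tval tp t) z (vκ (toℕ v))) m₃) (cong (var# (bit01 u) (tval tp t) (ival ip i)) m₄)))))
    found : ∀ t i n v → InRule (nthR rules n) t i (vb (toℕ v)) (vt (toℕ v)) (vi (toℕ v)) (vκ (toℕ v)) → Y v ≡ (n <ᵇ R⁺) →
      Good (n <ᵇ R⁺) X t i (nthR rules n)
    found t i n v h Yv = let (ℓ , ℓ∈ , m) = InRule-find (nthR rules n) h in finish t i n v ℓ ℓ∈ m Yv
    atClause : ∀ {t i n v j} → j ≡ clause# n t i → t < T → i < I → InN j v → InRule (nthR rules n) t i (vb v) (vt v) (vi v) (vκ v)
    atClause {t} {i} {n} {v} refl t< i< inv = InRules-out rules 0 n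
      (subst (λ z → InRules rules 0 n t z (vb v) (vt v) (vi v) (vκ v)) (proj₂ (proj₂ (clause-parts {n} t< i<)))
      (subst (λ z → InRules rules 0 n z (ji (clause# n t i)) (vb v) (vt v) (vi v) (vκ v)) (proj₁ (proj₂ (clause-parts {n} t< i<)))
      (subst (λ z → InRules rules 0 z (jt (clause# n t i)) (ji (clause# n t i)) (vb v) (vt v) (vi v) (vκ v)) (proj₁ (clause-parts {n} t< i<)) inv)))
    good : ∀ t i (t< : t < T) (i< : i < I) n → n < Rₙ → Good (n <ᵇ R⁺) X t i (nthR rules n)
    good t i t< i< n n< = let (v , (isVar , inv) , Yv) = sat a act in
      found t i n v (atClause a≡ t< i< inv) (trans Yv (cong (_<ᵇ R⁺) ρ≡))
      where
      a : Fin p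
      a = fromℕ< (clause< n< t< i<)
      a≡ : toℕ a ≡ clause# n t i
      a≡ = F.toℕ-fromℕ< (clause< n< t< i<)
      ρ≡ : jρ (toℕ a) ≡ n
      ρ≡ = trans (cong jρ a≡) (proj₁ (clause-parts {n} t< i<))
      act : jρ (toℕ a) < Rₙ
      act = subst (_< Rₙ) (sym ρ≡) n<
    pos-good : ∀ t i → t < T → i < I → ∀ r → r ∈ posR → Good true X t i r
    pos-good t i t< i< r r∈ = let (n , n< , eq) = index-of r∈ in subst₂ (λ z r → Good z X t i r) (≤ᵇ-true n<) (trans (nthR-++ˡ posR negR n n<) eq)
      (good t i t< i< n (ℕ.<-≤-trans n< (ℕ.≤-trans (ℕ.m≤m+n R⁺ _) (ℕ.≤-reflexive (sym (List.length-++ posR))))))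
    neg-good : ∀ t i → t < T → i < I → ∀ r → r ∈ negR → Good false X t i r
    neg-good t i t< i< r r∈ = let (n , n< , eq) = index-of r∈ in
      subst₂ (λ z r → Good z X t i r) (≤ᵇ-false {suc (R⁺ + n)} (s≤s (ℕ.m≤m+n R⁺ n))) (trans (nthR-++ʳ posR negR n) eq)
      (good t i t< i< (R⁺ + n) (ℕ.<-≤-trans (ℕ.+-monoʳ-< R⁺ n<) (ℕ.≤-reflexive (sym (List.length-++ posR)))))

-- The bits of the encoded square

concatTo-cong : ∀ {A : Set} n {f g : ℕ → List A} → (∀ i → i < n → f i ≡ g i) → concatTo n f ≡ concatTo n g
concatTo-cong zero    h = refl
concatTo-cong (suc n) h = cong₂ _++_ (concatTo-cong n (λ i lt → h i (ℕ.m<n⇒m<1+n lt))) (h n ℕ.≤-refl)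

concatTo-suc : ∀ {A : Set} n (f : ℕ → List A) → concatTo (suc n) f ≡ f 0 ++ concatTo n (f ∘ suc)
concatTo-suc zero    f = sym (List.++-identityʳ (f 0))
concatTo-suc (suc n) f = trans (cong (_++ f (suc n)) (concatTo-suc n f)) (List.++-assoc (f 0) (concatTo n (f ∘ suc)) (f (suc n)))

concatMap-allFin : ∀ {A : Set} n {h : Fin n → List A} {k : ℕ → List A} → (∀ i → h i ≡ k (toℕ i)) → concatMap h (allFin n) ≡ concatTo n k
concatMap-allFin {A} n {h} {k} eq = trans (cong concat (List.map-tabulate id h)) (go n h k eq)
  where
  go : ∀ n (h : Fin n → List A) k → (∀ i → h i ≡ k (toℕ i)) → concat (List.tabulate h) ≡ concatTo n k
  go zero    h k eq = refl
  go (suc n) h k eq = trans (cong₂ _++_ (eq zero) (go n (h ∘ suc) (k ∘ suc) (eq ∘ suc))) (sym (concatTo-suc n k))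

toList-tabulate : ∀ {A : Set} n {h : Fin n → A} {k : ℕ → A} → (∀ i → h i ≡ k (toℕ i)) → toList (tabulate h) ≡ concatTo n (λ i → k i ∷ [])
toList-tabulate zero    eq = refl
toList-tabulate (suc n) {h} {k} eq = trans (cong₂ _∷_ (eq zero) (toList-tabulate n (eq ∘ suc))) (sym (concatTo-suc n (λ i → k i ∷ [])))

unary-concat : ∀ n → unary n ≡ concatTo n (λ _ → true ∷ []) ++ false ∷ []
unary-concat zero    = refl
unary-concat (suc n) = trans (cong (true ∷_) (unary-concat n)) (sym (cong (_++ false ∷ []) (concatTo-suc n (λ _ → true ∷ []))))

squareBits : ℕ → (ℕ → ℕ → Bool) → (ℕ → ℕ → ℕ → Bool) → List Bool
squareBits n f g = concatTo n (λ _ → true ∷ []) ++ (false ∷ []) ++ concatTo n (λ r → concatTo n (λ c → (f r c ∷ []) ++ concatTo n (λ s → g r c s ∷ [])))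

encode-bits : ∀ n (P : Array n) f g → (∀ r c → cellCode (P r c) zero ≡ f (toℕ r) (toℕ c)) →
  (∀ r c s → cellCode (P r c) (suc s) ≡ g (toℕ r) (toℕ c) (toℕ s)) → encode n P ≡ squareBits n f g
encode-bits n P f g hf hg = trans (cong₂ _++_ (unary-concat n) (concatMap-allFin n λ r → concatMap-allFin n λ c → cong₂ _∷_ (hf r c) (toList-tabulate n (hg r c))))
  (List.++-assoc (concatTo n (λ _ → true ∷ [])) (false ∷ []) _)

subB : ℕ → ℕ → ℕ → ℕ → Bool
subB n x a s = (s + a ≡ᵇ x) ∨ (s + a ≡ᵇ x + n)

subB-ok : ∀ {n} (x a s : Fin (suc n)) → does (subF x a F.≟ s) ≡ subB (suc n) (toℕ x) (toℕ a) (toℕ s)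
subB-ok {n} x a s = does-⇔ (subF-spec x a s) (subF x a F.≟ s) ((toℕ s + toℕ a ℕ.≟ toℕ x) ⊎-dec (toℕ s + toℕ a ℕ.≟ toℕ x + suc n))

module Encoding (Φ : Formula) where
  open Correct Φ public

  block : ℕ
  block = 2 * (p * q)

  dI dT dX dY : ℕ → ℕ
  dI v = divS v block
  dT v = divS (modS v block) (p * q)
  dX v = divS (modS (modS v block) (p * q)) q
  dY v = modS (modS (modS v block) (p * q)) q

  emptyB flipB : ℕ → ℕ → Bool
  emptyB r c = does (emptyN? (dI r) (dT r) (dX r) (dY r) (dI c) (dT c) (dX c) (dY c))
  flipB  r c = does (flipN? (dI r) (dT r) (dX r) (dY r) (dI c) (dT c) (dX c) (dY c))

  symB : (fl : Bool) (i t x y i' t' a b si st sx sy : ℕ) → Bool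
  symB fl i t x y i' t' a b si st sx sy = subB M i i' si ∧ subB 2 (if fl then 1 else t) t' st ∧ subB p x a sx ∧ subB q y b sy

  valB : ℕ → ℕ → ℕ → Bool
  valB r c s = not (emptyB r c) ∧ symB (flipB r c) (dI r) (dT r) (dX r) (dY r) (dI c) (dT c) (dX c) (dY c) (dI s) (dT s) (dX s) (dY s)

  atIx : ∀ {A : Set} → (ℕ → ℕ → ℕ → ℕ → A) → Ix → A
  atIx f (i , t , x , y) = f (toℕ i) (toℕ t) (toℕ x) (toℕ y)

  -- `dec` is built from pairings of `Fin`, the digits from `divS` and `modS`; both invert the same
  -- mixed radix.
  digits : ∀ {A : Set} (f : ℕ → ℕ → ℕ → ℕ → A) k → f (dI (toℕ k)) (dT (toℕ k)) (dX (toℕ k)) (dY (toℕ k)) ≡ atIx f (dec k)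
  digits f k = trans (cong (λ z → f (dI (toℕ z)) (dT (toℕ z)) (dX (toℕ z)) (dY (toℕ z))) (sym (enc-dec k))) (go (dec k))
    where
    lt₁ : ∀ (x : Fin p) (y : Fin q) → q * toℕ x + toℕ y < p * q
    lt₁ x y = radix< q (F.toℕ<n x) (F.toℕ<n y)
    lt₂ : ∀ (t : Fin 2) (x : Fin p) (y : Fin q) → p * q * toℕ t + (q * toℕ x + toℕ y) < block
    lt₂ t x y = radix< (p * q) (F.toℕ<n t) (lt₁ x y)
    go : ∀ r → f (dI (toℕ (enc r))) (dT (toℕ (enc r))) (dX (toℕ (enc r))) (dY (toℕ (enc r))) ≡ atIx f r
    go (i , t , x , y) = four f dI≡ dT≡ dX≡ dY≡
      where
      v : ℕ
      v = toℕ (enc (i , t , x , y))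
      m₁≡ : modS v block ≡ p * q * toℕ t + (q * toℕ x + toℕ y)
      m₁≡ = trans (cong (λ z → modS z block) (toℕ-enc i t x y)) (modS-spec block (toℕ i) _ (lt₂ t x y))
      m₂≡ : modS (modS v block) (p * q) ≡ q * toℕ x + toℕ y
      m₂≡ = trans (cong (λ z → modS z (p * q)) m₁≡) (modS-spec (p * q) (toℕ t) _ (lt₁ x y))
      dI≡ : dI v ≡ toℕ i
      dI≡ = trans (cong (λ z → divS z block) (toℕ-enc i t x y)) (divS-spec block (toℕ i) _ (lt₂ t x y))
      dT≡ : dT v ≡ toℕ t
      dT≡ = trans (cong (λ z → divS z (p * q)) m₁≡) (divS-spec (p * q) (toℕ t) _ (lt₁ x y))
      dX≡ : dX v ≡ toℕ x
      dX≡ = trans (cong (λ z → divS z q) m₂≡) (divS-spec q (toℕ x) (toℕ y) (F.toℕ<n y))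
      dY≡ : dY v ≡ toℕ y
      dY≡ = trans (cong (λ z → modS z q) m₂≡) (modS-spec q (toℕ x) (toℕ y) (F.toℕ<n y))
      four : ∀ {A : Set} (f : ℕ → ℕ → ℕ → ℕ → A) {a b c d a' b' c' d'} → a ≡ a' → b ≡ b' → c ≡ c' → d ≡ d' → f a b c d ≡ f a' b' c' d'
      four f refl refl refl refl = refl

  emptyB-ok : ∀ r c → emptyB (toℕ r) (toℕ c) ≡ does (empty? (dec r) (dec c))
  emptyB-ok r c = trans (digits (λ i t x y → does (emptyN? i t x y (dI (toℕ c)) (dT (toℕ c)) (dX (toℕ c)) (dY (toℕ c)))) r)
    (digits (λ i' t' a b → atIx (λ i t x y → does (emptyN? i t x y i' t' a b)) (dec r)) c)

  flipB-ok : ∀ r c → flipB (toℕ r) (toℕ c) ≡ does (flip? (dec r) (dec c))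
  flipB-ok r c = trans (digits (λ i t x y → does (flipN? i t x y (dI (toℕ c)) (dT (toℕ c)) (dX (toℕ c)) (dY (toℕ c)))) r)
    (digits (λ i' t' a b → atIx (λ i t x y → does (flipN? i t x y i' t' a b)) (dec r)) c)

  symAt : Bool → Ix → Ix → Ix → Bool
  symAt fl (i , t , x , y) (i' , t' , a , b) (si , st , sx , sy) =
    symB fl (toℕ i) (toℕ t) (toℕ x) (toℕ y) (toℕ i') (toℕ t') (toℕ a) (toℕ b) (toℕ si) (toℕ st) (toℕ sx) (toℕ sy)

  symB-ok : ∀ fl r c s → symB fl (dI (toℕ r)) (dT (toℕ r)) (dX (toℕ r)) (dY (toℕ r)) (dI (toℕ c)) (dT (toℕ c)) (dX (toℕ c)) (dY (toℕ c))
    (dI (toℕ s)) (dT (toℕ s)) (dX (toℕ s)) (dY (toℕ s)) ≡ symAt fl (dec r) (dec c) (dec s)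
  symB-ok fl r c s = trans (digits (λ i t x y → symB fl i t x y (dI (toℕ c)) (dT (toℕ c)) (dX (toℕ c)) (dY (toℕ c)) (dI (toℕ s)) (dT (toℕ s)) (dX (toℕ s)) (dY (toℕ s))) r)
    (trans (digits (λ i' t' a b → atIx (λ i t x y → symB fl i t x y i' t' a b (dI (toℕ s)) (dT (toℕ s)) (dX (toℕ s)) (dY (toℕ s))) (dec r)) c)
      (digits (λ si st sx sy → atIx (λ i' t' a b → atIx (λ i t x y → symB fl i t x y i' t' a b si st sx sy) (dec r)) (dec c)) s))

  L-symAt : ∀ r c s → does (enc (L r c) F.≟ s) ≡ symAt false r c (dec s)
  L-symAt r@(i , t , x , y) c@(i' , t' , a , b) s = go (dec s) (enc-dec s)
    where
    go : ∀ z → enc z ≡ s → does (enc (L r c) F.≟ s) ≡ symAt false r c z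
    go (si , st , sx , sy) refl = trans
      (does-⇔ (mk⇔ (λ eq → components (enc-inj eq)) (λ (h₁ , h₂ , h₃ , h₄) → cong enc (cong₂ _,_ h₁ (cong₂ _,_ h₂ (cong₂ _,_ h₃ h₄)))))
        (enc (L r c) F.≟ s) ((subF i i' F.≟ si) ×-dec (subF t t' F.≟ st) ×-dec (subF x a F.≟ sx) ×-dec (subF y b F.≟ sy)))
      (cong₂ _∧_ (subB-ok i i' si) (cong₂ _∧_ (subB-ok t t' st) (cong₂ _∧_ (subB-ok x a sx) (subB-ok y b sy))))
      where
      components : L r c ≡ (si , st , sx , sy) → subF i i' ≡ si × subF t t' ≡ st × subF x a ≡ sx × subF y b ≡ sy
      components refl = refl , refl , refl , refl

  cell-bits : ∀ em fl r c s → cellCode (Maybe.map enc (if em then nothing else just (if fl then L (twin r) c else L r c))) (suc s) ≡ not em ∧ symAt fl r c (dec s)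
  cell-bits true  fl    r c s = refl
  cell-bits false true  r c s = L-symAt (twin r) c s
  cell-bits false false r c s = L-symAt r c s

  cell-empty : ∀ em z → cellCode (Maybe.map enc (if em then nothing else just z)) zero ≡ em
  cell-empty true  z = refl
  cell-empty false z = refl

  encode-P : encode N P ≡ squareBits N emptyB valB
  encode-P = encode-bits N P emptyB valB (λ r c → trans (cell-empty (does (empty? (dec r) (dec c))) _) (sym (emptyB-ok r c)))
    (λ r c s → trans (cell-bits (does (empty? (dec r) (dec c))) (does (flip? (dec r) (dec c))) (dec r) (dec c) s)
      (sym (cong₂ _∧_ (cong not (emptyB-ok r c)) (trans (symB-ok (flipB (toℕ r) (toℕ c)) r c s) (cong (λ fl → symAt fl (dec r) (dec c) (dec s)) (flipB-ok r c))))))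

open Computable

OC : ∀ n → (List Bool → Vec ℕ n → List Bool) → Set
OC n f = Σ (Out (n + 1)) λ o → ∀ x ρ → ⟦ o ⟧ₒ x (env x ρ) ≡ f x ρ

emitᶜ : ∀ {n f} → BC n f → OC n (λ x ρ → f x ρ ∷ [])
emitᶜ {f = f} (e , h) = emit# e , λ x ρ → cong (_∷ []) (trans (cong positiveB (h x ρ)) (eq (f x ρ)))
  where
  eq : ∀ b → positiveB (bit01 b) ≡ b
  eq true  = refl
  eq false = refl

_⨟ᶜ_ : ∀ {n f g} → OC n f → OC n g → OC n (λ x ρ → f x ρ ++ g x ρ)
(o , h) ⨟ᶜ (o' , h') = o ⨟ o' , λ x ρ → cong₂ _++_ (h x ρ) (h' x ρ)

infixr 5 _⨟ᶜ_

forᶜ : ∀ {n f g} → NC n f → OC (suc n) g → OC n (λ x ρ → concatTo (f x ρ) (λ d → g x ((f x ρ ∸ suc d) Vec.∷ ρ)))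
forᶜ {f = f} {g} (e , h) (o , h') = for# e o , λ x ρ → trans
  (cong (λ m → concatTo m (λ d → ⟦ o ⟧ₒ x ((m ∸ suc d) Vec.∷ env x ρ))) (h x ρ)) (concatTo-cong (f x ρ) (λ d _ → h' x ((f x ρ ∸ suc d) Vec.∷ ρ)))

convertₒ : ∀ {n f g} → (∀ x ρ → f x ρ ≡ g x ρ) → OC n f → OC n g
convertₒ eq (o , h) = o , λ x ρ → trans (h x ρ) (eq x ρ)

condᶜ : ∀ {n b f g} → BC n b → NC n f → NC n g → NC n (λ x ρ → if b x ρ then f x ρ else g x ρ)
condᶜ {b = b} {f} {g} u v w = convert (λ x ρ → eq (b x ρ) (f x ρ) (g x ρ)) ((u *ᶜ v) +ᶜ (notᶜ u *ᶜ w))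
  where
  eq : ∀ b m k → bit01 b * m + bit01 (not b) * k ≡ (if b then m else k)
  eq true  m k = trans (ℕ.+-identityʳ _) (ℕ.+-identityʳ m)
  eq false m k = ℕ.+-identityʳ k

flip-index : ∀ {n d} → d < n → n ∸ suc (n ∸ suc d) ≡ d
flip-index {suc n} (s≤s d≤n) = ℕ.m∸[m∸n]≡n d≤n

bitsᶜ : ∀ {N : List Bool → ℕ} {f : List Bool → ℕ → ℕ → Bool} {g : List Bool → ℕ → ℕ → ℕ → Bool} → (∀ {n} → NC n (λ x _ → N x)) →
  (∀ {n fr fc} → NC n fr → NC n fc → BC n (λ x ρ → f x (fr x ρ) (fc x ρ))) →
  (∀ {n fr fc fs} → NC n fr → NC n fc → NC n fs → BC n (λ x ρ → g x (fr x ρ) (fc x ρ) (fs x ρ))) → OC 0 (λ x _ → squareBits (N x) (f x) (g x))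
bitsᶜ {N} {f} {g} Nᶜ fᶜ gᶜ = convertₒ (λ x _ → same x)
    (forᶜ Nᶜ (emitᶜ trueᶜ) ⨟ᶜ emitᶜ falseᶜ ⨟ᶜ forᶜ Nᶜ (forᶜ Nᶜ (emitᶜ (fᶜ (index (suc zero)) (index zero)) ⨟ᶜ
      forᶜ Nᶜ (emitᶜ (gᶜ (index (suc (suc zero))) (index (suc zero)) (index zero))))))
    where
    -- Loop variables count down while the word has to be printed in increasing order, so each index
    -- is the complement of its loop variable.
    index : ∀ {n} (i : Fin n) → NC n (λ x ρ → N x ∸ suc (Vec.lookup ρ i))
    index i = Nᶜ ∸ᶜ sucᶜ (cVar i)
    same : ∀ x → squareBits (N x) (λ r c → f x (N x ∸ suc (N x ∸ suc r)) (N x ∸ suc (N x ∸ suc c)))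
      (λ r c s → g x (N x ∸ suc (N x ∸ suc r)) (N x ∸ suc (N x ∸ suc c)) (N x ∸ suc (N x ∸ suc s))) ≡ squareBits (N x) (f x) (g x)
    same x = cong (λ z → concatTo (N x) (λ _ → true ∷ []) ++ (false ∷ []) ++ z)
      (concatTo-cong (N x) λ r r< → concatTo-cong (N x) λ c c< → cong₂ _∷_ (cong₂ (f x) (flip-index r<) (flip-index c<))
        (concatTo-cong (N x) λ s s< → cong (_∷ []) (trans (cong₂ (λ r c → g x r c (N x ∸ suc (N x ∸ suc s))) (flip-index r<) (flip-index c<)) (cong (g x r c) (flip-index s<)))))

closed : ∀ {f : List Bool → Vec ℕ 0 → List Bool} {g : List Bool → List Bool} → OC 0 f → (∀ x → f x Vec.[] ≡ g x) → Σ (Out 1) λ o → ∀ x → ⟦ o ⟧ₒ x (length x Vec.∷ Vec.[]) ≡ g x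
closed (o , h) eq = o , λ x → trans (h x Vec.[]) (eq x)

-- Printing the squares of a family of formulas

record Coded (Φ : List Bool → Formula) : Set where
  open Formula
  field
    M'ᶜ   : ∀ {n} → NC n (λ x _ → M' (Φ x))
    p'ᶜ   : ∀ {n} → NC n (λ x _ → p' (Φ x))
    nvᶜ   : ∀ {n} → NC n (λ x _ → nv (Φ x))
    actᶜ  : ∀ {n f} → NC n f → BC n (λ x ρ → does (act? (Φ x) (f x ρ)))
    posᶜ  : ∀ {n f} → NC n f → BC n (λ x ρ → pos (Φ x) (f x ρ))
    keepᶜ : ∀ {n f} → NC n f → BC n (λ x ρ → does (keep? (Φ x) (f x ρ)))
    inᶜ   : ∀ {n f g} → NC n f → NC n g → BC n (λ x ρ → does (in? (Φ x) (f x ρ) (g x ρ)))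

module Printer (Φ : List Bool → Formula) (coded : Coded Φ) where
  open Coded coded
  module E x = Encoding (Φ x)

  module _ {n : ℕ} where

    pᶜ : NC n (λ x _ → E.p x)
    pᶜ = cLit 3 +ᶜ p'ᶜ

    qᶜ : NC n (λ x _ → E.q x)
    qᶜ = sucᶜ (nvᶜ +ᶜ (cLit 2 +ᶜ p'ᶜ))

    Mᶜ : NC n (λ x _ → E.M x)
    Mᶜ = sucᶜ M'ᶜ

    pqᶜ : NC n (λ x _ → E.p x * E.q x)
    pqᶜ = pᶜ *ᶜ qᶜ

    blockᶜ : NC n (λ x _ → E.block x)
    blockᶜ = cLit 2 *ᶜ pqᶜ

    Nᶜ : NC n (λ x _ → E.N x)
    Nᶜ = convert (λ x _ → sym (E.N≡ x)) (Mᶜ *ᶜ blockᶜ)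

    eᶜ : ∀ {f} → NC n f → NC n (λ x ρ → E.eN x (f x ρ))
    eᶜ a = condᶜ (posᶜ a) (cLit 1) (cLit 0)

    homeᶜ : ∀ {fx fy fa fb} → NC n fx → NC n fy → NC n fa → NC n fb → BC n (λ x ρ → does (E.homeN? x (fx x ρ) (fy x ρ) (fa x ρ) (fb x ρ)))
    homeᶜ X Y A B = ((X ≡ᶜ cLit 2) ∧ᶜ (Y ≡ᶜ B) ∧ᶜ (B <ᶜ nvᶜ)) ∨ᶜ (actᶜ A ∧ᶜ (X ≡ᶜ eᶜ A) ∧ᶜ (Y ≡ᶜ (nvᶜ +ᶜ A)))

    wireᶜ : ∀ {fx fy fa fb} → NC n fx → NC n fy → NC n fa → NC n fb → BC n (λ x ρ → does (E.wireN? x (fx x ρ) (fy x ρ) (fa x ρ) (fb x ρ)))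
    wireᶜ X Y A B = (X <ᶜ cLit 2) ∧ᶜ (Y <ᶜ nvᶜ) ∧ᶜ ((Y ≡ᶜ B) ∨ᶜ (actᶜ A ∧ᶜ (X ≡ᶜ eᶜ A) ∧ᶜ inᶜ A Y))

    dIᶜ : ∀ {f} → NC n f → NC n (λ x ρ → E.dI x (f x ρ))
    dIᶜ v = divᶜ v blockᶜ

    dTᶜ : ∀ {f} → NC n f → NC n (λ x ρ → E.dT x (f x ρ))
    dTᶜ v = divᶜ (modᶜ v blockᶜ) pqᶜ

    dXᶜ : ∀ {f} → NC n f → NC n (λ x ρ → E.dX x (f x ρ))
    dXᶜ v = divᶜ (modᶜ (modᶜ v blockᶜ) pqᶜ) qᶜ

    dYᶜ : ∀ {f} → NC n f → NC n (λ x ρ → E.dY x (f x ρ))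
    dYᶜ v = modᶜ (modᶜ (modᶜ v blockᶜ) pqᶜ) qᶜ

    emptyNᶜ : ∀ {fi ft fx fy fi' ft' fa fb} → NC n fi → NC n ft → NC n fx → NC n fy → NC n fi' → NC n ft' → NC n fa → NC n fb →
      BC n (λ x ρ → does (E.emptyN? x (fi x ρ) (ft x ρ) (fx x ρ) (fy x ρ) (fi' x ρ) (ft' x ρ) (fa x ρ) (fb x ρ)))
    emptyNᶜ i t X Y i' t' A B = notᶜ (keepᶜ i) ∨ᶜ ((i ≡ᶜ cLit 0) ∧ᶜ (i' ≡ᶜ cLit 0) ∧ᶜ
      (((t ≡ᶜ t') ∧ᶜ homeᶜ X Y A B) ∨ᶜ ((t ≡ᶜ cLit 1) ∧ᶜ wireᶜ X Y A B)))

    flipNᶜ : ∀ {fi ft fx fy fi' ft' fa fb} → NC n fi → NC n ft → NC n fx → NC n fy → NC n fi' → NC n ft' → NC n fa → NC n fb →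
      BC n (λ x ρ → does (E.flipN? x (fi x ρ) (ft x ρ) (fx x ρ) (fy x ρ) (fi' x ρ) (ft' x ρ) (fa x ρ) (fb x ρ)))
    flipNᶜ i t X Y i' t' A B = (i ≡ᶜ cLit 0) ∧ᶜ (i' ≡ᶜ cLit 0) ∧ᶜ (t ≡ᶜ cLit 0) ∧ᶜ (t' ≡ᶜ cLit 1) ∧ᶜ homeᶜ X Y A B

    emptyBᶜ : ∀ {fr fc} → NC n fr → NC n fc → BC n (λ x ρ → E.emptyB x (fr x ρ) (fc x ρ))
    emptyBᶜ r c = emptyNᶜ (dIᶜ r) (dTᶜ r) (dXᶜ r) (dYᶜ r) (dIᶜ c) (dTᶜ c) (dXᶜ c) (dYᶜ c)

    flipBᶜ : ∀ {fr fc} → NC n fr → NC n fc → BC n (λ x ρ → E.flipB x (fr x ρ) (fc x ρ))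
    flipBᶜ r c = flipNᶜ (dIᶜ r) (dTᶜ r) (dXᶜ r) (dYᶜ r) (dIᶜ c) (dTᶜ c) (dXᶜ c) (dYᶜ c)

    subᶜ : ∀ {fn fx fa fs} → NC n fn → NC n fx → NC n fa → NC n fs → BC n (λ x ρ → subB (fn x ρ) (fx x ρ) (fa x ρ) (fs x ρ))
    subᶜ m X A S = ((S +ᶜ A) ≡ᶜ X) ∨ᶜ ((S +ᶜ A) ≡ᶜ (X +ᶜ m))

    symᶜ : ∀ {ffl fi ft fx fy fi' ft' fa fb gi gt gx gy} → BC n ffl → NC n fi → NC n ft → NC n fx → NC n fy → NC n fi' → NC n ft' → NC n fa → NC n fb →
      NC n gi → NC n gt → NC n gx → NC n gy → BC n (λ x ρ → E.symB x (ffl x ρ) (fi x ρ) (ft x ρ) (fx x ρ) (fy x ρ) (fi' x ρ) (ft' x ρ) (fa x ρ) (fb x ρ) (gi x ρ) (gt x ρ) (gx x ρ) (gy x ρ))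
    symᶜ fl i t X Y i' t' A B si st sx sy = subᶜ Mᶜ i i' si ∧ᶜ subᶜ (cLit 2) (condᶜ fl (cLit 1) t) t' st ∧ᶜ subᶜ pᶜ X A sx ∧ᶜ subᶜ qᶜ Y B sy

    valBᶜ : ∀ {fr fc fs} → NC n fr → NC n fc → NC n fs → BC n (λ x ρ → E.valB x (fr x ρ) (fc x ρ) (fs x ρ))
    valBᶜ r c s = notᶜ (emptyBᶜ r c) ∧ᶜ symᶜ (flipBᶜ r c) (dIᶜ r) (dTᶜ r) (dXᶜ r) (dYᶜ r) (dIᶜ c) (dTᶜ c) (dXᶜ c) (dYᶜ c) (dIᶜ s) (dTᶜ s) (dXᶜ s) (dYᶜ s)

  program : OC 0 (λ x _ → squareBits (E.N x) (E.emptyB x) (E.valB x))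
  program = bitsᶜ {E.N} {E.emptyB} {E.valB} (λ {n} → Nᶜ {n}) (λ {n} {fr} {fc} → emptyBᶜ {n} {fr} {fc}) (λ {n} {fr} {fc} {fs} → valBᶜ {n} {fr} {fc} {fs})

  printer : Σ (Out 1) λ o → ∀ x → ⟦ o ⟧ₒ x (length x Vec.∷ Vec.[]) ≡ encode (E.N x) (E.P x)
  printer = closed {λ x _ → squareBits (E.N x) (E.emptyB x) (E.valB x)} {λ x → encode (E.N x) (E.P x)} program (λ x → sym (E.encode-P x))

module InstancePrinter (V : OTM) (few : Bool) (b : ℕ) (posR negR : List (Rules.Rule V)) (W T I : List Bool → ℕ) (0<T : ∀ x → 0 < T x) (0<I : ∀ x → 0 < I x)
  (two⁺ : ∀ x t i → All (Simulation.TwoLits V x (W x) (T x) (I x) t i) posR) (two⁻ : ∀ x t i → All (Simulation.TwoLits V x (W x) (T x) (I x) t i) negR)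
  (Wᶜ : ∀ {n} → NC n (λ x _ → W x)) (Tᶜ : ∀ {n} → NC n (λ x _ → T x)) (Iᶜ : ∀ {n} → NC n (λ x _ → I x)) where
  open Rules V
  module J x = Instance V x (W x) (T x) (I x) (0<T x) (0<I x) few b posR negR (two⁺ x) (two⁻ x)
  module Tab x = Tableau x (W x) (T x) (I x)

  module _ {n : ℕ} where

    allowedᶜ : ∀ {fn fs} → NC n fn → NC n fs → BC n (λ x ρ → does (Tab.allowed? x (fn x ρ) (fs x ρ)))
    allowedᶜ k s = ((k <ᶜ cLen) ∧ᶜ (s ≡ᶜ sucᶜ (bitᶜ k))) ∨ᶜ (((k ≡ᶜ cLen) ∧ᶜ (s ≡ᶜ cLit 3)) ∨ᶜ
      (((cLen <ᶜ k) ∧ᶜ (k ≤ᶜ (cLen +ᶜ Wᶜ)) ∧ᶜ (s <ᶜ cLit 3)) ∨ᶜ (((cLen +ᶜ Wᶜ) <ᶜ k) ∧ᶜ (s ≡ᶜ cLit 0))))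

    tvalᶜ : ∀ tp {ft} → NC n ft → NC n (λ x ρ → Tab.tval x tp (ft x ρ))
    tvalᶜ tz     t = cLit 0
    tvalᶜ te     t = Tᶜ
    tvalᶜ (tr d) t = cLit (toℕ d) +ᶜ t

    ivalᶜ : ∀ ip {fi} → NC n fi → NC n (λ x ρ → ival ip (fi x ρ))
    ivalᶜ iz     i = cLit 0
    ivalᶜ (ir d) i = cLit (toℕ d) +ᶜ i

    guardᶜ : ∀ g {fi} → NC n fi → BC n (λ x ρ → does (J.guardOK? x g (fi x ρ)))
    guardᶜ nothing        i = trueᶜ
    guardᶜ (just (p , s)) i = allowedᶜ (ivalᶜ p i) (cLit (toℕ s))

    module _ {ft fi fb ft' fi' fκ : List Bool → Vec ℕ n → ℕ} (t : NC n ft) (i : NC n fi) (b' : NC n fb) (t' : NC n ft') (i' : NC n fi') (κ' : NC n fκ) where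

      matchᶜ : ∀ ℓ → BC n (λ x ρ → does (J.match? x ℓ (ft x ρ) (fi x ρ) (fb x ρ) (ft' x ρ) (fi' x ρ) (fκ x ρ)))
      matchᶜ (lit u tp ip κ g) = (b' ≡ᶜ cLit (bit01 u)) ∧ᶜ (t' ≡ᶜ tvalᶜ tp t) ∧ᶜ (i' ≡ᶜ ivalᶜ ip i) ∧ᶜ (κ' ≡ᶜ cLit (toℕ (kind# κ))) ∧ᶜ guardᶜ g i

      inRuleᶜ : ∀ r → BC n (λ x ρ → does (J.inRule? x r (ft x ρ) (fi x ρ) (fb x ρ) (ft' x ρ) (fi' x ρ) (fκ x ρ)))
      inRuleᶜ []      = falseᶜ
      inRuleᶜ (ℓ ∷ r) = matchᶜ ℓ ∨ᶜ inRuleᶜ r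

      -- The rule list does not depend on the input, so the recursion over it unrolls into one
      -- expression.
      inRulesᶜ : ∀ {fρ} (ρᶜ : NC n fρ) rs m → BC n (λ x ρ → does (J.inRules? x rs m (fρ x ρ) (ft x ρ) (fi x ρ) (fb x ρ) (ft' x ρ) (fi' x ρ) (fκ x ρ)))
      inRulesᶜ ρᶜ []       m = falseᶜ
      inRulesᶜ ρᶜ (r ∷ rs) m = ((ρᶜ ≡ᶜ cLit m) ∧ᶜ inRuleᶜ r) ∨ᶜ inRulesᶜ ρᶜ rs (suc m)

    nv₁ᶜ : NC n (λ x _ → J.nv₁ x)
    nv₁ᶜ = cLit K

    nv₂ᶜ : NC n (λ x _ → J.nv₂ x)
    nv₂ᶜ = sucᶜ Iᶜ *ᶜ nv₁ᶜ

    nv₃ᶜ : NC n (λ x _ → J.nv₃ x)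
    nv₃ᶜ = sucᶜ Tᶜ *ᶜ nv₂ᶜ

    TIᶜ : NC n (λ x _ → T x * I x)
    TIᶜ = Tᶜ *ᶜ Iᶜ

    jρᶜ : ∀ {f} → NC n f → NC n (λ x ρ → J.jρ x (f x ρ))
    jρᶜ j = divᶜ j TIᶜ

    jtᶜ : ∀ {f} → NC n f → NC n (λ x ρ → J.jt x (f x ρ))
    jtᶜ j = divᶜ (modᶜ j TIᶜ) Iᶜ

    jiᶜ : ∀ {f} → NC n f → NC n (λ x ρ → J.ji x (f x ρ))
    jiᶜ j = modᶜ (modᶜ j TIᶜ) Iᶜ

    vbᶜ : ∀ {f} → NC n f → NC n (λ x ρ → J.vb x (f x ρ))
    vbᶜ v = divᶜ v nv₃ᶜ

    vtᶜ : ∀ {f} → NC n f → NC n (λ x ρ → J.vt x (f x ρ))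
    vtᶜ v = divᶜ (modᶜ v nv₃ᶜ) nv₂ᶜ

    viᶜ : ∀ {f} → NC n f → NC n (λ x ρ → J.vi x (f x ρ))
    viᶜ v = divᶜ (modᶜ (modᶜ v nv₃ᶜ) nv₂ᶜ) nv₁ᶜ

    vκᶜ : ∀ {f} → NC n f → NC n (λ x ρ → J.vκ x (f x ρ))
    vκᶜ v = modᶜ (modᶜ (modᶜ v nv₃ᶜ) nv₂ᶜ) nv₁ᶜ

    inNᶜ : ∀ {f g} → NC n f → NC n g → BC n (λ x ρ → does (J.inN? x (f x ρ) (g x ρ)))
    inNᶜ j v = inRulesᶜ (jtᶜ j) (jiᶜ j) (vbᶜ v) (vtᶜ v) (viᶜ v) (vκᶜ v) (jρᶜ j) (posR ++ negR) 0

    keepPᶜ : ∀ u {f} → NC n f → BC n (λ x ρ → does (keepₚ? u (f x ρ)))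
    keepPᶜ true  i = trueᶜ
    keepPᶜ false i = i ≡ᶜ cLit 0

  coded : Coded J.Φ
  coded = record
    { M'ᶜ   = cLit b
    ; p'ᶜ   = cLit (length (posR ++ negR)) *ᶜ TIᶜ
    ; nvᶜ   = cLit 2 *ᶜ nv₃ᶜ
    ; actᶜ  = λ j → jρᶜ j <ᶜ cLit (length (posR ++ negR))
    ; posᶜ  = λ j → jρᶜ j <ᶜ cLit (length posR)
    ; keepᶜ = keepPᶜ few
    ; inᶜ   = inNᶜ
    }

  instance-printer : Σ (Out 1) λ o → ∀ x → ⟦ o ⟧ₒ x (length x Vec.∷ Vec.[]) ≡ encode (J.N x) (J.P x)
  instance-printer = Printer.printer J.Φ coded

-- Proportion of empty cells and the reduction

module Density (Φ : Formula) where
  open Encoding Φ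

  0<block : 0 < block
  0<block = ℕ.*-mono-≤ {1} {2} {1} {p * q} (s≤s z≤n) (ℕ.*-mono-≤ {1} {p} {1} {q} (s≤s z≤n) (s≤s z≤n))

  first-block : ∀ r → toℕ (proj₁ (dec r)) ≡ 0 → toℕ r < block
  first-block r eq = subst (_< block) (sym toℕ≡) (proj₂ (divS-≡ (toℕ r) block 0<block))
    where
    dI≡0 : dI (toℕ r) ≡ 0
    dI≡0 = trans (digits (λ i _ _ _ → i) r) eq
    toℕ≡ : toℕ r ≡ modS (toℕ r) block
    toℕ≡ = trans (proj₁ (divS-≡ (toℕ r) block 0<block)) (cong (_+ modS (toℕ r) block) (trans (cong (block *_) dI≡0) (ℕ.*-zeroʳ block)))

  empty-Pc : ∀ r c → Pc r c ≡ nothing → Empty r c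
  empty-Pc r c eq = go (pview r c) eq
    where
    go : ∀ {z} → PView r c z → z ≡ nothing → Empty r c
    go (pE em) _ = em

  empty⇒Empty : ∀ r c → P r c ≡ nothing → Empty (dec r) (dec c)
  empty⇒Empty r c eq = empty-Pc (dec r) (dec c) (unmap-nothing (Pc (dec r) (dec c)) eq)
    where
    unmap-nothing : ∀ z → Maybe.map enc z ≡ nothing → z ≡ nothing
    unmap-nothing nothing _ = refl

  few-empty : (∀ i → Keep i) → numEmpty P ≤ block * block
  few-empty keep = numEmpty-corner P block λ r c eq → corner r c (dec r) (dec c) refl refl (empty⇒Empty r c eq)
    where
    corner : ∀ r c r' c' → dec r ≡ r' → dec c ≡ c' → Empty r' c' → toℕ r < block × toℕ c < block
    corner r c (i , _) (i' , _) _  _  (inj₁ ¬keep) = ⊥-elim (¬keep (keep (toℕ i)))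
    corner r c (i , _) (i' , _) er ec (inj₂ (i≡0 , i'≡0 , _)) =
      first-block r (trans (cong (toℕ ∘ proj₁) er) i≡0) , first-block c (trans (cong (toℕ ∘ proj₁) ec) i'≡0)

  many-empty : (∀ i → Keep i → i ≡ 0) → N * N ≤ numEmpty P + block * N
  many-empty only0 = numEmpty-rows P block λ r c le → cong (Maybe.map enc)
    (empty (dec r) (dec c) λ i≡0 → ℕ.<⇒≱ (first-block r i≡0) le)
    where
    empty : ∀ r c → toℕ (proj₁ r) ≢ 0 → Pc r c ≡ nothing
    empty r@(i , _) c@(_ , _) i≢0 = cong (λ u → if u then nothing else just (if does (flip? r c) then L (twin r) c else L r c))
      (dec-true (empty? r c) (inj₁ λ keep → i≢0 (only0 (toℕ i) keep)))

  -- The empty cells lie in one corner of side `block`, while `N = M * block` with `M = M' + 1`; the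
  -- factor `a` is at least 1.
  few-proportion : ∀ a → 0 < a → (∀ i → Keep i) → numEmpty P * M' < a * (N * N)
  few-proportion a 0<a keep = begin-strict
    numEmpty P * M'         ≤⟨ ℕ.*-mono-≤ (few-empty keep) (ℕ.m≤n*m M' M) ⟩
    block * block * (M * M') <⟨ ℕ.*-monoʳ-< (block * block) {{Data.Nat.>-nonZero (ℕ.*-mono-≤ 0<block 0<block)}} (ℕ.*-monoʳ-< M (ℕ.n<1+n M')) ⟩
    block * block * (M * M) ≡⟨ regroup block M ⟩
    M * block * (M * block) ≡⟨ cong₂ _*_ N≡ N≡ ⟨
    N * N                   ≤⟨ ℕ.m≤n*m (N * N) a {{Data.Nat.>-nonZero 0<a}} ⟩
    a * (N * N)             ∎
    where
    open ℕ.≤-Reasoning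
    regroup : ∀ k m → k * k * (m * m) ≡ m * k * (m * k)
    regroup = solve-∀

  0<N : 0 < N
  0<N = subst (0 <_) (sym N≡) (ℕ.*-mono-≤ {1} {M} {1} {block} (s≤s z≤n) 0<block)

  -- Outside the first `block` rows everything is empty, so at most `block * N` cells are filled,
  -- and `M' * block < M * block = N`.
  many-proportion : ∀ a → 0 < a → (∀ i → Keep i → i ≡ 0) → M' * (N * N) < numEmpty P * M' + a * (N * N)
  many-proportion a 0<a only0 = begin-strict
    M' * (N * N)                            ≤⟨ ℕ.*-monoʳ-≤ M' (many-empty only0) ⟩
    M' * (numEmpty P + block * N)           ≡⟨ regroup M' (numEmpty P) block N ⟩
    numEmpty P * M' + M' * block * N        <⟨ ℕ.+-monoʳ-< (numEmpty P * M') (ℕ.*-monoˡ-< N {{Data.Nat.>-nonZero 0<N}}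
                                                 (subst (M' * block <_) (sym N≡) (ℕ.*-monoˡ-< block {{Data.Nat.>-nonZero 0<block}} (ℕ.n<1+n M')))) ⟩
    numEmpty P * M' + N * N                 ≤⟨ ℕ.+-monoʳ-≤ (numEmpty P * M') (ℕ.m≤n*m (N * N) a {{Data.Nat.>-nonZero 0<a}}) ⟩
    numEmpty P * M' + a * (N * N)           ∎
    where
    open ℕ.≤-Reasoning
    regroup : ∀ m e k n → m * (e + k * n) ≡ e * m + m * k * n
    regroup = solve-∀

halted-step : ∀ V O C {u} → result V C ≡ just u → step V O C ≡ C
halted-step V O C@(cfg q w t) eq with eqQ q (acc V) | eqQ q (rej V)
... | true  | _    = refl
... | false | true = refl

poly-mono : ∀ c k {m n} → m ≤ n → poly c k m ≤ poly c k n
poly-mono c k le = ℕ.+-monoˡ-≤ c (ℕ.*-monoʳ-≤ c (ℕ.^-monoˡ-≤ k le))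

module Reduction (L : Language) (V : OTM) (c k : ℕ)
  (total : ∀ x w → ∃ λ u → run V noOracle (poly c k (length (verifierInput x w))) (initCfg V (verifierInput x w)) ≡ just u)
  (correct : ∀ x → (L x → ∃ λ w → length w ≤ poly c k (length x) × run V noOracle (poly c k (length (verifierInput x w))) (initCfg V (verifierInput x w)) ≡ just true) ×
    ((∃ λ w → length w ≤ poly c k (length x) × run V noOracle (poly c k (length (verifierInput x w))) (initCfg V (verifierInput x w)) ≡ just true) → L x))
  (few : Bool) (b : ℕ) where
  open Rules V using (posRules; negRules)

  -- `T` majorises the verifier's time on `x` with any witness of length at most `W`, and the
  -- successor makes it positive. `I` covers the whole input and, as one known cell is lost per
  -- step, `T` further cells.
  W T I : List Bool → ℕ
  W x = poly c k (length x)
  T x = suc (poly c k (length x + suc (W x)))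
  I x = T x + suc (length x + W x)

  0<T : ∀ x → 0 < T x
  0<T x = s≤s z≤n

  0<I : ∀ x → 0 < I x
  0<I x = s≤s z≤n

  two⁺ : ∀ x t i → All (Simulation.TwoLits V x (W x) (T x) (I x) t i) posRules
  two⁺ x = Simulation.two-positive V x (W x) (T x) (I x)

  two⁻ : ∀ x t i → All (Simulation.TwoLits V x (W x) (T x) (I x) t i) negRules
  two⁻ x = Simulation.two-negative V x (W x) (T x) (I x)

  Wᶜ : ∀ {n} → NC n (λ x _ → W x)
  Wᶜ = polyᶜ c k cLen

  Tᶜ : ∀ {n} → NC n (λ x _ → T x)
  Tᶜ = sucᶜ (polyᶜ c k (cLen +ᶜ sucᶜ Wᶜ))

  Iᶜ : ∀ {n} → NC n (λ x _ → I x)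
  Iᶜ = Tᶜ +ᶜ sucᶜ (cLen +ᶜ Wᶜ)

  module Ins x = Instance V x (W x) (T x) (I x) (0<T x) (0<I x) few b posRules negRules (two⁺ x) (two⁻ x)

  module _ (x : List Bool) where
    open Rules.Tableau V x (W x) (T x) (I x) using (config; run-config; Satisfies)

    within : ∀ w → length w ≤ W x → poly c k (length (verifierInput x w)) ≤ T x
    within w len = ℕ.m≤n⇒m≤1+n (poly-mono c k (ℕ.≤-trans (ℕ.≤-reflexive len≡) (ℕ.+-monoʳ-≤ (length x) (s≤s len))))
      where
      len≡ : length (verifierInput x w) ≡ length x + suc (length w)
      len≡ = trans (List.length-++ (map bitSym x)) (cong₂ (λ m n → m + suc n) (List.length-map bitSym x) (List.length-map bitSym w))

    stays : ∀ w d t {u} → result V (config w t) ≡ just u → result V (config w (d + t)) ≡ just u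
    stays w zero    t eq = eq
    stays w (suc d) t eq = trans (cong (result V) (halted-step V noOracle (config w (d + t)) (stays w d t eq))) (stays w d t eq)

    at-T : ∀ w {u} → length w ≤ W x → run V noOracle (poly c k (length (verifierInput x w))) (initCfg V (verifierInput x w)) ≡ just u → result V (config w (T x)) ≡ just u
    at-T w {u} len eq = subst (λ t → result V (config w t) ≡ just u) (ℕ.m∸n+n≡m (within w len))
      (stays w (T x ∸ bound) bound (trans (sym (run-config w bound 0)) eq))
      where
      bound : ℕ
      bound = poly c k (length (verifierInput x w))

    L⇒satisfiable : L x → Ins.Satisfiable x
    L⇒satisfiable Lx = let (w , len , acc) = proj₁ (correct x) Lx in go w len (at-T w len acc)
      where
      go : ∀ w → length w ≤ W x → result V (config w (T x)) ≡ just true → Ins.Satisfiable x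
      go w len acc = Ins.satisfies⇒satisfiable x {Simulation.FromRun.X V x (W x) (T x) (I x) w len acc} (Satisfies.positive sat) (Satisfies.negative sat)
        where
        sat : Satisfies (Simulation.FromRun.X V x (W x) (T x) (I x) w len acc)
        sat = Simulation.FromRun.satisfies V x (W x) (T x) (I x) w len acc

    satisfiable⇒L : Ins.Satisfiable x → L x
    satisfiable⇒L s = let (X , ps , ns) = Ins.satisfiable⇒satisfies x s in go X (record { positive = ps ; negative = ns })
      where
      go : ∀ X → Satisfies X → L x
      -- Acceptance is known only at time `T`. By `total` the verifier has halted within its own
      -- bound with some verdict, which persists up to `T` and is therefore acceptance.
      go X sat = proj₂ (correct x) (w , len , trans (proj₂ (total x w)) (trans (sym (at-T w len (proj₂ (total x w)))) accT))
        where
        module A = Simulation.FromAssignment V x (W x) (T x) (I x) (0<T x) (ℕ.m≤m+n (T x) _) (ℕ.m≤n+m _ (T x)) X sat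
        w : List Bool
        w = A.w
        len : length w ≤ W x
        len = proj₁ A.accepts
        accT : result V (config w (T x)) ≡ just true
        accT = proj₂ A.accepts

    hc : HalfCompletion (Ins.P x)
    hc = Ins.halfCompletion x (Ins.separated x) (Ins.twoMembers x)

  module _ {D : ∀ {n} → Array n → Set} (dense : ∀ x → D (Ins.P x)) where

    hard : Σ OTM λ M → Σ ℕ λ c → Σ ℕ λ k → (O : Oracle) → OracleFor (PromiseYes D) (PromiseNo D) O → (x : List Bool) →
      (L x → run M O (poly c k (length x)) (initCfg M (map bitSym x)) ≡ just true) ×
      (¬ L x → run M O (poly c k (length x)) (initCfg M (map bitSym x)) ≡ just false)
    hard = let (o , printed) = InstancePrinter.instance-printer V few b posRules negRules W T I 0<T 0<I two⁺ two⁻ Wᶜ Tᶜ Iᶜ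
               (M , c' , k' , answers) = query-machine o
           in M , c' , k' , λ O (yesO , noO) x → let answer = trans (answers O x) (cong (just ∘ O) (printed x)) in
             (λ Lx → trans answer (cong just (yesO _ (Ins.N x , Ins.P x , refl , halfCompletion⇒IsPLS (hc x) , halfCompletion⇒Hall (hc x) , dense x ,
               Ins.satisfiable⇒completable x (L⇒satisfiable x Lx))))) ,
             (λ ¬Lx → trans answer (cong just (noO _ (Ins.N x , Ins.P x , refl , halfCompletion⇒IsPLS (hc x) , halfCompletion⇒Hall (hc x) , dense x ,
               λ completable → ¬Lx (satisfiable⇒L x (Ins.completable⇒satisfiable x (Ins.separated x) completable))))))

theorem14 : (a b : ℕ) → 0 < a → 0 < b →
  NPHard (PromiseYes (FewEmpty a b)) (PromiseNo (FewEmpty a b)) ×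
  NPHard (PromiseYes (ManyEmpty a b)) (PromiseNo (ManyEmpty a b))
theorem14 a b 0<a 0<b =
  (λ L (V , c , k , total , correct) → let module R = Reduction L V c k total correct true b in
    R.hard {λ {n} → FewEmpty a b {n}} (λ x → Density.few-proportion (R.Ins.Φ x) a 0<a (λ _ → tt))) ,
  (λ L (V , c , k , total , correct) → let module R = Reduction L V c k total correct false b in
    R.hard {λ {n} → ManyEmpty a b {n}} (λ x → Density.many-proportion (R.Ins.Φ x) a 0<a (λ _ i≡0 → i≡0)))
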